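{- Let $P$ be a Gorenstein* poset of rank $r\ge1$. Then the Eulerian ($\varepsilon$-)Chow polynomial of $P$ is $\gamma$-positive: there are integers $\gamma_i\ge0$ with $\mathrm{H}_P(x)=\sum_{i=0}^{\lfloor(r-1)/2\rfloor}\gamma_i\,x^i(1+x)^{r-1-2i}$.
   Context: $P$ is a finite graded bounded poset with rank function $\rho$, $\rho_{st}=\rho(t)-\rho(s)$. $P$ is Eulerian if its Möbius function satisfies $\mu_{st}=(-1)^{\rho_{st}}$ for all $s\le t$; then $\varepsilon_{st}(x)=(x-1)^{\rho_{st}}$ defines a kernel in the incidence algebra (maps $[s,t]\mapsto a_{st}(x)\in\mathbb{Z}[x]$, product $(ab)_{st}=\sum_{s\le w\le t}a_{sw}b_{wt}$). Let $\overline{\varepsilon}_{st}=(x-1)^{\rho_{st}-1}$ for $s<t$ and $\overline{\varepsilon}_{ss}=-1$; the Eulerian Chow function is $\mathrm{H}=-(\overline{\varepsilon})^{ -1}$ and $\mathrm{H}_P=\mathrm{H}_{\widehat0\widehat1}$. $P$ is Cohen--Macaulay (over $\mathbb{Q}$) if for every $s<t$ the order complex of the open interval $(s,t)$ has rational reduced homology vanishing outside degree $\rho_{st}-2$. $P$ is Gorenstein* if it is both Eulerian and Cohen--Macaulay. -}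

module Defs where

open import Data.Nat as ℕ using (ℕ; zero; suc; _∸_; ⌊_/2⌋)
open import Data.Fin as Fin using (Fin)
open import Data.Bool using (T?; Bool; true; false; T; _∧_; not; if_then_else_)
open import Data.List using (List; []; _∷_; map; filter; foldr; length; upTo; allFin)
open import Data.Integer as ℤ using (ℤ; +_)
open import Data.Rational as ℚ using (ℚ)
open import Data.Product using (Σ; Σ-syntax; _×_; _,_)
open import Data.Unit using (⊤)
open import Data.Empty using (⊥)
open import Relation.Nullary using (¬_; does)
open import Relation.Binary.PropositionalEquality using (_≡_)

Poly : Set
Poly = List ℤ

coeff : Poly → ℕ → ℤ
coeff []       _       = + 0
coeff (a ∷ _)  zero    = a
coeff (_ ∷ p)  (suc k) = coeff p k

_≈ₚ_ : Poly → Poly → Set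
p ≈ₚ q = ∀ k → coeff p k ≡ coeff q k

infixl 6 _+ₚ_
infixl 7 _*ₚ_ _·ₚ_

_+ₚ_ : Poly → Poly → Poly
[]      +ₚ q       = q
(a ∷ p) +ₚ []      = a ∷ p
(a ∷ p) +ₚ (b ∷ q) = (a ℤ.+ b) ∷ (p +ₚ q)

_·ₚ_ : ℤ → Poly → Poly
c ·ₚ p = map (c ℤ.*_) p

_*ₚ_ : Poly → Poly → Poly
[]      *ₚ q = []
(a ∷ p) *ₚ q = (a ·ₚ q) +ₚ (+ 0 ∷ (p *ₚ q))

negₚ : Poly → Poly
negₚ p = ℤ.-1ℤ ·ₚ p

constₚ : ℤ → Poly
constₚ c = c ∷ []

sumₚ : List Poly → Poly
sumₚ = foldr _+ₚ_ []

powₚ : Poly → ℕ → Poly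
powₚ p zero    = constₚ (+ 1)
powₚ p (suc k) = p *ₚ powₚ p k

Xₚ Xm1 Xp1 : Poly
Xₚ  = + 0 ∷ + 1 ∷ []
Xm1 = ℤ.-1ℤ ∷ + 1 ∷ []
Xp1 = + 1 ∷ + 1 ∷ []

module Order {n : ℕ} (le : Fin n → Fin n → Bool) where

  lt : Fin n → Fin n → Bool
  lt x y = le x y ∧ not (does (x Fin.≟ y))

  Covers : Fin n → Fin n → Set
  Covers x y = T (lt x y) × (∀ z → T (lt x z) → T (lt z y) → ⊥)

record FinGradedBoundedPoset : Set where
  field
    n       : ℕ
    le      : Fin n → Fin n → Bool
    le-refl    : ∀ x → T (le x x)
    le-antisym : ∀ x y → T (le x y) → T (le y x) → x ≡ y
    le-trans   : ∀ x y z → T (le x y) → T (le y z) → T (le x z)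
    bot top : Fin n
    bot-min : ∀ x → T (le bot x)
    top-max : ∀ x → T (le x top)
    ρ       : Fin n → ℕ
    ρ-bot   : ρ bot ≡ 0
    ρ-cover : ∀ x y → Order.Covers le x y → ρ y ≡ suc (ρ x)

module PosetNotions (P : FinGradedBoundedPoset) where
  open FinGradedBoundedPoset P public
  open Order le public

  rank : ℕ
  rank = ρ top

  ρ[_,_] : Fin n → Fin n → ℕ
  ρ[ s , t ] = ρ t ∸ ρ s

  eqᵇ : Fin n → Fin n → Bool
  eqᵇ x y = does (x Fin.≟ y)

  halfOpen : Fin n → Fin n → List (Fin n)
  halfOpen s t = filter (λ w → T? (le s w ∧ lt w t)) (allFin n)

  -- Möbius function, by the recursion μ_ss = 1, μ_st = -Σ_{s≤w<t} μ_sw.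
  -- The fuel argument bounds the length of chains; fuel suc n suffices.
  mobiusF : ℕ → Fin n → Fin n → ℤ
  mobiusF zero    s t = + 0
  mobiusF (suc k) s t =
    if eqᵇ s t then + 1
    else if lt s t then ℤ.- foldr ℤ._+_ (+ 0) (map (mobiusF k s) (halfOpen s t))
    else + 0

  μ : Fin n → Fin n → ℤ
  μ = mobiusF (suc n)

  Eulerian : Set
  Eulerian = ∀ s t → T (le s t) → μ s t ≡ ℤ.-1ℤ ℤ.^ ρ[ s , t ]

  εbar : Fin n → Fin n → Poly
  εbar s t = if eqᵇ s t then constₚ ℤ.-1ℤ
             else if lt s t then powₚ Xm1 (ρ[ s , t ] ∸ 1)
             else []

  -- The inverse a = ε̄⁻¹ in the incidence algebra, via the recursion
  -- coming from (a ε̄)_st = δ_st :  a_ss = -1,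
  -- a_st = Σ_{s≤w<t} a_sw ε̄_wt   for s < t   (since ε̄_tt = -1).
  εbarInvF : ℕ → Fin n → Fin n → Poly
  εbarInvF zero    s t = []
  εbarInvF (suc k) s t =
    if eqᵇ s t then constₚ ℤ.-1ℤ
    else if lt s t then sumₚ (map (λ w → εbarInvF k s w *ₚ εbar w t) (halfOpen s t))
    else []

  εbarInv : Fin n → Fin n → Poly
  εbarInv = εbarInvF (suc n)

  H : Fin n → Fin n → Poly
  H s t = negₚ (εbarInv s t)

  H-P : Poly
  H-P = H bot top

  -- Cohen–Macaulay over ℚ.  Faces of the order complex of the open
  -- interval (s,t) are the chains w₀ < w₁ < … < w_{ℓ-1} with s < wᵢ < t,
  -- represented as strictly increasing lists; a face of length ℓ has
  -- dimension ℓ - 1 (the empty list is the (-1)-face: reduced homology).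
  -- A rational ℓ-chain is a function List (Fin n) → ℚ (only its values on
  -- faces of length ℓ matter).

  inOpen : Fin n → Fin n → Fin n → Bool
  inOpen s t w = lt s w ∧ lt w t

  increasing : List (Fin n) → Bool
  increasing []           = true
  increasing (x ∷ [])     = true
  increasing (x ∷ y ∷ xs) = lt x y ∧ increasing (y ∷ xs)

  allᵇ : (Fin n → Bool) → List (Fin n) → Bool
  allᵇ f []       = true
  allᵇ f (x ∷ xs) = f x ∧ allᵇ f xs

  isFace : Fin n → Fin n → List (Fin n) → Bool
  isFace s t σ = allᵇ (inOpen s t) σ ∧ increasing σ

  Face : Fin n → Fin n → ℕ → List (Fin n) → Set
  Face s t ℓ σ = T (isFace s t σ) × length σ ≡ ℓ

  insertAt : ℕ → Fin n → List (Fin n) → List (Fin n)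
  insertAt zero    w xs       = w ∷ xs
  insertAt (suc j) w []       = w ∷ []
  insertAt (suc j) w (x ∷ xs) = x ∷ insertAt j w xs

  sumℚ : List ℚ → ℚ
  sumℚ = foldr ℚ._+_ ℚ.0ℚ

  signℚ : ℕ → ℚ
  signℚ zero    = ℚ.1ℚ
  signℚ (suc j) = ℚ.- signℚ j

  -- (∂ d)(σ) = Σ_{τ ⊃ σ, |τ| = |σ|+1} (-1)^j d(τ), where j is the position
  -- of the vertex of τ not in σ; i.e. the simplicial boundary
  -- ∂τ = Σ_j (-1)^j (τ with j-th vertex removed), read off at σ.
  ∂ : Fin n → Fin n → (List (Fin n) → ℚ) → List (Fin n) → ℚ
  ∂ s t d σ =
    sumℚ (map (λ j → sumℚ (map (λ w →
                 if isFace s t (insertAt j w σ)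
                 then signℚ j ℚ.* d (insertAt j w σ)
                 else ℚ.0ℚ) (allFin n)))
              (upTo (suc (length σ))))

  Cycle : Fin n → Fin n → ℕ → (List (Fin n) → ℚ) → Set
  Cycle s t zero    c = ⊤
  Cycle s t (suc ℓ) c = ∀ σ → Face s t ℓ σ → ∂ s t c σ ≡ ℚ.0ℚ

  Boundary : Fin n → Fin n → ℕ → (List (Fin n) → ℚ) → Set
  Boundary s t ℓ c =
    Σ[ d ∈ (List (Fin n) → ℚ) ] (∀ σ → Face s t ℓ σ → ∂ s t d σ ≡ c σ)

  -- H̃_i(Δ(s,t); ℚ) = 0 where i = ℓ - 1
  ReducedHomologyVanishes : Fin n → Fin n → ℕ → Set
  ReducedHomologyVanishes s t ℓ =
    ∀ c → Cycle s t ℓ c → Boundary s t ℓ c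

  -- Cohen–Macaulay: for all s < t, H̃_i(Δ(s,t); ℚ) = 0 for i ≠ ρ_st - 2,
  -- i.e. for face-length ℓ = i + 1 with ℓ + 1 ≠ ρ_st.
  CohenMacaulay : Set
  CohenMacaulay = ∀ s t → T (lt s t) → ∀ ℓ → ¬ (suc ℓ ≡ ρ[ s , t ]) →
                  ReducedHomologyVanishes s t ℓ

  Gorenstein* : Set
  Gorenstein* = Eulerian × CohenMacaulay

gammaExpansion : ℕ → (ℕ → ℕ) → Poly
gammaExpansion r γ =
  sumₚ (map (λ i → constₚ (+ γ i) *ₚ powₚ Xₚ i *ₚ powₚ Xp1 (r ∸ 1 ∸ 2 ℕ.* i))
            (upTo (suc ⌊ r ∸ 1 /2⌋)))

{-# OPTIONS --safe #-}
-- By Cohen-Macaulayness every open interval has a one-dimensional top homology, and comparing generators gives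
-- incidence numbers e(σ,τ), nonzero exactly on the cover relations, that turn P into a cell complex all of whose
-- intervals have exact cochain complexes. On this complex consider sheaves of rational vector spaces whose cellular
-- cohomology over every upper set [σ,∞) vanishes below some degree i. For k < i such a sheaf has a dualizing sheaf on
-- its k-skeleton, and a generic symmetric form (a boundary with generic rational weights) embeds the sheaf into it;
-- this is Karu's argument for the cd-index. The cokernel is again such a sheaf, for the degree k - 1, and is
-- numerically self-dual. Writing f_k(m) for the polynomial attached to the dimension function m and the rank k, and n
-- for the dimension function of the cokernel, one gets f_{k+1}(m) = (1 + x) f_k(m) + 2 x f_{k-1}(n). By induction all
-- f_k are γ-positive, the coefficients being nonnegative combinations of dimensions, and H_P is f_{r-1} of the
-- constant sheaf.
module Submission where

open import Defs
import Algebra.Properties.Semiring.Sum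
import Algebra.Solver.Ring as RingSolver
import Algebra.Solver.Ring.AlmostCommutativeRing as ACR
open import Algebra.Bundles using (CommutativeRing)
open import Data.Bool using (Bool; true; false; T; T?; _∧_; if_then_else_)
open import Data.Bool.Properties using (T-∧)
open import Data.Empty using (⊥; ⊥-elim)
open import Data.Fin as Fin using (Fin; zero; suc; toℕ)
import Data.Fin.Induction as FinInduction
import Data.Fin.Properties as Finₚ
open import Data.Integer as ℤ using (ℤ; +_)
import Data.Integer.Properties as ℤₚ
import Data.Integer.Solver as ℤ-Solver
open import Data.List using (List; []; _∷_; map; filter; foldr; length; upTo; allFin; applyUpTo; tabulate; concatMap)
open import Data.List.Membership.Propositional using (_∈_)
open import Data.List.Membership.Propositional.Properties using (∈-concat⁺′; ∈-map⁺; ∈-allFin)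
open import Data.List.Relation.Unary.All as All using (All; []; _∷_)
open import Data.List.Relation.Unary.Any using (here; there)
import Data.Maybe
open import Data.Nat as ℕ using (ℕ; zero; suc; _∸_; ⌊_/2⌋; _≤_; _<_; z≤n; s≤s; s≤s⁻¹)
import Data.Nat.Coprimality as Coprimality
import Data.Nat.Properties as ℕₚ
open import Data.Product using (Σ; Σ-syntax; _×_; _,_; proj₁; proj₂)
open import Data.Rational as ℚ using (ℚ; 0ℚ; 1ℚ)
import Data.Rational.Properties as ℚₚ
open import Data.Rational.Solver using (module +-*-Solver)
open import Data.Sum as Sum using (_⊎_; inj₁; inj₂)
open import Data.Unit using (⊤; tt)
open import Function using (_∘_; case_of_)
open import Function.Bundles using (Equivalence)
open import Induction.WellFounded using (Acc; acc; WellFounded)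
open import Level using (0ℓ)
open import Relation.Binary.Definitions using (DecidableEquality; tri<; tri≈; tri>)
open import Relation.Binary.PropositionalEquality using (_≡_; _≢_; _≗_; refl; sym; trans; cong; cong₂; subst; isEquivalence; resp₂; module ≡-Reasoning)
import Relation.Binary.Reasoning.Setoid as SetoidReasoning
open import Relation.Binary.Structures using (IsStrictPartialOrder)
open import Relation.Nullary using (¬_; Dec; yes; no; does; contradiction)
open import Relation.Nullary.Decidable using (_×-dec_; dec⇒maybe)

-- The incidence numbers cannot be chosen independently. The row of `σ` is found after all rows
-- above it, as a generator of the closed cochains of rank `ρ σ + 1` on `[σ, top]`. These form a
-- line: Cohen-Macaulayness of the truncated intervals gives exactness in the higher ranks, and the
-- Eulerian condition fixes the Euler characteristic. Connectedness of open intervals keeps the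
-- generator nonzero at every cover. Generic weights are found among natural numbers. Each stalk
-- carries a sum of squares; the radicals belonging to two weights of one cell are orthogonal for
-- this positive definite form, so only finitely many weights are bad. With `Hs` the Chow-type sum
-- of a dimension function `m`, and `w m` the dimension function of the dualizing sheaf,
-- `(x - 1) f(m)` is `x Hs(m) - Hs(w m)`. Hence `f(m)` is `Hs(m)` whenever `m` is self-dual. The
-- constant function is self-dual by the Euler relation and the cokernel by construction, so that
-- `H_P` and the correction term of the recursion are both values of `f`.

module Sums (R : CommutativeRing 0ℓ 0ℓ) where
  open CommutativeRing R using (Carrier; _≈_; _+_; _*_; 0#; +-cong; +-congˡ; +-identityˡ; +-identityʳ)
  private module R = CommutativeRing R
  private module S = Algebra.Properties.Semiring.Sum R.semiring

  ∑ : ∀ {k} → (Fin k → Carrier) → Carrier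
  ∑ = S.sum

  ∑-cong : ∀ {k} {f g : Fin k → Carrier} → (∀ i → f i ≈ g i) → ∑ f ≈ ∑ g
  ∑-cong = S.sum-cong-≋

  ∑-+ : ∀ {k} (f g : Fin k → Carrier) → ∑ (λ i → f i + g i) ≈ ∑ f + ∑ g
  ∑-+ = S.∑-distrib-+

  ∑-*ˡ : ∀ {k} a (f : Fin k → Carrier) → a * ∑ f ≈ ∑ (λ i → a * f i)
  ∑-*ˡ = S.*-distribˡ-sum

  ∑-*ʳ : ∀ {k} (f : Fin k → Carrier) a → ∑ f * a ≈ ∑ (λ i → f i * a)
  ∑-*ʳ f a = S.*-distribʳ-sum a f

  ∑-swap : ∀ {k l} (f : Fin k → Fin l → Carrier) →
           ∑ (λ i → ∑ (f i)) ≈ ∑ (λ j → ∑ (λ i → f i j))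
  ∑-swap = S.∑-comm

  ∑-zero : ∀ {k} {f : Fin k → Carrier} → (∀ i → f i ≈ 0#) → ∑ f ≈ 0#
  ∑-zero {k} h = R.trans (∑-cong h) (S.sum-replicate-zero k)

  ∑-single : ∀ {k} {f : Fin k → Carrier} i → (∀ j → j ≢ i → f j ≈ 0#) → ∑ f ≈ f i
  ∑-single {f = f} zero h =
    R.trans (+-congˡ (∑-zero λ j → h (suc j) λ ())) (+-identityʳ _)
  ∑-single {f = f} (suc i) h =
    R.trans (+-cong (h zero λ ()) (∑-single i λ j j≢i → h (suc j) (j≢i ∘ Finₚ.suc-injective)))
            (+-identityˡ _)

open Sums ℚₚ.+-*-commutativeRing

∑-neg : ∀ {k} (f : Fin k → ℚ) → ∑ (λ i → ℚ.- f i) ≡ ℚ.- ∑ f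
∑-neg {zero}  f = refl
∑-neg {suc k} f = trans (cong (ℚ.- f zero ℚ.+_) (∑-neg (f ∘ suc)))
                        (sym (ℚₚ.neg-distrib-+ (f zero) _))

1ℚ≢0ℚ : 1ℚ ≢ 0ℚ
1ℚ≢0ℚ ()

inv : ∀ {a : ℚ} → a ≢ 0ℚ → Σ[ b ∈ ℚ ] b ℚ.* a ≡ 1ℚ
inv {a} a≢0 = (ℚ.1/ a) , ℚₚ.*-inverseˡ a
  where instance a-nonZero : ℚ.NonZero a
                 a-nonZero = ℚ.≢-nonZero a≢0

*-cancel-0 : ∀ {a b : ℚ} → a ≢ 0ℚ → a ℚ.* b ≡ 0ℚ → b ≡ 0ℚ
*-cancel-0 {a} {b} a≢0 ab≡0 with inv a≢0
... | c , ca≡1 = begin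
  b                ≡⟨ sym (ℚₚ.*-identityˡ b) ⟩
  1ℚ ℚ.* b         ≡⟨ cong (ℚ._* b) (sym ca≡1) ⟩
  c ℚ.* a ℚ.* b    ≡⟨ ℚₚ.*-assoc c a b ⟩
  c ℚ.* (a ℚ.* b)  ≡⟨ cong (c ℚ.*_) ab≡0 ⟩
  c ℚ.* 0ℚ         ≡⟨ ℚₚ.*-zeroʳ c ⟩
  0ℚ               ∎
  where open ≡-Reasoning

*-nonzero : ∀ {a b : ℚ} → a ≢ 0ℚ → b ≢ 0ℚ → a ℚ.* b ≢ 0ℚ
*-nonzero a≢0 b≢0 ab≡0 = b≢0 (*-cancel-0 a≢0 ab≡0)

x-y≡0⇒x≡y : ∀ {x y : ℚ} → x ℚ.- y ≡ 0ℚ → x ≡ y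
x-y≡0⇒x≡y {x} {y} h = begin
  x                ≡⟨ solve 2 (λ a b → a := (a :- b) :+ b) refl x y ⟩
  (x ℚ.- y) ℚ.+ y  ≡⟨ cong (ℚ._+ y) h ⟩
  0ℚ ℚ.+ y         ≡⟨ ℚₚ.+-identityˡ y ⟩
  y                ∎
  where open ≡-Reasoning
        open +-*-Solver

square-nonneg : ∀ (a : ℚ) → 0ℚ ℚ.≤ a ℚ.* a
square-nonneg a with ℚₚ.≤-total 0ℚ a
... | inj₁ 0≤a = ℚₚ.nonNegative⁻¹ (a ℚ.* a) {{ℚₚ.nonNeg*nonNeg⇒nonNeg a {{ℚ.nonNegative 0≤a}} a {{ℚ.nonNegative 0≤a}}}}
... | inj₂ a≤0 = ℚₚ.nonNegative⁻¹ (a ℚ.* a) {{ℚₚ.nonPos*nonPos⇒nonPos a {{ℚ.nonPositive a≤0}} a {{ℚ.nonPositive a≤0}}}}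

∑-squares-nonneg : ∀ {k} (f : Fin k → ℚ) → 0ℚ ℚ.≤ ∑ (λ i → f i ℚ.* f i)
∑-squares-nonneg {zero}  f = ℚₚ.≤-refl
∑-squares-nonneg {suc k} f = ℚₚ.+-mono-≤ (square-nonneg (f zero)) (∑-squares-nonneg (f ∘ suc))

∑-squares≡0 : ∀ {k} (f : Fin k → ℚ) → ∑ (λ i → f i ℚ.* f i) ≡ 0ℚ → ∀ i → f i ≡ 0ℚ
∑-squares≡0 {suc k} f h = go
  where
  s = ∑ (λ i → f (suc i) ℚ.* f (suc i))
  a² = f zero ℚ.* f zero
  a²≤0 : a² ℚ.≤ 0ℚ
  a²≤0 = subst (ℚ._≤ 0ℚ) (ℚₚ.+-identityʳ a²)
           (ℚₚ.≤-trans (ℚₚ.+-monoʳ-≤ a² (∑-squares-nonneg (f ∘ suc))) (ℚₚ.≤-reflexive h))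
  a²≡0 : a² ≡ 0ℚ
  a²≡0 = ℚₚ.≤-antisym a²≤0 (square-nonneg (f zero))
  s≡0 : s ≡ 0ℚ
  s≡0 = trans (sym (ℚₚ.+-identityˡ s)) (trans (cong (ℚ._+ s) (sym a²≡0)) h)
  go : ∀ i → f i ≡ 0ℚ
  go zero with f zero ℚₚ.≟ 0ℚ
  ... | yes p = p
  ... | no ¬p = *-cancel-0 ¬p a²≡0
  go (suc i) = ∑-squares≡0 (f ∘ suc) s≡0 i

*-cong-≢0 : ∀ a {s t : ℚ} → (a ≢ 0ℚ → s ≡ t) → a ℚ.* s ≡ a ℚ.* t
*-cong-≢0 a {s} {t} h with a ℚₚ.≟ 0ℚ
... | yes refl = trans (ℚₚ.*-zeroˡ s) (sym (ℚₚ.*-zeroˡ t))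
... | no a≢0   = cong (a ℚ.*_) (h a≢0)

*-zero-≢0 : ∀ a {s : ℚ} → (a ≢ 0ℚ → s ≡ 0ℚ) → a ℚ.* s ≡ 0ℚ
*-zero-≢0 a h = trans (*-cong-≢0 a h) (ℚₚ.*-zeroʳ a)

*-≢0ˡ : ∀ {a b : ℚ} → a ℚ.* b ≢ 0ℚ → a ≢ 0ℚ
*-≢0ˡ {b = b} h refl = h (ℚₚ.*-zeroˡ b)

*-≢0ʳ : ∀ {a b : ℚ} → a ℚ.* b ≢ 0ℚ → b ≢ 0ℚ
*-≢0ʳ {a} h refl = h (ℚₚ.*-zeroʳ a)

-- Linear algebra: functionals, subspaces, dimensions of subquotients.

record Fun (X : Set) : Set where
  no-eta-equality
  field
    ap      : (X → ℚ) → ℚ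
    ap-cong : ∀ {f g} → f ≗ g → ap f ≡ ap g
    ap-+    : ∀ f g → ap (λ x → f x ℚ.+ g x) ≡ ap f ℚ.+ ap g
    ap-*    : ∀ a f → ap (λ x → a ℚ.* f x) ≡ a ℚ.* ap f

  ap-0 : ap (λ _ → 0ℚ) ≡ 0ℚ
  ap-0 = trans (ap-* 0ℚ (λ _ → 0ℚ)) (ℚₚ.*-zeroˡ (ap (λ _ → 0ℚ)))

  ap-neg : ∀ f → ap (λ x → ℚ.- f x) ≡ ℚ.- ap f
  ap-neg f = begin
    ap (λ x → ℚ.- f x)         ≡⟨ ap-cong (λ x → -1* (f x)) ⟩
    ap (λ x → ℚ.- 1ℚ ℚ.* f x)  ≡⟨ ap-* (ℚ.- 1ℚ) f ⟩
    ℚ.- 1ℚ ℚ.* ap f            ≡⟨ -1* (ap f) ⟨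
    ℚ.- ap f                   ∎
    where
    open ≡-Reasoning
    open +-*-Solver
    -1* : ∀ a → ℚ.- a ≡ ℚ.- 1ℚ ℚ.* a
    -1* = solve 1 (λ a → :- a := :- con 1ℚ :* a) refl

  ap-- : ∀ f g → ap (λ x → f x ℚ.- g x) ≡ ap f ℚ.- ap g
  ap-- f g = trans (ap-+ f (λ x → ℚ.- g x)) (cong (ap f ℚ.+_) (ap-neg g))

  ap-∑ : ∀ {k} (f : Fin k → X → ℚ) → ap (λ x → ∑ (λ i → f i x)) ≡ ∑ (λ i → ap (f i))
  ap-∑ {zero}  f = ap-0
  ap-∑ {suc k} f = trans (ap-+ (f zero) _) (cong (ap (f zero) ℚ.+_) (ap-∑ (f ∘ suc)))
open Fun

-- A linear map from functions on `X` to functions on `Y`, stored as its family of coordinate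
-- functionals; `∘ᶠ` is then its transpose.
Map : Set → Set → Set
Map X Y = Y → Fun X

infixr 9 _$_ _∘ᶠ_
_$_ : ∀ {X Y} → Map X Y → (X → ℚ) → Y → ℚ
(T $ f) y = ap (T y) f

_∘ᶠ_ : ∀ {X Y} → Fun Y → Map X Y → Fun X
ap (c ∘ᶠ T) f = ap c (T $ f)
ap-cong (c ∘ᶠ T) h = ap-cong c λ y → ap-cong (T y) h
ap-+ (c ∘ᶠ T) f g = trans (ap-cong c λ y → ap-+ (T y) f g) (ap-+ c _ _)
ap-* (c ∘ᶠ T) a f = trans (ap-cong c λ y → ap-* (T y) a f) (ap-* c a _)

ev : ∀ {X} → X → Fun X
ap (ev x) f = f x
ap-cong (ev x) h = h x
ap-+ (ev x) _ _ = refl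
ap-* (ev x) _ _ = refl

infixl 6 _-ᶠ_
infixl 7 _·ᶠ_

_-ᶠ_ : ∀ {X} → Fun X → Fun X → Fun X
ap (c -ᶠ c′) f = ap c f ℚ.- ap c′ f
ap-cong (c -ᶠ c′) h = cong₂ ℚ._-_ (ap-cong c h) (ap-cong c′ h)
ap-+ (c -ᶠ c′) f g = trans (cong₂ ℚ._-_ (ap-+ c f g) (ap-+ c′ f g))
      (solve 4 (λ p q r s → (p :+ q) :- (r :+ s) := (p :- r) :+ (q :- s)) refl
         (ap c f) (ap c g) (ap c′ f) (ap c′ g))
  where open +-*-Solver
ap-* (c -ᶠ c′) a f = trans (cong₂ ℚ._-_ (ap-* c a f) (ap-* c′ a f))
      (solve 3 (λ a p q → a :* p :- a :* q := a :* (p :- q)) refl a (ap c f) (ap c′ f))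
  where open +-*-Solver

_·ᶠ_ : ∀ {X} → ℚ → Fun X → Fun X
ap (k ·ᶠ c) f = k ℚ.* ap c f
ap-cong (k ·ᶠ c) h = cong (k ℚ.*_) (ap-cong c h)
ap-+ (k ·ᶠ c) f g = trans (cong (k ℚ.*_) (ap-+ c f g)) (ℚₚ.*-distribˡ-+ k _ _)
ap-* (k ·ᶠ c) a f = trans (cong (k ℚ.*_) (ap-* c a f))
      (solve 3 (λ k a p → k :* (a :* p) := a :* (k :* p)) refl k a (ap c f))
  where open +-*-Solver

∑ᶠ : ∀ {X k} → (Fin k → Fun X) → Fun X
ap (∑ᶠ c) f = ∑ λ i → ap (c i) f
ap-cong (∑ᶠ c) h = ∑-cong λ i → ap-cong (c i) h
ap-+ (∑ᶠ c) f g = trans (∑-cong λ i → ap-+ (c i) f g) (∑-+ (λ i → ap (c i) f) (λ i → ap (c i) g))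
ap-* (∑ᶠ c) a f = trans (∑-cong λ i → ap-* (c i) a f) (sym (∑-*ˡ a (λ i → ap (c i) f)))

-- Membership is an arbitrary predicate and in general undecidable; all decisions are made by
-- evaluating functionals.
record Subspace (X : Set) : Set₁ where
  no-eta-equality
  infix 4 _∋_
  field
    _∋_    : (X → ℚ) → Set
    ∋-resp : ∀ {f g} → f ≗ g → _∋_ f → _∋_ g
    ∋-0    : _∋_ (λ _ → 0ℚ)
    ∋-+    : ∀ {f g} → _∋_ f → _∋_ g → _∋_ (λ x → f x ℚ.+ g x)
    ∋-*    : ∀ a {f} → _∋_ f → _∋_ (λ x → a ℚ.* f x)

  ∋-- : ∀ {f g} → _∋_ f → _∋_ g → _∋_ (λ x → f x ℚ.- g x)
  ∋-- {f} {g} p q = ∋-resp (λ x → solve 2 (λ a b → a :+ :- con 1ℚ :* b := a :- b) refl (f x) (g x))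
                           (∋-+ p (∋-* (ℚ.- 1ℚ) q))
    where open +-*-Solver

  ∋-∑ : ∀ {k} {f : Fin k → X → ℚ} → (∀ i → _∋_ (f i)) → _∋_ (λ x → ∑ (λ i → f i x))
  ∋-∑ {zero}  h = ∋-0
  ∋-∑ {suc k} h = ∋-+ (h zero) (∋-∑ (h ∘ suc))

  ∋-of-- : ∀ {f g} → _∋_ (λ x → f x ℚ.- g x) → _∋_ g → _∋_ f
  ∋-of-- {f} {g} p q = ∋-resp (λ x → solve 2 (λ a b → (a :- b) :+ b := a) refl (f x) (g x)) (∋-+ p q)
    where open +-*-Solver
open Subspace

full none : ∀ {X : Set} → Subspace X
_∋_ full _ = ⊤
∋-resp full _ _ = tt
∋-0 full = tt
∋-+ full _ _ = tt
∋-* full _ _ = tt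
_∋_ none f = ∀ x → f x ≡ 0ℚ
∋-resp none h p x = trans (sym (h x)) (p x)
∋-0 none x = refl
∋-+ none p q x = cong₂ ℚ._+_ (p x) (q x)
∋-* none a p x = trans (cong (a ℚ.*_) (p x)) (ℚₚ.*-zeroʳ a)

infix 4 _⊆_
_⊆_ : ∀ {X} → Subspace X → Subspace X → Set
S ⊆ N = ∀ f → S ∋ f → N ∋ f

Kills : ∀ {X} → Fun X → Subspace X → Set
Kills c N = ∀ f → N ∋ f → ap c f ≡ 0ℚ

Kills-≡ : ∀ {X} (N : Subspace X) (c : Fun X) → Kills c N →
          ∀ f g → N ∋ (λ x → f x ℚ.- g x) → ap c f ≡ ap c g
Kills-≡ N c cN f g p = x-y≡0⇒x≡y (trans (sym (ap-- c f g)) (cN _ p))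

infixl 6 _∩_
_∩_ : ∀ {X} → Subspace X → Fun X → Subspace X
_∋_ (S ∩ c) f = S ∋ f × ap c f ≡ 0ℚ
∋-resp (S ∩ c) h (p , q) = ∋-resp S h p , trans (sym (ap-cong c h)) q
∋-0 (S ∩ c) = ∋-0 S , ap-0 c
∋-+ (S ∩ c) (p , q) (p′ , q′) = ∋-+ S p p′ , trans (ap-+ c _ _) (cong₂ ℚ._+_ q q′)
∋-* (S ∩ c) a (p , q) = ∋-* S a p , trans (ap-* c a _) (trans (cong (a ℚ.*_) q) (ℚₚ.*-zeroʳ a))

preimage : ∀ {X Y} → Map X Y → Subspace X → Subspace Y → Subspace X
_∋_ (preimage T S N) f = S ∋ f × N ∋ (T $ f)
∋-resp (preimage T S N) h (p , q) = ∋-resp S h p , ∋-resp N (λ y → ap-cong (T y) h) q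
∋-0 (preimage T S N) = ∋-0 S , ∋-resp N (λ y → sym (ap-0 (T y))) (∋-0 N)
∋-+ (preimage T S N) (p , q) (p′ , q′) = ∋-+ S p p′ , ∋-resp N (λ y → sym (ap-+ (T y) _ _)) (∋-+ N q q′)
∋-* (preimage T S N) a (p , q) = ∋-* S a p , ∋-resp N (λ y → sym (ap-* (T y) a _)) (∋-* N a q)

_+⟨_⟩ : ∀ {X} → Subspace X → (X → ℚ) → Subspace X
_∋_ (N +⟨ v ⟩) f = Σ[ a ∈ ℚ ] N ∋ (λ x → f x ℚ.- a ℚ.* v x)
∋-resp (N +⟨ v ⟩) h (a , p) = a , ∋-resp N (λ x → cong (ℚ._- a ℚ.* v x) (h x)) p
∋-0 (N +⟨ v ⟩) = 0ℚ , ∋-resp N (λ x → solve 1 (λ v → con 0ℚ := con 0ℚ :- con 0ℚ :* v) refl (v x)) (∋-0 N)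
  where open +-*-Solver
∋-+ (N +⟨ v ⟩) {f} {g} (a , p) (b , q) = a ℚ.+ b , ∋-resp N (λ x →
      solve 5 (λ f g a b v → (f :- a :* v) :+ (g :- b :* v) := (f :+ g) :- (a :+ b) :* v) refl (f x) (g x) a b (v x))
      (∋-+ N p q)
  where open +-*-Solver
∋-* (N +⟨ v ⟩) k {f} (a , p) = k ℚ.* a , ∋-resp N (λ x →
      solve 4 (λ f k a v → k :* (f :- a :* v) := k :* f :- (k :* a) :* v) refl (f x) k a (v x))
      (∋-* N k p)
  where open +-*-Solver

sumWithImage : ∀ {X Y} → Subspace Y → Map X Y → Subspace X → Subspace Y
_∋_ (sumWithImage {X} N T S) f = Σ[ g ∈ (X → ℚ) ] S ∋ g × N ∋ (λ y → f y ℚ.- (T $ g) y)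
∋-resp (sumWithImage {X} N T S) h (g , p , q) = g , p , ∋-resp N (λ y → cong (ℚ._- (T $ g) y) (h y)) q
∋-0 (sumWithImage {X} N T S) = (λ _ → 0ℚ) , ∋-0 S , ∋-resp N (λ y → cong (λ t → 0ℚ ℚ.- t) (sym (ap-0 (T y)))) (∋-0 N)
∋-+ (sumWithImage {X} N T S) {f} {f′} (g , p , q) (g′ , p′ , q′) = (λ x → g x ℚ.+ g′ x) , ∋-+ S p p′ ,
      ∋-resp N (λ y → trans
        (solve 4 (λ f t f′ t′ → (f :- t) :+ (f′ :- t′) := (f :+ f′) :- (t :+ t′)) refl
               (f y) ((T $ g) y) (f′ y) ((T $ g′) y))
        (cong (λ t → f y ℚ.+ f′ y ℚ.- t) (sym (ap-+ (T y) g g′)))) (∋-+ N q q′)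
  where open +-*-Solver
∋-* (sumWithImage {X} N T S) a {f} (g , p , q) = (λ x → a ℚ.* g x) , ∋-* S a p ,
      ∋-resp N (λ y → trans
        (solve 3 (λ a f t → a :* (f :- t) := a :* f :- a :* t) refl a (f y) ((T $ g) y))
        (cong (λ t → a ℚ.* f y ℚ.- t) (sym (ap-* (T y) a g)))) (∋-* N a q)
  where open +-*-Solver

-- Dim S N d: the quotient S / (S ∩ N) has dimension d; each step splits off a line ⟨ b ⟩ from S.
Dim : ∀ {X} → Subspace X → Subspace X → ℕ → Set
Dim S N zero    = S ⊆ N
Dim {X} S N (suc d) = Σ[ b ∈ (X → ℚ) ] Σ[ c ∈ Fun X ]
  S ∋ b × ap c b ≡ 1ℚ × Kills c N × Dim (S ∩ c) N d

-- The projection onto the kernel of `c` along `b`, provided `c` is one at `b`.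
residual : ∀ {X} → (X → ℚ) → Fun X → Map X X
residual b c x = ev x -ᶠ b x ·ᶠ c

residual-∈ : ∀ {X} (S : Subspace X) {b} {c : Fun X} → S ∋ b → ap c b ≡ 1ℚ →
             ∀ f → S ∋ f → (S ∩ c) ∋ (residual b c $ f)
residual-∈ S {b} {c} b∈ cb≡1 f f∈ =
  ∋-- S f∈ (∋-resp S (λ x → ℚₚ.*-comm (ap c f) (b x)) (∋-* S (ap c f) b∈)) , (begin
  ap c (λ x → f x ℚ.- b x ℚ.* ap c f)      ≡⟨ ap-- c f _ ⟩
  ap c f ℚ.- ap c (λ x → b x ℚ.* ap c f)   ≡⟨ cong (λ u → ap c f ℚ.- u) (ap-cong c λ x → ℚₚ.*-comm (b x) (ap c f)) ⟩
  ap c f ℚ.- ap c (λ x → ap c f ℚ.* b x)   ≡⟨ cong (λ u → ap c f ℚ.- u) (ap-* c (ap c f) b) ⟩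
  ap c f ℚ.- ap c f ℚ.* ap c b             ≡⟨ cong (λ t → ap c f ℚ.- ap c f ℚ.* t) cb≡1 ⟩
  ap c f ℚ.- ap c f ℚ.* 1ℚ                 ≡⟨ solve 1 (λ a → a :- a :* con 1ℚ := con 0ℚ) refl (ap c f) ⟩
  0ℚ                                       ∎)
  where open ≡-Reasoning
        open +-*-Solver

ap-residual : ∀ {X} (g c : Fun X) b f → ap g (residual b c $ f) ≡ ap g f ℚ.- ap c f ℚ.* ap g b
ap-residual g c b f = trans (ap-- g f _) (cong (λ u → ap g f ℚ.- u)
  (trans (ap-cong g λ x → ℚₚ.*-comm (b x) (ap c f)) (ap-* g (ap c f) b)))

Dim-resp : ∀ {X} d {S S′ N N′ : Subspace X} → S′ ⊆ S → S ⊆ S′ → N ⊆ N′ → N′ ⊆ N → Dim S N d → Dim S′ N′ d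
Dim-resp zero    h k l m D f p = l f (D f (h f p))
Dim-resp (suc d) h k l m (b , c , b∈ , cb , cN , D) =
  b , c , k b b∈ , cb , (λ f → cN f ∘ m f) ,
  Dim-resp d (λ f (p , q) → h f p , q) (λ f (p , q) → k f p , q) l m D

Dim-iso : ∀ {X Y} d {S N : Subspace X} {S′ N′ : Subspace Y} (T : Map X Y) (U : Map Y X) →
          (∀ f → S ∋ f → S′ ∋ (T $ f)) → (∀ g → S′ ∋ g → S ∋ (U $ g)) →
          (∀ f → N ∋ f → N′ ∋ (T $ f)) → (∀ g → N′ ∋ g → N ∋ (U $ g)) →
          (∀ f → S ∋ f → N ∋ (λ x → f x ℚ.- (U $ T $ f) x)) →
          (∀ g → S′ ∋ g → N′ ∋ (λ y → g y ℚ.- (T $ U $ g) y)) →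
          Dim S′ N′ d → Dim S N d
Dim-iso zero {N = N} T U TS US TN UN UT TU D f f∈ = ∋-of-- N (UT f f∈) (UN _ (D _ (TS f f∈)))
Dim-iso (suc d) {S′ = S′} {N′} T U TS US TN UN UT TU (b , c , b∈ , cb , cN , D) =
  (U $ b) , c ∘ᶠ T , US b b∈ , trans (cTU b b∈) cb , (λ f p → cN _ (TN f p)) ,
  Dim-iso d T U (λ f (p , q) → TS f p , q) (λ g (p , q) → US g p , trans (cTU g p) q) TN UN
    (λ f → UT f ∘ proj₁) (λ g → TU g ∘ proj₁) D
  where
  cTU : ∀ g → S′ ∋ g → ap c (T $ U $ g) ≡ ap c g
  cTU g g∈ = sym (Kills-≡ N′ c cN g (T $ U $ g) (TU g g∈))

-- A functional that kills `N` can be tested on the `d` vectors split off by `Dim`.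
dec-fun : ∀ {X} d {S N : Subspace X} → Dim S N d → (g : Fun X) → Kills g N →
          (Σ[ f ∈ (X → ℚ) ] S ∋ f × ap g f ≢ 0ℚ) ⊎ Kills g S
dec-fun zero    D g gN = inj₂ λ f → gN f ∘ D f
dec-fun (suc d) {S} (b , c , b∈ , cb , cN , D) g gN with ap g b ℚₚ.≟ 0ℚ
... | no  gb≢0 = inj₁ (b , b∈ , gb≢0)
... | yes gb≡0 with dec-fun d D g gN
... | inj₁ (f , (f∈ , _) , gf≢0) = inj₁ (f , f∈ , gf≢0)
... | inj₂ h = inj₂ λ f f∈ → x-y≡0⇒x≡y (begin
  ap g f ℚ.- 0ℚ                 ≡⟨ cong (λ u → ap g f ℚ.- u) (sym (trans (cong (ap c f ℚ.*_) gb≡0) (ℚₚ.*-zeroʳ (ap c f)))) ⟩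
  ap g f ℚ.- ap c f ℚ.* ap g b  ≡⟨ ap-residual g c b f ⟨
  ap g (residual b c $ f)       ≡⟨ h _ (residual-∈ S {c = c} b∈ cb f f∈) ⟩
  0ℚ                            ∎)
  where open ≡-Reasoning

-- Exchange argument. If `g` vanishes on `S ∩ c`, it is proportional to `c` on `S` and cuts out the
-- same subspace. Otherwise a vector of `S ∩ c` on which `g` is nonzero corrects `b` into the kernel
-- of `g`, and the line of `b` survives the cut.
Dim-∩ : ∀ {X} d {S N : Subspace X} → Dim S N d → (g : Fun X) → Kills g N →
        ∀ f → S ∋ f → ap g f ≢ 0ℚ → Σ[ d′ ∈ ℕ ] d ≡ suc d′ × Dim (S ∩ g) N d′
Dim-∩ zero    D g gN f f∈ gf≢0 = contradiction (gN f (D f f∈)) gf≢0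
Dim-∩ (suc d) {S} (b , c , b∈ , cb , cN , D) g gN f₀ f₀∈ gf₀≢0 with dec-fun d D g gN
... | inj₂ h = d , refl , Dim-resp d (λ f (p , q) → p , cf≡0 f p q) (λ f (p , q) → p , h f (p , q)) (λ _ z → z) (λ _ z → z) D
  where
  gf : ∀ f → S ∋ f → ap g f ≡ ap c f ℚ.* ap g b
  gf f f∈ = x-y≡0⇒x≡y (trans (sym (ap-residual g c b f)) (h _ (residual-∈ S {c = c} b∈ cb f f∈)))
  gb≢0 : ap g b ≢ 0ℚ
  gb≢0 gb≡0 = gf₀≢0 (trans (gf f₀ f₀∈) (trans (cong (ap c f₀ ℚ.*_) gb≡0) (ℚₚ.*-zeroʳ (ap c f₀))))
  cf≡0 : ∀ f → S ∋ f → ap g f ≡ 0ℚ → ap c f ≡ 0ℚ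
  cf≡0 f f∈ gf≡0 = *-cancel-0 gb≢0 (trans (ℚₚ.*-comm (ap g b) (ap c f)) (trans (sym (gf f f∈)) gf≡0))
... | inj₁ (f₁ , (f₁∈ , cf₁≡0) , gf₁≢0) with Dim-∩ d D g gN f₁ (f₁∈ , cf₁≡0) gf₁≢0 | inv gf₁≢0
... | d′ , refl , D′ | k , kgf₁≡1 = suc d′ , refl , b′ , c , (b′∈ , gb′≡0) , cb′≡1 , cN ,
    Dim-resp d′ (λ _ ((p , q) , r) → (p , r) , q) (λ _ ((p , q) , r) → (p , r) , q) (λ _ z → z) (λ _ z → z) D′
  where
  open ≡-Reasoning
  open +-*-Solver
  t = ap g b ℚ.* k
  b′ = λ x → b x ℚ.- t ℚ.* f₁ x
  b′∈ : S ∋ b′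
  b′∈ = ∋-- S b∈ (∋-* S t f₁∈)
  ap-b′ : ∀ h → ap h b′ ≡ ap h b ℚ.- t ℚ.* ap h f₁
  ap-b′ h = trans (ap-- h b _) (cong (λ u → ap h b ℚ.- u) (ap-* h t f₁))
  gb′≡0 : ap g b′ ≡ 0ℚ
  gb′≡0 = begin
    ap g b′                                  ≡⟨ ap-b′ g ⟩
    ap g b ℚ.- ap g b ℚ.* k ℚ.* ap g f₁      ≡⟨ cong (λ u → ap g b ℚ.- u) (ℚₚ.*-assoc (ap g b) k (ap g f₁)) ⟩
    ap g b ℚ.- ap g b ℚ.* (k ℚ.* ap g f₁)    ≡⟨ cong (λ u → ap g b ℚ.- ap g b ℚ.* u) kgf₁≡1 ⟩
    ap g b ℚ.- ap g b ℚ.* 1ℚ                 ≡⟨ solve 1 (λ a → a :- a :* con 1ℚ := con 0ℚ) refl (ap g b) ⟩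
    0ℚ                                       ∎
  cb′≡1 : ap c b′ ≡ 1ℚ
  cb′≡1 = begin
    ap c b′                    ≡⟨ ap-b′ c ⟩
    ap c b ℚ.- t ℚ.* ap c f₁   ≡⟨ cong₂ (λ u v → u ℚ.- t ℚ.* v) cb cf₁≡0 ⟩
    1ℚ ℚ.- t ℚ.* 0ℚ            ≡⟨ solve 1 (λ t → con 1ℚ :- t :* con 0ℚ := con 1ℚ) refl t ⟩
    1ℚ                         ∎

⊆-+⟨⟩ : ∀ {X} (N : Subspace X) v → N ⊆ N +⟨ v ⟩
⊆-+⟨⟩ N v f p = 0ℚ , ∋-resp N (λ x → solve 2 (λ f v → f := f :- con 0ℚ :* v) refl (f x) (v x)) p
  where open +-*-Solver

-- Dual exchange. If `c` vanishes at `v`, the line of `b` is kept; otherwise `v`, rescaled, takes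
-- the place of `b`, and projecting along `v` identifies the new quotient with that of `S ∩ c`.
Dim-+⟨⟩ : ∀ {X} d {S N : Subspace X} → Dim S N d → ∀ v → S ∋ v → ¬ (N ∋ v) →
          Σ[ d′ ∈ ℕ ] d ≡ suc d′ × Dim S (N +⟨ v ⟩) d′
Dim-+⟨⟩ zero    D v v∈ v∉ = contradiction (D v v∈) v∉
Dim-+⟨⟩ (suc d) {S} {N} (b , c , b∈ , cb , cN , D) v v∈ v∉ with ap c v ℚₚ.≟ 0ℚ
... | yes cv≡0 with Dim-+⟨⟩ d D v (v∈ , cv≡0) v∉
... | d′ , refl , D′ = suc d′ , refl , b , c , b∈ , cb ,
    (λ f (a , p) → trans (Kills-≡ N c cN f (λ x → a ℚ.* v x) p)
       (trans (ap-* c a v) (trans (cong (a ℚ.*_) cv≡0) (ℚₚ.*-zeroʳ a)))) , D′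
Dim-+⟨⟩ (suc d) {S} {N} (b , c , b∈ , cb , cN , D) v v∈ v∉ | no cv≢0 with inv cv≢0
... | k , kcv≡1 = d , refl , Dim-iso d R ev
    (residual-∈ S {c = c} w∈ cw≡1) (λ _ → proj₁)
    (λ f (a , p) → ∋-resp N (λ x → sym (Tf f a x (cf≡ f a p))) p)
    (⊆-+⟨⟩ N v)
    (λ f f∈ → ap c f ℚ.* k , ∋-resp N (λ x →
      solve 4 (λ f p k v → con 0ℚ := f :- (f :- (k :* v) :* p) :- (p :* k) :* v) refl (f x) (ap c f) k (v x)) (∋-0 N))
    (λ g (g∈ , cg≡0) → ∋-resp N (λ x → sym (trans (cong (λ u → g x ℚ.- (g x ℚ.- w x ℚ.* u)) cg≡0)
      (solve 2 (λ g w → g :- (g :- w :* con 0ℚ) := con 0ℚ) refl (g x) (w x)))) (∋-0 N))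
    D
  where
  open +-*-Solver
  w = λ x → k ℚ.* v x
  w∈ : S ∋ w
  w∈ = ∋-* S k v∈
  cw≡1 : ap c w ≡ 1ℚ
  cw≡1 = trans (ap-* c k v) kcv≡1
  R = residual w c
  cf≡ : ∀ f a → N ∋ (λ x → f x ℚ.- a ℚ.* v x) → ap c f ≡ a ℚ.* ap c v
  cf≡ f a p = trans (Kills-≡ N c cN f (λ x → a ℚ.* v x) p) (ap-* c a v)
  Tf : ∀ f a x → ap c f ≡ a ℚ.* ap c v → (R $ f) x ≡ f x ℚ.- a ℚ.* v x
  Tf f a x h = begin
    f x ℚ.- k ℚ.* v x ℚ.* ap c f             ≡⟨ cong (λ u → f x ℚ.- k ℚ.* v x ℚ.* u) h ⟩
    f x ℚ.- k ℚ.* v x ℚ.* (a ℚ.* ap c v)     ≡⟨ solve 5 (λ f k v a q → f :- k :* v :* (a :* q) := f :- a :* v :* (k :* q)) refl (f x) k (v x) a (ap c v) ⟩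
    f x ℚ.- a ℚ.* v x ℚ.* (k ℚ.* ap c v)     ≡⟨ cong (λ u → f x ℚ.- a ℚ.* v x ℚ.* u) kcv≡1 ⟩
    f x ℚ.- a ℚ.* v x ℚ.* 1ℚ                 ≡⟨ cong (λ u → f x ℚ.- u) (ℚₚ.*-identityʳ _) ⟩
    f x ℚ.- a ℚ.* v x                        ∎
    where open ≡-Reasoning

-- Rank-nullity for a surjection of subquotients: a functional splitting off a line of the target
-- pulls back to one that is nonzero on `S`, hence cuts `S` by exactly one dimension.
kernelDim : ∀ {X Y} q {S N : Subspace X} {S′ N′ : Subspace Y} (T : Map X Y) →
            (∀ f → S ∋ f → S′ ∋ (T $ f)) → (∀ f → N ∋ f → N′ ∋ (T $ f)) →
            (∀ g → S′ ∋ g → Σ[ f ∈ (X → ℚ) ] S ∋ f × N′ ∋ (λ y → g y ℚ.- (T $ f) y)) →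
            Dim S′ N′ q → ∀ {d} → Dim S N d →
            Σ[ d′ ∈ ℕ ] d ≡ q ℕ.+ d′ × Dim (preimage T S N′) N d′
kernelDim zero T TS TN onto D′ {d} D =
  d , refl , Dim-resp d (λ _ → proj₁) (λ f p → p , D′ _ (TS f p)) (λ _ z → z) (λ _ z → z) D
kernelDim (suc q) {S} {N} {S′} {N′} T TS TN onto (b , c , b∈ , cb , cN′ , D′) {d} D =
  let f₀ , f₀∈ , bTf₀ = onto b b∈
      cTf₀≡1 : ap c (T $ f₀) ≡ 1ℚ
      cTf₀≡1 = trans (sym (Kills-≡ N′ c cN′ b (T $ f₀) bTf₀)) cb
      d₁ , e₁ , D₁ = Dim-∩ d D (c ∘ᶠ T) (λ f p → cN′ _ (TN f p)) f₀ f₀∈ (λ h → 1ℚ≢0ℚ (trans (sym cTf₀≡1) h))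
      d₂ , e₂ , D₂ = kernelDim q T (λ f (p , r) → TS f p , r) TN
         (λ g (p , r) → let f , f∈ , h = onto g p in
            f , (f∈ , trans (sym (Kills-≡ N′ c cN′ g (T $ f) h)) r) , h)
         D′ D₁
  in d₂ , trans e₁ (cong suc e₂) ,
     Dim-resp d₂ (λ _ (p , r) → (p , cN′ _ r) , r) (λ _ ((p , _) , r) → p , r) (λ _ z → z) (λ _ z → z) D₂

-- For an injection of subquotients, each split-off vector has an image that is new modulo `N`. The
-- rest stays injective: a multiple of `b` congruent to a vector killed by `c` has coefficient zero.
cokernelDim : ∀ {X Y} a {S N : Subspace X} {S′ N′ : Subspace Y} (T : Map Y X) →
              (∀ f → S′ ∋ f → S ∋ (T $ f)) → (∀ f → N′ ∋ f → N ∋ (T $ f)) →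
              (∀ f → S′ ∋ f → N ∋ (T $ f) → N′ ∋ f) →
              Dim S′ N′ a → ∀ {d} → Dim S N d →
              Σ[ d′ ∈ ℕ ] d ≡ a ℕ.+ d′ × Dim S (sumWithImage N T S′) d′
cokernelDim zero {N = N} {S′} T TS TN inj D′ {d} D =
  d , refl , Dim-resp d (λ _ z → z) (λ _ z → z)
    (λ f p → (λ _ → 0ℚ) , ∋-0 S′ , ∋-resp N (λ x → trans (sym (ℚₚ.+-identityʳ (f x)))
      (cong (λ t → f x ℚ.- t) (sym (ap-0 (T x))))) p)
    (λ f (g , g∈ , p) → ∋-of-- N p (TN g (D′ g g∈))) D
cokernelDim (suc a) {S} {N} {S′} {N′} T TS TN inj (b , c , b∈ , cb , cN′ , D′) {d} D =
  let d₁ , e₁ , D₁ = Dim-+⟨⟩ d D (T $ b) (TS b b∈) (λ h → 1ℚ≢0ℚ (trans (sym cb) (cN′ b (inj b b∈ h))))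
      d₂ , e₂ , D₂ = cokernelDim a T (λ f → TS f ∘ proj₁) (λ f p → ⊆-+⟨⟩ N (T $ b) _ (TN f p)) inj′ D′ D₁
  in d₂ , trans e₁ (cong suc e₂) , Dim-resp d₂ (λ _ z → z) (λ _ z → z) to from D₂
  where
  open +-*-Solver
  inj′ : ∀ f → (S′ ∩ c) ∋ f → (N +⟨ T $ b ⟩) ∋ (T $ f) → N′ ∋ f
  inj′ f (f∈ , cf≡0) (k , p) = inj f f∈ (∋-resp N (λ x → trans
      (cong (λ t → (T $ f) x ℚ.- t ℚ.* (T $ b) x) k≡0)
      (solve 2 (λ f b → f :- con 0ℚ :* b := f) refl ((T $ f) x) ((T $ b) x))) p)
    where
    q : N′ ∋ (λ y → f y ℚ.- k ℚ.* b y)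
    q = inj _ (∋-- S′ f∈ (∋-* S′ k b∈)) (∋-resp N (λ x → sym (trans (ap-- (T x) f (λ y → k ℚ.* b y))
          (cong (λ u → (T $ f) x ℚ.- u) (ap-* (T x) k b)))) p)
    k≡0 : k ≡ 0ℚ
    k≡0 = begin
      k                            ≡⟨ ℚₚ.*-identityʳ k ⟨
      k ℚ.* 1ℚ                     ≡⟨ cong (k ℚ.*_) cb ⟨
      k ℚ.* ap c b                 ≡⟨ ap-* c k b ⟨
      ap c (λ y → k ℚ.* b y)       ≡⟨ Kills-≡ N′ c cN′ f (λ y → k ℚ.* b y) q ⟨
      ap c f                       ≡⟨ cf≡0 ⟩
      0ℚ                           ∎
      where open ≡-Reasoning
  to : sumWithImage (N +⟨ T $ b ⟩) T (S′ ∩ c) ⊆ sumWithImage N T S′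
  to f (g , (g∈ , _) , k , p) = (λ y → g y ℚ.+ k ℚ.* b y) , ∋-+ S′ g∈ (∋-* S′ k b∈) ,
    ∋-resp N (λ x → trans
      (solve 4 (λ f t k u → (f :- t) :- k :* u := f :- (t :+ k :* u)) refl (f x) ((T $ g) x) k ((T $ b) x))
      (cong (λ u → f x ℚ.- u) (sym (trans (ap-+ (T x) g (λ y → k ℚ.* b y)) (cong ((T $ g) x ℚ.+_) (ap-* (T x) k b)))))) p
  from : sumWithImage N T S′ ⊆ sumWithImage (N +⟨ T $ b ⟩) T (S′ ∩ c)
  from f (g , g∈ , p) = (residual b c $ g) , residual-∈ S′ {c = c} b∈ cb g g∈ , ap c g ,
    ∋-resp N (λ x → trans
      (solve 4 (λ f t k u → f :- t := (f :- (t :- k :* u)) :- k :* u) refl (f x) ((T $ g) x) (ap c g) ((T $ b) x))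
      (cong (λ t → (f x ℚ.- t) ℚ.- ap c g ℚ.* (T $ b) x) (sym (ap-residual (T x) c b g)))) p

-- The dual functionals live on the whole function space, so they can also be applied to vectors
-- coming from other stalks.
record Basis {X : Set} (S N : Subspace X) (d : ℕ) : Set where
  field
    vec      : Fin d → X → ℚ
    co       : Fin d → Fun X
    vec∈     : ∀ i → S ∋ vec i
    co-same  : ∀ i → ap (co i) (vec i) ≡ 1ℚ
    co-diff  : ∀ i j → j ≢ i → ap (co i) (vec j) ≡ 0ℚ
    co-kills : ∀ i → Kills (co i) N
    expand   : ∀ f → S ∋ f → N ∋ (λ x → f x ℚ.- ∑ (λ i → ap (co i) f ℚ.* vec i x))

  ap-comb : ∀ (g : Fun X) (a : Fin d → ℚ) →
            ap g (λ x → ∑ (λ i → a i ℚ.* vec i x)) ≡ ∑ (λ i → a i ℚ.* ap g (vec i))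
  ap-comb g a = trans (ap-∑ g (λ i x → a i ℚ.* vec i x)) (∑-cong λ i → ap-* g (a i) (vec i))

  ap-expand : ∀ g → Kills g N → ∀ f → S ∋ f → ap g f ≡ ∑ (λ i → ap (co i) f ℚ.* ap g (vec i))
  ap-expand g gN f f∈ = trans (Kills-≡ N g gN f _ (expand f f∈)) (ap-comb g (λ i → ap (co i) f))

  co-comb : ∀ i (a : Fin d → ℚ) → ap (co i) (λ x → ∑ (λ j → a j ℚ.* vec j x)) ≡ a i
  co-comb i a = begin
    ap (co i) (λ x → ∑ (λ j → a j ℚ.* vec j x))  ≡⟨ ap-comb (co i) a ⟩
    ∑ (λ j → a j ℚ.* ap (co i) (vec j))          ≡⟨ ∑-single i (λ j j≢i → trans (cong (a j ℚ.*_) (co-diff i j j≢i)) (ℚₚ.*-zeroʳ (a j))) ⟩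
    a i ℚ.* ap (co i) (vec i)                    ≡⟨ cong (a i ℚ.*_) (co-same i) ⟩
    a i ℚ.* 1ℚ                                   ≡⟨ ℚₚ.*-identityʳ (a i) ⟩
    a i                                          ∎
    where open ≡-Reasoning

  co≡0⇒∈ : ∀ f → S ∋ f → (∀ i → ap (co i) f ≡ 0ℚ) → N ∋ f
  co≡0⇒∈ f f∈ h = ∋-resp N (λ x → trans
    (cong (λ t → f x ℚ.- t) (∑-zero λ i → trans (cong (ℚ._* vec i x) (h i)) (ℚₚ.*-zeroˡ (vec i x))))
    (ℚₚ.+-identityʳ (f x))) (expand f f∈)
open Basis

basis : ∀ {X} d {S N : Subspace X} → Dim S N d → Basis S N d
basis zero {N = N} D = record
  { vec = λ () ; co = λ () ; vec∈ = λ () ; co-same = λ () ; co-diff = λ () ; co-kills = λ ()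
  ; expand = λ f f∈ → ∋-resp N (λ x → sym (ℚₚ.+-identityʳ (f x))) (D f f∈) }
basis {X} (suc d) {S} {N} (b , c , b∈ , cb , cN , D) = record
  { vec      = vec′
  ; co       = co′
  ; vec∈     = λ { zero → b∈ ; (suc i) → proj₁ (vec∈ B i) }
  ; co-same  = λ { zero → cb ; (suc i) → trans (co′-vec i i) (co-same B i) }
  ; co-diff  = λ { zero    zero    0≢0 → contradiction refl 0≢0
                 ; zero    (suc j) _   → proj₂ (vec∈ B j)
                 ; (suc i) zero    _   → co′-b i
                 ; (suc i) (suc j) h   → trans (co′-vec i j) (co-diff B i j (h ∘ cong suc)) }
  ; co-kills = λ { zero → cN
                 ; (suc i) f p → trans (ap-residual (co B i) c b f)
                     (trans (cong₂ (λ u v → u ℚ.- v ℚ.* ap (co B i) b) (co-kills B i f p) (cN f p))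
                            (solve 1 (λ t → con 0ℚ :- con 0ℚ :* t := con 0ℚ) refl (ap (co B i) b))) }
  ; expand   = λ f f∈ → ∋-resp N (λ x →
      solve 4 (λ f b c s → (f :- b :* c) :- s := f :- (c :* b :+ s)) refl (f x) (b x) (ap c f)
        (∑ λ i → ap (co B i) (residual b c $ f) ℚ.* vec B i x))
      (expand B (residual b c $ f) (residual-∈ S {c = c} b∈ cb f f∈))
  }
  where
  open +-*-Solver
  B = basis d D
  vec′ : Fin (suc d) → X → ℚ
  vec′ zero    = b
  vec′ (suc i) = vec B i
  co′ : Fin (suc d) → Fun X
  co′ zero    = c
  co′ (suc i) = co B i ∘ᶠ residual b c
  co′-vec : ∀ i j → ap (co′ (suc i)) (vec B j) ≡ ap (co B i) (vec B j)
  co′-vec i j = trans (ap-residual (co B i) c b (vec B j))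
    (trans (cong (λ v → ap (co B i) (vec B j) ℚ.- v ℚ.* ap (co B i) b) (proj₂ (vec∈ B j)))
           (solve 2 (λ s t → s :- con 0ℚ :* t := s) refl (ap (co B i) (vec B j)) (ap (co B i) b)))
  co′-b : ∀ i → ap (co′ (suc i)) b ≡ 0ℚ
  co′-b i = trans (ap-residual (co B i) c b b)
    (trans (cong (λ v → ap (co B i) b ℚ.- v ℚ.* ap (co B i) b) cb)
           (solve 1 (λ t → t :- con 1ℚ :* t := con 0ℚ) refl (ap (co B i) b)))

-- R stands for "is a combination of the functionals B i, modulo the annihilator of S".
fredholm : ∀ {X} d {S N : Subspace X} → Dim S N d →
           ∀ {I : Set} (B : I → Fun X) → (∀ i → Kills (B i) N) → (R : Fun X → Set) →
           (∀ ψ → Kills ψ S → R ψ) → (∀ ψ i a → R (ψ -ᶠ a ·ᶠ B i) → R ψ) →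
           ∀ (L : List I) ψ → Kills ψ N →
           R ψ ⊎ (Σ[ f ∈ (X → ℚ) ] S ∋ f × All (λ i → ap (B i) f ≡ 0ℚ) L × ap ψ f ≢ 0ℚ)
fredholm d D B BN R base step [] ψ ψN with dec-fun d D ψ ψN
... | inj₁ (f , f∈ , ψf) = inj₂ (f , f∈ , [] , ψf)
... | inj₂ h             = inj₁ (base ψ h)
fredholm {X} d {S} {N} D B BN R base step (i ∷ L) ψ ψN
  with fredholm d D B BN R base step L ψ ψN
... | inj₁ r = inj₁ r
... | inj₂ (f , f∈ , hf , ψf) with ap (B i) f ℚₚ.≟ 0ℚ
... | yes Bf≡0 = inj₂ (f , f∈ , Bf≡0 ∷ hf , ψf)
... | no  Bf≢0 with inv Bf≢0
... | k , kBf≡1 = go (fredholm d D B BN R base step L ψ′ ψ′N)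
  where
  open +-*-Solver
  -- With this factor `ψ′` vanishes at `f`. Correcting `g` by a multiple of `f` into the kernel of
  -- `B i` therefore leaves its value under `ψ′` unchanged, and on that kernel `ψ` and `ψ′` agree.
  a = ap ψ f ℚ.* k
  ψ′ = ψ -ᶠ a ·ᶠ B i
  ψ′N : Kills ψ′ N
  ψ′N g p = trans (cong₂ (λ u v → u ℚ.- a ℚ.* v) (ψN g p) (BN i g p))
                  (solve 1 (λ a → con 0ℚ :- a :* con 0ℚ := con 0ℚ) refl a)
  go : R ψ′ ⊎ (Σ[ g ∈ (X → ℚ) ] S ∋ g × All (λ j → ap (B j) g ≡ 0ℚ) L × ap ψ′ g ≢ 0ℚ) →
       R ψ ⊎ (Σ[ g ∈ (X → ℚ) ] S ∋ g × All (λ j → ap (B j) g ≡ 0ℚ) (i ∷ L) × ap ψ g ≢ 0ℚ)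
  go (inj₁ r) = inj₁ (step ψ i a r)
  go (inj₂ (g , g∈ , hg , ψ′g)) =
    inj₂ (h , ∋-- S g∈ (∋-* S t f∈) , Bh≡0 ∷ All.zipWith (λ {j} (p , q) → Bj j p q) (hg , hf) , ψ′g ∘ trans ψ′g≡ψh)
    where
    t = ap (B i) g ℚ.* k
    h = λ x → g x ℚ.- t ℚ.* f x
    ap-h : ∀ c → ap c h ≡ ap c g ℚ.- t ℚ.* ap c f
    ap-h c = trans (ap-- c g (λ x → t ℚ.* f x)) (cong (λ u → ap c g ℚ.- u) (ap-* c t f))
    Bh≡0 : ap (B i) h ≡ 0ℚ
    Bh≡0 = trans (ap-h (B i)) (trans (cong (λ u → ap (B i) g ℚ.- u) (ℚₚ.*-assoc (ap (B i) g) k (ap (B i) f)))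
      (trans (cong (λ u → ap (B i) g ℚ.- ap (B i) g ℚ.* u) kBf≡1)
             (solve 1 (λ p → p :- p :* con 1ℚ := con 0ℚ) refl (ap (B i) g))))
    Bj : ∀ j → ap (B j) g ≡ 0ℚ → ap (B j) f ≡ 0ℚ → ap (B j) h ≡ 0ℚ
    Bj j p q = trans (ap-h (B j)) (trans (cong₂ (λ u v → u ℚ.- t ℚ.* v) p q)
      (solve 1 (λ a → con 0ℚ :- a :* con 0ℚ := con 0ℚ) refl t))
    ψ′g≡ψh : ap ψ′ g ≡ ap ψ h
    ψ′g≡ψh = trans
      (solve 4 (λ p q k b → p :- (q :* k) :* b := p :- (b :* k) :* q) refl (ap ψ g) (ap ψ f) k (ap (B i) g))
      (sym (ap-h ψ))

-- Each `g i` cuts the dimension by one and leaves the remaining vectors in place. This will bound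
-- the number of bad weights of a form.
orthogonal-bound : ∀ {X} q d {S N : Subspace X} → Dim S N d → (g : Fin q → Fun X) (u : Fin q → X → ℚ) →
                   (∀ i → S ∋ u i) → (∀ i → Kills (g i) N) → (∀ i → ap (g i) (u i) ≢ 0ℚ) →
                   (∀ i j → i ≢ j → ap (g i) (u j) ≡ 0ℚ) → q ≤ d
orthogonal-bound zero    d D g u u∈ gN gu≢0 gu≡0 = z≤n
orthogonal-bound (suc q) d D g u u∈ gN gu≢0 gu≡0 =
  let d′ , e , D′ = Dim-∩ d D (g zero) (gN zero) (u zero) (u∈ zero) (gu≢0 zero)
  in subst (suc q ≤_) (sym e)
       (s≤s (orthogonal-bound q d′ D′ (g ∘ suc) (u ∘ suc)
         (λ i → u∈ (suc i) , gu≡0 zero (suc i) λ ()) (gN ∘ suc) (gu≢0 ∘ suc)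
         (λ i j i≢j → gu≡0 (suc i) (suc j) (i≢j ∘ Finₚ.suc-injective))))

sumℕ : ∀ {k} → (Fin k → ℕ) → ℕ
sumℕ {zero}  f = 0
sumℕ {suc k} f = f zero ℕ.+ sumℕ (f ∘ suc)

-- Coordinate vectors and coordinate subspaces.

module Units {Y : Set} (_≟_ : DecidableEquality Y) where

  unit : Y → Y → ℚ
  unit y x with x ≟ y
  ... | yes _ = 1ℚ
  ... | no  _ = 0ℚ

  unit-same : ∀ y → unit y y ≡ 1ℚ
  unit-same y with y ≟ y
  ... | yes _  = refl
  ... | no y≢y = contradiction refl y≢y

  unit-diff : ∀ y x → x ≢ y → unit y x ≡ 0ℚ
  unit-diff y x x≢y with x ≟ y
  ... | yes x≡y = contradiction x≡y x≢y
  ... | no _    = refl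

  vanishing : ∀ {q} → Subspace Y → (Fin q → Y) → Subspace Y
  _∋_ (vanishing S ys) f = S ∋ f × (∀ i → f (ys i) ≡ 0ℚ)
  ∋-resp (vanishing S ys) h (p , q) = ∋-resp S h p , λ i → trans (sym (h (ys i))) (q i)
  ∋-0 (vanishing S ys) = ∋-0 S , λ i → refl
  ∋-+ (vanishing S ys) (p , q) (p′ , q′) = ∋-+ S p p′ , λ i → cong₂ ℚ._+_ (q i) (q′ i)
  ∋-* (vanishing S ys) a (p , q) = ∋-* S a p , λ i → trans (cong (a ℚ.*_) (q i)) (ℚₚ.*-zeroʳ a)

  Dim-vanishing : ∀ q {d} {S N : Subspace Y} (ys : Fin q → Y) → (∀ {i j} → ys i ≡ ys j → i ≡ j) →
                  (∀ i → S ∋ unit (ys i)) → (∀ i f → N ∋ f → f (ys i) ≡ 0ℚ) →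
                  Dim (vanishing S ys) N d → Dim S N (q ℕ.+ d)
  Dim-vanishing zero {d} ys ys-inj units N-zero D =
    Dim-resp d (λ f p → p , λ ()) (λ f → proj₁) (λ _ z → z) (λ _ z → z) D
  Dim-vanishing (suc q) {d} ys ys-inj units N-zero D =
    unit (ys zero) , ev (ys zero) , units zero , unit-same (ys zero) , N-zero zero ,
    Dim-vanishing q (ys ∘ suc) (Finₚ.suc-injective ∘ ys-inj)
      (λ i → units (suc i) , unit-diff _ _ (λ h → case ys-inj h of λ ()))
      (N-zero ∘ suc)
      (Dim-resp d (λ f ((p , q) , r) → p , λ { zero → q ; (suc i) → r i })
                  (λ f (p , r) → (p , r zero) , r ∘ suc) (λ _ z → z) (λ _ z → z) D)

-- Functions on `Block` will encode one functional on each stalk, written in the dual basis of that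
-- stalk.
module Blocks {n : ℕ} (m : Fin n → ℕ) where

  Block : Set
  Block = Σ[ w ∈ Fin n ] Fin (m w)

  _≟ᴮ_ : DecidableEquality Block
  (w , j) ≟ᴮ (w′ , j′) with w Fin.≟ w′
  ... | no w≢w′ = no λ { refl → w≢w′ refl }
  ... | yes refl with j Fin.≟ j′
  ... | no j≢j′  = no λ { refl → j≢j′ refl }
  ... | yes refl = yes refl

  open Units _≟ᴮ_ public

  Dim-blocks : ∀ k {S N : Subspace Block} (g : Fin n → Bool) (ws : Fin k → Fin n) →
               (∀ {i j} → ws i ≡ ws j → i ≡ j) →
               (∀ i j → S ∋ unit (ws i , j)) →
               (∀ i → T (g (ws i)) → ∀ f → N ∋ f → ∀ j → f (ws i , j) ≡ 0ℚ) →
               (∀ f → S ∋ f → (∀ i → T (g (ws i)) → ∀ j → f (ws i , j) ≡ 0ℚ) → N ∋ f) →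
               Dim S N (sumℕ λ i → if g (ws i) then m (ws i) else 0)
  Dim-blocks zero    g ws inj units N-zero zero-N f f∈ = zero-N f f∈ λ ()
  Dim-blocks (suc k) {S} {N} g ws inj units N-zero zero-N with g (ws zero) in eq
  ... | false = Dim-blocks k g (ws ∘ suc) (Finₚ.suc-injective ∘ inj) (units ∘ suc) (N-zero ∘ suc)
                  (λ f f∈ h → zero-N f f∈ λ { zero t → contradiction (subst T eq t) λ () ; (suc i) → h i })
  ... | true  = Dim-vanishing (m (ws zero)) (ws zero ,_) (λ { refl → refl }) (units zero)
                  (λ j f p → N-zero zero g₀ f p j)
                  (Dim-blocks k g (ws ∘ suc) (Finₚ.suc-injective ∘ inj)
                    (λ i j → units (suc i) j , λ j′ → unit-diff _ _ λ h → case inj (cong proj₁ h) of λ ())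
                    (N-zero ∘ suc)
                    (λ f (f∈ , h₀) h → zero-N f f∈ λ { zero _ → h₀ ; (suc i) → h i }))
    where
    g₀ : T (g (ws zero))
    g₀ = subst T (sym eq) tt

  Dim-full : Dim {Block} full none (sumℕ m)
  Dim-full = Dim-blocks n (λ _ → true) (λ w → w) (λ h → h) (λ _ _ → tt)
    (λ w _ f p j → p (w , j)) (λ f _ h (w , j) → h w tt j)

-- Cell complexes, sheaves on them, and transposed coboundaries.

module Differential {n : ℕ} (le : Fin n → Fin n → Bool) (ρ : Fin n → ℕ) (e : Fin n → Fin n → ℚ) where

  δ : Fin n → Fin n → ℚ
  δ σ τ = if le σ τ then 1ℚ else 0ℚ

  δ-yes : ∀ {σ τ} → T (le σ τ) → δ σ τ ≡ 1ℚ
  δ-yes {σ} {τ} p with le σ τ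
  ... | true = refl

  δ≢0 : ∀ {σ τ} → δ σ τ ≢ 0ℚ → T (le σ τ)
  δ≢0 {σ} {τ} h with le σ τ
  ... | true  = tt
  ... | false = contradiction refl h

  -- The coboundary of the complex of `[σ, ∞)`. Cochains carry all ranks at once; the rank is fixed
  -- only where closedness or exactness is stated.
  D : ∀ {X : Set} → Fin n → (Fin n → X → ℚ) → Fin n → X → ℚ
  D σ x υ a = ∑ λ τ → (δ σ τ ℚ.* e τ υ) ℚ.* x τ a

  -- Exactness of the cellular cochain complex of the interval [ s , t ].
  Exact : Fin n → Fin n → Set
  Exact s t = ∀ r (x : Fin n → ℚ) →
    (∀ υ → ρ υ ≡ suc r → T (le s υ) → T (le υ t) → ∑ (λ τ → (δ s τ ℚ.* e τ υ) ℚ.* x τ) ≡ 0ℚ) →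
    Σ[ y ∈ (Fin n → ℚ) ] (∀ τ → ρ τ ≡ r → T (le s τ) → T (le τ t) →
                          ∑ (λ π → (δ s π ℚ.* e π τ) ℚ.* y π) ≡ x τ)

  ap-D : ∀ {X : Set} (c : Fun X) σ x υ → ap c (D σ x υ) ≡ ∑ λ τ → (δ σ τ ℚ.* e τ υ) ℚ.* ap c (x τ)
  ap-D c σ x υ = trans (ap-∑ c λ τ a → (δ σ τ ℚ.* e τ υ) ℚ.* x τ a)
                       (∑-cong λ τ → ap-* c (δ σ τ ℚ.* e τ υ) (x τ))

  D-- : ∀ {X : Set} σ (x y : Fin n → X → ℚ) υ a →
        D σ (λ τ b → x τ b ℚ.- y τ b) υ a ≡ D σ x υ a ℚ.- D σ y υ a
  D-- σ x y υ a = begin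
    ∑ (λ τ → k τ ℚ.* (x τ a ℚ.- y τ a))
      ≡⟨ ∑-cong (λ τ → solve 3 (λ k p q → k :* (p :- q) := k :* p :+ :- (k :* q)) refl (k τ) (x τ a) (y τ a)) ⟩
    ∑ (λ τ → k τ ℚ.* x τ a ℚ.+ ℚ.- (k τ ℚ.* y τ a))
      ≡⟨ ∑-+ (λ τ → k τ ℚ.* x τ a) (λ τ → ℚ.- (k τ ℚ.* y τ a)) ⟩
    ∑ (λ τ → k τ ℚ.* x τ a) ℚ.+ ∑ (λ τ → ℚ.- (k τ ℚ.* y τ a))
      ≡⟨ cong (∑ (λ τ → k τ ℚ.* x τ a) ℚ.+_) (∑-neg (λ τ → k τ ℚ.* y τ a)) ⟩
    ∑ (λ τ → k τ ℚ.* x τ a) ℚ.- ∑ (λ τ → k τ ℚ.* y τ a) ∎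
    where
    open ≡-Reasoning
    open +-*-Solver
    k = λ τ → δ σ τ ℚ.* e τ υ

  D-cong : ∀ {X : Set} σ (x y : Fin n → X → ℚ) υ a →
           (∀ τ → T (le σ τ) → e τ υ ≢ 0ℚ → x τ a ≡ y τ a) → D σ x υ a ≡ D σ y υ a
  D-cong σ x y υ a h = ∑-cong λ τ → *-cong-≢0 (δ σ τ ℚ.* e τ υ) λ k≢0 →
    h τ (δ≢0 (*-≢0ˡ {b = e τ υ} k≢0)) (*-≢0ʳ {δ σ τ} k≢0)

record CellComplex : Set where
  field
    n        : ℕ
    le       : Fin n → Fin n → Bool
    ρ        : Fin n → ℕ
    e        : Fin n → Fin n → ℚ
    le-refl  : ∀ x → T (le x x)
    le-trans : ∀ x y z → T (le x y) → T (le y z) → T (le x z)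
    rank-<   : ∀ x y → T (le x y) → x ≢ y → ρ x < ρ y
    e-cover  : ∀ x y → e x y ≢ 0ℚ → T (le x y) × ρ y ≡ suc (ρ x)
    e-e      : ∀ x z → ∑ (λ y → e x y ℚ.* e y z) ≡ 0ℚ
    exact    : ∀ s t → T (le s t) → s ≢ t → Differential.Exact le ρ e s t

module Sheaves (K : CellComplex) where

  open CellComplex K public
  open Differential le ρ e public

  e-le : ∀ {x y} → e x y ≢ 0ℚ → T (le x y)
  e-le h = proj₁ (e-cover _ _ h)

  -- The indicator `δ σ τ` follows from `δ σ π` and a nonzero `e π τ`; once it is dropped, `e-e`
  -- applies.
  D-D : ∀ {X : Set} σ (x : Fin n → X → ℚ) υ a → D σ (D σ x) υ a ≡ 0ℚ
  D-D σ x υ a = begin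
    ∑ (λ τ → (δ σ τ ℚ.* e τ υ) ℚ.* ∑ (λ π → (δ σ π ℚ.* e π τ) ℚ.* x π a))
      ≡⟨ ∑-cong (λ τ → ∑-*ˡ (δ σ τ ℚ.* e τ υ) (λ π → (δ σ π ℚ.* e π τ) ℚ.* x π a)) ⟩
    ∑ (λ τ → ∑ λ π → (δ σ τ ℚ.* e τ υ) ℚ.* ((δ σ π ℚ.* e π τ) ℚ.* x π a))
      ≡⟨ ∑-swap (λ τ π → (δ σ τ ℚ.* e τ υ) ℚ.* ((δ σ π ℚ.* e π τ) ℚ.* x π a)) ⟩
    ∑ (λ π → ∑ λ τ → (δ σ τ ℚ.* e τ υ) ℚ.* ((δ σ π ℚ.* e π τ) ℚ.* x π a))
      ≡⟨ ∑-cong (λ π → ∑-cong (regroup π)) ⟩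
    ∑ (λ π → ∑ λ τ → (δ σ π ℚ.* x π a) ℚ.* (e π τ ℚ.* e τ υ))
      ≡⟨ ∑-zero (λ π → trans (sym (∑-*ˡ (δ σ π ℚ.* x π a) (λ τ → e π τ ℚ.* e τ υ)))
           (trans (cong ((δ σ π ℚ.* x π a) ℚ.*_) (e-e π υ)) (ℚₚ.*-zeroʳ (δ σ π ℚ.* x π a)))) ⟩
    0ℚ ∎
    where
    open ≡-Reasoning
    open +-*-Solver
    regroup : ∀ π τ → (δ σ τ ℚ.* e τ υ) ℚ.* ((δ σ π ℚ.* e π τ) ℚ.* x π a) ≡
                      (δ σ π ℚ.* x π a) ℚ.* (e π τ ℚ.* e τ υ)
    regroup π τ = begin
      (δ σ τ ℚ.* e τ υ) ℚ.* ((δ σ π ℚ.* e π τ) ℚ.* x π a)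
        ≡⟨ solve 5 (λ a b c d f → (a :* b) :* ((c :* d) :* f) := (c :* d) :* (a :* (f :* b))) refl
             (δ σ τ) (e τ υ) (δ σ π) (e π τ) (x π a) ⟩
      (δ σ π ℚ.* e π τ) ℚ.* (δ σ τ ℚ.* (x π a ℚ.* e τ υ))
        ≡⟨ *-cong-≢0 (δ σ π ℚ.* e π τ) (λ h → trans
             (cong (ℚ._* (x π a ℚ.* e τ υ)) (δ-yes (le-trans σ π τ (δ≢0 (*-≢0ˡ {b = e π τ} h)) (e-le (*-≢0ʳ {δ σ π} h)))))
             (ℚₚ.*-identityˡ (x π a ℚ.* e τ υ))) ⟩
      (δ σ π ℚ.* e π τ) ℚ.* (x π a ℚ.* e τ υ)
        ≡⟨ solve 4 (λ c d f b → (c :* d) :* (f :* b) := (c :* f) :* (d :* b)) refl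
             (δ σ π) (e π τ) (x π a) (e τ υ) ⟩
      (δ σ π ℚ.* x π a) ℚ.* (e π τ ℚ.* e τ υ) ∎

  -- The stalk at σ is Sub σ / Nul σ, and the restriction maps are induced by the identity of Q^X.
  record Sheaf : Set₁ where
    field
      X        : Set
      Sub Nul  : Fin n → Subspace X
      Sub-mono : ∀ σ τ → T (le σ τ) → Sub σ ⊆ Sub τ
      Nul-mono : ∀ σ τ → T (le σ τ) → Nul σ ⊆ Nul τ
      m        : Fin n → ℕ
      dim      : ∀ σ → Dim (Sub σ) (Nul σ) (m σ)

  -- Vanishing of the cellular cohomology of [ σ , ∞ ) below degree i, for every σ.
  ExactBelow : ∀ {X : Set} → (Fin n → Subspace X) → (Fin n → Subspace X) → ℕ → Set
  ExactBelow {X} Sub Nul i = ∀ σ r → r < i → (x : Fin n → X → ℚ) → (∀ τ → Sub τ ∋ x τ) →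
    (∀ υ → ρ υ ≡ suc r → T (le σ υ) → Nul υ ∋ D σ x υ) →
    Σ[ y ∈ (Fin n → X → ℚ) ] (∀ τ → Sub τ ∋ y τ) ×
      (∀ τ → ρ τ ≡ r → T (le σ τ) → Nul τ ∋ (λ a → x τ a ℚ.- D σ y τ a))

  CM : Sheaf → ℕ → Set
  CM M = ExactBelow (Sheaf.Sub M) (Sheaf.Nul M)

  module Dual (M : Sheaf) where
    open Sheaf M

    B : ∀ σ → Basis (Sub σ) (Nul σ) (m σ)
    B σ = basis (m σ) (dim σ)

    open Blocks m public

    D∈Sub : ∀ σ x υ → (∀ τ → Sub τ ∋ x τ) → Sub υ ∋ D σ x υ
    D∈Sub σ x υ x∈ = ∋-∑ (Sub υ) λ τ → scaled τ
      where
      scaled : ∀ τ → Sub υ ∋ (λ a → (δ σ τ ℚ.* e τ υ) ℚ.* x τ a)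
      scaled τ with e τ υ ℚₚ.≟ 0ℚ
      ... | no  h = ∋-* (Sub υ) (δ σ τ ℚ.* e τ υ) (Sub-mono τ υ (e-le h) (x τ) (x∈ τ))
      ... | yes h = ∋-resp (Sub υ) (λ a → sym (trans (cong (λ t → (δ σ τ ℚ.* t) ℚ.* x τ a) h)
                      (solve 2 (λ d x → (d :* con 0ℚ) :* x := con 0ℚ) refl (δ σ τ) (x τ a)))) (∋-0 (Sub υ))
        where open +-*-Solver

    -- The pairing of ψ (a family of functionals on the stalks, in dual coordinates) with the coboundary of f at σ.
    Θ : Fin n → (X → ℚ) → Fun Block
    Θ σ f = ∑ᶠ λ w → ∑ᶠ λ j → e σ w ·ᶠ (ap (co (B w) j) f ·ᶠ ev (w , j))

    -- The transposed coboundary in dual coordinates; it lowers the rank by one.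
    Tr : Map Block Block
    Tr (σ , l) = Θ σ (vec (B σ) l)

    -- The pairing depends only on the class of `f` at `σ`: a nonzero `e σ w` puts `w` above `σ`,
    -- and there `Nul-mono` makes it kill `Nul σ`. Hence the values on the basis at `σ` determine
    -- it.
    Θ-expand : ∀ σ f ψ → Sub σ ∋ f → ap (Θ σ f) ψ ≡ ∑ λ l → ap (co (B σ) l) f ℚ.* (Tr $ ψ) (σ , l)
    Θ-expand σ f ψ f∈ = ap-expand (B σ) F F-kills f f∈
      where
      F : Fun X
      F = ∑ᶠ λ w → ∑ᶠ λ j → record
        { ap      = λ g → e σ w ℚ.* (ap (co (B w) j) g ℚ.* ψ (w , j))
        ; ap-cong = λ h → cong (λ t → e σ w ℚ.* (t ℚ.* ψ (w , j))) (ap-cong (co (B w) j) h)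
        ; ap-+    = λ g h → trans (cong (λ t → e σ w ℚ.* (t ℚ.* ψ (w , j))) (ap-+ (co (B w) j) g h))
            (solve 4 (λ e a b p → e :* ((a :+ b) :* p) := e :* (a :* p) :+ e :* (b :* p)) refl
              (e σ w) (ap (co (B w) j) g) (ap (co (B w) j) h) (ψ (w , j)))
        ; ap-*    = λ a g → trans (cong (λ t → e σ w ℚ.* (t ℚ.* ψ (w , j))) (ap-* (co (B w) j) a g))
            (solve 4 (λ e a g p → e :* ((a :* g) :* p) := a :* (e :* (g :* p))) refl
              (e σ w) a (ap (co (B w) j) g) (ψ (w , j)))
        }
        where open +-*-Solver
      F-kills : Kills F (Nul σ)
      F-kills g p = ∑-zero λ w → ∑-zero λ j → *-zero-≢0 (e σ w) λ h →
        trans (cong (ℚ._* ψ (w , j)) (co-kills (B w) j g (Nul-mono σ w (e-le h) g p))) (ℚₚ.*-zeroˡ (ψ (w , j)))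

    -- Transpose of `e-e`. A basis vector at `σ` is also a vector of the stalks above, so `Θ-expand`
    -- contracts the inner transpose.
    Tr-Tr : ∀ ψ y → (Tr $ Tr $ ψ) y ≡ 0ℚ
    Tr-Tr ψ (σ , l) = begin
      ∑ (λ τ → ∑ λ i → e σ τ ℚ.* (ap (co (B τ) i) b ℚ.* (Tr $ ψ) (τ , i)))
        ≡⟨ ∑-cong (λ τ → sym (∑-*ˡ (e σ τ) (λ i → ap (co (B τ) i) b ℚ.* (Tr $ ψ) (τ , i)))) ⟩
      ∑ (λ τ → e σ τ ℚ.* ∑ λ i → ap (co (B τ) i) b ℚ.* (Tr $ ψ) (τ , i))
        ≡⟨ ∑-cong (λ τ → *-cong-≢0 (e σ τ) λ h → sym (Θ-expand τ b ψ (Sub-mono σ τ (e-le h) b (vec∈ (B σ) l)))) ⟩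
      ∑ (λ τ → e σ τ ℚ.* ∑ λ w → ∑ λ j → e τ w ℚ.* (ap (co (B w) j) b ℚ.* ψ (w , j)))
        ≡⟨ ∑-cong (λ τ → trans (∑-*ˡ (e σ τ) (λ w → ∑ λ j → e τ w ℚ.* (ap (co (B w) j) b ℚ.* ψ (w , j))))
                               (∑-cong λ w → trans (cong (e σ τ ℚ.*_) (sym (∑-*ˡ (e τ w) (λ j → ap (co (B w) j) b ℚ.* ψ (w , j)))))
                                                   (sym (ℚₚ.*-assoc (e σ τ) (e τ w) (p w))))) ⟩
      ∑ (λ τ → ∑ λ w → (e σ τ ℚ.* e τ w) ℚ.* p w)
        ≡⟨ ∑-swap (λ τ w → (e σ τ ℚ.* e τ w) ℚ.* p w) ⟩
      ∑ (λ w → ∑ λ τ → (e σ τ ℚ.* e τ w) ℚ.* p w)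
        ≡⟨ ∑-zero (λ w → trans (sym (∑-*ʳ (λ τ → e σ τ ℚ.* e τ w) (p w)))
             (trans (cong (ℚ._* p w) (e-e σ w)) (ℚₚ.*-zeroˡ (p w)))) ⟩
      0ℚ ∎
      where
      open ≡-Reasoning
      b = vec (B σ) l
      p : Fin n → ℚ
      p w = ∑ λ j → ap (co (B w) j) b ℚ.* ψ (w , j)

    -- Ω k σ modulo Negl k σ is the dual of the top cohomology of the sheaf on { τ ≥ σ : ρ τ ≤ k }.
    Ω Negl : ℕ → Fin n → Subspace Block
    _∋_ (Ω k σ) ψ = ∀ τ → suc (ρ τ) ≡ k → T (le σ τ) → ∀ l → (Tr $ ψ) (τ , l) ≡ 0ℚ
    ∋-resp (Ω k σ) h p τ q r l = trans (sym (ap-cong (Tr (τ , l)) h)) (p τ q r l)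
    ∋-0 (Ω k σ) τ q r l = ap-0 (Tr (τ , l))
    ∋-+ (Ω k σ) {f} {g} p p′ τ q r l = trans (ap-+ (Tr (τ , l)) f g) (cong₂ ℚ._+_ (p τ q r l) (p′ τ q r l))
    ∋-* (Ω k σ) a {f} p τ q r l = trans (ap-* (Tr (τ , l)) a f) (trans (cong (a ℚ.*_) (p τ q r l)) (ℚₚ.*-zeroʳ a))
    _∋_ (Negl k σ) ψ = ∀ w → ρ w ≡ k → T (le σ w) → ∀ j → ψ (w , j) ≡ 0ℚ
    ∋-resp (Negl k σ) h p w q r j = trans (sym (h (w , j))) (p w q r j)
    ∋-0 (Negl k σ) w q r j = refl
    ∋-+ (Negl k σ) p p′ w q r j = cong₂ ℚ._+_ (p w q r j) (p′ w q r j)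
    ∋-* (Negl k σ) a p w q r j = trans (cong (a ℚ.*_) (p w q r j)) (ℚₚ.*-zeroʳ a)

    Ω-mono : ∀ k σ τ → T (le σ τ) → Ω k σ ⊆ Ω k τ
    Ω-mono k σ τ σ≤τ ψ p υ q τ≤υ = p υ q (le-trans σ τ υ σ≤τ τ≤υ)

    Negl-mono : ∀ k σ τ → T (le σ τ) → Negl k σ ⊆ Negl k τ
    Negl-mono k σ τ σ≤τ ψ p υ q τ≤υ = p υ q (le-trans σ τ υ σ≤τ τ≤υ)

    Negl⊆Ω : ∀ k σ → Negl k σ ⊆ Ω k σ
    Negl⊆Ω k σ ψ p τ q σ≤τ l = ∑-zero λ w → ∑-zero λ j → *-zero-≢0 (e τ w) λ h →
      let τ≤w , ρw = e-cover τ w h in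
      trans (cong (ap (co (B w) j) (vec (B τ) l) ℚ.*_) (p w (trans ρw q) (le-trans σ τ w σ≤τ τ≤w) j))
            (ℚₚ.*-zeroʳ (ap (co (B w) j) (vec (B τ) l)))

-- The dualizing sheaf: lifting, exactness, dimension.

module Duality (K : CellComplex) (M : Sheaves.Sheaf K) (i : ℕ) (cm : Sheaves.CM K M i) where

  open Sheaves K
  open Sheaf M
  open Dual M

  allBlocks : List Block
  allBlocks = concatMap (λ w → map (w ,_) (allFin (m w))) (allFin n)

  ∈-allBlocks : ∀ y → y ∈ allBlocks
  ∈-allBlocks (w , j) = ∈-concat⁺′ (∈-map⁺ (w ,_) (∈-allFin j)) (∈-map⁺ (λ w → map (w ,_) (allFin (m w))) (∈-allFin w))

  -- By exactness below i, a family of functionals that kills the coboundaries in rank k factors through the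
  -- coboundary map from rank k to rank k + 1.
  module Lift (k : ℕ) (k<i : k < i) (π : Fin n) (v : Block → ℚ) (v∈ : Ω k π ∋ v) where

    onRank : Fin n → ℚ
    onRank τ with ρ τ ℕ.≟ k | T? (le π τ)
    ... | yes _ | yes _ = 1ℚ
    ... | _     | _     = 0ℚ

    onRank-yes : ∀ τ → ρ τ ≡ k → T (le π τ) → onRank τ ≡ 1ℚ
    onRank-yes τ p q with ρ τ ℕ.≟ k | T? (le π τ)
    ... | yes _ | yes _ = refl
    ... | no ¬p | _     = contradiction p ¬p
    ... | yes _ | no ¬q = contradiction q ¬q

    onRank≢0 : ∀ τ → onRank τ ≢ 0ℚ → ρ τ ≡ k × T (le π τ)
    onRank≢0 τ h with ρ τ ℕ.≟ k | T? (le π τ)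
    ... | yes p | yes q = p , q
    ... | no  _ | _     = contradiction refl h
    ... | yes _ | no  _ = contradiction refl h

    row : Block → Fun Block
    row (w , j) = ∑ᶠ λ τ → ∑ᶠ λ l → (δ π τ ℚ.* e τ w) ℚ.* ap (co (B w) j) (vec (B τ) l) ·ᶠ ev (τ , l)

    target : Fun Block
    target = ∑ᶠ λ τ → ∑ᶠ λ l → onRank τ ℚ.* v (τ , l) ·ᶠ ev (τ , l)

    -- The combinations meant in `fredholm`: this is stable under adding rows, because a row is the
    -- transposed coboundary of a unit vector.
    IsLift : Fun Block → Set
    IsLift ψ = Σ[ η ∈ (Block → ℚ) ] (∀ τ → T (le π τ) → ∀ l → ap ψ (unit (τ , l)) ≡ (Tr $ η) (τ , l))

    pick : ∀ (F : ∀ w → Fin (m w) → ℚ) w j → ∑ (λ w′ → ∑ λ j′ → F w′ j′ ℚ.* unit (w , j) (w′ , j′)) ≡ F w j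
    pick F w j = begin
      ∑ (λ w′ → ∑ λ j′ → F w′ j′ ℚ.* unit (w , j) (w′ , j′))
        ≡⟨ ∑-single w (λ w′ w′≢w → ∑-zero λ j′ → off w′ j′ (w′≢w ∘ cong proj₁)) ⟩
      ∑ (λ j′ → F w j′ ℚ.* unit (w , j) (w , j′))
        ≡⟨ ∑-single j (λ j′ j′≢j → off w j′ λ { refl → j′≢j refl }) ⟩
      F w j ℚ.* unit (w , j) (w , j)
        ≡⟨ trans (cong (F w j ℚ.*_) (unit-same (w , j))) (ℚₚ.*-identityʳ (F w j)) ⟩
      F w j ∎
      where
      open ≡-Reasoning
      off : ∀ w′ j′ → (w′ , j′) ≢ (w , j) → F w′ j′ ℚ.* unit (w , j) (w′ , j′) ≡ 0ℚ
      off w′ j′ h = trans (cong (F w′ j′ ℚ.*_) (unit-diff (w , j) (w′ , j′) h)) (ℚₚ.*-zeroʳ (F w′ j′))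

    Tr-unit : ∀ w j τ l → (Tr $ unit (w , j)) (τ , l) ≡ e τ w ℚ.* ap (co (B w) j) (vec (B τ) l)
    Tr-unit w j τ l = trans
      (∑-cong λ w′ → ∑-cong λ j′ → sym (ℚₚ.*-assoc (e τ w′) (ap (co (B w′) j′) (vec (B τ) l)) (unit (w , j) (w′ , j′))))
      (pick (λ w′ j′ → e τ w′ ℚ.* ap (co (B w′) j′) (vec (B τ) l)) w j)

    base : ∀ ψ → Kills ψ full → IsLift ψ
    base ψ h = (λ _ → 0ℚ) , λ τ _ l → trans (h (unit (τ , l)) tt) (sym (ap-0 (Tr (τ , l))))

    step : ∀ ψ y a → IsLift (ψ -ᶠ a ·ᶠ row y) → IsLift ψ
    step ψ (w , j) a (η , h) = (λ y → η y ℚ.+ a ℚ.* unit (w , j) y) , λ τ π≤τ l →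
      let u = unit (τ , l) in begin
      ap ψ u
        ≡⟨ solve 2 (λ p q → p := (p :- q) :+ q) refl (ap ψ u) (a ℚ.* ap (row (w , j)) u) ⟩
      (ap ψ u ℚ.- a ℚ.* ap (row (w , j)) u) ℚ.+ a ℚ.* ap (row (w , j)) u
        ≡⟨ cong₂ (λ p q → p ℚ.+ a ℚ.* q) (h τ π≤τ l) (row-unit τ π≤τ l) ⟩
      (Tr $ η) (τ , l) ℚ.+ a ℚ.* (Tr $ unit (w , j)) (τ , l)
        ≡⟨ sym (trans (ap-+ (Tr (τ , l)) η _) (cong ((Tr $ η) (τ , l) ℚ.+_) (ap-* (Tr (τ , l)) a _))) ⟩
      (Tr $ (λ y → η y ℚ.+ a ℚ.* unit (w , j) y)) (τ , l) ∎
      where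
      open ≡-Reasoning
      open +-*-Solver
      row-unit : ∀ τ → T (le π τ) → ∀ l → ap (row (w , j)) (unit (τ , l)) ≡ (Tr $ unit (w , j)) (τ , l)
      row-unit τ π≤τ l = begin
        ap (row (w , j)) (unit (τ , l))
          ≡⟨ pick (λ τ′ l′ → (δ π τ′ ℚ.* e τ′ w) ℚ.* ap (co (B w) j) (vec (B τ′) l′)) τ l ⟩
        (δ π τ ℚ.* e τ w) ℚ.* ap (co (B w) j) (vec (B τ) l)
          ≡⟨ cong (ℚ._* ap (co (B w) j) (vec (B τ) l)) (trans (cong (ℚ._* e τ w) (δ-yes π≤τ)) (ℚₚ.*-identityˡ (e τ w))) ⟩
        e τ w ℚ.* ap (co (B w) j) (vec (B τ) l)
          ≡⟨ Tr-unit w j τ l ⟨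
        (Tr $ unit (w , j)) (τ , l) ∎

    -- A cochain `a` killed by all rows is closed, hence a coboundary in rank `k`. Transposing the
    -- coboundary turns its pairing with `v` into a pairing with `Tr $ v` in rank `k - 1`, where
    -- membership of `v` in `Ω k π` makes it zero.
    no-obstruction : ∀ a → All (λ y → ap (row y) a ≡ 0ℚ) allBlocks → ap target a ≡ 0ℚ
    no-obstruction a rows = begin
      ∑ (λ τ → ∑ λ l → onRank τ ℚ.* v (τ , l) ℚ.* a (τ , l))
        ≡⟨ ∑-cong (λ τ → ∑-cong λ l → trans (ℚₚ.*-assoc (onRank τ) (v (τ , l)) (a (τ , l)))
             (*-cong-≢0 (onRank τ) λ h → cong (v (τ , l) ℚ.*_) (a-exact τ (onRank≢0 τ h) l))) ⟩
      ∑ (λ τ → ∑ λ l → onRank τ ℚ.* (v (τ , l) ℚ.* ∑ λ σ → (δ π σ ℚ.* e σ τ) ℚ.* c τ l σ))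
        ≡⟨ ∑-cong (λ τ → ∑-cong λ l → trans (sym (ℚₚ.*-assoc (onRank τ) (v (τ , l)) _))
             (trans (∑-*ˡ (onRank τ ℚ.* v (τ , l)) (λ σ → (δ π σ ℚ.* e σ τ) ℚ.* c τ l σ))
               (∑-cong λ σ → solve 5 (λ g v d e c → (g :* v) :* ((d :* e) :* c) := d :* (g :* (e :* (c :* v)))) refl
                 (onRank τ) (v (τ , l)) (δ π σ) (e σ τ) (c τ l σ)))) ⟩
      ∑ (λ τ → ∑ λ l → ∑ λ σ → δ π σ ℚ.* (onRank τ ℚ.* (e σ τ ℚ.* (c τ l σ ℚ.* v (τ , l)))))
        ≡⟨ ∑-cong (λ τ → ∑-swap (λ l σ → δ π σ ℚ.* (onRank τ ℚ.* (e σ τ ℚ.* (c τ l σ ℚ.* v (τ , l)))))) ⟩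
      ∑ (λ τ → ∑ λ σ → ∑ λ l → δ π σ ℚ.* (onRank τ ℚ.* (e σ τ ℚ.* (c τ l σ ℚ.* v (τ , l)))))
        ≡⟨ ∑-swap (λ τ σ → ∑ λ l → δ π σ ℚ.* (onRank τ ℚ.* (e σ τ ℚ.* (c τ l σ ℚ.* v (τ , l))))) ⟩
      ∑ (λ σ → ∑ λ τ → ∑ λ l → δ π σ ℚ.* (onRank τ ℚ.* (e σ τ ℚ.* (c τ l σ ℚ.* v (τ , l)))))
        ≡⟨ ∑-zero (λ σ → trans
             (trans (∑-cong λ τ → sym (∑-*ˡ (δ π σ) (λ l → onRank τ ℚ.* (e σ τ ℚ.* (c τ l σ ℚ.* v (τ , l))))))
                    (sym (∑-*ˡ (δ π σ) (λ τ → ∑ λ l → onRank τ ℚ.* (e σ τ ℚ.* (c τ l σ ℚ.* v (τ , l)))))))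
             (*-zero-≢0 (δ π σ) λ h → vanish σ (δ≢0 h))) ⟩
      0ℚ ∎
      where
      open ≡-Reasoning
      open +-*-Solver
      x : Fin n → X → ℚ
      x τ t = ∑ λ l → a (τ , l) ℚ.* vec (B τ) l t
      x∈ : ∀ τ → Sub τ ∋ x τ
      x∈ τ = ∋-∑ (Sub τ) λ l → ∋-* (Sub τ) (a (τ , l)) (vec∈ (B τ) l)
      closed : ∀ w → ρ w ≡ suc k → T (le π w) → Nul w ∋ D π x w
      closed w _ _ = co≡0⇒∈ (B w) (D π x w) (D∈Sub π x w x∈) λ j → begin
        ap (co (B w) j) (D π x w)
          ≡⟨ ap-D (co (B w) j) π x w ⟩
        ∑ (λ τ → (δ π τ ℚ.* e τ w) ℚ.* ap (co (B w) j) (x τ))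
          ≡⟨ ∑-cong (λ τ → trans (cong ((δ π τ ℚ.* e τ w) ℚ.*_) (ap-comb (B τ) (co (B w) j) (λ l → a (τ , l))))
               (trans (∑-*ˡ (δ π τ ℚ.* e τ w) (λ l → a (τ , l) ℚ.* ap (co (B w) j) (vec (B τ) l)))
                 (∑-cong λ l → solve 3 (λ d a c → d :* (a :* c) := (d :* c) :* a) refl
                   (δ π τ ℚ.* e τ w) (a (τ , l)) (ap (co (B w) j) (vec (B τ) l))))) ⟩
        ap (row (w , j)) a
          ≡⟨ All.lookup rows (∈-allBlocks (w , j)) ⟩
        0ℚ ∎
      primitive-of-x = cm π k k<i x x∈ closed
      y = proj₁ primitive-of-x
      y∈ = proj₁ (proj₂ primitive-of-x)
      c : ∀ τ → Fin (m τ) → Fin n → ℚ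
      c τ l σ = ap (co (B τ) l) (y σ)
      a-exact : ∀ τ → ρ τ ≡ k × T (le π τ) → ∀ l → a (τ , l) ≡ ∑ λ σ → (δ π σ ℚ.* e σ τ) ℚ.* c τ l σ
      a-exact τ (p , q) l = trans (sym (co-comb (B τ) l (λ l → a (τ , l))))
        (trans (Kills-≡ (Nul τ) (co (B τ) l) (co-kills (B τ) l) (x τ) (D π y τ) (proj₂ (proj₂ primitive-of-x) τ p q))
               (ap-D (co (B τ) l) π y τ))
      drop : ∀ σ → T (le π σ) → suc (ρ σ) ≡ k → ∀ τ t → onRank τ ℚ.* (e σ τ ℚ.* t) ≡ e σ τ ℚ.* t
      drop σ π≤σ ρσ≡ τ t = begin
        onRank τ ℚ.* (e σ τ ℚ.* t)  ≡⟨ solve 3 (λ a b c → a :* (b :* c) := b :* (a :* c)) refl (onRank τ) (e σ τ) t ⟩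
        e σ τ ℚ.* (onRank τ ℚ.* t)  ≡⟨ *-cong-≢0 (e σ τ) (λ h → let σ≤τ , ρτ = e-cover σ τ h in
                                        trans (cong (ℚ._* t) (onRank-yes τ (trans ρτ ρσ≡) (le-trans π σ τ π≤σ σ≤τ)))
                                              (ℚₚ.*-identityˡ t)) ⟩
        e σ τ ℚ.* t ∎
      vanish-at : ∀ σ → T (le π σ) → Dec (suc (ρ σ) ≡ k) →
                  ∑ (λ τ → ∑ λ l → onRank τ ℚ.* (e σ τ ℚ.* (c τ l σ ℚ.* v (τ , l)))) ≡ 0ℚ
      -- Only cells of rank `k - 1` have a nonzero incidence number with cells of rank `k`; for `k`
      -- zero this case is the only one.
      vanish-at σ π≤σ (no ρσ≢) = ∑-zero λ τ → ∑-zero λ l →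
        *-zero-≢0 (onRank τ) {e σ τ ℚ.* (c τ l σ ℚ.* v (τ , l))} λ h →
        *-zero-≢0 (e σ τ) {c τ l σ ℚ.* v (τ , l)} λ h′ →
        contradiction (trans (sym (proj₂ (e-cover σ τ h′))) (proj₁ (onRank≢0 τ h))) ρσ≢
      vanish-at σ π≤σ (yes ρσ≡) = begin
        ∑ (λ τ → ∑ λ l → onRank τ ℚ.* (e σ τ ℚ.* (c τ l σ ℚ.* v (τ , l))))
          ≡⟨ ∑-cong (λ τ → ∑-cong λ l → drop σ π≤σ ρσ≡ τ (c τ l σ ℚ.* v (τ , l))) ⟩
        ap (Θ σ (y σ)) v
          ≡⟨ Θ-expand σ (y σ) v (y∈ σ) ⟩
        ∑ (λ l → ap (co (B σ) l) (y σ) ℚ.* (Tr $ v) (σ , l))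
          ≡⟨ ∑-zero (λ l → trans (cong (ap (co (B σ) l) (y σ) ℚ.*_) (v∈ σ ρσ≡ π≤σ l)) (ℚₚ.*-zeroʳ (ap (co (B σ) l) (y σ)))) ⟩
        0ℚ ∎
      vanish : ∀ σ → T (le π σ) → ∑ (λ τ → ∑ λ l → onRank τ ℚ.* (e σ τ ℚ.* (c τ l σ ℚ.* v (τ , l)))) ≡ 0ℚ
      vanish σ π≤σ = vanish-at σ π≤σ (suc (ρ σ) ℕ.≟ k)

    lift : Σ[ η ∈ (Block → ℚ) ] (∀ τ → ρ τ ≡ k → T (le π τ) → ∀ l → (Tr $ η) (τ , l) ≡ v (τ , l))
    lift = case alternative of λ
      { (inj₁ (η , h)) → η , λ τ p q l → trans (sym (h τ q l))
          (trans (pick (λ τ′ l′ → onRank τ′ ℚ.* v (τ′ , l′)) τ l)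
                 (trans (cong (ℚ._* v (τ , l)) (onRank-yes τ p q)) (ℚₚ.*-identityˡ (v (τ , l)))))
      ; (inj₂ (a , _ , rows , h)) → contradiction (no-obstruction a rows) h }
      where
      alternative = fredholm (sumℕ m) Dim-full row
        (λ y f p → trans (ap-cong (row y) p) (ap-0 (row y))) IsLift base step allBlocks target
        (λ f p → trans (ap-cong target p) (ap-0 target))

module Dualizing (K : CellComplex) (M : Sheaves.Sheaf K) (i : ℕ) (cm : Sheaves.CM K M i) where

  open Sheaves K
  open Sheaf M
  open Dual M
  open Duality K M i cm

  rank-≤ : ∀ x y → T (le x y) → ρ x ≤ ρ y
  rank-≤ x y x≤y with x Fin.≟ y
  ... | yes refl = ℕₚ.≤-refl
  ... | no x≢y   = ℕₚ.<⇒≤ (rank-< x y x≤y x≢y)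

  Tr-local : ∀ τ l ψ ψ′ → (∀ w → e τ w ≢ 0ℚ → ∀ j → ψ (w , j) ≡ ψ′ (w , j)) → (Tr $ ψ) (τ , l) ≡ (Tr $ ψ′) (τ , l)
  Tr-local τ l ψ ψ′ h = ∑-cong λ w → ∑-cong λ j → *-cong-≢0 (e τ w) λ p →
    cong (ap (co (B w) j) (vec (B τ) l) ℚ.*_) (h w p j)

  -- `y₀` solves the equation separately in each coordinate `(w , j)` with `w` of rank `k + 1`, by
  -- exactness of the interval `[σ, w]`. It need not lie in `Ω (suc k)`; the defect is `u`, a closed
  -- cochain of the dualizing sheaf one rank lower.
  module ExactStep (k : ℕ) (k<i : k < i) (σ : Fin n) (r : ℕ) (r≤k : r ≤ k) (x : Fin n → Block → ℚ)
    (x∈ : ∀ τ → Ω (suc k) τ ∋ x τ) (closed : ∀ υ → ρ υ ≡ suc r → T (le σ υ) → Negl (suc k) υ ∋ D σ x υ) where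

    CoordSol : (w : Fin n) → Fin (m w) → Set
    CoordSol w j = Σ[ y ∈ (Fin n → ℚ) ] (ρ w ≡ suc k → ∀ τ → ρ τ ≡ r → T (le σ τ) → T (le τ w) →
                     ∑ (λ π → (δ σ π ℚ.* e π τ) ℚ.* y π) ≡ x τ (w , j))

    coordSol : ∀ w j → Dec (ρ w ≡ suc k) → Dec (T (le σ w)) → Dec (σ ≡ w) → CoordSol w j
    coordSol w j (no ρw) _ _ = (λ _ → 0ℚ) , λ h → contradiction h ρw
    coordSol w j (yes _) (no σ≰w) _ = (λ _ → 0ℚ) , λ _ τ _ p q → contradiction (le-trans σ τ w p q) σ≰w
    -- A one-point interval is not exact, but here `τ` would lie above a cell of rank `k + 1` while
    -- having rank at most `k`.
    coordSol w j (yes ρw) (yes σ≤w) (yes refl) = (λ _ → 0ℚ) , λ _ τ ρτ p q →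
      contradiction (ℕₚ.≤-trans (ℕₚ.≤-reflexive (sym ρw)) (ℕₚ.≤-trans (rank-≤ σ τ p) (ℕₚ.≤-trans (ℕₚ.≤-reflexive ρτ) r≤k)))
                    ℕₚ.1+n≰n
    coordSol w j (yes ρw) (yes σ≤w) (no σ≢w) =
      let y , h = exact σ w σ≤w σ≢w r (λ τ → x τ (w , j)) (λ υ ρυ p q → closed υ ρυ p w ρw q j)
      in y , λ _ → h

    y₀ : Fin n → Block → ℚ
    y₀ π (w , j) = proj₁ (coordSol w j (ρ w ℕ.≟ suc k) (T? (le σ w)) (σ Fin.≟ w)) π

    y₀-sol : ∀ τ → ρ τ ≡ r → T (le σ τ) → ∀ w → ρ w ≡ suc k → T (le τ w) → ∀ j → D σ y₀ τ (w , j) ≡ x τ (w , j)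
    y₀-sol τ ρτ p w ρw q j = proj₂ (coordSol w j (ρ w ℕ.≟ suc k) (T? (le σ w)) (σ Fin.≟ w)) ρw τ ρτ p q

    Primitive : Set
    Primitive = Σ[ y ∈ (Fin n → Block → ℚ) ] (∀ τ → Ω (suc k) τ ∋ y τ) ×
      (∀ τ → ρ τ ≡ r → T (le σ τ) → Negl (suc k) τ ∋ (λ a → x τ a ℚ.- D σ y τ a))

    finish : ∀ y → (∀ τ → Ω (suc k) τ ∋ y τ) → (∀ τ → ρ τ ≡ r → ∀ a → D σ y τ a ≡ D σ y₀ τ a) → Primitive
    finish y y∈ h = y , y∈ , λ τ ρτ p w ρw q j → trans
      (cong₂ ℚ._-_ (sym (y₀-sol τ ρτ p w ρw q j)) (h τ ρτ (w , j)))
      (ℚₚ.+-inverseʳ (D σ y₀ τ (w , j)))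

    u : Fin n → Block → ℚ
    u τ = Tr $ y₀ τ

    u∈ : ∀ τ → Ω k τ ∋ u τ
    u∈ τ τ′ _ _ l = Tr-Tr (y₀ τ) (τ′ , l)

    u-closed : ∀ υ → ρ υ ≡ r → T (le σ υ) → Negl k υ ∋ D σ u υ
    u-closed υ ρυ p τ ρτ q l = begin
      D σ u υ (τ , l)            ≡⟨ ap-D (Tr (τ , l)) σ y₀ υ ⟨
      (Tr $ D σ y₀ υ) (τ , l)    ≡⟨ Tr-local τ l (D σ y₀ υ) (x υ) (λ w h j → let τ≤w , ρw = e-cover τ w h in
                                      y₀-sol υ ρυ p w (trans ρw (cong suc ρτ)) (le-trans υ τ w q τ≤w) j) ⟩
      (Tr $ x υ) (τ , l)         ≡⟨ x∈ υ τ (cong suc ρτ) q l ⟩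
      0ℚ                         ∎
      where open ≡-Reasoning

  -- The defect `u` is the coboundary of `v`. Lifting `v` along `Tr` and subtracting the coboundary
  -- of the lift from `y₀` removes the defect and leaves the coboundary of `y₀` unchanged.
  module Correct (k : ℕ) (k<i : k < i) (σ : Fin n) (r : ℕ) (r<k : suc r ≤ k) (x : Fin n → Block → ℚ)
    (x∈ : ∀ τ → Ω (suc k) τ ∋ x τ) (closed : ∀ υ → ρ υ ≡ suc (suc r) → T (le σ υ) → Negl (suc k) υ ∋ D σ x υ)
    (v : Fin n → Block → ℚ) (v∈ : ∀ τ → Ω k τ ∋ v τ)
    (v-sol : ∀ τ → ρ τ ≡ r → T (le σ τ) → Negl k τ ∋ (λ a → ExactStep.u k k<i σ (suc r) r<k x x∈ closed τ a ℚ.- D σ v τ a)) where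

    open ExactStep k k<i σ (suc r) r<k x x∈ closed

    v̂ : Fin n → Block → ℚ
    v̂ π = proj₁ (Lift.lift k k<i π (v π) (v∈ π))

    v̂-lift : ∀ π τ → ρ τ ≡ k → T (le π τ) → ∀ l → (Tr $ v̂ π) (τ , l) ≡ v π (τ , l)
    v̂-lift π = proj₂ (Lift.lift k k<i π (v π) (v∈ π))

    y₁ : Fin n → Block → ℚ
    y₁ π a = y₀ π a ℚ.- D σ v̂ π a

    y₁∈ : ∀ π → ρ π ≡ r → T (le σ π) → Ω (suc k) π ∋ y₁ π
    y₁∈ π ρπ p τ ρτ q l = begin
      (Tr $ y₁ π) (τ , l)
        ≡⟨ ap-- (Tr (τ , l)) (y₀ π) (D σ v̂ π) ⟩
      u π (τ , l) ℚ.- (Tr $ D σ v̂ π) (τ , l)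
        ≡⟨ cong (λ t → u π (τ , l) ℚ.- t) (trans (ap-D (Tr (τ , l)) σ v̂ π)
             (D-cong σ (λ ω → Tr $ v̂ ω) v π (τ , l) λ ω _ h →
               v̂-lift ω τ (ℕₚ.suc-injective ρτ) (le-trans ω π τ (e-le h) q) l)) ⟩
      u π (τ , l) ℚ.- D σ v π (τ , l)
        ≡⟨ v-sol π ρπ p τ (ℕₚ.suc-injective ρτ) q l ⟩
      0ℚ ∎
      where open ≡-Reasoning

    -- The corrected cochain is known to lie in `Ω (suc k)` only at cells of rank `r` above `σ`.
    -- Zero elsewhere makes it admissible, and its coboundary in rank `r + 1` does not see the
    -- change.
    gated : ∀ π → Dec (ρ π ≡ r) → Dec (T (le σ π)) →
            Σ[ y ∈ (Block → ℚ) ] Ω (suc k) π ∋ y × (ρ π ≡ r → T (le σ π) → ∀ a → y a ≡ y₁ π a)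
    gated π (yes p) (yes q) = y₁ π , y₁∈ π p q , λ _ _ _ → refl
    gated π (no ¬p) _       = (λ _ → 0ℚ) , ∋-0 (Ω (suc k) π) , λ p → contradiction p ¬p
    gated π (yes _) (no ¬q) = (λ _ → 0ℚ) , ∋-0 (Ω (suc k) π) , λ _ q → contradiction q ¬q

    y₂ : Fin n → Block → ℚ
    y₂ π = proj₁ (gated π (ρ π ℕ.≟ r) (T? (le σ π)))

    primitive-step : Primitive
    primitive-step = finish y₂ (λ π → proj₁ (proj₂ (gated π (ρ π ℕ.≟ r) (T? (le σ π))))) λ τ ρτ a → begin
      D σ y₂ τ a
        ≡⟨ D-cong σ y₂ y₁ τ a (λ π p h → proj₂ (proj₂ (gated π (ρ π ℕ.≟ r) (T? (le σ π))))
             (ℕₚ.suc-injective (trans (sym (proj₂ (e-cover π τ h))) ρτ)) p a) ⟩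
      D σ y₁ τ a
        ≡⟨ D-- σ y₀ (D σ v̂) τ a ⟩
      D σ y₀ τ a ℚ.- D σ (D σ v̂) τ a
        ≡⟨ trans (cong (λ t → D σ y₀ τ a ℚ.- t) (D-D σ v̂ τ a)) (ℚₚ.+-identityʳ (D σ y₀ τ a)) ⟩
      D σ y₀ τ a ∎
      where open ≡-Reasoning

  -- Modulo negligible vectors, `Ω (suc k)` is the kernel of `Tr` from all block vectors of rank
  -- `k + 1` onto `Ω k`. The middle term is a sum of interval complexes, so a chase passes exactness
  -- from `Ω k` to `Ω (suc k)` with a gain of one degree.
  Ω-exact : ∀ k → k ≤ i → ExactBelow (Ω k) (Negl k) k
  Ω-exact (suc k) k<i σ zero r<k x x∈ closed =
    E.finish (λ _ _ → 0ℚ) (λ τ → ∋-0 (Ω (suc k) τ)) λ τ ρτ a → D-cong σ (λ _ _ → 0ℚ) E.y₀ τ a λ π _ h →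
      case trans (sym (proj₂ (e-cover π τ h))) ρτ of λ ()
    where module E = ExactStep k k<i σ zero (s≤s⁻¹ r<k) x x∈ closed
  Ω-exact (suc k) k<i σ (suc r) r<k x x∈ closed =
    let v , v∈ , v-sol = Ω-exact k (ℕₚ.<⇒≤ k<i) σ r (s≤s⁻¹ r<k) E.u E.u∈ E.u-closed
    in Correct.primitive-step k k<i σ r (s≤s⁻¹ r<k) x x∈ closed v v∈ v-sol
    where module E = ExactStep k k<i σ (suc r) (s≤s⁻¹ r<k) x x∈ closed

  atRank : ℕ → Fin n → Fin n → Bool
  atRank k σ w = (ρ w ℕ.≡ᵇ k) ∧ le σ w

  atRank-out : ∀ k σ w → T (atRank k σ w) → ρ w ≡ k × T (le σ w)
  atRank-out k σ w t = let p , q = Equivalence.to T-∧ t in ℕₚ.≡ᵇ⇒≡ (ρ w) k p , q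

  atRank-in : ∀ k σ w → ρ w ≡ k → T (le σ w) → T (atRank k σ w)
  atRank-in k σ w p q = Equivalence.from T-∧ (ℕₚ.≡⇒≡ᵇ (ρ w) k p , q)

  blockCount : ℕ → Fin n → ℕ
  blockCount k σ = sumℕ λ w → if atRank k σ w then m w else 0

  Dim-full/Negl : ∀ k σ → Dim full (Negl k σ) (blockCount k σ)
  Dim-full/Negl k σ = Dim-blocks n (atRank k σ) (λ w → w) (λ h → h) (λ _ _ → tt)
    (λ w t f p → let ρw , σ≤w = atRank-out k σ w t in p w ρw σ≤w)
    (λ f _ h w ρw σ≤w → h w (atRank-in k σ w ρw σ≤w))

  abstract
    -- The lifting property makes `Tr` surjective onto `Ω k`, and `kernelDim` gives the next
    -- dimension. The equation is kept along with it, since it exhibits the dimension as an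
    -- alternating sum.
    Ω-dim : ∀ k → k ≤ i → ∀ σ → Σ[ d ∈ ℕ ] Dim (Ω k σ) (Negl k σ) d
    Ω-dim-suc : ∀ k (k<i : k < i) σ → Σ[ d ∈ ℕ ] blockCount (suc k) σ ≡ proj₁ (Ω-dim k (ℕₚ.<⇒≤ k<i) σ) ℕ.+ d ×
                Dim (preimage Tr full (Negl k σ)) (Negl (suc k) σ) d
    Ω-dim zero    k≤i σ = blockCount 0 σ ,
      Dim-resp (blockCount 0 σ) (λ _ _ → tt) (λ f _ τ ()) (λ _ z → z) (λ _ z → z) (Dim-full/Negl 0 σ)
    Ω-dim (suc k) k<i σ = let d , _ , D = Ω-dim-suc k k<i σ in d ,
      Dim-resp d (λ ψ p → tt , λ τ ρτ q l → p τ (cong suc ρτ) q l)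
                 (λ ψ (_ , p) τ ρτ q l → p τ (ℕₚ.suc-injective ρτ) q l) (λ _ z → z) (λ _ z → z) D
    Ω-dim-suc k k<i σ = kernelDim (proj₁ (Ω-dim k (ℕₚ.<⇒≤ k<i) σ)) Tr
      (λ ψ _ τ _ _ l → Tr-Tr ψ (τ , l))
      (λ ψ p τ ρτ q l → Negl⊆Ω (suc k) σ ψ p τ (cong suc ρτ) q l)
      (λ v v∈ → let η , h = Lift.lift k k<i σ v v∈ in
         η , tt , λ τ ρτ q l → trans (cong (λ t → v (τ , l) ℚ.- t) (h τ ρτ q l)) (ℚₚ.+-inverseʳ (v (τ , l))))
      (proj₂ (Ω-dim k (ℕₚ.<⇒≤ k<i) σ)) (Dim-full/Negl (suc k) σ)

    Ω-dim-zero : ∀ (0≤i : 0 ≤ i) σ → proj₁ (Ω-dim 0 0≤i σ) ≡ blockCount 0 σ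
    Ω-dim-zero 0≤i σ = refl

    Ω-dim-count : ∀ k (k<i : k < i) σ →
                  blockCount (suc k) σ ≡ proj₁ (Ω-dim k (ℕₚ.<⇒≤ k<i) σ) ℕ.+ proj₁ (Ω-dim (suc k) k<i σ)
    Ω-dim-count k k<i σ = proj₁ (proj₂ (Ω-dim-suc k k<i σ))

-- Generic symmetric forms.

all-or-some : ∀ {k} {A B : Fin k → Set} → (∀ i → A i ⊎ B i) → (∀ i → A i) ⊎ Σ (Fin k) B
all-or-some {zero}  h = inj₁ λ ()
all-or-some {suc k} h with h zero | all-or-some (h ∘ suc)
... | inj₂ b | _            = inj₂ (zero , b)
... | inj₁ a | inj₂ (i , b) = inj₂ (suc i , b)
... | inj₁ a | inj₁ as      = inj₁ λ { zero → a ; (suc i) → as i }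

fromℕ : ℕ → ℚ
fromℕ q = ℚ.mkℚ (+ q) 0 (Coprimality.sym (Coprimality.1-coprimeTo q))

fromℕ-injective : ∀ {p q} → fromℕ p ≡ fromℕ q → p ≡ q
fromℕ-injective h = ℤₚ.+-injective (cong ℚ.numerator h)

module Forms (K : CellComplex) (M : Sheaves.Sheaf K) where

  open Sheaves K
  open Sheaf M
  open Dual M
  module FinUnits = Units {Fin n} Fin._≟_

  -- The sum of squares of the dual coordinates, a positive definite form on the stalk at `υ`.
  Q : Fin n → (X → ℚ) → Fun X
  Q υ f = ∑ᶠ λ l → ap (co (B υ) l) f ·ᶠ co (B υ) l

  -- The boundary at `w` of the weighted forms on the cells above it.
  G : (Fin n → ℚ) → Fin n → (X → ℚ) → Fun X
  G W w f = ∑ᶠ λ υ → e w υ ·ᶠ (W υ ·ᶠ Q υ f)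

  Q-sym : ∀ υ f g → ap (Q υ f) g ≡ ap (Q υ g) f
  Q-sym υ f g = ∑-cong λ l → ℚₚ.*-comm (ap (co (B υ) l) f) (ap (co (B υ) l) g)

  G-sym : ∀ W w f g → ap (G W w f) g ≡ ap (G W w g) f
  G-sym W w f g = ∑-cong λ υ → cong (λ t → e w υ ℚ.* (W υ ℚ.* t)) (Q-sym υ f g)

  G-kills : ∀ W w f → Kills (G W w f) (Nul w)
  G-kills W w f g p = ∑-zero λ υ → *-zero-≢0 (e w υ) λ h →
    trans (cong (W υ ℚ.*_) (∑-zero λ l → trans
            (cong (ap (co (B υ) l) f ℚ.*_) (co-kills (B υ) l g (Nul-mono w υ (e-le h) g p)))
            (ℚₚ.*-zeroʳ (ap (co (B υ) l) f))))
          (ℚₚ.*-zeroʳ (W υ))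

  -- Sends `f` to the functional `G W w f` on each stalk; by symmetry the basis vector may be the
  -- first argument, which makes linearity in `f` immediate.
  Φ : (Fin n → ℚ) → Map X Block
  Φ W (w , j) = G W w (vec (B w) j)

  Φ-radical : ∀ W w f → (∀ j → (Φ W $ f) (w , j) ≡ 0ℚ) → ∀ g → Sub w ∋ g → ap (G W w f) g ≡ 0ℚ
  Φ-radical W w f h g g∈ = trans (ap-expand (B w) (G W w f) (G-kills W w f) g g∈)
    (∑-zero λ j → trans (cong (ap (co (B w) j) g ℚ.*_) (trans (G-sym W w f (vec (B w) j)) (h j)))
                        (ℚₚ.*-zeroʳ (ap (co (B w) j) g)))

  -- The form G W is a boundary, hence a cycle.
  Tr-Φ : ∀ W f y → (Tr $ Φ W $ f) y ≡ 0ℚ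
  Tr-Φ W f (σ , l) = begin
    ∑ (λ w → ∑ λ j → e σ w ℚ.* (ap (co (B w) j) b ℚ.* (Φ W $ f) (w , j)))
      ≡⟨ ∑-cong (λ w → trans (sym (∑-*ˡ (e σ w) (λ j → ap (co (B w) j) b ℚ.* (Φ W $ f) (w , j))))
           (*-cong-≢0 (e σ w) λ h → trans
             (∑-cong λ j → cong (ap (co (B w) j) b ℚ.*_) (G-sym W w (vec (B w) j) f))
             (sym (ap-expand (B w) (G W w f) (G-kills W w f) b (Sub-mono σ w (e-le h) b (vec∈ (B σ) l)))))) ⟩
    ∑ (λ w → e σ w ℚ.* ∑ λ υ → e w υ ℚ.* t υ)
      ≡⟨ ∑-cong (λ w → trans (∑-*ˡ (e σ w) (λ υ → e w υ ℚ.* t υ))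
           (∑-cong λ υ → sym (ℚₚ.*-assoc (e σ w) (e w υ) (t υ)))) ⟩
    ∑ (λ w → ∑ λ υ → (e σ w ℚ.* e w υ) ℚ.* t υ)
      ≡⟨ ∑-swap (λ w υ → (e σ w ℚ.* e w υ) ℚ.* t υ) ⟩
    ∑ (λ υ → ∑ λ w → (e σ w ℚ.* e w υ) ℚ.* t υ)
      ≡⟨ ∑-zero (λ υ → trans (sym (∑-*ʳ (λ w → e σ w ℚ.* e w υ) (t υ)))
           (trans (cong (ℚ._* t υ) (e-e σ υ)) (ℚₚ.*-zeroˡ (t υ)))) ⟩
    0ℚ ∎
    where
    open ≡-Reasoning
    b = vec (B σ) l
    t : Fin n → ℚ
    t υ = W υ ℚ.* ap (Q υ f) b

  module AddWeight (W : Fin n → ℚ) (υ₀ : Fin n) where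

    W+ : ℚ → Fin n → ℚ
    W+ a υ = W υ ℚ.+ a ℚ.* FinUnits.unit υ₀ υ

    G-W+ : ∀ a w f g → ap (G (W+ a) w f) g ≡ ap (G W w f) g ℚ.+ a ℚ.* (e w υ₀ ℚ.* ap (Q υ₀ f) g)
    G-W+ a w f g = begin
      ∑ (λ υ → e w υ ℚ.* ((W υ ℚ.+ a ℚ.* u υ) ℚ.* q υ))
        ≡⟨ ∑-cong (λ υ → solve 5 (λ e w a u q → e :* ((w :+ a :* u) :* q) := e :* (w :* q) :+ (a :* (e :* q)) :* u)
             refl (e w υ) (W υ) a (u υ) (q υ)) ⟩
      ∑ (λ υ → e w υ ℚ.* (W υ ℚ.* q υ) ℚ.+ (a ℚ.* (e w υ ℚ.* q υ)) ℚ.* u υ)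
        ≡⟨ ∑-+ (λ υ → e w υ ℚ.* (W υ ℚ.* q υ)) (λ υ → (a ℚ.* (e w υ ℚ.* q υ)) ℚ.* u υ) ⟩
      ap (G W w f) g ℚ.+ ∑ (λ υ → (a ℚ.* (e w υ ℚ.* q υ)) ℚ.* u υ)
        ≡⟨ cong (ap (G W w f) g ℚ.+_) (trans
             (∑-single υ₀ λ υ υ≢ → trans (cong (a ℚ.* (e w υ ℚ.* q υ) ℚ.*_) (FinUnits.unit-diff υ₀ υ υ≢))
                                         (ℚₚ.*-zeroʳ (a ℚ.* (e w υ ℚ.* q υ))))
             (trans (cong (a ℚ.* (e w υ₀ ℚ.* q υ₀) ℚ.*_) (FinUnits.unit-same υ₀)) (ℚₚ.*-identityʳ (a ℚ.* (e w υ₀ ℚ.* q υ₀))))) ⟩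
      ap (G W w f) g ℚ.+ a ℚ.* (e w υ₀ ℚ.* q υ₀) ∎
      where
      open ≡-Reasoning
      open +-*-Solver
      q : Fin n → ℚ
      q υ = ap (Q υ f) g
      u = FinUnits.unit υ₀

    Radical : ℚ → Fin n → (X → ℚ) → Set
    Radical a τ f = Sub τ ∋ f × (∀ j → (Φ (W+ a) $ f) (τ , j) ≡ 0ℚ)

    Good Bad : ℚ → Fin n → Fin (m υ₀) → Set
    Good a τ l = e τ υ₀ ≢ 0ℚ → ∀ f → Radical a τ f → ap (co (B υ₀) l) f ≡ 0ℚ
    Bad  a τ l = e τ υ₀ ≢ 0ℚ × Σ[ f ∈ (X → ℚ) ] Radical a τ f × ap (co (B υ₀) l) f ≢ 0ℚ

    -- The radical is cut out by finitely many functionals. Either the coordinate `l` at `υ₀` is a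
    -- combination of them up to the annihilator of `Sub τ`, and vanishes on the radical, or
    -- `fredholm` yields a radical vector on which it does not.
    good-or-bad : ∀ a τ l → Good a τ l ⊎ Bad a τ l
    good-or-bad a τ l = decide (e τ υ₀ ℚₚ.≟ 0ℚ)
      where
      Vanishes : Fun X → Set
      Vanishes ψ = ∀ f → Radical a τ f → ap ψ f ≡ 0ℚ
      step : ∀ ψ j k → Vanishes (ψ -ᶠ k ·ᶠ Φ (W+ a) (τ , j)) → Vanishes ψ
      step ψ j k h f r = trans (sym (trans (cong (λ t → ap ψ f ℚ.- k ℚ.* t) (proj₂ r j))
        (solve 2 (λ p k → p :- k :* con 0ℚ := p) refl (ap ψ f) k))) (h f r)
        where open +-*-Solver
      decide : Dec (e τ υ₀ ≡ 0ℚ) → Good a τ l ⊎ Bad a τ l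
      decide (yes p) = inj₁ λ h → contradiction p h
      decide (no e≢0) = conclude (fredholm (m τ) (dim τ) (λ j → Φ (W+ a) (τ , j))
          (λ j → G-kills (W+ a) τ (vec (B τ) j)) Vanishes (λ ψ h f r → h f (proj₁ r)) step (allFin (m τ))
          (co (B υ₀) l) (λ f p → co-kills (B υ₀) l f (Nul-mono τ υ₀ (e-le e≢0) f p)))
        where
        conclude : _ → Good a τ l ⊎ Bad a τ l
        conclude (inj₁ h) = inj₁ λ _ → h
        conclude (inj₂ (f , f∈ , rows , h)) =
          inj₂ (e≢0 , f , (f∈ , λ j → All.lookup rows (∈-allFin j)) , h)

    -- As for eigenvectors of a pencil of symmetric forms with distinct eigenvalues.
    orthogonal : ∀ {a b} → a ≢ b → ∀ τ → e τ υ₀ ≢ 0ℚ → ∀ f g → Radical a τ f → Radical b τ g → ap (Q υ₀ f) g ≡ 0ℚ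
    orthogonal {a} {b} a≢b τ e≢0 f g (f∈ , rf) (g∈ , rg) = *-cancel-0 e≢0 (*-cancel-0 (a≢b ∘ x-y≡0⇒x≡y) (begin
      (a ℚ.- b) ℚ.* (e τ υ₀ ℚ.* ap (Q υ₀ f) g)
        ≡⟨ solve 4 (λ a b p t → (a :- b) :* t := (p :+ a :* t) :- (p :+ b :* t)) refl a b (ap (G W τ f) g) (e τ υ₀ ℚ.* ap (Q υ₀ f) g) ⟩
      (ap (G W τ f) g ℚ.+ a ℚ.* (e τ υ₀ ℚ.* ap (Q υ₀ f) g)) ℚ.- (ap (G W τ f) g ℚ.+ b ℚ.* (e τ υ₀ ℚ.* ap (Q υ₀ f) g))
        ≡⟨ cong₂ ℚ._-_ (trans (sym (G-W+ a τ f g)) (Φ-radical (W+ a) τ f rf g g∈))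
                       (trans (sym (G-W+ b τ f g)) (trans (G-sym (W+ b) τ f g) (Φ-radical (W+ b) τ g rg f f∈))) ⟩
      0ℚ ∎))
      where
      open ≡-Reasoning
      open +-*-Solver

    module AllBad (k : ℕ) where

      module Copies = Blocks {n} (λ _ → m υ₀)

      size : ℕ
      size = sumℕ {n} λ _ → m υ₀

      IsBad : ℚ → Set
      IsBad a = Σ[ τ ∈ Fin n ] ρ τ ≡ k × Σ[ l ∈ Fin (m υ₀) ] Bad a τ l

      module Family (bad : ∀ (q : Fin (suc size)) → IsBad (fromℕ (toℕ q))) where

        at : Fin (suc size) → Fin n
        at q = proj₁ (bad q)

        vector : Fin (suc size) → X → ℚ
        vector q = proj₁ (proj₂ (proj₂ (proj₂ (proj₂ (bad q)))))

        coordinates : Fin (suc size) → Copies.Block → ℚ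
        coordinates q (w , l) = FinUnits.unit (at q) w ℚ.* ap (co (B υ₀) l) (vector q)

        dual : Fin (suc size) → Fun Copies.Block
        dual q = ∑ᶠ λ l → ap (co (B υ₀) l) (vector q) ·ᶠ ev (at q , l)

        dual-coordinates : ∀ p q → ap (dual p) (coordinates q) ≡
                           FinUnits.unit (at q) (at p) ℚ.* ap (Q υ₀ (vector p)) (vector q)
        dual-coordinates p q = trans
          (∑-cong λ l → solve 3 (λ c u d → c :* (u :* d) := u :* (c :* d)) refl
            (ap (co (B υ₀) l) (vector p)) (FinUnits.unit (at q) (at p)) (ap (co (B υ₀) l) (vector q)))
          (sym (∑-*ˡ (FinUnits.unit (at q) (at p)) (λ l → ap (co (B υ₀) l) (vector p) ℚ.* ap (co (B υ₀) l) (vector q))))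
          where open +-*-Solver

        nonzero : ∀ q → ap (dual q) (coordinates q) ≢ 0ℚ
        nonzero q h =
          let _ , _ , l , _ , f , _ , c≢0 = bad q in
          c≢0 (∑-squares≡0 (λ l → ap (co (B υ₀) l) f)
            (trans (sym (ℚₚ.*-identityˡ (ap (Q υ₀ f) f)))
              (trans (cong (ℚ._* ap (Q υ₀ f) f) (sym (FinUnits.unit-same (at q))))
                (trans (sym (dual-coordinates q q)) h))) l)

        dual-orthogonal : ∀ p q → p ≢ q → ap (dual p) (coordinates q) ≡ 0ℚ
        dual-orthogonal p q p≢q = trans (dual-coordinates p q) (by (at p Fin.≟ at q))
          where
          by : Dec (at p ≡ at q) → FinUnits.unit (at q) (at p) ℚ.* ap (Q υ₀ (vector p)) (vector q) ≡ 0ℚ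
          by (no h) = trans (cong (ℚ._* ap (Q υ₀ (vector p)) (vector q)) (FinUnits.unit-diff (at q) (at p) h))
                            (ℚₚ.*-zeroˡ (ap (Q υ₀ (vector p)) (vector q)))
          by (yes h) =
            let τ , _ , _ , e≢0 , f , rf , _ = bad p
                τ′ , _ , _ , _ , g , rg , _ = bad q
            in trans (cong (FinUnits.unit (at q) (at p) ℚ.*_)
                 (orthogonal (p≢q ∘ Finₚ.toℕ-injective ∘ fromℕ-injective) τ e≢0 f g rf
                   (subst (λ t → Radical (fromℕ (toℕ q)) t g) (sym h) rg)))
                 (ℚₚ.*-zeroʳ (FinUnits.unit (at q) (at p)))

        absurd : ⊥
        absurd = ℕₚ.1+n≰n (orthogonal-bound (suc size) size Copies.Dim-full dual coordinates
          (λ _ → tt) (λ q f p → trans (ap-cong (dual q) p) (ap-0 (dual q))) nonzero dual-orthogonal)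

      IsGood : ℚ → Set
      IsGood a = ∀ τ → ρ τ ≡ k → ∀ l → Good a τ l

      -- Of the weights `0` to `size` one is good. If all were bad, each would give a radical vector
      -- with a nonzero coordinate at `υ₀`. Placed into one copy of the stalk of `υ₀` per cell,
      -- these vectors are pairwise orthogonal and, `Q` being a sum of squares, not isotropic: one
      -- more than the dimension allows.
      good-weight : Σ ℚ IsGood
      good-weight = conclude (all-or-some λ q → Sum.swap (isGood? (fromℕ (toℕ q))))
        where
        isGood? : ∀ a → IsGood a ⊎ IsBad a
        isGood? a = all-or-some λ τ → atRank? τ (ρ τ ℕ.≟ k)
          where
          atRank? : ∀ τ → Dec (ρ τ ≡ k) → (ρ τ ≡ k → ∀ l → Good a τ l) ⊎ (ρ τ ≡ k × Σ[ l ∈ Fin (m υ₀) ] Bad a τ l)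
          atRank? τ (no h)  = inj₁ λ p → contradiction p h
          atRank? τ (yes p) with all-or-some (good-or-bad a τ)
          ... | inj₁ g = inj₁ λ _ → g
          ... | inj₂ b = inj₂ (p , b)
        conclude : (∀ q → IsBad (fromℕ (toℕ q))) ⊎ Σ[ q ∈ Fin (suc size) ] IsGood (fromℕ (toℕ q)) → Σ ℚ IsGood
        conclude (inj₁ bad)     = ⊥-elim (Family.absurd bad)
        conclude (inj₂ (q , g)) = fromℕ (toℕ q) , g

  Generic : (Fin n → ℚ) → List (Fin n) → ℕ → Set
  Generic W L k = ∀ τ → ρ τ ≡ k → ∀ f → Sub τ ∋ f → (∀ j → (Φ W $ f) (τ , j) ≡ 0ℚ) →
                  ∀ υ → υ ∈ L → e τ υ ≢ 0ℚ → ∀ l → ap (co (B υ) l) f ≡ 0ℚ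

  abstract
    -- One cell is treated at a time. A radical vector of the new form has zero coordinates at `υ₀`,
    -- so the added term vanishes on it and it already lay in the radical of the old form; what was
    -- achieved for `L` is kept.
    generic-weights : ∀ k L → Σ[ W ∈ (Fin n → ℚ) ] Generic W L k
    generic-weights k []       = (λ _ → 0ℚ) , λ _ _ _ _ _ _ ()
    generic-weights k (υ₀ ∷ L) = W+ a , generic
      where
      W : Fin n → ℚ
      W = proj₁ (generic-weights k L)
      open AddWeight W υ₀
      open AllBad k
      a : ℚ
      a = proj₁ good-weight
      generic : Generic (W+ a) (υ₀ ∷ L) k
      generic τ ρτ f f∈ h .υ₀ (here refl) e≢0 l = proj₂ good-weight τ ρτ l e≢0 f (f∈ , h)
      generic τ ρτ f f∈ h υ (there υ∈) e≢0 l = proj₂ (generic-weights k L) τ ρτ f f∈ radical υ υ∈ e≢0 l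
        where
        Q-part : ∀ g → e τ υ₀ ℚ.* ap (Q υ₀ f) g ≡ 0ℚ
        Q-part g = *-zero-≢0 (e τ υ₀) λ e≢0′ → ∑-zero λ l →
          trans (cong (ℚ._* ap (co (B υ₀) l) g) (proj₂ good-weight τ ρτ l e≢0′ f (f∈ , h))) (ℚₚ.*-zeroˡ (ap (co (B υ₀) l) g))
        radical : ∀ j → (Φ W $ f) (τ , j) ≡ 0ℚ
        radical j = begin
          (Φ W $ f) (τ , j)         ≡⟨ G-sym W τ b f ⟩
          ap (G W τ f) b            ≡⟨ solve 2 (λ p a → p := p :+ a :* con 0ℚ) refl (ap (G W τ f) b) a ⟩
          ap (G W τ f) b ℚ.+ a ℚ.* 0ℚ ≡⟨ cong (λ t → ap (G W τ f) b ℚ.+ a ℚ.* t) (Q-part b) ⟨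
          ap (G W τ f) b ℚ.+ a ℚ.* (e τ υ₀ ℚ.* ap (Q υ₀ f) b) ≡⟨ G-W+ a τ f b ⟨
          ap (G (W+ a) τ f) b       ≡⟨ Φ-radical (W+ a) τ f h b (vec∈ (B τ) j) ⟩
          0ℚ ∎
          where
          open ≡-Reasoning
          open +-*-Solver
          b : X → ℚ
          b = vec (B τ) j

-- The embedding into the dualizing sheaf and its cokernel.

module Support (K : CellComplex) (M : Sheaves.Sheaf K) (i : ℕ) (cm : Sheaves.CM K M i) (k : ℕ) (k<i : k < i) where

  open Sheaves K
  open Sheaf M
  open Dual M
  open Forms K M using (module FinUnits)
  open Dualizing K M i cm

  -- Exactness in the lowest degree: `f` placed at `σ` alone is a cocycle of `[σ, ∞)`, hence a
  -- coboundary, and there is nothing below `σ` for it to come from.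
  Nul-of-covers : ∀ σ → ρ σ < i → ∀ f → Sub σ ∋ f → (∀ υ → e σ υ ≢ 0ℚ → Nul υ ∋ f) → Nul σ ∋ f
  Nul-of-covers σ ρσ<i f f∈ h =
    let y , _ , sol = cm σ (ρ σ) ρσ<i x x∈ closed in
    ∋-resp (Nul σ) (λ a → trans (cong₂ ℚ._-_ (x-at a) (no-lower y a)) (ℚₚ.+-identityʳ (f a))) (sol σ refl (le-refl σ))
    where
    x : Fin n → X → ℚ
    x τ a = FinUnits.unit σ τ ℚ.* f a
    x-at : ∀ a → x σ a ≡ f a
    x-at a = trans (cong (ℚ._* f a) (FinUnits.unit-same σ)) (ℚₚ.*-identityˡ (f a))
    x∈ : ∀ τ → Sub τ ∋ x τ
    x∈ τ with τ Fin.≟ σ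
    ... | yes refl = ∋-* (Sub σ) 1ℚ f∈
    ... | no _     = ∋-resp (Sub τ) (λ a → sym (ℚₚ.*-zeroˡ (f a))) (∋-0 (Sub τ))
    D-x : ∀ υ a → (δ σ σ ℚ.* e σ υ) ℚ.* f a ≡ D σ x υ a
    D-x υ a = sym (trans
      (∑-single σ λ τ τ≢σ → trans
        (cong (λ t → (δ σ τ ℚ.* e τ υ) ℚ.* (t ℚ.* f a)) (FinUnits.unit-diff σ τ τ≢σ))
        (solve 2 (λ k f → k :* (con 0ℚ :* f) := con 0ℚ) refl (δ σ τ ℚ.* e τ υ) (f a)))
      (cong (λ t → (δ σ σ ℚ.* e σ υ) ℚ.* t) (x-at a)))
      where open +-*-Solver
    closed : ∀ υ → ρ υ ≡ suc (ρ σ) → T (le σ υ) → Nul υ ∋ D σ x υ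
    closed υ _ _ = by (e σ υ ℚₚ.≟ 0ℚ)
      where
      by : Dec (e σ υ ≡ 0ℚ) → Nul υ ∋ D σ x υ
      by (no e≢0) = ∋-resp (Nul υ) (D-x υ) (∋-* (Nul υ) (δ σ σ ℚ.* e σ υ) (h υ e≢0))
      by (yes e≡0) = ∋-resp (Nul υ) (λ a → trans (sym (trans
        (cong (λ t → (δ σ σ ℚ.* t) ℚ.* f a) e≡0)
        (solve 2 (λ d f → (d :* con 0ℚ) :* f := con 0ℚ) refl (δ σ σ) (f a)))) (D-x υ a)) (∋-0 (Nul υ))
        where open +-*-Solver
    no-lower : ∀ y a → D σ y σ a ≡ 0ℚ
    no-lower y a = ∑-zero λ π → trans
      (cong (ℚ._* y π a) (*-zero-≢0 (δ σ π) λ p → e-zero π (δ≢0 p)))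
      (ℚₚ.*-zeroˡ (y π a))
      where
      e-zero : ∀ π → T (le σ π) → e π σ ≡ 0ℚ
      e-zero π σ≤π with e π σ ℚₚ.≟ 0ℚ
      ... | yes p = p
      ... | no p  = contradiction (ℕₚ.≤-trans (ℕₚ.≤-reflexive (sym (proj₂ (e-cover π σ p)))) (rank-≤ σ π σ≤π)) ℕₚ.1+n≰n

  Nul-of-top : ∀ gap σ → ρ σ ℕ.+ gap ≡ k → ∀ f → Sub σ ∋ f → (∀ w → ρ w ≡ k → T (le σ w) → Nul w ∋ f) → Nul σ ∋ f
  Nul-of-top zero σ g f f∈ h = h σ (trans (sym (ℕₚ.+-identityʳ (ρ σ))) g) (le-refl σ)
  Nul-of-top (suc gap) σ g f f∈ h = Nul-of-covers σ (ℕₚ.≤-<-trans (ℕₚ.≤-trans (ℕₚ.m≤m+n (ρ σ) (suc gap)) (ℕₚ.≤-reflexive g)) k<i) f f∈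
    λ υ e≢0 → let σ≤υ , ρυ = e-cover σ υ e≢0 in
      Nul-of-top gap υ (trans (cong (ℕ._+ gap) ρυ) (trans (sym (ℕₚ.+-suc (ρ σ) gap)) g)) f
        (Sub-mono σ υ σ≤υ f f∈) (λ w ρw υ≤w → h w ρw (le-trans σ υ w σ≤υ υ≤w))

module Lefschetz (K : CellComplex) (M : Sheaves.Sheaf K) (i : ℕ) (cm : Sheaves.CM K M i) (k : ℕ) (k<i : k < i) where

  open Sheaves K
  open Sheaf M
  open Dual M
  open Forms K M
  open Support K M i cm k k<i

  W : Fin n → ℚ
  W = proj₁ (generic-weights k (allFin n))

  -- By genericity a radical vector vanishes at the cells covering `w`, hence at `w`. The last step
  -- takes exactness in degree `k`, whence `k < i`.
  Φ-injective : ∀ w → ρ w ≡ k → ∀ f → Sub w ∋ f → (∀ j → (Φ W $ f) (w , j) ≡ 0ℚ) → Nul w ∋ f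
  Φ-injective w ρw f f∈ h = Nul-of-covers w (subst (_< i) (sym ρw) k<i) f f∈ λ υ e≢0 →
    co≡0⇒∈ (B υ) f (Sub-mono w υ (e-le e≢0) f f∈)
      (proj₂ (generic-weights k (allFin n)) w ρw f f∈ h υ (∈-allFin υ) e≢0)

  Φ-kills : ∀ σ f → Nul σ ∋ f → Negl k σ ∋ (Φ W $ f)
  Φ-kills σ f p w _ σ≤w j = trans (G-sym W w (vec (B w) j) f)
    (trans (G-sym W w f (vec (B w) j)) (G-kills W w (vec (B w) j) f (Nul-mono σ w σ≤w f p)))

-- The cokernel of an injective self-dual map Ψ from the k-skeleton of M to its dualizing sheaf.
module Quotient (K : CellComplex) (M : Sheaves.Sheaf K) (i : ℕ) (cm : Sheaves.CM K M i) (k : ℕ) (k<i : k < i)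
  (Ψ : Map (Sheaves.Sheaf.X M) (Sheaves.Dual.Block K M))
  (Tr-Ψ : ∀ f y → (Sheaves.Dual.Tr K M $ Ψ $ f) y ≡ 0ℚ)
  (Ψ-kills : ∀ σ f → Sheaves.Sheaf.Nul M σ ∋ f → Sheaves.Dual.Negl K M k σ ∋ (Ψ $ f))
  (Ψ-injective : ∀ w → CellComplex.ρ K w ≡ k → ∀ f → Sheaves.Sheaf.Sub M w ∋ f →
                 (∀ j → (Ψ $ f) (w , j) ≡ 0ℚ) → Sheaves.Sheaf.Nul M w ∋ f) where

  open Sheaves K
  open Sheaf M
  open Dual M
  open Dualizing K M i cm
  open Support K M i cm k k<i

  -- Below rank `k` a vector is determined by its restrictions to the cells of rank `k`, where `Ψ`
  -- is injective.
  Nul-of-Ψ : ∀ σ → ρ σ ≤ k → ∀ f → Sub σ ∋ f → Negl k σ ∋ (Ψ $ f) → Nul σ ∋ f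
  Nul-of-Ψ σ ρσ≤k f f∈ h = Nul-of-top (k ∸ ρ σ) σ (ℕₚ.m+[n∸m]≡n ρσ≤k) f f∈
    λ w ρw σ≤w → Ψ-injective w ρw f (Sub-mono σ w σ≤w f f∈) (h w ρw σ≤w)

  NulQ : Fin n → Subspace Block
  NulQ σ = sumWithImage (Negl k σ) Ψ (Sub σ)

  QDim : Fin n → ℕ → Set
  QDim σ d = Dim (Ω k σ) (NulQ σ) d × (ρ σ ≤ k → proj₁ (Ω-dim k (ℕₚ.<⇒≤ k<i) σ) ≡ m σ ℕ.+ d)

  injectiveDim : ∀ σ → ρ σ ≤ k → ∀ d → Dim (Ω k σ) (Negl k σ) d →
                 Σ[ d′ ∈ ℕ ] d ≡ m σ ℕ.+ d′ × Dim (Ω k σ) (NulQ σ) d′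
  injectiveDim σ ρσ≤k d D = cokernelDim (m σ) {Ω k σ} {Negl k σ} {Sub σ} {Nul σ} Ψ (λ f _ τ _ _ l → Tr-Ψ f (τ , l)) (Ψ-kills σ)
                              (Nul-of-Ψ σ ρσ≤k) (dim σ) {d} D

  trivialDim : ∀ σ → ¬ (ρ σ ≤ k) → Dim (Ω k σ) (NulQ σ) 0
  trivialDim σ ρσ≰k f _ = (λ _ → 0ℚ) , ∋-0 (Sub σ) , λ w ρw σ≤w →
    contradiction (subst (ρ σ ≤_) ρw (rank-≤ σ w σ≤w)) ρσ≰k

  quotientDim : ∀ σ → Dec (ρ σ ≤ k) → Σ ℕ (QDim σ)
  quotientDim σ (yes ρσ≤k) = conclude (injectiveDim σ ρσ≤k (proj₁ (Ω-dim k (ℕₚ.<⇒≤ k<i) σ)) (proj₂ (Ω-dim k (ℕₚ.<⇒≤ k<i) σ)))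
    where
    conclude : Σ[ d ∈ ℕ ] proj₁ (Ω-dim k (ℕₚ.<⇒≤ k<i) σ) ≡ m σ ℕ.+ d × Dim (Ω k σ) (NulQ σ) d → Σ ℕ (QDim σ)
    conclude (d , eq , D) = d , D , λ _ → eq
  quotientDim σ (no ρσ≰k) = 0 , trivialDim σ ρσ≰k , λ p → contradiction p ρσ≰k

  quotient : Sheaf
  quotient = record
    { X        = Block
    ; Sub      = Ω k
    ; Nul      = NulQ
    ; Sub-mono = Ω-mono k
    ; Nul-mono = λ σ τ σ≤τ ψ (f , f∈ , p) → f , Sub-mono σ τ σ≤τ f f∈ , Negl-mono k σ τ σ≤τ _ p
    ; m        = λ σ → proj₁ (quotientDim σ (ρ σ ℕ.≤? k))
    ; dim      = λ σ → proj₁ (proj₂ (quotientDim σ (ρ σ ℕ.≤? k)))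
    }

  quotient-m : ∀ σ → ρ σ ≤ k → proj₁ (Ω-dim k (ℕₚ.<⇒≤ k<i) σ) ≡ m σ ℕ.+ Sheaf.m quotient σ
  quotient-m σ = proj₂ (proj₂ (quotientDim σ (ρ σ ℕ.≤? k)))

  module Chase (σ : Fin n) (r : ℕ) (r<k : suc r < k) (x : Fin n → Block → ℚ) (x∈ : ∀ τ → Ω k τ ∋ x τ)
    (closed : ∀ υ → ρ υ ≡ suc r → T (le σ υ) → NulQ υ ∋ D σ x υ) where

    Lifted : Fin n → Set
    Lifted υ = Σ[ z ∈ (X → ℚ) ] Sub υ ∋ z ×
      (ρ υ ≡ suc r → T (le σ υ) → Negl k υ ∋ (λ y → D σ x υ y ℚ.- (Ψ $ z) y))

    lifted : ∀ υ → Dec (ρ υ ≡ suc r) → Dec (T (le σ υ)) → Lifted υ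
    lifted υ (yes p) (yes q) = let z , z∈ , h = closed υ p q in z , z∈ , λ _ _ → h
    lifted υ (no ¬p) _       = (λ _ → 0ℚ) , ∋-0 (Sub υ) , λ p → contradiction p ¬p
    lifted υ (yes _) (no ¬q) = (λ _ → 0ℚ) , ∋-0 (Sub υ) , λ _ q → contradiction q ¬q

    z : Fin n → X → ℚ
    z υ = proj₁ (lifted υ (ρ υ ℕ.≟ suc r) (T? (le σ υ)))

    z∈ : ∀ υ → Sub υ ∋ z υ
    z∈ υ = proj₁ (proj₂ (lifted υ (ρ υ ℕ.≟ suc r) (T? (le σ υ))))

    Dx≡Ψz : ∀ υ → ρ υ ≡ suc r → T (le σ υ) → ∀ w → ρ w ≡ k → T (le υ w) → ∀ j → D σ x υ (w , j) ≡ (Ψ $ z υ) (w , j)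
    Dx≡Ψz υ p q w ρw υ≤w j = x-y≡0⇒x≡y
      (proj₂ (proj₂ (lifted υ (ρ υ ℕ.≟ suc r) (T? (le σ υ)))) p q w ρw υ≤w j)

    z-closed : ∀ υ → ρ υ ≡ suc (suc r) → T (le σ υ) → Nul υ ∋ D σ z υ
    z-closed υ ρυ σ≤υ = Nul-of-Ψ υ (subst (_≤ k) (sym ρυ) r<k) (D σ z υ) (D∈Sub σ z υ z∈) λ w ρw υ≤w j → begin
      (Ψ $ D σ z υ) (w , j)
        ≡⟨ ap-D (Ψ (w , j)) σ z υ ⟩
      D σ (λ τ → Ψ $ z τ) υ (w , j)
        ≡⟨ D-cong σ (λ τ → Ψ $ z τ) (D σ x) υ (w , j) (λ τ σ≤τ h → let τ≤υ , ρυ′ = e-cover τ υ h in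
             sym (Dx≡Ψz τ (ℕₚ.suc-injective (trans (sym ρυ′) ρυ)) σ≤τ w ρw (le-trans τ υ w τ≤υ υ≤w) j)) ⟩
      D σ (D σ x) υ (w , j)
        ≡⟨ D-D σ x υ (w , j) ⟩
      0ℚ ∎
      where open ≡-Reasoning

    module Corrected (y : Fin n → X → ℚ) (y∈ : ∀ τ → Sub τ ∋ y τ)
      (sol : ∀ τ → ρ τ ≡ suc r → T (le σ τ) → Nul τ ∋ (λ a → z τ a ℚ.- D σ y τ a)) where

      x₁ : Fin n → Block → ℚ
      x₁ τ b = x τ b ℚ.- (Ψ $ y τ) b

      x₁∈ : ∀ τ → Ω k τ ∋ x₁ τ
      x₁∈ τ = ∋-- (Ω k τ) (x∈ τ) (λ τ′ _ _ l → Tr-Ψ (y τ) (τ′ , l))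

      x₁-closed : ∀ υ → ρ υ ≡ suc r → T (le σ υ) → Negl k υ ∋ D σ x₁ υ
      x₁-closed υ ρυ σ≤υ w ρw υ≤w j = begin
        D σ x₁ υ (w , j)
          ≡⟨ D-- σ x (λ τ → Ψ $ y τ) υ (w , j) ⟩
        D σ x υ (w , j) ℚ.- D σ (λ τ → Ψ $ y τ) υ (w , j)
          ≡⟨ cong₂ ℚ._-_ (Dx≡Ψz υ ρυ σ≤υ w ρw υ≤w j) (sym (ap-D (Ψ (w , j)) σ y υ)) ⟩
        (Ψ $ z υ) (w , j) ℚ.- (Ψ $ D σ y υ) (w , j)
          ≡⟨ ap-- (Ψ (w , j)) (z υ) (D σ y υ) ⟨
        (Ψ $ (λ a → z υ a ℚ.- D σ y υ a)) (w , j)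
          ≡⟨ Ψ-kills υ _ (sol υ ρυ σ≤υ) w ρw υ≤w j ⟩
        0ℚ ∎
        where open ≡-Reasoning

      solution : Σ[ y′ ∈ (Fin n → Block → ℚ) ] (∀ τ → Ω k τ ∋ y′ τ) ×
                  (∀ τ → ρ τ ≡ r → T (le σ τ) → NulQ τ ∋ (λ b → x τ b ℚ.- D σ y′ τ b))
      solution =
        let y′ , y′∈ , sol′ = Ω-exact k (ℕₚ.<⇒≤ k<i) σ r (ℕₚ.<-trans (ℕₚ.n<1+n r) r<k) x₁ x₁∈ x₁-closed
        in y′ , y′∈ , λ τ ρτ σ≤τ → y τ , y∈ τ , ∋-resp (Negl k τ) (λ b →
             solve 3 (λ x p d → (x :- p) :- d := (x :- d) :- p) refl (x τ b) ((Ψ $ y τ) b) (D σ y′ τ b))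
             (sol′ τ ρτ σ≤τ)
        where open +-*-Solver

  -- Modulo `Negl`, the coboundary of a cocycle `x` of the cokernel is `Ψ` of a cochain `z` of `M`.
  -- Since `Ψ` is injective, `z` is closed, so it is the coboundary of some `y`; then `x - Ψ y` is
  -- closed in `Ω k` and bounds there. Injectivity is applied in rank `r + 2`, which has to be at
  -- most `k`: hence the strict bound on `j`.
  quotient-CM : ∀ j → j < k → CM quotient j
  quotient-CM j j<k σ r r<j x x∈ closed =
    let y , y∈ , sol = cm σ (suc r) (ℕₚ.<-trans r<k k<i) C.z C.z∈ C.z-closed
    in C.Corrected.solution y y∈ sol
    where
    r<k : suc r < k
    r<k = ℕₚ.≤-<-trans r<j j<k
    module C = Chase σ r r<k x x∈ closed

-- The ring of integer polynomials.

conv : (ℕ → ℤ) → (ℕ → ℤ) → ℕ → ℤ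
conv f g zero    = f 0 ℤ.* g 0
conv f g (suc k) = f 0 ℤ.* g (suc k) ℤ.+ conv (f ∘ suc) g k

conv-cong : ∀ {f f′ g g′} → f ≗ f′ → g ≗ g′ → conv f g ≗ conv f′ g′
conv-cong p q zero    = cong₂ ℤ._*_ (p 0) (q 0)
conv-cong p q (suc k) = cong₂ ℤ._+_ (cong₂ ℤ._*_ (p 0) (q (suc k))) (conv-cong (p ∘ suc) q k)

module _ where
  open ℤ-Solver.+-*-Solver
  open ≡-Reasoning

  conv-0 : ∀ g k → conv (λ _ → + 0) g k ≡ + 0
  conv-0 g zero    = refl
  conv-0 g (suc k) = trans (ℤₚ.+-identityˡ (conv (λ _ → + 0) g k)) (conv-0 g k)

  conv-+ˡ : ∀ f f′ g k → conv (λ i → f i ℤ.+ f′ i) g k ≡ conv f g k ℤ.+ conv f′ g k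
  conv-+ˡ f f′ g zero    = ℤₚ.*-distribʳ-+ (g 0) (f 0) (f′ 0)
  conv-+ˡ f f′ g (suc k) = trans (cong (λ t → (f 0 ℤ.+ f′ 0) ℤ.* g (suc k) ℤ.+ t) (conv-+ˡ (f ∘ suc) (f′ ∘ suc) g k))
    (solve 5 (λ a b c p q → (a :+ b) :* c :+ (p :+ q) := (a :* c :+ p) :+ (b :* c :+ q)) refl
      (f 0) (f′ 0) (g (suc k)) (conv (f ∘ suc) g k) (conv (f′ ∘ suc) g k))

  conv-*ˡ : ∀ a f g k → conv (λ i → a ℤ.* f i) g k ≡ a ℤ.* conv f g k
  conv-*ˡ a f g zero    = ℤₚ.*-assoc a (f 0) (g 0)
  conv-*ˡ a f g (suc k) = trans (cong (λ t → a ℤ.* f 0 ℤ.* g (suc k) ℤ.+ t) (conv-*ˡ a (f ∘ suc) g k))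
    (solve 4 (λ a b c p → a :* b :* c :+ a :* p := a :* (b :* c :+ p)) refl a (f 0) (g (suc k)) (conv (f ∘ suc) g k))

  conv-sucʳ : ∀ f g k → conv f g (suc k) ≡ conv f (g ∘ suc) k ℤ.+ f (suc k) ℤ.* g 0
  conv-sucʳ f g zero    = refl
  conv-sucʳ f g (suc k) = trans (cong (λ t → f 0 ℤ.* g (suc (suc k)) ℤ.+ t) (conv-sucʳ (f ∘ suc) g k))
    (sym (ℤₚ.+-assoc (f 0 ℤ.* g (suc (suc k))) (conv (f ∘ suc) (g ∘ suc) k) (f (suc (suc k)) ℤ.* g 0)))

  conv-comm : ∀ f g k → conv f g k ≡ conv g f k
  conv-comm f g zero    = ℤₚ.*-comm (f 0) (g 0)
  conv-comm f g (suc k) = begin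
    f 0 ℤ.* g (suc k) ℤ.+ conv (f ∘ suc) g k  ≡⟨ cong (λ t → f 0 ℤ.* g (suc k) ℤ.+ t) (conv-comm (f ∘ suc) g k) ⟩
    f 0 ℤ.* g (suc k) ℤ.+ conv g (f ∘ suc) k  ≡⟨ solve 3 (λ a b c → a :* b :+ c := c :+ b :* a) refl (f 0) (g (suc k)) (conv g (f ∘ suc) k) ⟩
    conv g (f ∘ suc) k ℤ.+ g (suc k) ℤ.* f 0  ≡⟨ conv-sucʳ g f k ⟨
    conv g f (suc k)                          ∎

  conv-assoc : ∀ f g h k → conv (conv f g) h k ≡ conv f (conv g h) k
  conv-assoc f g h zero    = ℤₚ.*-assoc (f 0) (g 0) (h 0)
  conv-assoc f g h (suc k) = begin
    f 0 ℤ.* g 0 ℤ.* h (suc k) ℤ.+ conv (λ i → f 0 ℤ.* g (suc i) ℤ.+ conv (f ∘ suc) g i) h k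
      ≡⟨ cong (λ t → f 0 ℤ.* g 0 ℤ.* h (suc k) ℤ.+ t) (trans (conv-+ˡ (λ i → f 0 ℤ.* g (suc i)) (conv (f ∘ suc) g) h k)
           (cong₂ ℤ._+_ (conv-*ˡ (f 0) (g ∘ suc) h k) (conv-assoc (f ∘ suc) g h k))) ⟩
    f 0 ℤ.* g 0 ℤ.* h (suc k) ℤ.+ (f 0 ℤ.* conv (g ∘ suc) h k ℤ.+ conv (f ∘ suc) (conv g h) k)
      ≡⟨ solve 5 (λ a b c p q → a :* b :* c :+ (a :* p :+ q) := a :* (b :* c :+ p) :+ q) refl
           (f 0) (g 0) (h (suc k)) (conv (g ∘ suc) h k) (conv (f ∘ suc) (conv g h) k) ⟩
    f 0 ℤ.* (g 0 ℤ.* h (suc k) ℤ.+ conv (g ∘ suc) h k) ℤ.+ conv (f ∘ suc) (conv g h) k ∎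

coeff-+ : ∀ p q k → coeff (p +ₚ q) k ≡ coeff p k ℤ.+ coeff q k
coeff-+ []      q       k       = sym (ℤₚ.+-identityˡ (coeff q k))
coeff-+ (a ∷ p) []      k       = sym (ℤₚ.+-identityʳ (coeff (a ∷ p) k))
coeff-+ (a ∷ p) (b ∷ q) zero    = refl
coeff-+ (a ∷ p) (b ∷ q) (suc k) = coeff-+ p q k

coeff-· : ∀ c p k → coeff (c ·ₚ p) k ≡ c ℤ.* coeff p k
coeff-· c []      k       = sym (ℤₚ.*-zeroʳ c)
coeff-· c (a ∷ p) zero    = refl
coeff-· c (a ∷ p) (suc k) = coeff-· c p k

coeff-* : ∀ p q k → coeff (p *ₚ q) k ≡ conv (coeff p) (coeff q) k
coeff-* []      q k       = sym (conv-0 (coeff q) k)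
coeff-* (a ∷ p) q zero    = trans (coeff-+ (a ·ₚ q) (+ 0 ∷ p *ₚ q) 0)
  (trans (cong (λ t → t ℤ.+ + 0) (coeff-· a q 0)) (ℤₚ.+-identityʳ (a ℤ.* coeff q 0)))
coeff-* (a ∷ p) q (suc k) = trans (coeff-+ (a ·ₚ q) (+ 0 ∷ p *ₚ q) (suc k))
  (cong₂ ℤ._+_ (coeff-· a q (suc k)) (coeff-* p q k))

conv-const : ∀ a g k → conv (coeff (constₚ a)) g k ≡ a ℤ.* g k
conv-const a g zero    = refl
conv-const a g (suc k) = trans (cong (λ t → a ℤ.* g (suc k) ℤ.+ t) (conv-0 g k)) (ℤₚ.+-identityʳ (a ℤ.* g (suc k)))

-- All laws are checked on coefficients, because lists that differ by trailing zeros are the same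
-- polynomial; products become convolutions of infinite sequences.
polyRing : CommutativeRing 0ℓ 0ℓ
polyRing = record
  { Carrier = Poly ; _≈_ = _≈ₚ_ ; _+_ = _+ₚ_ ; _*_ = _*ₚ_ ; -_ = negₚ ; 0# = [] ; 1# = constₚ (+ 1)
  ; isCommutativeRing = record
    { isRing = record
      { +-isAbelianGroup = record
        { isGroup = record
          { isMonoid = record
            { isSemigroup = record
              { isMagma = record
                { isEquivalence = record
                  { refl = λ k → refl ; sym = λ h k → sym (h k) ; trans = λ h h′ k → trans (h k) (h′ k) }
                ; ∙-cong = λ {p} {p′} {q} {q′} h h′ k →
                    trans (coeff-+ p q k) (trans (cong₂ ℤ._+_ (h k) (h′ k)) (sym (coeff-+ p′ q′ k))) }
              ; assoc = λ p q r k → trans (coeff-+ (p +ₚ q) r k) (trans (cong (λ t → t ℤ.+ coeff r k) (coeff-+ p q k))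
                  (trans (ℤₚ.+-assoc (coeff p k) (coeff q k) (coeff r k))
                    (sym (trans (coeff-+ p (q +ₚ r) k) (cong (λ t → coeff p k ℤ.+ t) (coeff-+ q r k)))))) }
            ; identity = (λ p k → refl) , (λ p k → trans (coeff-+ p [] k) (ℤₚ.+-identityʳ (coeff p k))) }
          ; inverse = (λ p k → trans (coeff-+ (negₚ p) p k) (trans (cong (λ t → t ℤ.+ coeff p k) (coeff-neg p k)) (ℤₚ.+-inverseˡ (coeff p k))))
                    , (λ p k → trans (coeff-+ p (negₚ p) k) (trans (cong (λ t → coeff p k ℤ.+ t) (coeff-neg p k)) (ℤₚ.+-inverseʳ (coeff p k))))
          ; ⁻¹-cong = λ {p} {q} h k → trans (coeff-neg p k) (trans (cong ℤ.-_ (h k)) (sym (coeff-neg q k))) }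
        ; comm = λ p q k → trans (coeff-+ p q k) (trans (ℤₚ.+-comm (coeff p k) (coeff q k)) (sym (coeff-+ q p k))) }
      ; *-cong = λ {p} {p′} {q} {q′} h h′ k →
          trans (coeff-* p q k) (trans (conv-cong h h′ k) (sym (coeff-* p′ q′ k)))
      ; *-assoc = λ p q r k → trans (coeff-* (p *ₚ q) r k) (trans (conv-cong (coeff-* p q) (λ _ → refl) k)
          (trans (conv-assoc (coeff p) (coeff q) (coeff r) k)
            (sym (trans (coeff-* p (q *ₚ r) k) (conv-cong (λ i → refl {x = coeff p i}) (coeff-* q r) k)))))
      ; *-identity = identityˡ , λ p k → trans (comm p (constₚ (+ 1)) k) (identityˡ p k)
      ; distrib = (λ p q r k → trans (comm p (q +ₚ r) k) (trans (distribʳ p q r k)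
                    (trans (coeff-+ (q *ₚ p) (r *ₚ p) k) (trans (cong₂ ℤ._+_ (comm q p k) (comm r p k))
                      (sym (coeff-+ (p *ₚ q) (p *ₚ r) k))))))
                , distribʳ }
    ; *-comm = comm } }
  where
  coeff-neg : ∀ p k → coeff (negₚ p) k ≡ ℤ.- coeff p k
  coeff-neg p k = trans (coeff-· ℤ.-1ℤ p k) (ℤₚ.-1*i≡-i (coeff p k))
  comm : ∀ p q → (p *ₚ q) ≈ₚ (q *ₚ p)
  comm p q k = trans (coeff-* p q k) (trans (conv-comm (coeff p) (coeff q) k) (sym (coeff-* q p k)))
  identityˡ : ∀ p → (constₚ (+ 1) *ₚ p) ≈ₚ p
  identityˡ p k = trans (coeff-* (constₚ (+ 1)) p k) (trans (conv-const (+ 1) (coeff p) k) (ℤₚ.*-identityˡ (coeff p k)))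
  distribʳ : ∀ p q r → ((q +ₚ r) *ₚ p) ≈ₚ (q *ₚ p +ₚ r *ₚ p)
  distribʳ p q r k = trans (coeff-* (q +ₚ r) p k) (trans (conv-cong (coeff-+ q r) (λ _ → refl) k)
    (trans (conv-+ˡ (coeff q) (coeff r) (coeff p) k)
      (sym (trans (coeff-+ (q *ₚ p) (r *ₚ p) k) (cong₂ ℤ._+_ (coeff-* q p k) (coeff-* r p k))))))

-- Numerical identities for dimension functions.

record ℤ-Algebra : Set₁ where
  field
    ring : CommutativeRing 0ℓ 0ℓ
    hom  : CommutativeRing.rawRing ℤₚ.+-*-commutativeRing ACR.-Raw-AlmostCommutative⟶ ACR.fromCommutativeRing ring

module Guards (A : ℤ-Algebra) where

  open ℤ-Algebra A public
  open ACR._-Raw-AlmostCommutative⟶_ hom public using () renaming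
    (⟦_⟧ to ι; +-homo to ι-+; *-homo to ι-*; -‿homo to ι-neg; 0-homo to ι-0; 1-homo to ι-1)
  open CommutativeRing ring public using
    ( Carrier; _≈_; _+_; _*_; -_; _-_; 0#; 1#; setoid; +-cong; +-congˡ; +-congʳ; *-cong; *-congˡ; *-congʳ; -‿cong
    ; +-identityˡ; +-identityʳ; *-identityˡ; *-identityʳ; +-comm; *-comm; +-assoc; *-assoc; zeroˡ; zeroʳ
    ; distribˡ; distribʳ; -‿inverseˡ; -‿inverseʳ)
    renaming (refl to ≈-refl; sym to ≈-sym; trans to ≈-trans)
  open Sums ring public using () renaming
    ( ∑ to ∑ᴿ; ∑-cong to ∑ᴿ-cong; ∑-+ to ∑ᴿ-+; ∑-*ˡ to ∑ᴿ-*ˡ; ∑-*ʳ to ∑ᴿ-*ʳ; ∑-swap to ∑ᴿ-swap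
    ; ∑-zero to ∑ᴿ-zero; ∑-single to ∑ᴿ-single)
  module Solver = RingSolver (CommutativeRing.rawRing ℤₚ.+-*-commutativeRing) (ACR.fromCommutativeRing ring) hom
    (λ i j → Data.Maybe.map (λ h → CommutativeRing.reflexive ring (cong ι h)) (dec⇒maybe (i ℤ.≟ j)))
  module ≈-Reasoning = SetoidReasoning setoid

  infix 8 [_]_
  [_]_ : Bool → Carrier → Carrier
  [ b ] a = if b then a else 0#

  []-cong : ∀ b {a c} → (T b → a ≈ c) → [ b ] a ≈ [ b ] c
  []-cong true  h = h tt
  []-cong false h = ≈-refl

  []-yes : ∀ b {a} → T b → [ b ] a ≈ a
  []-yes true _ = ≈-refl

  []-no : ∀ b {a} → ¬ T b → [ b ] a ≈ 0#
  []-no true  h = contradiction tt h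
  []-no false _ = ≈-refl

  []-⇔ : ∀ b b′ {a} → (T b → T b′) → (T b′ → T b) → [ b ] a ≈ [ b′ ] a
  []-⇔ true  true  h k = ≈-refl
  []-⇔ true  false h k = ⊥-elim (h tt)
  []-⇔ false true  h k = ⊥-elim (k tt)
  []-⇔ false false h k = ≈-refl

  []-- : ∀ b a c → [ b ] (a - c) ≈ [ b ] a - [ b ] c
  []-- true  a c = ≈-refl
  []-- false a c = ≈-sym (-‿inverseʳ 0#)

  []-zero : ∀ b → [ b ] 0# ≈ 0#
  []-zero true  = ≈-refl
  []-zero false = ≈-refl

  []-*ˡ : ∀ b k {a} → k * [ b ] a ≈ [ b ] (k * a)
  []-*ˡ true  k = ≈-refl
  []-*ˡ false k = zeroʳ k

  []-*ʳ : ∀ b k {a} → [ b ] a * k ≈ [ b ] (a * k)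
  []-*ʳ true  k = ≈-refl
  []-*ʳ false k = zeroˡ k

  []-∧ : ∀ b b′ {a} → [ b ] [ b′ ] a ≈ [ b ∧ b′ ] a
  []-∧ true  b′ = ≈-refl
  []-∧ false b′ = ≈-refl

  ∑-[] : ∀ {k} b (f : Fin k → Carrier) → ∑ᴿ (λ i → [ b ] f i) ≈ [ b ] ∑ᴿ f
  ∑-[] true  f = ≈-refl
  ∑-[] {k} false f = ∑ᴿ-zero {k} {λ _ → 0#} λ _ → ≈-refl

  ∑-- : ∀ {k} (f g : Fin k → Carrier) → ∑ᴿ (λ i → f i - g i) ≈ ∑ᴿ f - ∑ᴿ g
  ∑-- {zero}  f g = ≈-sym (-‿inverseʳ 0#)
  ∑-- {suc k} f g = ≈-trans (+-congˡ (∑-- (f ∘ suc) (g ∘ suc)))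
    (solve 4 (λ a b c d → (a :- b) :+ (c :- d) := (a :+ c) :- (b :+ d)) ≈-refl
      (f zero) (g zero) (∑ᴿ (f ∘ suc)) (∑ᴿ (g ∘ suc)))
    where open Solver

  ∑-‿ : ∀ {k} (f : Fin k → Carrier) → - ∑ᴿ f ≈ ∑ᴿ (λ i → - f i)
  ∑-‿ {zero}  f = ≈-trans (-‿cong (≈-sym ι-0)) (≈-trans (solve 0 (:- con (+ 0) := con (+ 0)) ≈-refl) ι-0)
    where open Solver
  ∑-‿ {suc k} f = ≈-trans (solve 2 (λ a b → :- (a :+ b) := :- a :+ :- b) ≈-refl (f zero) (∑ᴿ (f ∘ suc)))
    (+-congˡ (∑-‿ (f ∘ suc)))
    where open Solver

  []-‿* : ∀ b a c → - ([ b ] (a * c)) ≈ [ b ] ((- a) * c)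
  []-‿* true  a c = solve 2 (λ a c → :- (a :* c) := (:- a) :* c) ≈-refl a c
    where open Solver
  []-‿* false a c = ≈-trans (-‿cong (≈-sym ι-0)) (≈-trans (solve 0 (:- con (+ 0) := con (+ 0)) ≈-refl) ι-0)
    where open Solver

  minus-minus : ∀ a b → b ≈ a - (a - b)
  minus-minus = solve 2 (λ a b → b := a :- (a :- b)) ≈-refl
    where open Solver

  *-shuffle : ∀ c x a b → (c * (x * a)) * b ≈ x * ((c * a) * b)
  *-shuffle = solve 4 (λ c x a b → (c :* (x :* a)) :* b := x :* ((c :* a) :* b)) ≈-refl
    where open Solver

  infixr 9 _^^_
  _^^_ : Carrier → ℕ → Carrier
  a ^^ zero  = 1#
  a ^^ suc k = a * a ^^ k

  sign : ℕ → Carrier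
  sign zero    = 1#
  sign (suc k) = - sign k

  sign² : ∀ k → sign k * sign k ≈ 1#
  sign² zero    = *-identityˡ 1#
  sign² (suc k) = ≈-trans (solve 1 (λ s → :- s :* :- s := s :* s) ≈-refl (sign k)) (sign² k)
    where open Solver

  EulerRelation : ∀ {n} → (Fin n → Fin n → Bool) → (Fin n → ℕ) → Set
  EulerRelation le ρ = ∀ σ υ → T (le σ υ) → σ ≢ υ → ∑ᴿ (λ τ → [ le σ τ ∧ le τ υ ] sign (ρ τ)) ≈ 0#

  -- The recursion of the Chow function for an interval of rank `k + 1` with fixed bottom, `y`
  -- standing for `x - 1`.
  ChowRecurrence : ∀ {n} → (Fin n → Fin n → Bool) → (Fin n → ℕ) → (Fin n → Carrier) → Carrier → Set
  ChowRecurrence le ρ H y = ∀ τ k → ρ τ ≡ suc k → H τ ≈ ∑ᴿ λ σ → [ (ρ σ ℕ.≤ᵇ k) ∧ le σ τ ] (H σ * y ^^ (k ∸ ρ σ))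

module Numeric (A : ℤ-Algebra) {n : ℕ} (le : Fin n → Fin n → Bool) (ρ : Fin n → ℕ)
  (le-refl : ∀ x → T (le x x)) (rank-< : ∀ x y → T (le x y) → x ≢ y → ρ x < ρ y) where

  open Guards A

  rank-mono : ∀ x y → T (le x y) → ρ x ≤ ρ y
  rank-mono x y x≤y with x Fin.≟ y
  ... | yes refl = ℕₚ.≤-refl
  ... | no x≢y   = ℕₚ.<⇒≤ (rank-< x y x≤y x≢y)

  below : ℕ → Fin n → Fin n → Bool
  below k σ τ = (ρ τ ℕ.≤ᵇ k) ∧ le σ τ

  level : ℕ → Fin n → Fin n → Bool
  level k σ τ = (ρ τ ℕ.≡ᵇ k) ∧ le σ τ

  S : ℕ → (Fin n → Carrier) → Fin n → Carrier
  S k m σ = ∑ᴿ λ τ → [ level k σ τ ] m τ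

  -- w k m σ = Σ (-1)^(k - ρ τ) m τ over τ ≥ σ with ρ τ ≤ k.
  w : ℕ → (Fin n → Carrier) → Fin n → Carrier
  w zero    m σ = S 0 m σ
  w (suc k) m σ = S (suc k) m σ - w k m σ

  -- The dimension function of the quotient sheaf obtained from the k-skeleton of a sheaf with dimension function m.
  excess : ℕ → (Fin n → Carrier) → Fin n → Carrier
  excess k m σ = w k m σ - m σ

  S-above : ∀ k m σ → k < ρ σ → S k m σ ≈ 0#
  S-above k m σ k<ρσ = ∑ᴿ-zero λ τ → []-no (level k σ τ) λ t →
    let p , q = Equivalence.to T-∧ t in
    ℕₚ.<⇒≱ k<ρσ (subst (ρ σ ≤_) (ℕₚ.≡ᵇ⇒≡ (ρ τ) k p) (rank-mono σ τ q))

  S-top : ∀ k m σ → ρ σ ≡ k → S k m σ ≈ m σ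
  S-top k m σ ρσ = ≈-trans
    (∑ᴿ-single σ λ τ τ≢σ → []-no (level k σ τ) λ t → let p , q = Equivalence.to T-∧ t in
      ℕₚ.<⇒≢ (rank-< σ τ q (τ≢σ ∘ sym)) (trans ρσ (sym (ℕₚ.≡ᵇ⇒≡ (ρ τ) k p))))
    ([]-yes (level k σ σ) (Equivalence.from T-∧ (ℕₚ.≡⇒≡ᵇ (ρ σ) k ρσ , le-refl σ)))

  a-0 : ∀ a b → b ≈ 0# → a - b ≈ a
  a-0 a b h = ≈-trans (+-congˡ (-‿cong (≈-trans h (≈-sym ι-0))))
    (solve 1 (λ a → a :- con (+ 0) := a) ≈-refl a)
    where open Solver

  w-above : ∀ k m σ → k < ρ σ → w k m σ ≈ 0#
  w-above zero    m σ h = S-above 0 m σ h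
  w-above (suc k) m σ h = ≈-trans (a-0 _ _ (w-above k m σ (ℕₚ.<-trans (ℕₚ.n<1+n k) h))) (S-above (suc k) m σ h)

  w-top : ∀ k m σ → ρ σ ≡ k → w k m σ ≈ m σ
  w-top zero    m σ ρσ = S-top 0 m σ ρσ
  w-top (suc k) m σ ρσ = ≈-trans (a-0 _ _ (w-above k m σ (subst (k <_) (sym ρσ) (ℕₚ.n<1+n k)))) (S-top (suc k) m σ ρσ)

  S-cong : ∀ k {m m′} → (∀ τ → ρ τ ≡ k → m τ ≈ m′ τ) → ∀ σ → S k m σ ≈ S k m′ σ
  S-cong k h σ = ∑ᴿ-cong λ τ → []-cong (level k σ τ) λ t →
    h τ (ℕₚ.≡ᵇ⇒≡ (ρ τ) k (proj₁ (Equivalence.to (T-∧ {ρ τ ℕ.≡ᵇ k}) t)))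

  w-cong : ∀ k {m m′} → (∀ τ → ρ τ ≤ k → m τ ≈ m′ τ) → ∀ σ → w k m σ ≈ w k m′ σ
  w-cong zero    h σ = S-cong 0 (λ τ p → h τ (ℕₚ.≤-reflexive p)) σ
  w-cong (suc k) h σ = +-cong (S-cong (suc k) (λ τ p → h τ (ℕₚ.≤-reflexive p)) σ)
                              (-‿cong (w-cong k (λ τ p → h τ (ℕₚ.m≤n⇒m≤1+n p)) σ))

  excess-cong : ∀ k {m m′} → (∀ τ → ρ τ ≤ k → m τ ≈ m′ τ) → ∀ σ → ρ σ ≤ k → excess k m σ ≈ excess k m′ σ
  excess-cong k h σ p = +-cong (w-cong k h σ) (-‿cong (h σ p))

  split-≤ : ∀ k j (a : Carrier) → [ j ℕ.≤ᵇ suc k ] a ≈ [ j ℕ.≤ᵇ k ] a + [ j ℕ.≡ᵇ suc k ] a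
  split-≤ k j a with ℕₚ.<-cmp j (suc k)
  ... | tri< j<1+k j≢1+k _ = ≈-trans ([]-yes (j ℕ.≤ᵇ suc k) (ℕₚ.≤⇒≤ᵇ (ℕₚ.<⇒≤ j<1+k)))
        (≈-sym (≈-trans (+-cong ([]-yes (j ℕ.≤ᵇ k) (ℕₚ.≤⇒≤ᵇ (s≤s⁻¹ j<1+k))) ([]-no (j ℕ.≡ᵇ suc k) (j≢1+k ∘ ℕₚ.≡ᵇ⇒≡ j (suc k)))) (+-identityʳ a)))
  ... | tri≈ j≮1+k j≡1+k _ = ≈-trans ([]-yes (j ℕ.≤ᵇ suc k) (ℕₚ.≤⇒≤ᵇ (ℕₚ.≤-reflexive j≡1+k)))
        (≈-sym (≈-trans (+-cong ([]-no (j ℕ.≤ᵇ k) (λ t → j≮1+k (s≤s (ℕₚ.≤ᵇ⇒≤ j k t)))) ([]-yes (j ℕ.≡ᵇ suc k) (ℕₚ.≡⇒≡ᵇ j (suc k) j≡1+k))) (+-identityˡ a)))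
  ... | tri> j≮1+k j≢1+k 1+k<j = ≈-trans ([]-no (j ℕ.≤ᵇ suc k) (ℕₚ.<⇒≱ 1+k<j ∘ ℕₚ.≤ᵇ⇒≤ j (suc k)))
        (≈-sym (≈-trans (+-cong ([]-no (j ℕ.≤ᵇ k) (λ t → j≮1+k (s≤s (ℕₚ.≤ᵇ⇒≤ j k t)))) ([]-no (j ℕ.≡ᵇ suc k) (j≢1+k ∘ ℕₚ.≡ᵇ⇒≡ j (suc k)))) (+-identityˡ 0#)))

  module Involution
    (euler : EulerRelation le ρ)
    (le-trans : ∀ x y z → T (le x y) → T (le y z) → T (le x z))
    (le-antisym : ∀ x y → T (le x y) → T (le y x) → x ≡ y) where

    -- `w k` without its global sign `(-1)^k`; in this form the Euler relation applies to inner
    -- sums.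
    C : ℕ → (Fin n → Carrier) → Fin n → Carrier
    C k m σ = ∑ᴿ λ τ → [ below k σ τ ] (sign (ρ τ) * m τ)

    C-suc : ∀ k m σ → C (suc k) m σ ≈ C k m σ + sign (suc k) * S (suc k) m σ
    C-suc k m σ = begin
      ∑ᴿ (λ τ → [ below (suc k) σ τ ] t τ)
        ≈⟨ ∑ᴿ-cong (λ τ → ≈-trans (≈-sym ([]-∧ (ρ τ ℕ.≤ᵇ suc k) (le σ τ)))
             (≈-trans (split-≤ k (ρ τ) ([ le σ τ ] t τ))
               (+-cong ([]-∧ (ρ τ ℕ.≤ᵇ k) (le σ τ)) ([]-∧ (ρ τ ℕ.≡ᵇ suc k) (le σ τ))))) ⟩
      ∑ᴿ (λ τ → [ below k σ τ ] t τ + [ level (suc k) σ τ ] t τ)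
        ≈⟨ ∑ᴿ-+ (λ τ → [ below k σ τ ] t τ) (λ τ → [ level (suc k) σ τ ] t τ) ⟩
      C k m σ + ∑ᴿ (λ τ → [ level (suc k) σ τ ] t τ)
        ≈⟨ +-congˡ (≈-trans (∑ᴿ-cong λ τ → ≈-trans
             ([]-cong (level (suc k) σ τ) λ p → *-congʳ (CommutativeRing.reflexive ring
               (cong sign (ℕₚ.≡ᵇ⇒≡ (ρ τ) (suc k) (proj₁ (Equivalence.to (T-∧ {ρ τ ℕ.≡ᵇ suc k}) p))))))
             (≈-sym ([]-*ˡ (level (suc k) σ τ) (sign (suc k)))))
             (≈-sym (∑ᴿ-*ˡ (sign (suc k)) (λ τ → [ level (suc k) σ τ ] m τ)))) ⟩
      C k m σ + sign (suc k) * S (suc k) m σ ∎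
      where
      open ≈-Reasoning
      t : Fin n → Carrier
      t τ = sign (ρ τ) * m τ

    w-closed : ∀ k m σ → w k m σ ≈ sign k * C k m σ
    w-closed zero m σ = ≈-trans
      (∑ᴿ-cong λ τ → ≈-trans
        ([]-⇔ (level 0 σ τ) (below 0 σ τ)
          (λ p → let a , b = Equivalence.to (T-∧ {ρ τ ℕ.≡ᵇ 0}) p in
             Equivalence.from T-∧ (ℕₚ.≤⇒≤ᵇ (ℕₚ.≤-reflexive (ℕₚ.≡ᵇ⇒≡ (ρ τ) 0 a)) , b))
          (λ p → let a , b = Equivalence.to (T-∧ {ρ τ ℕ.≤ᵇ 0}) p in
             Equivalence.from T-∧ (ℕₚ.≡⇒≡ᵇ (ρ τ) 0 (ℕₚ.n≤0⇒n≡0 (ℕₚ.≤ᵇ⇒≤ (ρ τ) 0 a)) , b)))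
        ([]-cong (below 0 σ τ) λ p → ≈-sym (≈-trans
          (*-congʳ (CommutativeRing.reflexive ring (cong sign (ℕₚ.n≤0⇒n≡0 (ℕₚ.≤ᵇ⇒≤ (ρ τ) 0 (proj₁ (Equivalence.to (T-∧ {ρ τ ℕ.≤ᵇ 0}) p)))))))
          (*-identityˡ (m τ)))))
      (≈-sym (*-identityˡ (C 0 m σ)))
    w-closed (suc k) m σ = ≈-sym (begin
      sign (suc k) * C (suc k) m σ
        ≈⟨ *-congˡ (C-suc k m σ) ⟩
      sign (suc k) * (C k m σ + sign (suc k) * S (suc k) m σ)
        ≈⟨ solve 3 (λ s c t → :- s :* (c :+ :- s :* t) := (:- s :* :- s) :* t :- s :* c) ≈-refl (sign k) (C k m σ) (S (suc k) m σ) ⟩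
      sign (suc k) * sign (suc k) * S (suc k) m σ - sign k * C k m σ
        ≈⟨ +-cong (≈-trans (*-congʳ (sign² (suc k))) (*-identityˡ (S (suc k) m σ))) (-‿cong (≈-sym (w-closed k m σ))) ⟩
      w (suc k) m σ ∎)
      where open ≈-Reasoning
            open Solver

    -- The bound on `ρ τ` follows from `τ ≤ υ`, so this is the Euler relation of the interval from
    -- `σ` to `υ`, or an empty sum.
    euler-δ : ∀ k σ υ → T (ρ υ ℕ.≤ᵇ k) → υ ≢ σ →
              ∑ᴿ (λ τ → [ below k σ τ ] (sign (ρ τ) * [ le τ υ ] 1#)) ≈ 0#
    euler-δ k σ υ p υ≢σ = ≈-trans (∑ᴿ-cong λ τ → begin
        [ below k σ τ ] (sign (ρ τ) * [ le τ υ ] 1#)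
          ≈⟨ []-cong (below k σ τ) (λ _ → ≈-trans ([]-*ˡ (le τ υ) (sign (ρ τ))) ([]-cong (le τ υ) λ _ → *-identityʳ (sign (ρ τ)))) ⟩
        [ below k σ τ ] [ le τ υ ] sign (ρ τ)
          ≈⟨ []-∧ (below k σ τ) (le τ υ) ⟩
        [ below k σ τ ∧ le τ υ ] sign (ρ τ)
          ≈⟨ []-⇔ (below k σ τ ∧ le τ υ) (le σ τ ∧ le τ υ)
               (λ t → let a , b = Equivalence.to (T-∧ {below k σ τ}) t in
                  Equivalence.from T-∧ (proj₂ (Equivalence.to (T-∧ {ρ τ ℕ.≤ᵇ k}) a) , b))
               (λ t → let a , b = Equivalence.to (T-∧ {le σ τ}) t in
                  Equivalence.from (T-∧ {below k σ τ}) (Equivalence.from T-∧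
                    (ℕₚ.≤⇒≤ᵇ (ℕₚ.≤-trans (rank-mono τ υ b) (ℕₚ.≤ᵇ⇒≤ (ρ υ) k p)) , a) , b)) ⟩
        [ le σ τ ∧ le τ υ ] sign (ρ τ) ∎)
      (by (T? (le σ υ)))
      where
      open ≈-Reasoning
      by : Dec (T (le σ υ)) → ∑ᴿ (λ τ → [ le σ τ ∧ le τ υ ] sign (ρ τ)) ≈ 0#
      by (yes σ≤υ) = euler σ υ σ≤υ (υ≢σ ∘ sym)
      by (no σ≰υ)  = ∑ᴿ-zero λ τ → []-no (le σ τ ∧ le τ υ) λ t →
        let a , b = Equivalence.to (T-∧ {le σ τ}) t in σ≰υ (le-trans σ τ υ a b)

    -- Biduality on the level of dimensions. The Euler relation makes the matrix with entries
    -- `(-1)^(ρ τ)` for `σ ≤ τ` its own inverse: after exchanging the sums only `υ = σ` survives.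
    w-w : ∀ k m σ → ρ σ ≤ k → w k (w k m) σ ≈ m σ
    w-w k m σ ρσ≤k = begin
      w k (w k m) σ
        ≈⟨ w-closed k (w k m) σ ⟩
      sign k * ∑ᴿ (λ τ → [ below k σ τ ] (sign (ρ τ) * w k m τ))
        ≈⟨ *-congˡ (∑ᴿ-cong λ τ → ≈-trans ([]-cong (below k σ τ) λ _ → ≈-trans
             (*-congˡ (w-closed k m τ))
             (solve 3 (λ a b c → a :* (b :* c) := b :* (a :* c)) ≈-refl (sign (ρ τ)) (sign k) (C k m τ)))
             (≈-sym ([]-*ˡ (below k σ τ) (sign k)))) ⟩
      sign k * ∑ᴿ (λ τ → sign k * [ below k σ τ ] (sign (ρ τ) * C k m τ))
        ≈⟨ *-congˡ (≈-sym (∑ᴿ-*ˡ (sign k) (λ τ → [ below k σ τ ] (sign (ρ τ) * C k m τ)))) ⟩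
      sign k * (sign k * ∑ᴿ (λ τ → [ below k σ τ ] (sign (ρ τ) * C k m τ)))
        ≈⟨ ≈-trans (≈-sym (*-assoc (sign k) (sign k) _)) (≈-trans (*-congʳ (sign² k)) (*-identityˡ _)) ⟩
      ∑ᴿ (λ τ → [ below k σ τ ] (sign (ρ τ) * C k m τ))
        ≈⟨ ∑ᴿ-cong (λ τ → ≈-trans ([]-cong (below k σ τ) λ _ → ≈-trans
             (∑ᴿ-*ˡ (sign (ρ τ)) (λ υ → [ below k τ υ ] t υ))
             (∑ᴿ-cong λ υ → rearrange τ υ))
             (≈-sym (∑-[] (below k σ τ) (λ υ → (sign (ρ τ) * [ le τ υ ] 1#) * [ ρ υ ℕ.≤ᵇ k ] t υ)))) ⟩
      ∑ᴿ (λ τ → ∑ᴿ λ υ → [ below k σ τ ] ((sign (ρ τ) * [ le τ υ ] 1#) * [ ρ υ ℕ.≤ᵇ k ] t υ))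
        ≈⟨ ∑ᴿ-swap (λ τ υ → [ below k σ τ ] ((sign (ρ τ) * [ le τ υ ] 1#) * [ ρ υ ℕ.≤ᵇ k ] t υ)) ⟩
      ∑ᴿ (λ υ → ∑ᴿ λ τ → [ below k σ τ ] ((sign (ρ τ) * [ le τ υ ] 1#) * [ ρ υ ℕ.≤ᵇ k ] t υ))
        ≈⟨ ∑ᴿ-cong (λ υ → ≈-trans
             (∑ᴿ-cong λ τ → ≈-sym ([]-*ʳ (below k σ τ) ([ ρ υ ℕ.≤ᵇ k ] t υ)))
             (≈-sym (∑ᴿ-*ʳ (λ τ → [ below k σ τ ] (sign (ρ τ) * [ le τ υ ] 1#)) ([ ρ υ ℕ.≤ᵇ k ] t υ)))) ⟩
      ∑ᴿ (λ υ → E υ * [ ρ υ ℕ.≤ᵇ k ] t υ)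
        ≈⟨ ∑ᴿ-single σ (λ υ υ≢σ → off υ υ≢σ (T? (ρ υ ℕ.≤ᵇ k))) ⟩
      E σ * [ ρ σ ℕ.≤ᵇ k ] t σ
        ≈⟨ *-cong E-σ ([]-yes (ρ σ ℕ.≤ᵇ k) (ℕₚ.≤⇒≤ᵇ ρσ≤k)) ⟩
      sign (ρ σ) * (sign (ρ σ) * m σ)
        ≈⟨ ≈-trans (≈-sym (*-assoc (sign (ρ σ)) (sign (ρ σ)) (m σ))) (≈-trans (*-congʳ (sign² (ρ σ))) (*-identityˡ (m σ))) ⟩
      m σ ∎
      where
      open ≈-Reasoning
      open Solver
      t E : Fin n → Carrier
      t υ = sign (ρ υ) * m υ
      E υ = ∑ᴿ λ τ → [ below k σ τ ] (sign (ρ τ) * [ le τ υ ] 1#)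
      rearrange : ∀ τ υ → sign (ρ τ) * [ below k τ υ ] t υ ≈ (sign (ρ τ) * [ le τ υ ] 1#) * [ ρ υ ℕ.≤ᵇ k ] t υ
      rearrange τ υ with ρ υ ℕ.≤ᵇ k | le τ υ
      ... | true  | true  = *-congʳ (≈-sym (*-identityʳ (sign (ρ τ))))
      ... | true  | false = ≈-trans (zeroʳ (sign (ρ τ))) (≈-sym (≈-trans (*-congʳ (zeroʳ (sign (ρ τ)))) (zeroˡ (t υ))))
      ... | false | _     = ≈-trans (zeroʳ (sign (ρ τ))) (≈-sym (zeroʳ _))
      off : ∀ υ → υ ≢ σ → Dec (T (ρ υ ℕ.≤ᵇ k)) → E υ * [ ρ υ ℕ.≤ᵇ k ] t υ ≈ 0#
      off υ υ≢σ (yes p) = ≈-trans (*-congʳ (euler-δ k σ υ p υ≢σ)) (zeroˡ _)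
      off υ υ≢σ (no ¬p) = ≈-trans (*-congˡ ([]-no (ρ υ ℕ.≤ᵇ k) ¬p)) (zeroʳ (E υ))
      E-σ : E σ ≈ sign (ρ σ)
      E-σ = ≈-trans
        (∑ᴿ-single σ λ τ τ≢σ → ≈-trans ([]-cong (below k σ τ) λ p →
           ≈-trans (*-congˡ ([]-no (le τ σ) λ τ≤σ →
             τ≢σ (le-antisym τ σ τ≤σ (proj₂ (Equivalence.to (T-∧ {ρ τ ℕ.≤ᵇ k}) p)))))
             (zeroʳ (sign (ρ τ))))
           ([]-zero (below k σ τ)))
        (≈-trans ([]-yes (below k σ σ) (Equivalence.from T-∧ (ℕₚ.≤⇒≤ᵇ ρσ≤k , le-refl σ)))
          (≈-trans (*-congˡ ([]-yes (le σ σ) (le-refl σ))) (*-identityʳ (sign (ρ σ)))))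

    -- The quotient sheaf is self-dual.
    w-excess : ∀ k m σ → ρ σ ≤ k → w k (excess (suc k) m) σ ≈ excess (suc k) m σ
    w-excess k m σ ρσ≤k = begin
      w k n′ σ
        ≈⟨ solve 2 (λ s a → a := s :- (s :- a)) ≈-refl (S (suc k) n′ σ) (w k n′ σ) ⟩
      S (suc k) n′ σ - w (suc k) n′ σ
        -- The excess vanishes in rank `k + 1`, and the involution `w (suc k)` turns it into its
        -- negative.
        ≈⟨ +-cong S≈0 (-‿cong (≈-trans (w-- (suc k) (w (suc k) m) m σ)
             (+-congʳ (w-w (suc k) m σ (ℕₚ.m≤n⇒m≤1+n ρσ≤k))))) ⟩
      0# - (m σ - w (suc k) m σ)
        ≈⟨ ≈-trans (+-congʳ (≈-sym ι-0)) (solve 2 (λ m w → con (+ 0) :- (m :- w) := w :- m) ≈-refl (m σ) (w (suc k) m σ)) ⟩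
      n′ σ ∎
      where
      open ≈-Reasoning
      open Solver
      n′ = excess (suc k) m
      S≈0 : S (suc k) n′ σ ≈ 0#
      S≈0 = ∑ᴿ-zero λ τ → ≈-trans ([]-cong (level (suc k) σ τ) λ p →
          ≈-trans (+-congʳ (w-top (suc k) m τ (ℕₚ.≡ᵇ⇒≡ (ρ τ) (suc k) (proj₁ (Equivalence.to (T-∧ {ρ τ ℕ.≡ᵇ suc k}) p)))))
                  (-‿inverseʳ (m τ)))
        ([]-zero (level (suc k) σ τ))
      S-- : ∀ j m m′ σ → S j (λ τ → m τ - m′ τ) σ ≈ S j m σ - S j m′ σ
      S-- j m m′ σ = ≈-trans (∑ᴿ-cong λ τ → []-- (level j σ τ) (m τ) (m′ τ))
        (∑-- (λ τ → [ level j σ τ ] m τ) (λ τ → [ level j σ τ ] m′ τ))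
      w-- : ∀ j m m′ σ → w j (λ τ → m τ - m′ τ) σ ≈ w j m σ - w j m′ σ
      w-- zero    m m′ σ = S-- 0 m m′ σ
      w-- (suc j) m m′ σ = ≈-trans (+-cong (S-- (suc j) m m′ σ) (-‿cong (w-- j m m′ σ)))
        (solve 4 (λ a b c d → (a :- b) :- (c :- d) := (a :- c) :- (b :- d)) ≈-refl
          (S (suc j) m σ) (S (suc j) m′ σ) (w j m σ) (w j m′ σ))

-- The polynomials `f`, their recursion, and gamma-positivity.

module Recursion (A : ℤ-Algebra) {n : ℕ} (le : Fin n → Fin n → Bool) (ρ : Fin n → ℕ)
  (le-refl : ∀ x → T (le x x)) (rank-< : ∀ x y → T (le x y) → x ≢ y → ρ x < ρ y)
  (H : Fin n → Guards.Carrier A) (y : Guards.Carrier A) (H-rec : Guards.ChowRecurrence A le ρ H y) where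

  open Guards A
  open Numeric A le ρ le-refl rank-<

  -- In terms of the variable x of the Chow polynomial, y is x - 1 and p is x + 1.
  x p : Carrier
  x = y + ι (+ 1)
  p = y + ι (+ 2)

  -- `Hs k m` is the Chow recurrence at a virtual element of rank `k + 1` lying `m σ` times above
  -- each `σ`.
  Hs F : ℕ → (Fin n → Carrier) → Carrier
  Hs k m = ∑ᴿ λ σ → [ ρ σ ℕ.≤ᵇ k ] (m σ * (H σ * y ^^ (k ∸ ρ σ)))
  F  k m = ∑ᴿ λ σ → [ ρ σ ℕ.≡ᵇ k ] (m σ * H σ)

  Hs-cong : ∀ k {m m′} → (∀ σ → ρ σ ≤ k → m σ ≈ m′ σ) → Hs k m ≈ Hs k m′
  Hs-cong k h = ∑ᴿ-cong λ σ → []-cong (ρ σ ℕ.≤ᵇ k) λ t → *-congʳ (h σ (ℕₚ.≤ᵇ⇒≤ (ρ σ) k t))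

  Hs-- : ∀ k m m′ → Hs k (λ σ → m σ - m′ σ) ≈ Hs k m - Hs k m′
  Hs-- k m m′ = ≈-trans
    (∑ᴿ-cong λ σ → ≈-trans
      ([]-cong (ρ σ ℕ.≤ᵇ k) λ _ → solve 3 (λ a b c → (a :- b) :* c := a :* c :- b :* c) ≈-refl (m σ) (m′ σ) (H σ * y ^^ (k ∸ ρ σ)))
      ([]-- (ρ σ ℕ.≤ᵇ k) _ _))
    (∑-- (λ σ → [ ρ σ ℕ.≤ᵇ k ] (m σ * (H σ * y ^^ (k ∸ ρ σ)))) (λ σ → [ ρ σ ℕ.≤ᵇ k ] (m′ σ * (H σ * y ^^ (k ∸ ρ σ)))))
    where open Solver

  Hs-suc : ∀ k m → Hs (suc k) m ≈ y * Hs k m + F (suc k) m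
  Hs-suc k m = begin
    Hs (suc k) m
      ≈⟨ ∑ᴿ-cong (λ σ → ≈-trans (split-≤ k (ρ σ) (t (suc k) σ)) (+-cong (lower σ) (upper σ))) ⟩
    ∑ᴿ (λ σ → y * [ ρ σ ℕ.≤ᵇ k ] t k σ + [ ρ σ ℕ.≡ᵇ suc k ] (m σ * H σ))
      ≈⟨ ∑ᴿ-+ (λ σ → y * [ ρ σ ℕ.≤ᵇ k ] t k σ) (λ σ → [ ρ σ ℕ.≡ᵇ suc k ] (m σ * H σ)) ⟩
    ∑ᴿ (λ σ → y * [ ρ σ ℕ.≤ᵇ k ] t k σ) + F (suc k) m
      ≈⟨ +-congʳ (≈-sym (∑ᴿ-*ˡ y (λ σ → [ ρ σ ℕ.≤ᵇ k ] t k σ))) ⟩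
    y * Hs k m + F (suc k) m ∎
    where
    open ≈-Reasoning
    open Solver
    t : ℕ → Fin n → Carrier
    t j σ = m σ * (H σ * y ^^ (j ∸ ρ σ))
    lower : ∀ σ → [ ρ σ ℕ.≤ᵇ k ] t (suc k) σ ≈ y * [ ρ σ ℕ.≤ᵇ k ] t k σ
    lower σ = ≈-trans ([]-cong (ρ σ ℕ.≤ᵇ k) λ q → ≈-trans
      (CommutativeRing.reflexive ring (cong (λ j → m σ * (H σ * y ^^ j)) (ℕₚ.+-∸-assoc 1 (ℕₚ.≤ᵇ⇒≤ (ρ σ) k q))))
      (solve 4 (λ m h y z → m :* (h :* (y :* z)) := y :* (m :* (h :* z))) ≈-refl (m σ) (H σ) y (y ^^ (k ∸ ρ σ))))
      (≈-sym ([]-*ˡ (ρ σ ℕ.≤ᵇ k) y))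
    upper : ∀ σ → [ ρ σ ℕ.≡ᵇ suc k ] t (suc k) σ ≈ [ ρ σ ℕ.≡ᵇ suc k ] (m σ * H σ)
    upper σ = []-cong (ρ σ ℕ.≡ᵇ suc k) λ q → *-congˡ (≈-trans
      (*-congˡ (CommutativeRing.reflexive ring (cong (y ^^_)
        (trans (cong (suc k ∸_) (ℕₚ.≡ᵇ⇒≡ (ρ σ) (suc k) q)) (ℕₚ.n∸n≡0 (suc k))))))
      (*-identityʳ (H σ)))

  -- After exchanging the sums, the inner one is the Chow recurrence at an element of rank `k + 1`.
  Hs-S : ∀ k m → Hs k (S (suc k) m) ≈ F (suc k) m
  Hs-S k m = begin
    ∑ᴿ (λ σ → [ ρ σ ℕ.≤ᵇ k ] (S (suc k) m σ * z σ))
      ≈⟨ ∑ᴿ-cong (λ σ → ≈-trans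
           ([]-cong (ρ σ ℕ.≤ᵇ k) λ _ → ∑ᴿ-*ʳ (λ τ → [ level (suc k) σ τ ] m τ) (z σ))
           (≈-sym (∑-[] (ρ σ ℕ.≤ᵇ k) (λ τ → [ level (suc k) σ τ ] m τ * z σ)))) ⟩
    ∑ᴿ (λ σ → ∑ᴿ λ τ → [ ρ σ ℕ.≤ᵇ k ] ([ level (suc k) σ τ ] m τ * z σ))
      ≈⟨ ∑ᴿ-swap (λ σ τ → [ ρ σ ℕ.≤ᵇ k ] ([ level (suc k) σ τ ] m τ * z σ)) ⟩
    ∑ᴿ (λ τ → ∑ᴿ λ σ → [ ρ σ ℕ.≤ᵇ k ] ([ level (suc k) σ τ ] m τ * z σ))
      ≈⟨ ∑ᴿ-cong (λ τ → ≈-trans (∑ᴿ-cong λ σ → rearrange τ σ)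
           (≈-sym (∑ᴿ-*ˡ ([ ρ τ ℕ.≡ᵇ suc k ] m τ) (λ σ → [ (ρ σ ℕ.≤ᵇ k) ∧ le σ τ ] z σ)))) ⟩
    ∑ᴿ (λ τ → [ ρ τ ℕ.≡ᵇ suc k ] m τ * ∑ᴿ λ σ → [ (ρ σ ℕ.≤ᵇ k) ∧ le σ τ ] z σ)
      ≈⟨ ∑ᴿ-cong (λ τ → ≈-trans ([]-*ʳ (ρ τ ℕ.≡ᵇ suc k) _)
           ([]-cong (ρ τ ℕ.≡ᵇ suc k) λ q → *-congˡ (≈-sym (H-rec τ k (ℕₚ.≡ᵇ⇒≡ (ρ τ) (suc k) q))))) ⟩
    F (suc k) m ∎
    where
    open ≈-Reasoning
    z : Fin n → Carrier
    z σ = H σ * y ^^ (k ∸ ρ σ)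
    rearrange : ∀ τ σ → [ ρ σ ℕ.≤ᵇ k ] ([ level (suc k) σ τ ] m τ * z σ) ≈
                        [ ρ τ ℕ.≡ᵇ suc k ] m τ * [ (ρ σ ℕ.≤ᵇ k) ∧ le σ τ ] z σ
    rearrange τ σ with ρ σ ℕ.≤ᵇ k | ρ τ ℕ.≡ᵇ suc k | le σ τ
    ... | true  | true  | true  = ≈-refl
    ... | true  | true  | false = ≈-trans (zeroˡ (z σ)) (≈-sym (zeroʳ (m τ)))
    ... | true  | false | _     = ≈-trans (zeroˡ (z σ)) (≈-sym (zeroˡ _))
    ... | false | _     | _     = ≈-sym (zeroʳ _)

  -- `N k m` is the quotient of `Hs k (w k m) - Hs k m` by `y`, given explicitly in place of a
  -- division; thus `y * f k m` is `x * Hs k m - Hs k (w k m)`.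
  N f : ℕ → (Fin n → Carrier) → Carrier
  N zero    m = 0#
  N (suc k) m = Hs k (excess (suc k) m)
  f k m = Hs k m - N k m

  -- Multiplication by `y` turns `Hs k` into `Hs (suc k)` up to terms of rank `k + 1`, and there the
  -- excess vanishes.
  y*N : ∀ k m → y * N k m ≈ Hs k (w k m) - Hs k m
  y*N zero m = ≈-trans (zeroʳ y) (≈-sym (≈-trans
    (+-congʳ (Hs-cong 0 λ σ h → w-top 0 m σ (ℕₚ.n≤0⇒n≡0 h))) (-‿inverseʳ (Hs 0 m))))
  y*N (suc k) m = begin
    y * Hs k n′                          ≈⟨ ≈-sym (+-identityʳ (y * Hs k n′)) ⟩
    y * Hs k n′ + 0#                     ≈⟨ +-congˡ (≈-sym top) ⟩
    y * Hs k n′ + F (suc k) n′           ≈⟨ ≈-sym (Hs-suc k n′) ⟩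
    Hs (suc k) n′                        ≈⟨ Hs-- (suc k) (w (suc k) m) m ⟩
    Hs (suc k) (w (suc k) m) - Hs (suc k) m ∎
    where
    open ≈-Reasoning
    n′ = excess (suc k) m
    top : F (suc k) n′ ≈ 0#
    top = ∑ᴿ-zero λ σ → ≈-trans ([]-cong (ρ σ ℕ.≡ᵇ suc k) λ q → ≈-trans
        (*-congʳ (≈-trans (+-congʳ (w-top (suc k) m σ (ℕₚ.≡ᵇ⇒≡ (ρ σ) (suc k) q))) (-‿inverseʳ (m σ))))
        (zeroˡ (H σ)))
      ([]-zero (ρ σ ℕ.≡ᵇ suc k))

  N-suc : ∀ k m → N (suc k) m ≈ (F (suc k) m - Hs k (w k m)) - Hs k m
  N-suc k m = ≈-trans (Hs-- k (w (suc k) m) m) (+-congʳ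
    (≈-trans (Hs-- k (S (suc k) m) (w k m)) (+-congʳ (Hs-S k m))))

  -- The contributions `F (suc k) m` cancel, so only ranks up to `k` remain. The factor `2 x` is
  -- `p + y`, with `y` from the division identity and `p` from completing `Hs k m` to `f k m`.
  f-suc : ∀ k m → f (suc k) m ≈ p * f k m + ι (+ 2) * (x * N k m)
  f-suc k m = begin
    Hs (suc k) m - N (suc k) m
      ≈⟨ +-cong (Hs-suc k m) (-‿cong (N-suc k m)) ⟩
    (y * h + F (suc k) m) - ((F (suc k) m - hw) - h)
      ≈⟨ solve 4 (λ y h F hw → (y :* h :+ F) :- ((F :- hw) :- h) := (y :+ con (+ 2)) :* h :+ (hw :- h)) ≈-refl y h (F (suc k) m) hw ⟩
    (y + ι (+ 2)) * h + (hw - h)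
      ≈⟨ +-congˡ (≈-sym (y*N k m)) ⟩
    (y + ι (+ 2)) * h + y * N k m
      ≈⟨ solve 3 (λ y h N → (y :+ con (+ 2)) :* h :+ y :* N :=
           (y :+ con (+ 2)) :* (h :- N) :+ con (+ 2) :* ((y :+ con (+ 1)) :* N)) ≈-refl y h (N k m) ⟩
    p * f k m + ι (+ 2) * (x * N k m) ∎
    where
    open ≈-Reasoning
    open Solver
    h = Hs k m
    hw = Hs k (w k m)

  f-cong : ∀ k {m m′} → (∀ σ → ρ σ ≤ k → m σ ≈ m′ σ) → f k m ≈ f k m′
  f-cong k {m} {m′} h = +-cong (Hs-cong k h) (-‿cong (N-cong k h))
    where
    N-cong : ∀ k → (∀ σ → ρ σ ≤ k → m σ ≈ m′ σ) → N k m ≈ N k m′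
    N-cong zero    h = ≈-refl
    N-cong (suc k) h = Hs-cong k λ σ q → excess-cong (suc k) h σ (ℕₚ.m≤n⇒m≤1+n q)

  -- Applied to the constant function and to the excess: this makes `H_P` and the term `N` of the
  -- recursion values of `f`.
  f-self-dual : ∀ k m → (∀ σ → ρ σ ≤ k → w k m σ ≈ m σ) → f k m ≈ Hs k m
  f-self-dual k m h = a-0 (Hs k m) (N k m) (N≈0 k h)
    where
    N≈0 : ∀ k → (∀ σ → ρ σ ≤ k → w k m σ ≈ m σ) → N k m ≈ 0#
    N≈0 zero    h = ≈-refl
    N≈0 (suc k) h = ∑ᴿ-zero λ σ → ≈-trans ([]-cong (ρ σ ℕ.≤ᵇ k) λ q → ≈-trans
        (*-congʳ (≈-trans (+-congʳ (h σ (ℕₚ.m≤n⇒m≤1+n (ℕₚ.≤ᵇ⇒≤ (ρ σ) k q)))) (-‿inverseʳ (m σ))))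
        (zeroˡ _))
      ([]-zero (ρ σ ℕ.≤ᵇ k))

  f-0 : ∀ m bot → ρ bot ≡ 0 → (∀ σ → ρ σ ≡ 0 → σ ≡ bot) → f 0 m ≈ m bot * H bot
  f-0 m bot ρ-bot unique = ≈-trans (a-0 (Hs 0 m) 0# ≈-refl) (≈-trans
    (∑ᴿ-single bot λ σ σ≢bot → []-no (ρ σ ℕ.≤ᵇ 0) λ q → σ≢bot (unique σ (ℕₚ.n≤0⇒n≡0 (ℕₚ.≤ᵇ⇒≤ (ρ σ) 0 q))))
    (≈-trans ([]-yes (ρ bot ℕ.≤ᵇ 0) (ℕₚ.≤⇒≤ᵇ (ℕₚ.≤-reflexive ρ-bot)))
      (*-congˡ (≈-trans (*-congˡ (CommutativeRing.reflexive ring (cong (y ^^_) (ℕₚ.0∸n≡0 (ρ bot))))) (*-identityʳ (H bot))))))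

  -- The gamma expansion of degree `i`, peeled from its first term: the others are `x` times an
  -- expansion of degree `i - 2`.
  G : ℕ → (ℕ → ℕ) → Carrier
  G zero          γ = ι (+ γ 0)
  G (suc zero)    γ = ι (+ γ 0) * p
  G (suc (suc i)) γ = ι (+ γ 0) * p ^^ suc (suc i) + x * G i (γ ∘ suc)

  GammaPositive : ℕ → Carrier → Set
  GammaPositive i q = Σ[ γ ∈ (ℕ → ℕ) ] q ≈ G i γ

  GP-resp : ∀ i {q q′} → q ≈ q′ → GammaPositive i q → GammaPositive i q′
  GP-resp i h (γ , e) = γ , ≈-trans (≈-sym h) e

  GP-+ : ∀ i {q q′} → GammaPositive i q → GammaPositive i q′ → GammaPositive i (q + q′)
  GP-+ i (γ , e) (γ′ , e′) = (λ j → γ j ℕ.+ γ′ j) , ≈-trans (+-cong e e′) (G-+ i γ γ′)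
    where
    open Solver
    G-+ : ∀ i γ γ′ → G i γ + G i γ′ ≈ G i (λ j → γ j ℕ.+ γ′ j)
    G-+ zero          γ γ′ = ≈-sym (ι-+ (+ γ 0) (+ γ′ 0))
    G-+ (suc zero)    γ γ′ = ≈-sym (≈-trans (*-congʳ (ι-+ (+ γ 0) (+ γ′ 0))) (distribʳ p _ _))
    G-+ (suc (suc i)) γ γ′ = ≈-trans
      (solve 6 (λ a b c d x t → (a :* t :+ x :* c) :+ (b :* t :+ x :* d) := (a :+ b) :* t :+ x :* (c :+ d)) ≈-refl
        (ι (+ γ 0)) (ι (+ γ′ 0)) (G i (γ ∘ suc)) (G i (γ′ ∘ suc)) x (p ^^ suc (suc i)))
      (+-cong (*-congʳ (≈-sym (ι-+ (+ γ 0) (+ γ′ 0)))) (*-congˡ (G-+ i (γ ∘ suc) (γ′ ∘ suc))))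

  prepend : ℕ → (ℕ → ℕ) → ℕ → ℕ
  prepend c γ zero    = c
  prepend c γ (suc j) = γ j

  GP-x : ∀ i {q} → GammaPositive i q → GammaPositive (suc (suc i)) (x * q)
  GP-x i (γ , e) = prepend 0 γ , ≈-trans (*-congˡ e)
    (≈-sym (≈-trans (+-congʳ (≈-trans (*-congʳ ι-0) (zeroˡ _))) (+-identityˡ (x * G i γ))))

  GP-p : ∀ i {q} → GammaPositive i q → GammaPositive (suc i) (p * q)
  GP-p i (γ , e) = let γ′ , e′ = go i γ in γ′ , ≈-trans (*-congˡ e) e′
    where
    open Solver
    go : ∀ i γ → GammaPositive (suc i) (p * G i γ)
    go zero          γ = γ , *-comm p (ι (+ γ 0))
    -- From odd to even degree a new coefficient appears; it has to be zero, whereas the later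
    -- values of `γ` are arbitrary.
    go (suc zero)    γ = prepend (γ 0) (λ _ → 0) , ≈-trans
      (solve 2 (λ p c → p :* (c :* p) := c :* (p :* p)) ≈-refl p (ι (+ γ 0)))
      (≈-sym (≈-trans (+-cong (*-congˡ (*-congˡ (*-identityʳ p))) (≈-trans (*-congˡ ι-0) (zeroʳ x))) (+-identityʳ _)))
    go (suc (suc i)) γ = let γ′ , e′ = go i (γ ∘ suc) in prepend (γ 0) γ′ , ≈-trans
      (solve 5 (λ p c t x g → p :* (c :* t :+ x :* g) := c :* (p :* t) :+ x :* (p :* g)) ≈-refl
        p (ι (+ γ 0)) (p ^^ suc (suc i)) x (G i (γ ∘ suc)))
      (+-congˡ (*-congˡ e′))

  GP-2* : ∀ i {q} → GammaPositive i q → GammaPositive i (ι (+ 2) * q)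
  GP-2* i {q} g = GP-resp i
    (≈-sym (≈-trans (*-congʳ (ι-+ (+ 1) (+ 1))) (≈-trans (distribʳ q _ _)
      (+-cong (≈-trans (*-congʳ ι-1) (*-identityˡ q)) (≈-trans (*-congʳ ι-1) (*-identityˡ q))))))
    (GP-+ i g g)

  GP-const : ∀ c → GammaPositive 0 (ι (+ c))
  GP-const c = (λ _ → c) , ≈-refl

-- Gamma-positivity for sheaves.

module GammaPositivity (A : ℤ-Algebra) (K : CellComplex)
  (le-antisym : ∀ x y → T (CellComplex.le K x y) → T (CellComplex.le K y x) → x ≡ y)
  (bot : Fin (CellComplex.n K)) (ρ-bot : CellComplex.ρ K bot ≡ 0)
  (bot-unique : ∀ σ → CellComplex.ρ K σ ≡ 0 → σ ≡ bot)
  (euler : Guards.EulerRelation A (CellComplex.le K) (CellComplex.ρ K))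
  (H : Fin (CellComplex.n K) → Guards.Carrier A) (y : Guards.Carrier A)
  (H-bot : Guards._≈_ A (H bot) (Guards.1# A))
  (H-rec : Guards.ChowRecurrence A (CellComplex.le K) (CellComplex.ρ K) H y) where

  open Sheaves K
  open Guards A
  open Numeric A le ρ le-refl rank-<
  open Involution euler le-trans le-antisym
  open Recursion A le ρ le-refl rank-< H y H-rec

  ν : ℕ → Carrier
  ν c = ι (+ c)

  ν-sum : ∀ {k} (c : Fin k → ℕ) → ν (sumℕ c) ≈ ∑ᴿ (ν ∘ c)
  ν-sum {zero}  c = ι-0
  ν-sum {suc k} c = ≈-trans (ι-+ (+ c zero) (+ sumℕ (c ∘ suc))) (+-congˡ (ν-sum (c ∘ suc)))

  ν-if : ∀ b c → ν (if b then c else 0) ≈ [ b ] ν c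
  ν-if true  c = ≈-refl
  ν-if false c = ι-0

  difference : ∀ a b c → a ≡ b ℕ.+ c → ν c ≈ ν a - ν b
  difference a b c h = ≈-sym (≈-trans (+-congʳ (≈-trans (CommutativeRing.reflexive ring (cong ν h)) (ι-+ (+ b) (+ c))))
    (solve 2 (λ b c → (b :+ c) :- b := c) ≈-refl (ν b) (ν c)))
    where open Solver

  module _ (M : Sheaf) (i : ℕ) (cm : CM M i) where

    open Sheaf M
    open Dualizing K M i cm

    ν-blockCount : ∀ k σ → ν (blockCount k σ) ≈ S k (ν ∘ m) σ
    ν-blockCount k σ = ≈-trans (ν-sum λ τ → if atRank k σ τ then m τ else 0)
      (∑ᴿ-cong λ τ → ν-if (atRank k σ τ) (m τ))

    -- The exact sequences behind `Ω-dim-count` give the dimensions the recursion that defines `w`.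
    ν-Ω : ∀ k (k≤i : k ≤ i) σ → ν (proj₁ (Ω-dim k k≤i σ)) ≈ w k (ν ∘ m) σ
    ν-Ω zero    k≤i σ = ≈-trans (CommutativeRing.reflexive ring (cong ν (Ω-dim-zero k≤i σ))) (ν-blockCount 0 σ)
    ν-Ω (suc k) k<i σ = ≈-trans (difference _ _ _ (Ω-dim-count k k<i σ))
      (+-cong (ν-blockCount (suc k) σ) (-‿cong (ν-Ω k (ℕₚ.<⇒≤ k<i) σ)))

  record Reduction (M : Sheaf) (k : ℕ) : Set₁ where
    field
      sheaf    : Sheaf
      sheaf-CM : CM sheaf k
      sheaf-m  : ∀ σ → ρ σ ≤ suc k → ν (Sheaf.m sheaf σ) ≈ excess (suc k) (ν ∘ Sheaf.m M) σ

  reduce : ∀ M k → CM M (suc (suc k)) → Reduction M k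
  reduce M k cm = record
    { sheaf    = Q.quotient
    ; sheaf-CM = Q.quotient-CM k (ℕₚ.n<1+n k)
    ; sheaf-m  = λ σ ρσ≤ → ≈-trans (difference _ _ _ (Q.quotient-m σ ρσ≤))
                   (+-congʳ (ν-Ω M (suc (suc k)) cm (suc k) (ℕₚ.<⇒≤ (ℕₚ.n<1+n (suc k))) σ))
    }
    where
    module L = Lefschetz K M (suc (suc k)) cm (suc k) (ℕₚ.n<1+n (suc k))
    module Q = Quotient K M (suc (suc k)) cm (suc k) (ℕₚ.n<1+n (suc k)) (Forms.Φ K M L.W)
                 (Forms.Tr-Φ K M L.W) L.Φ-kills L.Φ-injective

  -- In the recursion the first summand belongs to the same sheaf in one degree less, the second to
  -- the cokernel two degrees below. Nonnegativity starts in degree zero, where `f` is the dimension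
  -- of the stalk at `bot`.
  γ-positive : ∀ i M → CM M i → GammaPositive i (f i (ν ∘ Sheaf.m M))
  γ-positive zero M cm = GP-resp 0
    (≈-sym (≈-trans (f-0 (ν ∘ Sheaf.m M) bot ρ-bot bot-unique) (≈-trans (*-congˡ H-bot) (*-identityʳ _))))
    (GP-const (Sheaf.m M bot))
  γ-positive (suc zero) M cm = GP-resp 1
    (≈-sym (≈-trans (f-suc 0 (ν ∘ Sheaf.m M))
      (≈-trans (+-congˡ (≈-trans (*-congˡ (zeroʳ x)) (zeroʳ _))) (+-identityʳ _))))
    (GP-p 0 (γ-positive 0 M (λ σ r ())))
  γ-positive (suc (suc k)) M cm = GP-resp (suc (suc k)) (≈-sym (f-suc (suc k) (ν ∘ Sheaf.m M)))
    (GP-+ (suc (suc k))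
      (GP-p (suc k) (γ-positive (suc k) M λ σ r r<1+k → cm σ r (ℕₚ.m≤n⇒m≤1+n r<1+k)))
      (GP-2* (suc (suc k)) (GP-x k (GP-resp k
        (≈-trans (f-cong k λ σ ρσ≤k → sheaf-m σ (ℕₚ.m≤n⇒m≤1+n ρσ≤k))
          (f-self-dual k (excess (suc k) (ν ∘ Sheaf.m M)) λ σ → w-excess k (ν ∘ Sheaf.m M) σ))
        (γ-positive k sheaf sheaf-CM)))))
    where open Reduction (reduce M k cm)

-- Graded posets: ranks, Euler relation, Chow recurrence.

∧-out : ∀ b {c} → T (b ∧ c) → T b × T c
∧-out b = Equivalence.to (T-∧ {b})

∧-in : ∀ b {c} → T b → T c → T (b ∧ c)
∧-in b p q = Equivalence.from (T-∧ {b}) (p , q)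

module FilterSum (R : CommutativeRing 0ℓ 0ℓ) where
  open CommutativeRing R using (Carrier; _≈_; _+_; 0#; +-congˡ; +-identityˡ) renaming (refl to ≈-refl; sym to ≈-sym; trans to ≈-trans)
  private module S = Sums R

  foldr-filter : ∀ {k n} (p : Fin n → Bool) (f : Fin n → Carrier) (g : Fin k → Fin n) →
                 foldr _+_ 0# (map f (filter (λ w → T? (p w)) (tabulate g))) ≈ S.∑ (λ i → if p (g i) then f (g i) else 0#)
  foldr-filter {zero}  p f g = ≈-refl
  foldr-filter {suc k} p f g with p (g zero)
  ... | true  = +-congˡ (foldr-filter p f (g ∘ suc))
  ... | false = ≈-trans (foldr-filter p f (g ∘ suc)) (≈-sym (+-identityˡ _))

module ℤ-Sums = Sums ℤₚ.+-*-commutativeRing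

sgn : ℕ → ℤ
sgn k = ℤ.-1ℤ ℤ.^ k

sgn-suc : ∀ k → sgn (suc k) ≡ ℤ.- sgn k
sgn-suc k = ℤₚ.-1*i≡-i (sgn k)

sgn² : ∀ k → sgn k ℤ.* sgn k ≡ + 1
sgn² zero    = refl
sgn² (suc k) = trans (cong₂ ℤ._*_ (sgn-suc k) (sgn-suc k))
  (trans (solve 1 (λ s → :- s :* :- s := s :* s) refl (sgn k)) (sgn² k))
  where open ℤ-Solver.+-*-Solver

module GradedPoset (P : FinGradedBoundedPoset) where

  open PosetNotions P

  lt⇒le : ∀ {x y} → T (lt x y) → T (le x y)
  lt⇒le {x} {y} h = proj₁ (∧-out (le x y) h)

  lt⇒≢ : ∀ {x y} → T (lt x y) → x ≢ y
  lt⇒≢ {x} {y} h x≡y with x Fin.≟ y | ∧-out (le x y) h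
  ... | yes _  | _ , ()
  ... | no x≢y | _ = x≢y x≡y

  le∧≢⇒lt : ∀ {x y} → T (le x y) → x ≢ y → T (lt x y)
  le∧≢⇒lt {x} {y} p x≢y with x Fin.≟ y
  ... | yes x≡y = contradiction x≡y x≢y
  ... | no _    = ∧-in (le x y) p tt

  lt-irrefl : ∀ {x} → ¬ T (lt x x)
  lt-irrefl h = lt⇒≢ h refl

  le-lt-trans : ∀ {x y z} → T (le x y) → T (lt y z) → T (lt x z)
  le-lt-trans {x} {y} {z} p q = le∧≢⇒lt (le-trans x y z p (lt⇒le q))
    λ { refl → lt⇒≢ q (le-antisym y x (lt⇒le q) p) }

  lt-le-trans : ∀ {x y z} → T (lt x y) → T (le y z) → T (lt x z)
  lt-le-trans {x} {y} {z} p q = le∧≢⇒lt (le-trans x y z (lt⇒le p) q)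
    λ { refl → lt⇒≢ p (le-antisym x y (lt⇒le p) q) }

  lt-trans : ∀ {x y z} → T (lt x y) → T (lt y z) → T (lt x z)
  lt-trans p q = lt-le-trans p (lt⇒le q)

  isSPO : IsStrictPartialOrder _≡_ (λ x y → T (lt x y))
  isSPO = record
    { isEquivalence = isEquivalence
    ; irrefl        = λ { refl → lt-irrefl }
    ; trans         = lt-trans
    ; <-resp-≈      = resp₂ (λ x y → T (lt x y))
    }

  lt-wf : WellFounded (λ x y → T (lt x y))
  lt-wf = FinInduction.spo-wellFounded isSPO

  gt-wf : WellFounded (λ x y → T (lt y x))
  gt-wf = FinInduction.spo-noetherian isSPO

  between? : ∀ s t → Dec (Σ[ z ∈ Fin n ] T (lt s z) × T (lt z t))
  between? s t = Finₚ.any? λ z → T? (lt s z) ×-dec T? (lt z t)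

  lower-cover : ∀ {s t} → T (lt s t) → Σ[ w ∈ Fin n ] T (le s w) × Covers w t
  lower-cover {s} {t} = go s (gt-wf s)
    where
    go : ∀ s → Acc (λ x y → T (lt y x)) s → T (lt s t) → Σ[ w ∈ Fin n ] T (le s w) × Covers w t
    go s (acc rec) s<t with between? s t
    ... | no none-between = s , le-refl s , s<t , λ z p q → none-between (z , p , q)
    ... | yes (z , s<z , z<t) = let w , z≤w , c = go z (rec s<z) z<t in w , le-trans s z w (lt⇒le s<z) z≤w , c

  upper-cover : ∀ {s t} → T (lt s t) → Σ[ w ∈ Fin n ] Covers s w × T (le w t)
  upper-cover {s} {t} = go t (lt-wf t)
    where
    go : ∀ t → Acc (λ x y → T (lt x y)) t → T (lt s t) → Σ[ w ∈ Fin n ] Covers s w × T (le w t)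
    go t (acc rec) s<t with between? s t
    ... | no none-between = t , (s<t , λ z p q → none-between (z , p , q)) , le-refl t
    ... | yes (z , s<z , z<t) = let w , c , w≤z = go z (rec z<t) s<z in w , c , le-trans w z t w≤z (lt⇒le z<t)

  rank-lt : ∀ {s t} → T (lt s t) → ρ s < ρ t
  rank-lt {s} {t} = go t (lt-wf t) s
    where
    go : ∀ t → Acc (λ x y → T (lt x y)) t → ∀ s → T (lt s t) → ρ s < ρ t
    go t (acc rec) s s<t with lower-cover s<t
    ... | w , s≤w , c with s Fin.≟ w
    ... | yes refl = ℕₚ.≤-reflexive (sym (ρ-cover s t c))
    ... | no s≢w   = ℕₚ.<-trans (go w (rec (proj₁ c)) s (le∧≢⇒lt s≤w s≢w)) (ℕₚ.≤-reflexive (sym (ρ-cover w t c)))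

  rank-< : ∀ x y → T (le x y) → x ≢ y → ρ x < ρ y
  rank-< x y p x≢y = rank-lt (le∧≢⇒lt p x≢y)

  rank-≤ : ∀ {x y} → T (le x y) → ρ x ≤ ρ y
  rank-≤ {x} {y} p with x Fin.≟ y
  ... | yes refl = ℕₚ.≤-refl
  ... | no x≢y   = ℕₚ.<⇒≤ (rank-< x y p x≢y)

  rank-eq : ∀ {x y} → T (le x y) → ρ x ≡ ρ y → x ≡ y
  rank-eq {x} {y} p h with x Fin.≟ y
  ... | yes x≡y = x≡y
  ... | no x≢y  = contradiction h (ℕₚ.<⇒≢ (rank-< x y p x≢y))

  le∧rank⇒lt : ∀ {x y} → T (le x y) → ρ x < ρ y → T (lt x y)
  le∧rank⇒lt p h = le∧≢⇒lt p λ { refl → ℕₚ.<-irrefl refl h }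

  le∧rank⇒Covers : ∀ {x y} → T (le x y) → ρ y ≡ suc (ρ x) → Covers x y
  le∧rank⇒Covers p h = le∧rank⇒lt p (ℕₚ.≤-reflexive (sym h)) ,
    λ z a b → ℕₚ.<⇒≱ (rank-lt b) (subst (_≤ ρ z) (sym h) (rank-lt a))

  bot-unique : ∀ σ → ρ σ ≡ 0 → σ ≡ bot
  bot-unique σ h = sym (rank-eq (bot-min σ) (trans ρ-bot (sym h)))

  -- Below `t` there is an element of each rank from zero to `ρ t`, and these are distinct. Hence
  -- the fuel suffices.
  rank-bound : ∀ t → ρ t < n
  rank-bound t = Finₚ.injective⇒≤ {f = λ i → proj₁ (elements (toℕ i) (s≤s⁻¹ (Finₚ.toℕ<n i)))} λ {i} {j} h →
    Finₚ.toℕ-injective (trans (sym (proj₁ (proj₂ (elements (toℕ i) (s≤s⁻¹ (Finₚ.toℕ<n i))))))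
      (trans (cong ρ h) (proj₁ (proj₂ (elements (toℕ j) (s≤s⁻¹ (Finₚ.toℕ<n j)))))))
    where
    descend : ∀ g t → ∀ r → r ℕ.+ g ≡ ρ t → Σ[ w ∈ Fin n ] ρ w ≡ r × T (le w t)
    descend zero    t r h = t , trans (sym h) (ℕₚ.+-identityʳ r) , le-refl t
    descend (suc g) t r h =
      let bot<t = le∧rank⇒lt (bot-min t) (subst (_< ρ t) (sym ρ-bot) (subst (0 <_) (trans (sym (ℕₚ.+-suc r g)) h) (s≤s z≤n)))
          w , _ , c = lower-cover bot<t
          v , ρv , v≤w = descend g w r (ℕₚ.suc-injective (trans (sym (ℕₚ.+-suc r g)) (trans h (ρ-cover w t c))))
      in v , ρv , le-trans v w t v≤w (lt⇒le (proj₁ c))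
    elements : ∀ r → r ≤ ρ t → Σ[ w ∈ Fin n ] ρ w ≡ r × T (le w t)
    elements r r≤ρt = descend (ρ t ∸ r) t r (ℕₚ.m+[n∸m]≡n r≤ρt)

  halfOpen-out : ∀ s t w → T (le s w ∧ lt w t) → T (le s w) × T (lt w t)
  halfOpen-out s t w = ∧-out (le s w)

  eqᵇ-no : ∀ {x y} → x ≢ y → eqᵇ x y ≡ false
  eqᵇ-no {x} {y} x≢y with x Fin.≟ y
  ... | yes x≡y = contradiction x≡y x≢y
  ... | no _    = refl

  T⇒≡true : ∀ {b} → T b → b ≡ true
  T⇒≡true {true} _ = refl

  if-cong : ∀ {A : Set} b {x y z : A} → (T b → x ≡ y) → (if b then x else z) ≡ (if b then y else z)
  if-cong true  h = h tt
  if-cong false h = refl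

  ρ-drop : ∀ s t w → T (le s w) → T (lt w t) → ρ[ s , w ] < ρ[ s , t ]
  ρ-drop s t w s≤w w<t = ℕₚ.∸-monoˡ-< (rank-lt w<t) (rank-≤ s≤w)

  mobius-fuel : ∀ k k′ s t → ρ[ s , t ] < k → ρ[ s , t ] < k′ → mobiusF k s t ≡ mobiusF k′ s t
  mobius-fuel (suc k) (suc k′) s t h h′ with eqᵇ s t | le s t
  ... | true  | _     = refl
  ... | false | false = refl
  ... | false | true  = cong ℤ.-_ (trans (foldr-filter (λ w → le s w ∧ lt w t) (mobiusF k s) (λ w → w))
      (trans (ℤ-Sums.∑-cong λ w → if-cong (le s w ∧ lt w t) λ p →
                let s≤w , w<t = halfOpen-out s t w p in
                mobius-fuel k k′ s w (ℕₚ.<-≤-trans (ρ-drop s t w s≤w w<t) (s≤s⁻¹ h))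
                                     (ℕₚ.<-≤-trans (ρ-drop s t w s≤w w<t) (s≤s⁻¹ h′)))
        (sym (foldr-filter (λ w → le s w ∧ lt w t) (mobiusF k′ s) (λ w → w)))))
    where open FilterSum ℤₚ.+-*-commutativeRing

  μ-rec : ∀ {s t} → T (lt s t) → μ s t ≡ ℤ.- ℤ-Sums.∑ (λ w → if le s w ∧ lt w t then μ s w else + 0)
  μ-rec {s} {t} s<t rewrite eqᵇ-no (lt⇒≢ s<t) | T⇒≡true (lt⇒le s<t) =
    cong ℤ.-_ (trans (foldr-filter (λ w → le s w ∧ lt w t) (mobiusF n s) (λ w → w))
      (ℤ-Sums.∑-cong λ w → if-cong (le s w ∧ lt w t) λ p →
        let s≤w , w<t = halfOpen-out s t w p
            below-n = ℕₚ.<-≤-trans (ρ-drop s t w s≤w w<t) (ℕₚ.≤-trans (ℕₚ.m∸n≤m (ρ t) (ρ s)) (s≤s⁻¹ (ℕₚ.m≤n⇒m≤1+n (rank-bound t))))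
        in mobius-fuel n (suc n) s w below-n (ℕₚ.m≤n⇒m≤1+n below-n)))
    where open FilterSum ℤₚ.+-*-commutativeRing

  -- The recursion of `μ` says that `μ s w` sums to zero over the interval, and `sgn (ρ s) * μ s w`
  -- is `sgn (ρ w)`.
  euler : Eulerian → ∀ s t → T (le s t) → s ≢ t →
          ℤ-Sums.∑ (λ w → if le s w ∧ le w t then sgn (ρ w) else + 0) ≡ + 0
  euler eul s t s≤t s≢t = begin
    ∑ℤ (λ w → if le s w ∧ le w t then sgn (ρ w) else + 0)
      ≡⟨ ℤ-Sums.∑-cong (λ w → split w) ⟩
    ∑ℤ (λ w → sgn (ρ s) ℤ.* (if le s w ∧ lt w t then μ s w else + 0) ℤ.+ (if does (w Fin.≟ t) then sgn (ρ t) else + 0))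
      ≡⟨ ℤ-Sums.∑-+ (λ w → sgn (ρ s) ℤ.* h w) (λ w → if does (w Fin.≟ t) then sgn (ρ t) else + 0) ⟩
    ∑ℤ (λ w → sgn (ρ s) ℤ.* h w) ℤ.+ ∑ℤ (λ w → if does (w Fin.≟ t) then sgn (ρ t) else + 0)
      ≡⟨ cong₂ ℤ._+_ (sym (ℤ-Sums.∑-*ˡ (sgn (ρ s)) h)) (trans (ℤ-Sums.∑-single t λ w w≢t → at-other w w≢t) at-t) ⟩
    sgn (ρ s) ℤ.* ∑ℤ h ℤ.+ sgn (ρ t)
      ≡⟨ cong (λ u → sgn (ρ s) ℤ.* ∑ℤ h ℤ.+ u) (trans (sgn-diff s t s≤t) (cong (λ u → sgn (ρ s) ℤ.* u) (μ-rec s<t))) ⟩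
    sgn (ρ s) ℤ.* ∑ℤ h ℤ.+ sgn (ρ s) ℤ.* ℤ.- ∑ℤ h
      ≡⟨ solve 2 (λ a b → a :* b :+ a :* :- b := con (+ 0)) refl (sgn (ρ s)) (∑ℤ h) ⟩
    + 0 ∎
    where
    open ≡-Reasoning
    open ℤ-Solver.+-*-Solver
    ∑ℤ : (Fin n → ℤ) → ℤ
    ∑ℤ = ℤ-Sums.∑
    s<t : T (lt s t)
    s<t = le∧≢⇒lt s≤t s≢t
    h : Fin n → ℤ
    h w = if le s w ∧ lt w t then μ s w else + 0
    sgn-diff : ∀ s w → T (le s w) → sgn (ρ w) ≡ sgn (ρ s) ℤ.* μ s w
    sgn-diff s w s≤w = trans (cong sgn (sym (ℕₚ.m+[n∸m]≡n (rank-≤ s≤w))))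
      (trans (ℤₚ.^-distribˡ-+-* ℤ.-1ℤ (ρ s) (ρ w ∸ ρ s)) (cong (λ u → sgn (ρ s) ℤ.* u) (sym (eul s w s≤w))))
    at-t : (if does (t Fin.≟ t) then sgn (ρ t) else + 0) ≡ sgn (ρ t)
    at-t with t Fin.≟ t
    ... | yes _  = refl
    ... | no t≢t = contradiction refl t≢t
    at-other : ∀ w → w ≢ t → (if does (w Fin.≟ t) then sgn (ρ t) else + 0) ≡ + 0
    at-other w w≢t with w Fin.≟ t
    ... | yes w≡t = contradiction w≡t w≢t
    ... | no _    = refl
    split : ∀ w → (if le s w ∧ le w t then sgn (ρ w) else + 0) ≡
                  sgn (ρ s) ℤ.* (if le s w ∧ lt w t then μ s w else + 0) ℤ.+ (if does (w Fin.≟ t) then sgn (ρ t) else + 0)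
    split w with w Fin.≟ t
    ... | yes refl rewrite T⇒≡true s≤t | T⇒≡true (le-refl t) =
          sym (trans (cong (λ u → u ℤ.+ sgn (ρ t)) (ℤₚ.*-zeroʳ (sgn (ρ s)))) (ℤₚ.+-identityˡ (sgn (ρ t))))
    ... | no _ = guarded (le s w) (le w t) (μ s w) (sgn-diff s w)
      where
      guarded : ∀ b c {a} v → (T b → a ≡ sgn (ρ s) ℤ.* v) →
                (if b ∧ c then a else + 0) ≡ sgn (ρ s) ℤ.* (if b ∧ (c ∧ true) then v else + 0) ℤ.+ + 0
      guarded false _     v h = sym (trans (ℤₚ.+-identityʳ _) (ℤₚ.*-zeroʳ (sgn (ρ s))))
      guarded true  false v h = sym (trans (ℤₚ.+-identityʳ _) (ℤₚ.*-zeroʳ (sgn (ρ s))))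
      guarded true  true  v h = trans (h tt) (sym (ℤₚ.+-identityʳ _))

  module εbar where

    open CommutativeRing polyRing using (*-cong; setoid)
    open SetoidReasoning setoid
    open Sums polyRing using () renaming (∑ to ∑ₚ; ∑-cong to ∑ₚ-cong)

    terms : ℕ → Fin n → Fin n → Poly
    terms k t w = if le bot w ∧ lt w t then εbarInvF k bot w *ₚ εbar w t else []

    terms-sum : ∀ k t → sumₚ (map (λ w → εbarInvF k bot w *ₚ εbar w t) (halfOpen bot t)) ≈ₚ ∑ₚ (terms k t)
    terms-sum k t = FilterSum.foldr-filter polyRing (λ w → le bot w ∧ lt w t) (λ w → εbarInvF k bot w *ₚ εbar w t) (λ w → w)

    if-cong-≈ : ∀ b {p q : Poly} → (T b → p ≈ₚ q) → (if b then p else []) ≈ₚ (if b then q else [])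
    if-cong-≈ true  h = h tt
    if-cong-≈ false h = λ _ → refl

    fuel : ∀ k k′ t → ρ t < k → ρ t < k′ → εbarInvF k bot t ≈ₚ εbarInvF k′ bot t
    terms-fuel : ∀ k k′ t → ρ t ≤ k → ρ t ≤ k′ → ∀ w → terms k t w ≈ₚ terms k′ t w
    fuel (suc k) (suc k′) t h h′ with eqᵇ bot t | le bot t
    ... | true  | _     = λ _ → refl
    ... | false | false = λ _ → refl
    ... | false | true  = begin
      sumₚ (map (λ w → εbarInvF k bot w *ₚ εbar w t) (halfOpen bot t))   ≈⟨ terms-sum k t ⟩
      ∑ₚ (terms k t)                                                     ≈⟨ ∑ₚ-cong {f = terms k t} {terms k′ t} (terms-fuel k k′ t (s≤s⁻¹ h) (s≤s⁻¹ h′)) ⟩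
      ∑ₚ (terms k′ t)                                                    ≈⟨ terms-sum k′ t ⟨
      sumₚ (map (λ w → εbarInvF k′ bot w *ₚ εbar w t) (halfOpen bot t))  ∎
    terms-fuel k k′ t h h′ w = if-cong-≈ (le bot w ∧ lt w t) λ p → let w<t = proj₂ (∧-out (le bot w) p) in
      *-cong {εbarInvF k bot w} {εbarInvF k′ bot w} {εbar w t} {εbar w t}
        (fuel k k′ w (ℕₚ.<-≤-trans (rank-lt w<t) h) (ℕₚ.<-≤-trans (rank-lt w<t) h′)) (λ _ → refl)

    εbar-lt : ∀ w t → T (lt w t) → εbar w t ≡ powₚ Xm1 (ρ t ∸ ρ w ∸ 1)
    εbar-lt w t w<t rewrite eqᵇ-no (lt⇒≢ w<t) | T⇒≡true (lt⇒le w<t) = refl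

    inverse-terms : Fin n → Fin n → Poly
    inverse-terms t w = if le bot w ∧ lt w t then εbarInv bot w *ₚ powₚ Xm1 (ρ t ∸ ρ w ∸ 1) else []

    unfold : ∀ {t} → t ≢ bot → εbarInv bot t ≡ sumₚ (map (λ w → εbarInvF n bot w *ₚ εbar w t) (halfOpen bot t))
    unfold {t} t≢bot rewrite eqᵇ-no (t≢bot ∘ sym) | T⇒≡true (bot-min t) = refl

    εbarInv-rec : ∀ {t} → t ≢ bot → εbarInv bot t ≈ₚ ∑ₚ (inverse-terms t)
    εbarInv-rec {t} t≢bot = begin
      εbarInv bot t                                                     ≡⟨ unfold t≢bot ⟩
      sumₚ (map (λ w → εbarInvF n bot w *ₚ εbar w t) (halfOpen bot t))  ≈⟨ terms-sum n t ⟩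
      ∑ₚ (terms n t)                                                    ≈⟨ ∑ₚ-cong {f = terms n t} {inverse-terms t} term ⟩
      ∑ₚ (inverse-terms t)                                              ∎
      where
      term : ∀ w → terms n t w ≈ₚ inverse-terms t w
      term w = if-cong-≈ (le bot w ∧ lt w t) λ p →
        *-cong {εbarInvF n bot w} {εbarInv bot w} {εbar w t} {powₚ Xm1 (ρ t ∸ ρ w ∸ 1)}
          (fuel n (suc n) w (rank-bound w) (ℕₚ.m≤n⇒m≤1+n (rank-bound w)))
          (λ k → cong (λ p → coeff p k) (εbar-lt w t (proj₂ (∧-out (le bot w) p))))

-- Simplicial chains of open intervals and of their rank truncations.

module Chains (P : FinGradedBoundedPoset) where

  open PosetNotions P
  open GradedPoset P

  Chain : Set
  Chain = List (Fin n)

  -- The simplicial boundary, by recursion on the smallest vertex of the face at which it is evaluated.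
  ∂ᶜ : (Chain → ℚ) → Chain → ℚ
  ∂ᶜ d []      = ∑ λ w → d (w ∷ [])
  ∂ᶜ d (u ∷ G) = ∑ (λ w → d (w ∷ u ∷ G)) ℚ.- ∂ᶜ (λ F → d (u ∷ F)) G

  ∂ᶜ-cong : ∀ F d d′ → (∀ F′ → length F′ ≡ suc (length F) → d F′ ≡ d′ F′) → ∂ᶜ d F ≡ ∂ᶜ d′ F
  ∂ᶜ-cong []      d d′ h = ∑-cong λ w → h (w ∷ []) refl
  ∂ᶜ-cong (u ∷ G) d d′ h = cong₂ ℚ._-_ (∑-cong λ w → h (w ∷ u ∷ G) refl)
    (∂ᶜ-cong G (λ F → d (u ∷ F)) (λ F → d′ (u ∷ F)) λ F e → h (u ∷ F) (cong suc e))

  ∂ᶜ-0 : ∀ F d → (∀ F′ → length F′ ≡ suc (length F) → d F′ ≡ 0ℚ) → ∂ᶜ d F ≡ 0ℚ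
  ∂ᶜ-0 []      d h = ∑-zero λ w → h (w ∷ []) refl
  ∂ᶜ-0 (u ∷ G) d h = cong₂ ℚ._-_ (∑-zero λ w → h (w ∷ u ∷ G) refl)
    (∂ᶜ-0 G (λ F → d (u ∷ F)) λ F e → h (u ∷ F) (cong suc e))

  ∂ᶜ-+ : ∀ F d d′ → ∂ᶜ (λ F → d F ℚ.+ d′ F) F ≡ ∂ᶜ d F ℚ.+ ∂ᶜ d′ F
  ∂ᶜ-+ []      d d′ = ∑-+ (λ w → d (w ∷ [])) (λ w → d′ (w ∷ []))
  ∂ᶜ-+ (u ∷ G) d d′ = trans
    (cong₂ ℚ._-_ (∑-+ (λ w → d (w ∷ u ∷ G)) (λ w → d′ (w ∷ u ∷ G))) (∂ᶜ-+ G (λ F → d (u ∷ F)) (λ F → d′ (u ∷ F))))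
    (solve 4 (λ a b c e → (a :+ b) :- (c :+ e) := (a :- c) :+ (b :- e)) refl
      (∑ λ w → d (w ∷ u ∷ G)) (∑ λ w → d′ (w ∷ u ∷ G)) (∂ᶜ (λ F → d (u ∷ F)) G) (∂ᶜ (λ F → d′ (u ∷ F)) G))
    where open +-*-Solver

  ∂ᶜ-* : ∀ F a d → ∂ᶜ (λ F → a ℚ.* d F) F ≡ a ℚ.* ∂ᶜ d F
  ∂ᶜ-* []      a d = sym (∑-*ˡ a (λ w → d (w ∷ [])))
  ∂ᶜ-* (u ∷ G) a d = trans
    (cong₂ ℚ._-_ (sym (∑-*ˡ a (λ w → d (w ∷ u ∷ G)))) (∂ᶜ-* G a (λ F → d (u ∷ F))))
    (solve 3 (λ a b c → a :* b :- a :* c := a :* (b :- c)) refl a (∑ λ w → d (w ∷ u ∷ G)) (∂ᶜ (λ F → d (u ∷ F)) G))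
    where open +-*-Solver

  ∂ᶜ-∑ : ∀ {k} F (d : Fin k → Chain → ℚ) → ∂ᶜ (λ F → ∑ λ i → d i F) F ≡ ∑ λ i → ∂ᶜ (d i) F
  ∂ᶜ-∑ {zero}  F d = ∂ᶜ-0 F (λ _ → 0ℚ) λ _ _ → refl
  ∂ᶜ-∑ {suc k} F d = trans (∂ᶜ-+ F (d zero) (λ F → ∑ λ i → d (suc i) F)) (cong (∂ᶜ (d zero) F ℚ.+_) (∂ᶜ-∑ F (d ∘ suc)))

  -- For `s` below `t` this is equivalent to `isFace`, but its recursion moves the lower end, as is
  -- required for passing to links.
  asc : Fin n → Fin n → Chain → Bool
  asc s t []      = lt s t
  asc s t (x ∷ F) = lt s x ∧ asc x t F

  asc⇒lt : ∀ s t F → T (asc s t F) → T (lt s t)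
  asc⇒lt s t []      h = h
  asc⇒lt s t (x ∷ F) h = let a , b = ∧-out (lt s x) h in lt-trans a (asc⇒lt x t F b)

  asc-extend : ∀ s x t F → T (lt s x) → T (asc x t F) → T (asc s t F)
  asc-extend s x t []      p h = lt-trans p h
  asc-extend s x t (y ∷ F) p h = let a , b = ∧-out (lt x y) h in ∧-in (lt s y) (lt-trans p a) b

  asc-length : ∀ s t F → T (asc s t F) → ρ s ℕ.+ length F < ρ t
  asc-length s t []      h = subst (_< ρ t) (sym (ℕₚ.+-identityʳ (ρ s))) (rank-lt h)
  asc-length s t (x ∷ F) h = let a , b = ∧-out (lt s x) h in
    ℕₚ.≤-<-trans (subst (_≤ ρ x ℕ.+ length F) (sym (ℕₚ.+-suc (ρ s) (length F))) (ℕₚ.+-monoˡ-≤ (length F) (rank-lt a)))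
                 (asc-length x t F b)

  isFace⇒asc : ∀ {s t} → T (lt s t) → ∀ F → T (isFace s t F) → T (asc s t F)
  isFace⇒asc {s} {t} s<t []      h = s<t
  isFace⇒asc {s} {t} s<t (x ∷ F) h =
    let a , b = ∧-out (allᵇ (inOpen s t) (x ∷ F)) h
        x∈ , F∈ = ∧-out (inOpen s t x) a
    in ∧-in (lt s x) (proj₁ (∧-out (lt s x) x∈)) (go x F (proj₂ (∧-out (lt s x) x∈)) F∈ b)
    where
    go : ∀ x F → T (lt x t) → T (allᵇ (inOpen s t) F) → T (increasing (x ∷ F)) → T (asc x t F)
    go x []      x<t _ _ = x<t
    go x (y ∷ F) x<t F∈ inc =
      let x<y , inc′ = ∧-out (lt x y) inc
          y∈ , F∈′ = ∧-out (inOpen s t y) F∈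
      in ∧-in (lt x y) x<y (go y F (proj₂ (∧-out (lt s y) y∈)) F∈′ inc′)

  asc⇒isFace : ∀ {s t} F → T (asc s t F) → T (isFace s t F)
  asc⇒isFace {s} {t} F h = ∧-in (allᵇ (inOpen s t) F) (inside s F (le-refl s) h) (inc s F h)
    where
    inside : ∀ x F → T (le s x) → T (asc x t F) → T (allᵇ (inOpen s t) F)
    inside x []      s≤x h = tt
    inside x (y ∷ F) s≤x h =
      let a , b = ∧-out (lt x y) h
          s<y = le-lt-trans s≤x a
      in ∧-in (inOpen s t y) (∧-in (lt s y) s<y (asc⇒lt y t F b)) (inside y F (lt⇒le s<y) b)
    inc : ∀ x F → T (asc x t F) → T (increasing F)
    inc x []          h = tt
    inc x (y ∷ [])    h = tt
    inc x (y ∷ z ∷ F) h = let _ , b = ∧-out (lt x y) h in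
      ∧-in (lt y z) (proj₁ (∧-out (lt y z) b)) (inc y (z ∷ F) b)

  restrict : Fin n → Fin n → (Chain → ℚ) → Chain → ℚ
  restrict s t d F = if isFace s t F then d F else 0ℚ

  sumUp : ℕ → (ℕ → ℚ) → ℚ
  sumUp zero    f = 0ℚ
  sumUp (suc k) f = f 0 ℚ.+ sumUp k (f ∘ suc)

  -- Position zero is insertion in front; the later positions insert into the tail with opposite
  -- sign.
  ∂≡∂ᶜ : ∀ s t d σ → ∂ s t d σ ≡ ∂ᶜ (restrict s t d) σ
  ∂≡∂ᶜ s t d σ = trans (sumUp-list (suc (length σ)) outer (λ j → j))
    (trans (sumUp-cong (suc (length σ)) inner) (expand-∂ σ (restrict s t d)))
    where
    outer : ℕ → ℚ
    outer j = sumℚ (map (λ w → if isFace s t (insertAt j w σ) then signℚ j ℚ.* d (insertAt j w σ) else 0ℚ) (allFin n))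
    sumUp-list : ∀ k (f : ℕ → ℚ) (g : ℕ → ℕ) → sumℚ (map f (applyUpTo g k)) ≡ sumUp k (f ∘ g)
    sumUp-list zero    f g = refl
    sumUp-list (suc k) f g = cong (f (g 0) ℚ.+_) (sumUp-list k f (g ∘ suc))
    sumUp-cong : ∀ k {f g : ℕ → ℚ} → f ≗ g → sumUp k f ≡ sumUp k g
    sumUp-cong zero    h = refl
    sumUp-cong (suc k) h = cong₂ ℚ._+_ (h 0) (sumUp-cong k (h ∘ suc))
    sumUp-neg : ∀ k (f : ℕ → ℚ) → sumUp k (λ j → ℚ.- f j) ≡ ℚ.- sumUp k f
    sumUp-neg zero    f = refl
    sumUp-neg (suc k) f = trans (cong (ℚ.- f 0 ℚ.+_) (sumUp-neg k (f ∘ suc))) (sym (ℚₚ.neg-distrib-+ (f 0) _))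
    sum-allFin : ∀ {k} (f : Fin n → ℚ) (g : Fin k → Fin n) → sumℚ (map f (tabulate g)) ≡ ∑ (f ∘ g)
    sum-allFin {zero}  f g = refl
    sum-allFin {suc k} f g = cong (f (g zero) ℚ.+_) (sum-allFin f (g ∘ suc))
    if-* : ∀ b a {c} → (if b then a ℚ.* c else 0ℚ) ≡ a ℚ.* (if b then c else 0ℚ)
    if-* true  a = refl
    if-* false a = sym (ℚₚ.*-zeroʳ a)
    inner : ∀ j → outer j ≡ ∑ λ w → signℚ j ℚ.* restrict s t d (insertAt j w σ)
    inner j = trans (sum-allFin _ (λ w → w)) (∑-cong λ w → if-* (isFace s t (insertAt j w σ)) (signℚ j))
    expand-∂ : ∀ σ d → sumUp (suc (length σ)) (λ j → ∑ λ w → signℚ j ℚ.* d (insertAt j w σ)) ≡ ∂ᶜ d σ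
    expand-∂ []      d = trans (ℚₚ.+-identityʳ _) (∑-cong λ w → ℚₚ.*-identityˡ (d (w ∷ [])))
    expand-∂ (u ∷ σ) d = cong₂ ℚ._+_ (∑-cong λ w → ℚₚ.*-identityˡ (d (w ∷ u ∷ σ))) (begin
      sumUp (suc (length σ)) (λ j → ∑ λ w → ℚ.- signℚ j ℚ.* d (u ∷ insertAt j w σ))
        ≡⟨ sumUp-cong (suc (length σ)) (λ j → trans
             (∑-cong λ w → sym (ℚₚ.neg-distribˡ-* (signℚ j) (d (u ∷ insertAt j w σ))))
             (∑-neg (λ w → signℚ j ℚ.* d (u ∷ insertAt j w σ)))) ⟩
      sumUp (suc (length σ)) (λ j → ℚ.- ∑ λ w → signℚ j ℚ.* d (u ∷ insertAt j w σ))
        ≡⟨ sumUp-neg (suc (length σ)) (λ j → ∑ λ w → signℚ j ℚ.* d (u ∷ insertAt j w σ)) ⟩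
      ℚ.- sumUp (suc (length σ)) (λ j → ∑ λ w → signℚ j ℚ.* d (u ∷ insertAt j w σ))
        ≡⟨ cong ℚ.-_ (expand-∂ σ (λ F → d (u ∷ F))) ⟩
      ℚ.- ∂ᶜ (λ F → d (u ∷ F)) σ ∎)
      where open ≡-Reasoning

  Supported : Fin n → Fin n → (Chain → ℚ) → Set
  Supported s t d = ∀ F → d F ≢ 0ℚ → T (asc s t F)

  unsupported : ∀ {s t d} → Supported s t d → ∀ F → ¬ T (asc s t F) → d F ≡ 0ℚ
  unsupported {d = d} supp F h with d F ℚₚ.≟ 0ℚ
  ... | yes p = p
  ... | no p  = contradiction (supp F p) h

  Supported-head : ∀ {s t d} → Supported s t d → ∀ u → Supported u t (λ F → d (u ∷ F))
  Supported-head {s} supp u F h = proj₂ (∧-out (lt s u) (supp (u ∷ F) h))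

  ∂ᶜ-unsupported : ∀ s t d F → Supported s t d → ¬ T (asc s t F) → ∂ᶜ d F ≡ 0ℚ
  ∂ᶜ-unsupported s t d [] supp h = ∑-zero λ w → unsupported supp (w ∷ []) λ p →
    h (asc⇒lt s t (w ∷ []) p)
  ∂ᶜ-unsupported s t d (u ∷ G) supp h = cong₂ ℚ._-_
    (∑-zero λ w → unsupported supp (w ∷ u ∷ G) λ p → let a , b = ∧-out (lt s w) p in h (asc-extend s w t (u ∷ G) a b))
    (by (T? (lt s u)))
    where
    by : Dec (T (lt s u)) → ∂ᶜ (λ F → d (u ∷ F)) G ≡ 0ℚ
    by (no s≮u)  = ∂ᶜ-0 G (λ F → d (u ∷ F)) λ F _ → unsupported supp (u ∷ F) (s≮u ∘ proj₁ ∘ ∧-out (lt s u))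
    by (yes s<u) = ∂ᶜ-unsupported u t (λ F → d (u ∷ F)) G (Supported-head supp u) (h ∘ ∧-in (lt s u) s<u)

  IsCycle : ℕ → (Chain → ℚ) → Set
  IsCycle ℓ c = ∀ G → suc (length G) ≡ ℓ → ∂ᶜ c G ≡ 0ℚ

  -- Cohen-Macaulayness for chains that vanish off the faces: the face tests then drop out of the
  -- boundary, whose values off the faces are zero as well.
  cm-exact : CohenMacaulay → ∀ s t → T (lt s t) → ∀ ℓ → suc ℓ ≢ ρ[ s , t ] → ∀ c → Supported s t c → IsCycle ℓ c →
             Σ[ d ∈ (Chain → ℚ) ] Supported s t d × (∀ F → length F ≡ ℓ → ∂ᶜ d F ≡ c F)
  cm-exact cm s t s<t ℓ ℓ≢ c supp cyc =
    let d , h = cm s t s<t ℓ ℓ≢ c (cycle ℓ cyc) in restrict s t d , supp-d d , λ F e → boundary d h F e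
    where
    restrict-no : ∀ d F → ¬ T (isFace s t F) → restrict s t d F ≡ 0ℚ
    restrict-no d F h with isFace s t F
    ... | true  = contradiction tt h
    ... | false = refl
    restrict-c : ∀ F → restrict s t c F ≡ c F
    restrict-c F = by (T? (isFace s t F))
      where
      by : Dec (T (isFace s t F)) → restrict s t c F ≡ c F
      by (yes p) = cong (λ b → if b then c F else 0ℚ) (T⇒≡true p)
      by (no ¬p) = trans (restrict-no c F ¬p) (sym (unsupported supp F (¬p ∘ asc⇒isFace F)))
    cycle : ∀ ℓ → IsCycle ℓ c → Cycle s t ℓ c
    cycle zero    cyc = tt
    cycle (suc ℓ) cyc σ (_ , e) = trans (∂≡∂ᶜ s t c σ)
      (trans (∂ᶜ-cong σ (restrict s t c) c (λ F _ → restrict-c F)) (cyc σ (cong suc e)))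
    supp-d : ∀ d → Supported s t (restrict s t d)
    supp-d d F h = by (T? (isFace s t F))
      where
      by : Dec (T (isFace s t F)) → T (asc s t F)
      by (yes p) = isFace⇒asc s<t F p
      by (no ¬p) = contradiction (restrict-no d F ¬p) h
    boundary : ∀ d → (∀ σ → Face s t ℓ σ → ∂ s t d σ ≡ c σ) → ∀ F → length F ≡ ℓ → ∂ᶜ (restrict s t d) F ≡ c F
    boundary d h F e = by (T? (isFace s t F))
      where
      by : Dec (T (isFace s t F)) → ∂ᶜ (restrict s t d) F ≡ c F
      by (yes p) = trans (sym (∂≡∂ᶜ s t d F)) (h F (p , e))
      by (no ¬p) = trans (∂ᶜ-unsupported s t (restrict s t d) F (supp-d d) (¬p ∘ asc⇒isFace F))
                         (sym (unsupported supp F (¬p ∘ asc⇒isFace F)))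

  -- For a supported chain `w` is the smallest vertex, so this confines it to the ranks from `q` on.
  Headed : ℕ → (Chain → ℚ) → Set
  Headed q d = ∀ w F → d (w ∷ F) ≢ 0ℚ → q ≤ ρ w

  Filling : Fin n → Fin n → ℕ → ℕ → (Chain → ℚ) → Set
  Filling s t q ℓ c = Σ[ d ∈ (Chain → ℚ) ] Supported s t d × Headed q d × (∀ F → length F ≡ ℓ → ∂ᶜ d F ≡ c F)

  -- Removing the elements of rank q: the part of a filling through an element w of rank q is w joined with a
  -- cycle of ( w , t ), which bounds there; subtracting the boundary of the cone pushes the filling off w.
  module RaiseRank (cm : CohenMacaulay) (s t : Fin n) (q ℓ : ℕ) (bound : ℓ ℕ.+ suc q < ρ t)
    (c : Chain → ℚ) (c-headed : Headed (suc q) c)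
    (d : Chain → ℚ) (d-supp : Supported s t d) (d-headed : Headed q d) (d-bound : ∀ F → length F ≡ ℓ → ∂ᶜ d F ≡ c F) where

    atq : Fin n → ℚ
    atq w = if ρ w ℕ.≡ᵇ q then 1ℚ else 0ℚ

    atq-yes : ∀ w → ρ w ≡ q → atq w ≡ 1ℚ
    atq-yes w h with ρ w ℕ.≡ᵇ q | ℕₚ.≡⇒≡ᵇ (ρ w) q h
    ... | true | _ = refl

    atq≢0 : ∀ w → atq w ≢ 0ℚ → ρ w ≡ q
    atq≢0 w h = ℕₚ.≡ᵇ⇒≡ (ρ w) q (by (ρ w ℕ.≡ᵇ q) h)
      where
      by : ∀ b → (if b then 1ℚ else 0ℚ) ≢ 0ℚ → T b
      by true  _ = tt
      by false h = contradiction refl h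

    link-cycle : ∀ w → ρ w ≡ q → IsCycle ℓ (λ F → d (w ∷ F))
    link-cycle w ρw G e = begin
      ∂ᶜ (λ F → d (w ∷ F)) G
        ≡⟨ solve 2 (λ a b → a := b :- (b :- a)) refl (∂ᶜ (λ F → d (w ∷ F)) G) (∑ λ v → d (v ∷ w ∷ G)) ⟩
      ∑ (λ v → d (v ∷ w ∷ G)) ℚ.- ∂ᶜ d (w ∷ G)
        ≡⟨ cong₂ ℚ._-_ (∑-zero below-w) (trans (d-bound (w ∷ G) e) c-vanishes) ⟩
      0ℚ ∎
      where
      open ≡-Reasoning
      open +-*-Solver
      c-vanishes : c (w ∷ G) ≡ 0ℚ
      c-vanishes with c (w ∷ G) ℚₚ.≟ 0ℚ
      ... | yes p = p
      ... | no p  = contradiction (c-headed w G p) (ℕₚ.<⇒≱ (ℕₚ.≤-reflexive (cong suc ρw)))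
      below-w : ∀ v → d (v ∷ w ∷ G) ≡ 0ℚ
      below-w v with d (v ∷ w ∷ G) ℚₚ.≟ 0ℚ
      ... | yes p = p
      ... | no p  = contradiction (d-headed v (w ∷ G) p)
            (ℕₚ.<⇒≱ (subst (ρ v <_) ρw (rank-lt (proj₁ (∧-out (lt v w) (proj₂ (∧-out (lt s v) (d-supp (v ∷ w ∷ G) p))))))))

    Cone : Fin n → Set
    Cone w = Σ[ g ∈ (Chain → ℚ) ] (∀ F → g F ≢ 0ℚ → ρ w ≡ q × T (lt s w) × T (asc w t F)) ×
             (∀ F → length F ≡ ℓ → ∂ᶜ g F ≡ atq w ℚ.* d (w ∷ F))

    cone : ∀ w → Cone w
    cone w = by (ρ w ℕ.≟ q) (T? (lt s w)) (T? (lt w t))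
      where
      empty : (∀ F → atq w ℚ.* d (w ∷ F) ≡ 0ℚ) → Cone w
      empty h = (λ _ → 0ℚ) , (λ F p → contradiction refl p) ,
                λ F _ → trans (∂ᶜ-0 F (λ _ → 0ℚ) (λ _ _ → refl)) (sym (h F))
      by : Dec (ρ w ≡ q) → Dec (T (lt s w)) → Dec (T (lt w t)) → Cone w
      by (no h) _ _ = empty λ F → *-zero-≢0 (atq w) λ p → contradiction (atq≢0 w p) h
      by (yes _) (no h) _ = empty λ F → trans (cong (atq w ℚ.*_) (unsupported d-supp (w ∷ F) (h ∘ proj₁ ∘ ∧-out (lt s w)))) (ℚₚ.*-zeroʳ (atq w))
      by (yes _) (yes _) (no h) = empty λ F → trans (cong (atq w ℚ.*_) (unsupported d-supp (w ∷ F)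
        (h ∘ asc⇒lt w t F ∘ proj₂ ∘ ∧-out (lt s w)))) (ℚₚ.*-zeroʳ (atq w))
      by (yes ρw) (yes s<w) (yes w<t) =
        let g , g-supp , g-bound = cm-exact cm w t w<t ℓ ℓ≢ (λ F → d (w ∷ F)) (Supported-head d-supp w) (link-cycle w ρw)
        in g , (λ F h → ρw , s<w , g-supp F h) , λ F e →
           trans (g-bound F e) (sym (trans (cong (ℚ._* d (w ∷ F)) (atq-yes w ρw)) (ℚₚ.*-identityˡ (d (w ∷ F)))))
        where
        ℓ≢ : suc ℓ ≢ ρ[ w , t ]
        ℓ≢ e = ℕₚ.<-irrefl (trans (ℕₚ.+-suc ℓ q) (trans (cong (ℕ._+ q) e)
          (trans (cong (ρ[ w , t ] ℕ.+_) (sym ρw)) (ℕₚ.m∸n+n≡m (rank-≤ (lt⇒le w<t)))))) bound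

    start rest : Chain → ℚ
    start []      = 0ℚ
    start (w ∷ F) = atq w ℚ.* d (w ∷ F)
    rest F = d F ℚ.- start F

    through : Chain → ℚ
    through F = ∑ λ w → atq w ℚ.* d (w ∷ F)

    -- The remaining boundary terms lie in links of elements of rank `q`, which are cycles.
    ∂-start : ∀ F → length F ≡ ℓ → ∂ᶜ start F ≡ through F
    ∂-start []      e = refl
    ∂-start (u ∷ G) e = trans (cong (λ t → through (u ∷ G) ℚ.- t)
        (trans (∂ᶜ-* G (atq u) (λ F → d (u ∷ F))) (*-zero-≢0 (atq u) λ h → link-cycle u (atq≢0 u h) G e)))
      (ℚₚ.+-identityʳ (through (u ∷ G)))

    cones : Chain → ℚ
    cones F = ∑ λ w → proj₁ (cone w) F

    filling : Filling s t (suc q) ℓ c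
    filling = (λ F → rest F ℚ.+ cones F) , supp , headed , λ F e → begin
      ∂ᶜ (λ F → rest F ℚ.+ cones F) F
        ≡⟨ trans (∂ᶜ-+ F rest cones) (cong (∂ᶜ rest F ℚ.+_) (trans (∂ᶜ-∑ F (λ w → proj₁ (cone w)))
             (∑-cong λ w → proj₂ (proj₂ (cone w)) F e))) ⟩
      ∂ᶜ rest F ℚ.+ through F
        ≡⟨ cong (∂ᶜ rest F ℚ.+_) (∂-start F e) ⟨
      ∂ᶜ rest F ℚ.+ ∂ᶜ start F
        ≡⟨ ∂ᶜ-+ F rest start ⟨
      ∂ᶜ (λ F → rest F ℚ.+ start F) F
        ≡⟨ ∂ᶜ-cong F (λ F → rest F ℚ.+ start F) d (λ F _ → solve 2 (λ a b → (a :- b) :+ b := a) refl (d F) (start F)) ⟩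
      ∂ᶜ d F
        ≡⟨ d-bound F e ⟩
      c F ∎
      where
      open ≡-Reasoning
      open +-*-Solver
      d≢0 : ∀ F → rest F ≢ 0ℚ → d F ≢ 0ℚ
      d≢0 []      h d≡0 = h (cong (ℚ._- 0ℚ) d≡0)
      d≢0 (w ∷ F) h d≡0 = h (trans (cong (λ t → t ℚ.- atq w ℚ.* t) d≡0) (solve 1 (λ a → con 0ℚ :- a :* con 0ℚ := con 0ℚ) refl (atq w)))
      sum≢0 : ∀ F → cones F ≢ 0ℚ → Σ[ w ∈ Fin n ] proj₁ (cone w) F ≢ 0ℚ
      sum≢0 F h with all-or-some {A = λ w → proj₁ (cone w) F ≡ 0ℚ} {λ w → proj₁ (cone w) F ≢ 0ℚ}
                       (λ w → by (proj₁ (cone w) F ℚₚ.≟ 0ℚ))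
        where
        by : ∀ {a : ℚ} → Dec (a ≡ 0ℚ) → a ≡ 0ℚ ⊎ a ≢ 0ℚ
        by (yes p) = inj₁ p
        by (no p)  = inj₂ p
      ... | inj₁ z = contradiction (∑-zero z) h
      ... | inj₂ w = w
      either : ∀ F → rest F ℚ.+ cones F ≢ 0ℚ → rest F ≢ 0ℚ ⊎ Σ[ w ∈ Fin n ] proj₁ (cone w) F ≢ 0ℚ
      either F h with rest F ℚₚ.≟ 0ℚ
      ... | no p  = inj₁ p
      ... | yes p = inj₂ (sum≢0 F λ z → h (cong₂ ℚ._+_ p z))
      supp : Supported s t (λ F → rest F ℚ.+ cones F)
      supp F h with either F h
      ... | inj₁ p       = d-supp F (d≢0 F p)
      ... | inj₂ (w , p) = let _ , s<w , a = proj₁ (proj₂ (cone w)) F p in asc-extend s w t F s<w a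
      headed : Headed (suc q) (λ F → rest F ℚ.+ cones F)
      headed v F h with either (v ∷ F) h
      ... | inj₂ (w , p) = let ρw , _ , a = proj₁ (proj₂ (cone w)) (v ∷ F) p in
            subst (_< ρ v) ρw (rank-lt (proj₁ (∧-out (lt w v) a)))
      ... | inj₁ p = ℕₚ.≤∧≢⇒< (d-headed v F (d≢0 (v ∷ F) p)) λ q≡ρv → p (trans
            (cong (λ t → d (v ∷ F) ℚ.- t ℚ.* d (v ∷ F)) (atq-yes v (sym q≡ρv)))
            (solve 1 (λ a → a :- con 1ℚ :* a := con 0ℚ) refl (d (v ∷ F))))

  -- Removing the lowest ranks of an interval keeps homology concentrated in the top degree. `j`
  -- counts the removed ranks; each of them is removed by filling the links of its elements.
  truncated-exact : CohenMacaulay → ∀ s t j q ℓ → q ≡ suc (ρ s ℕ.+ j) → ℓ ℕ.+ q < ρ t →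
                    ∀ c → T (lt s t) → Supported s t c → Headed q c → IsCycle ℓ c → Filling s t q ℓ c
  truncated-exact cm s t zero q ℓ q≡ bound c s<t supp headed cyc =
    let d , d-supp , d-bound = cm-exact cm s t s<t ℓ ℓ≢ c supp cyc
    in d , d-supp , (λ w F h → subst (_≤ ρ w) (sym q≡′) (rank-lt (proj₁ (∧-out (lt s w) (d-supp (w ∷ F) h))))) , d-bound
    where
    q≡′ : q ≡ suc (ρ s)
    q≡′ = trans q≡ (cong suc (ℕₚ.+-identityʳ (ρ s)))
    ℓ≢ : suc ℓ ≢ ρ[ s , t ]
    ℓ≢ e = ℕₚ.<-irrefl (trans (cong (ℓ ℕ.+_) q≡′) (trans (ℕₚ.+-suc ℓ (ρ s)) (trans (cong (ℕ._+ ρ s) e)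
      (ℕₚ.m∸n+n≡m (rank-≤ (lt⇒le s<t)))))) bound
  truncated-exact cm s t (suc j) q ℓ refl bound c s<t supp headed cyc =
    let q′ = suc (ρ s ℕ.+ j)
        q≡ : suc (ρ s ℕ.+ suc j) ≡ suc q′
        q≡ = cong suc (ℕₚ.+-suc (ρ s) j)
        bound′ : ℓ ℕ.+ suc q′ < ρ t
        bound′ = subst (λ q → ℓ ℕ.+ q < ρ t) q≡ bound
        c-headed : Headed (suc q′) c
        c-headed = subst (λ q → Headed q c) q≡ headed
        d , d-supp , d-headed , d-bound = truncated-exact cm s t j q′ ℓ refl
          (ℕₚ.<-trans (ℕₚ.+-monoʳ-< ℓ (ℕₚ.n<1+n q′)) bound′) c s<t supp (λ w F h → ℕₚ.<⇒≤ (c-headed w F h)) cyc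
    in subst (λ q → Filling s t q ℓ c) (sym q≡)
         (RaiseRank.filling cm s t q′ ℓ bound′ c c-headed d d-supp d-headed d-bound)

-- Incidence numbers and top cycles of open intervals.

module Incidence (P : FinGradedBoundedPoset)
  (e : Fin (FinGradedBoundedPoset.n P) → Fin (FinGradedBoundedPoset.n P) → ℚ)
  (e-cover : ∀ x y → e x y ≢ 0ℚ → PosetNotions.Covers P x y) where

  open PosetNotions P hiding (∂)
  open GradedPoset P
  open Chains P
  open Differential le ρ e

  e-rank : ∀ {x y} → e x y ≢ 0ℚ → ρ y ≡ suc (ρ x)
  e-rank {x} {y} h = ρ-cover x y (e-cover x y h)

  e-lt : ∀ {x y} → e x y ≢ 0ℚ → T (lt x y)
  e-lt {x} {y} h = proj₁ (e-cover x y h)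

  -- A condition on single rows, since the rows are found from the top down and at each stage only
  -- the upper ones are final.
  Good : Fin n → Set
  Good x = (∀ y → Covers x y → e x y ≢ 0ℚ) × (∀ z → ∑ (λ y → e x y ℚ.* e y z) ≡ 0ℚ)

  GoodAbove : Fin n → Set
  GoodAbove s = ∀ x → T (le s x) → Good x

  ≡0-dec : ∀ {a : ℚ} → (a ≢ 0ℚ → ⊥) → a ≡ 0ℚ
  ≡0-dec {a} h with a ℚₚ.≟ 0ℚ
  ... | yes p = p
  ... | no p  = ⊥-elim (h p)

  module Top (t : Fin n) where

    -- The fundamental cycle of `( u , t )`: the product of the incidence numbers along the chain,
    -- zero unless the chain is saturated.
    z : Fin n → Chain → ℚ
    z u []      = e u t
    z u (v ∷ F) = e u v ℚ.* z v F

    z-supp : ∀ u → Supported u t (z u)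
    z-supp u []      h = e-lt h
    z-supp u (v ∷ F) h = ∧-in (lt u v) (e-lt (*-≢0ˡ {b = z v F} h)) (z-supp v F (*-≢0ʳ {e u v} h))

    -- Inserting a vertex between two consecutive ones sums the products of two incidence numbers
    -- over all middle elements, which is zero for good rows.
    z-cycle : ∀ u → GoodAbove u → ∀ G → ∂ᶜ (z u) G ≡ 0ℚ
    z-cycle u good []      = proj₂ (good u (le-refl u)) t
    z-cycle u good (v ∷ G) = cong₂ ℚ._-_
      (trans (∑-cong λ w → sym (ℚₚ.*-assoc (e u w) (e w v) (z v G)))
        (trans (sym (∑-*ʳ (λ w → e u w ℚ.* e w v) (z v G)))
          (trans (cong (ℚ._* z v G) (proj₂ (good u (le-refl u)) v)) (ℚₚ.*-zeroˡ (z v G)))))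
      (trans (∂ᶜ-* G (e u v) (z v)) (*-zero-≢0 (e u v) λ h →
        z-cycle v (λ x p → good x (le-trans u v x (lt⇒le (e-lt h)) p)) G))

    Saturated : Fin n → Set
    Saturated u = Σ[ F ∈ Chain ] z u F ≢ 0ℚ × suc (length F) ℕ.+ ρ u ≡ ρ t

    saturated : ∀ u → T (lt u t) → GoodAbove u → Saturated u
    saturated u = go u (gt-wf u)
      where
      go : ∀ u → Acc (λ x y → T (lt y x)) u → T (lt u t) → GoodAbove u → Saturated u
      go u (acc rec) u<t good with upper-cover u<t
      ... | w , c , w≤t with w Fin.≟ t
      ... | yes refl = [] , proj₁ (good u (le-refl u)) w c , sym (ρ-cover u w c)
      ... | no w≢t   =
        let F , zF , len = go w (rec (proj₁ c)) (le∧≢⇒lt w≤t w≢t) (λ x p → good x (le-trans u w x (lt⇒le (proj₁ c)) p))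
        in w ∷ F , *-nonzero (proj₁ (good u (le-refl u)) w c) zF ,
           trans (sym (ℕₚ.+-suc (suc (length F)) (ρ u))) (trans (cong (suc (length F) ℕ.+_) (sym (ρ-cover u w c))) len)

    -- The top-dimensional cycles of the open interval ( σ , t ) are the multiples of z σ.
    UniqueTop : Fin n → Set
    UniqueTop σ = ∀ g → Supported σ t g → (∀ G → suc (suc (length G)) ℕ.+ ρ σ ≡ ρ t → ∂ᶜ g G ≡ 0ℚ) →
                  Σ[ y ∈ ℚ ] (∀ F → suc (length F) ℕ.+ ρ σ ≡ ρ t → g F ≡ y ℚ.* z σ F)

    head-rank : ∀ {σ w} H → T (asc σ t (w ∷ H)) → suc (suc (length H)) ℕ.+ ρ σ ≡ ρ t → ρ w ≡ suc (ρ σ)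
    head-rank {σ} {w} H a len = ℕₚ.≤-antisym
      (s≤s⁻¹ (ℕₚ.+-cancelʳ-≤ (length H) (suc (ρ w)) (suc (suc (ρ σ)))
        (ℕₚ.≤-trans (asc-length w t H (proj₂ (∧-out (lt σ w) a)))
          (ℕₚ.≤-reflexive (trans (sym len) (cong (λ k → suc (suc k)) (ℕₚ.+-comm (length H) (ρ σ))))))))
      (rank-lt (proj₁ (∧-out (lt σ w) a)))

    too-long : ∀ {s d} → Supported s t d → ∀ υ F → suc (length F) ℕ.+ ρ υ ≡ ρ t → ∂ᶜ (λ F′ → d (υ ∷ F′)) F ≡ 0ℚ
    too-long {s} {d} supp υ F len = ∂ᶜ-0 F (λ F′ → d (υ ∷ F′)) λ F′ eq → ≡0-dec λ h →
      ℕₚ.<-irrefl (trans (cong (ρ υ ℕ.+_) eq) (trans (ℕₚ.+-comm (ρ υ) (suc (length F))) len))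
        (asc-length υ t F′ (proj₂ (∧-out (lt s υ) (supp (υ ∷ F′) h))))

    module UniqueStep (σ : Fin n) (σ<t : T (lt σ t)) (good : GoodAbove σ) (exact-σ : Exact σ t)
      (IH : ∀ τ → T (lt σ τ) → T (lt τ t) → UniqueTop τ)
      (g : Chain → ℚ) (supp : Supported σ t g) (cyc : ∀ G → suc (suc (length G)) ℕ.+ ρ σ ≡ ρ t → ∂ᶜ g G ≡ 0ℚ) where

      Coeff : Fin n → Set
      Coeff τ = Σ[ y ∈ ℚ ] (ρ τ ≡ suc (ρ σ) → ∀ F → suc (length F) ℕ.+ ρ τ ≡ ρ t → g (τ ∷ F) ≡ y ℚ.* z τ F)

      link-cycle : ∀ τ → ρ τ ≡ suc (ρ σ) → ∀ G → suc (suc (length G)) ℕ.+ ρ τ ≡ ρ t → ∂ᶜ (λ F → g (τ ∷ F)) G ≡ 0ℚ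
      link-cycle τ ρτ G len = begin
        ∂ᶜ (λ F → g (τ ∷ F)) G
          ≡⟨ solve 2 (λ a b → a := b :- (b :- a)) refl (∂ᶜ (λ F → g (τ ∷ F)) G) (∑ λ v → g (v ∷ τ ∷ G)) ⟩
        ∑ (λ v → g (v ∷ τ ∷ G)) ℚ.- ∂ᶜ g (τ ∷ G)
          ≡⟨ cong₂ ℚ._-_ (∑-zero λ v → ≡0-dec (between v)) (cyc (τ ∷ G) (trans (sym (trans (cong (suc (suc (length G)) ℕ.+_) ρτ)
               (ℕₚ.+-suc (suc (suc (length G))) (ρ σ)))) len)) ⟩
        0ℚ ∎
        where
        open ≡-Reasoning
        open +-*-Solver
        between : ∀ v → g (v ∷ τ ∷ G) ≢ 0ℚ → ⊥
        between v h =
          let a , b = ∧-out (lt σ v) (supp (v ∷ τ ∷ G) h)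
              v<τ = rank-lt (proj₁ (∧-out (lt v τ) b))
          in ℕₚ.<⇒≱ (rank-lt a) (s≤s⁻¹ (subst (ρ v <_) ρτ v<τ))

      coeffs : ∀ τ → Coeff τ
      coeffs τ = by (ρ τ ℕ.≟ suc (ρ σ)) (T? (lt σ τ)) (T? (lt τ t))
        where
        vanishing : (∀ F → g (τ ∷ F) ≡ 0ℚ) → Coeff τ
        vanishing h = 0ℚ , λ _ F _ → trans (h F) (sym (ℚₚ.*-zeroˡ (z τ F)))
        by : Dec (ρ τ ≡ suc (ρ σ)) → Dec (T (lt σ τ)) → Dec (T (lt τ t)) → Coeff τ
        by (no h) _ _ = 0ℚ , λ p → contradiction p h
        by (yes _) (no h) _ = vanishing λ F → unsupported supp (τ ∷ F) (h ∘ proj₁ ∘ ∧-out (lt σ τ))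
        by (yes _) (yes _) (no h) = vanishing λ F → unsupported supp (τ ∷ F) (h ∘ asc⇒lt τ t F ∘ proj₂ ∘ ∧-out (lt σ τ))
        by (yes ρτ) (yes σ<τ) (yes τ<t) =
          let y , h = IH τ σ<τ τ<t (λ F → g (τ ∷ F)) (Supported-head supp τ) (link-cycle τ ρτ) in y , λ _ → h

      y : Fin n → ℚ
      y τ = proj₁ (coeffs τ)

      shift : ∀ {τ} (H : Chain) → suc (suc (length H)) ℕ.+ ρ σ ≡ ρ t → ρ τ ≡ suc (ρ σ) → suc (length H) ℕ.+ ρ τ ≡ ρ t
      shift H len ρτ = trans (cong (suc (length H) ℕ.+_) ρτ) (trans (ℕₚ.+-suc (suc (length H)) (ρ σ)) len)

      term : ∀ w υ H k → suc (suc (length H)) ℕ.+ ρ σ ≡ ρ t → ρ υ ≡ suc (suc (ρ σ)) → z w H ≡ e w υ ℚ.* k →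
             g (w ∷ H) ≡ ((δ σ w ℚ.* e w υ) ℚ.* y w) ℚ.* k
      term w υ H k len ρυ zH = by (ρ w ℕ.≟ suc (ρ σ)) (T? (le σ w))
        where
        open +-*-Solver
        by : Dec (ρ w ≡ suc (ρ σ)) → Dec (T (le σ w)) → g (w ∷ H) ≡ ((δ σ w ℚ.* e w υ) ℚ.* y w) ℚ.* k
        by (yes ρw) (yes σ≤w) = trans (proj₂ (coeffs w) ρw H (shift H len ρw))
          (trans (cong (y w ℚ.*_) zH)
            (trans (solve 3 (λ y e k → y :* (e :* k) := ((con 1ℚ :* e) :* y) :* k) refl (y w) (e w υ) k)
                   (cong (λ d → ((d ℚ.* e w υ) ℚ.* y w) ℚ.* k) (sym (δ-yes σ≤w)))))
        by (yes _) (no σ≰w) = trans (unsupported supp (w ∷ H) (σ≰w ∘ lt⇒le ∘ proj₁ ∘ ∧-out (lt σ w)))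
          (sym (trans (cong (λ d → ((d ℚ.* e w υ) ℚ.* y w) ℚ.* k) (≡0-dec (σ≰w ∘ δ≢0)))
            (solve 3 (λ y e k → ((con 0ℚ :* e) :* y) :* k := con 0ℚ) refl (y w) (e w υ) k)))
        by (no ρw≢) _ = trans (unsupported supp (w ∷ H) λ a → ρw≢ (head-rank H a len))
          (sym (trans (cong (λ d → ((δ σ w ℚ.* d) ℚ.* y w) ℚ.* k)
                 (≡0-dec λ h → ρw≢ (ℕₚ.suc-injective (trans (sym (e-rank h)) ρυ))))
            (solve 3 (λ d y k → ((d :* con 0ℚ) :* y) :* k := con 0ℚ) refl (δ σ w) (y w) k)))

      closed : ∀ υ → ρ υ ≡ suc (suc (ρ σ)) → T (le σ υ) → T (le υ t) → ∑ (λ τ → (δ σ τ ℚ.* e τ υ) ℚ.* y τ) ≡ 0ℚ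
      closed υ ρυ σ≤υ υ≤t = by (υ Fin.≟ t)
        where
        open ≡-Reasoning
        by : Dec (υ ≡ t) → ∑ (λ τ → (δ σ τ ℚ.* e τ υ) ℚ.* y τ) ≡ 0ℚ
        by (yes refl) = begin
          ∑ (λ τ → (δ σ τ ℚ.* e τ υ) ℚ.* y τ)
            ≡⟨ ∑-cong (λ τ → trans (sym (ℚₚ.*-identityʳ _)) (sym (term τ υ [] 1ℚ (sym ρυ) ρυ (sym (ℚₚ.*-identityʳ (e τ υ)))))) ⟩
          ∂ᶜ g []
            ≡⟨ cyc [] (sym ρυ) ⟩
          0ℚ ∎
        -- The equation is read off at a saturated chain `F` above `υ`, where `z υ F` is nonzero and
        -- cancels.
        by (no υ≢t) = *-cancel-0 zF (begin
          z υ F ℚ.* ∑ (λ τ → (δ σ τ ℚ.* e τ υ) ℚ.* y τ)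
            ≡⟨ ℚₚ.*-comm (z υ F) _ ⟩
          ∑ (λ τ → (δ σ τ ℚ.* e τ υ) ℚ.* y τ) ℚ.* z υ F
            ≡⟨ ∑-*ʳ (λ τ → (δ σ τ ℚ.* e τ υ) ℚ.* y τ) (z υ F) ⟩
          ∑ (λ τ → ((δ σ τ ℚ.* e τ υ) ℚ.* y τ) ℚ.* z υ F)
            ≡⟨ ∑-cong (λ τ → sym (term τ υ (υ ∷ F) (z υ F) len′ ρυ refl)) ⟩
          ∑ (λ τ → g (τ ∷ υ ∷ F))
            ≡⟨ solve 1 (λ a → a := a :- con 0ℚ) refl _ ⟩
          ∑ (λ τ → g (τ ∷ υ ∷ F)) ℚ.- 0ℚ
            ≡⟨ cong (λ u → ∑ (λ τ → g (τ ∷ υ ∷ F)) ℚ.- u) (too-long supp υ F len) ⟨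
          ∂ᶜ g (υ ∷ F)
            ≡⟨ cyc (υ ∷ F) len′ ⟩
          0ℚ ∎)
          where
          open +-*-Solver
          sat = saturated υ (le∧≢⇒lt υ≤t υ≢t) (λ x p → good x (le-trans σ υ x σ≤υ p))
          F = proj₁ sat
          zF = proj₁ (proj₂ sat)
          len = proj₂ (proj₂ sat)
          len′ : suc (suc (suc (length F))) ℕ.+ ρ σ ≡ ρ t
          len′ = trans (sym (trans (ℕₚ.+-suc (suc (length F)) (suc (ρ σ))) (cong suc (ℕₚ.+-suc (suc (length F)) (ρ σ)))))
                       (trans (cong (suc (length F) ℕ.+_) (sym ρυ)) len)

      sol : Σ[ y′ ∈ (Fin n → ℚ) ] (∀ τ → ρ τ ≡ suc (ρ σ) → T (le σ τ) → T (le τ t) →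
                                   ∑ (λ π → (δ σ π ℚ.* e π τ) ℚ.* y′ π) ≡ y τ)
      sol = exact-σ (suc (ρ σ)) y closed

      only-σ : ∀ (y′ : Fin n → ℚ) τ → ρ τ ≡ suc (ρ σ) → ∑ (λ π → (δ σ π ℚ.* e π τ) ℚ.* y′ π) ≡ e σ τ ℚ.* y′ σ
      only-σ y′ τ ρτ = trans
        (∑-single σ λ π π≢σ → trans (cong (ℚ._* y′ π) (≡0-dec λ h → π≢σ (sym (rank-eq (δ≢0 (*-≢0ˡ {b = e π τ} h))
          (ℕₚ.suc-injective (trans (sym ρτ) (e-rank (*-≢0ʳ {δ σ π} h)))))))) (ℚₚ.*-zeroˡ (y′ π)))
        (cong (ℚ._* y′ σ) (trans (cong (ℚ._* e σ τ) (δ-yes (le-refl σ))) (ℚₚ.*-identityˡ (e σ τ))))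

      result : Σ[ a ∈ ℚ ] (∀ F → suc (length F) ℕ.+ ρ σ ≡ ρ t → g F ≡ a ℚ.* z σ F)
      result = by (ρ t ℕ.≟ suc (ρ σ))
        where
        open +-*-Solver
        by : Dec (ρ t ≡ suc (ρ σ)) → Σ[ a ∈ ℚ ] (∀ F → suc (length F) ℕ.+ ρ σ ≡ ρ t → g F ≡ a ℚ.* z σ F)
        by (yes ρt) =
          let k , ke≡1 = inv (proj₁ (good σ (le-refl σ)) t (le∧rank⇒Covers (lt⇒le σ<t) ρt))
          in g [] ℚ.* k , multiple k ke≡1
          where
          multiple : ∀ k → k ℚ.* e σ t ≡ 1ℚ → ∀ F → suc (length F) ℕ.+ ρ σ ≡ ρ t → g F ≡ (g [] ℚ.* k) ℚ.* z σ F
          multiple k ke≡1 []      _   =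
            sym (trans (ℚₚ.*-assoc (g []) k (e σ t)) (trans (cong (g [] ℚ.*_) ke≡1) (ℚₚ.*-identityʳ (g []))))
          multiple k ke≡1 (τ ∷ F) len = contradiction (trans len ρt) λ eq → ℕₚ.m≢1+n+m (ρ σ) (sym (ℕₚ.suc-injective eq))
        by (no ρt≢) = proj₁ sol σ , multiple
          where
          in-chain : ∀ τ F → suc (suc (length F)) ℕ.+ ρ σ ≡ ρ t → Dec (T (asc σ t (τ ∷ F))) →
                     g (τ ∷ F) ≡ proj₁ sol σ ℚ.* (e σ τ ℚ.* z τ F)
          in-chain τ F len (no h) = trans (unsupported supp (τ ∷ F) h)
            (sym (trans (cong (proj₁ sol σ ℚ.*_) (unsupported (z-supp σ) (τ ∷ F) h)) (ℚₚ.*-zeroʳ (proj₁ sol σ))))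
          in-chain τ F len (yes a) =
            let p , q = ∧-out (lt σ τ) a
                ρτ = head-rank F a len
            in trans (proj₂ (coeffs τ) ρτ F (shift F len ρτ))
                 (trans (cong (ℚ._* z τ F) (trans (sym (proj₂ sol τ ρτ (lt⇒le p) (lt⇒le (asc⇒lt τ t F q)))) (only-σ (proj₁ sol) τ ρτ)))
                   (solve 3 (λ e y z → (e :* y) :* z := y :* (e :* z)) refl (e σ τ) (proj₁ sol σ) (z τ F)))
          multiple : ∀ F → suc (length F) ℕ.+ ρ σ ≡ ρ t → g F ≡ proj₁ sol σ ℚ.* z σ F
          multiple []      len = contradiction (sym len) ρt≢
          multiple (τ ∷ F) len = in-chain τ F len (T? (asc σ t (τ ∷ F)))

    -- The link of `g` at a cover `τ` of `σ` is a top cycle, hence by induction `y τ` times `z τ`.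
    -- The boundary of `g` at chains starting in rank `ρ σ + 2` says that `y` is closed on `[σ, t]`.
    -- By exactness `y` is a multiple of the row `e σ`, and `g` is the same multiple of `z σ`.
    unique-top : ∀ σ → T (lt σ t) → GoodAbove σ → (∀ x → T (le σ x) → T (lt x t) → Exact x t) → UniqueTop σ
    unique-top σ = go σ (gt-wf σ)
      where
      go : ∀ σ → Acc (λ x y → T (lt y x)) σ → T (lt σ t) → GoodAbove σ → (∀ x → T (le σ x) → T (lt x t) → Exact x t) → UniqueTop σ
      go σ (acc rec) σ<t good ex g supp cyc = UniqueStep.result σ σ<t good (ex σ (le-refl σ) σ<t)
        (λ τ σ<τ τ<t → go τ (rec σ<τ) τ<t (λ x p → good x (le-trans σ τ x (lt⇒le σ<τ) p))
                                          (λ x p → ex x (le-trans σ τ x (lt⇒le σ<τ) p)))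
        g supp cyc

-- Exactness of the cellular cochain complex of an interval.

module UpperExactness (P : FinGradedBoundedPoset) (cm : PosetNotions.CohenMacaulay P)
  (e : Fin (FinGradedBoundedPoset.n P) → Fin (FinGradedBoundedPoset.n P) → ℚ)
  (e-cover : ∀ x y → e x y ≢ 0ℚ → PosetNotions.Covers P x y)
  (s t : Fin (FinGradedBoundedPoset.n P)) (s<t : T (PosetNotions.lt P s t))
  (good : ∀ x → T (PosetNotions.lt P s x) → Incidence.Good P e e-cover x)
  (exact-above : ∀ x → T (PosetNotions.lt P s x) → T (PosetNotions.lt P x t) →
                 Differential.Exact (FinGradedBoundedPoset.le P) (FinGradedBoundedPoset.ρ P) e x t) where

  open PosetNotions P hiding (∂)
  open GradedPoset P
  open Chains P
  open Differential le ρ e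
  open Incidence P e e-cover
  open Top t

  Closed : ℕ → (Fin n → ℚ) → Set
  Closed r x = ∀ υ → ρ υ ≡ suc r → T (le s υ) → T (le υ t) → ∑ (λ τ → (δ s τ ℚ.* e τ υ) ℚ.* x τ) ≡ 0ℚ

  Primitive : ℕ → (Fin n → ℚ) → Set
  Primitive r x = Σ[ y ∈ (Fin n → ℚ) ] (∀ τ → ρ τ ≡ r → T (le s τ) → T (le τ t) →
                                        ∑ (λ π → (δ s π ℚ.* e π τ) ℚ.* y π) ≡ x τ)

  module Middle (r : ℕ) (s<r : ρ s < r) (r<t : suc r < ρ t) (x : Fin n → ℚ) (closed : Closed (suc r) x) where

    κ : Fin n → ℚ
    κ τ = if ρ τ ℕ.≡ᵇ suc r then δ s τ ℚ.* x τ else 0ℚ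

    κ-yes : ∀ τ → ρ τ ≡ suc r → κ τ ≡ δ s τ ℚ.* x τ
    κ-yes τ h = cong (λ b → if b then δ s τ ℚ.* x τ else 0ℚ) (T⇒≡true (ℕₚ.≡⇒≡ᵇ (ρ τ) (suc r) h))

    κ≢0 : ∀ τ → κ τ ≢ 0ℚ → ρ τ ≡ suc r × T (lt s τ)
    κ≢0 τ h with ρ τ ℕ.≟ suc r
    ... | yes p = p , le∧rank⇒lt (δ≢0 (*-≢0ˡ {b = x τ} (h ∘ trans (κ-yes τ p)))) (subst (ρ s <_) (sym p) (ℕₚ.m≤n⇒m≤1+n s<r))
    ... | no ¬p = contradiction κ≡0 h
      where
      κ≡0 : κ τ ≡ 0ℚ
      κ≡0 with ρ τ ℕ.≡ᵇ suc r in eq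
      ... | false = refl
      ... | true  = contradiction (ℕₚ.≡ᵇ⇒≡ (ρ τ) (suc r) (subst T (sym eq) tt)) ¬p

    -- The simplicial form of the cochain: each cell `τ` of rank `r + 1` is joined with the
    -- fundamental cycle of `( τ , t )`.
    chain : Chain → ℚ
    chain []      = 0ℚ
    chain (τ ∷ F) = κ τ ℚ.* z τ F

    chain-supp : Supported s t chain
    chain-supp []      h = contradiction refl h
    chain-supp (τ ∷ F) h = ∧-in (lt s τ) (proj₂ (κ≢0 τ (*-≢0ˡ {b = z τ F} h))) (z-supp τ F (*-≢0ʳ {κ τ} h))

    good-above : ∀ u → T (lt s u) → GoodAbove u
    good-above u s<u x u≤x = good x (lt-le-trans s<u u≤x)

    κ-closed : ∀ u → T (le u t) → ∑ (λ w → κ w ℚ.* e w u) ≡ 0ℚ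
    κ-closed u u≤t = by (ρ u ℕ.≟ suc (suc r)) (T? (le s u))
      where
      nothing-below : (∀ w → κ w ≢ 0ℚ → e w u ≢ 0ℚ → ⊥) → ∑ (λ w → κ w ℚ.* e w u) ≡ 0ℚ
      nothing-below h = ∑-zero λ w → ≡0-dec λ p → h w (*-≢0ˡ {b = e w u} p) (*-≢0ʳ {κ w} p)
      by : Dec (ρ u ≡ suc (suc r)) → Dec (T (le s u)) → ∑ (λ w → κ w ℚ.* e w u) ≡ 0ℚ
      by (no h) _ = nothing-below λ w p q → h (trans (e-rank q) (cong suc (proj₁ (κ≢0 w p))))
      by (yes _) (no h) = nothing-below λ w p q → h (lt⇒le (lt-trans (proj₂ (κ≢0 w p)) (e-lt q)))
      by (yes ρu) (yes s≤u) = trans (∑-cong λ w → trans (ℚₚ.*-comm (κ w) (e w u)) (trans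
        (*-cong-≢0 (e w u) λ q → κ-yes w (ℕₚ.suc-injective (trans (sym (e-rank q)) ρu)))
        (solve 3 (λ e d x → e :* (d :* x) := (d :* e) :* x) refl (e w u) (δ s w) (x w)))) (closed u ρu s≤u u≤t)
        where open +-*-Solver

    -- Inserting a vertex in front gives the coboundary of `x`; later insertions give boundaries of
    -- fundamental cycles.
    chain-cycle : ∀ G → ∂ᶜ chain G ≡ 0ℚ
    chain-cycle []      = κ-closed t (le-refl t)
    chain-cycle (u ∷ G) = cong₂ ℚ._-_
      (trans (∑-cong λ w → sym (ℚₚ.*-assoc (κ w) (e w u) (z u G)))
        (trans (sym (∑-*ʳ (λ w → κ w ℚ.* e w u) (z u G)))
          (trans (ℚₚ.*-comm _ (z u G)) (*-zero-≢0 (z u G) λ h → κ-closed u (lt⇒le (asc⇒lt u t G (z-supp u G h)))))))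
      (trans (∂ᶜ-* G (κ u) (z u)) (*-zero-≢0 (κ u) λ h → z-cycle u (good-above u (proj₂ (κ≢0 u h))) G))

    ℓ : ℕ
    ℓ = ρ t ∸ suc r

    ℓ+ : ℓ ℕ.+ suc r ≡ ρ t
    ℓ+ = ℕₚ.m∸n+n≡m (ℕₚ.<⇒≤ r<t)

    filled : Filling s t r ℓ chain
    -- Truncation at rank `r` leaves room for exactly one more vertex, as `ℓ + r` is one less than
    -- `ρ t`.
    filled = truncated-exact cm s t (r ∸ suc (ρ s)) r ℓ (sym (ℕₚ.m+[n∸m]≡n s<r))
      (ℕₚ.≤-reflexive (trans (sym (ℕₚ.+-suc ℓ r)) ℓ+)) chain s<t chain-supp
      (λ w F h → subst (r ≤_) (sym (proj₁ (κ≢0 w (*-≢0ˡ {b = z w F} h)))) (ℕₚ.n≤1+n r)) (λ G _ → chain-cycle G)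

    Y : Chain → ℚ
    Y = proj₁ filled
    Y-supp : Supported s t Y
    Y-supp = proj₁ (proj₂ filled)
    Y-headed : Headed r Y
    Y-headed = proj₁ (proj₂ (proj₂ filled))
    Y-bound : ∀ F → length F ≡ ℓ → ∂ᶜ Y F ≡ chain F
    Y-bound = proj₂ (proj₂ (proj₂ filled))

    length-ℓ : ∀ (F : Chain) → suc (length F) ℕ.+ suc r ≡ ρ t → suc (length F) ≡ ℓ
    length-ℓ F len = ℕₚ.+-cancelʳ-≡ (suc r) _ _ (trans len (sym ℓ+))

    link-cycle : ∀ σ → ρ σ ≡ r → ∀ G → suc (suc (length G)) ℕ.+ ρ σ ≡ ρ t → ∂ᶜ (λ F → Y (σ ∷ F)) G ≡ 0ℚ
    link-cycle σ ρσ G len = begin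
      ∂ᶜ (λ F → Y (σ ∷ F)) G
        ≡⟨ solve 2 (λ a b → a := b :- (b :- a)) refl (∂ᶜ (λ F → Y (σ ∷ F)) G) (∑ λ v → Y (v ∷ σ ∷ G)) ⟩
      ∑ (λ v → Y (v ∷ σ ∷ G)) ℚ.- ∂ᶜ Y (σ ∷ G)
        ≡⟨ cong₂ ℚ._-_ (∑-zero λ v → ≡0-dec (below-σ v)) (trans (Y-bound (σ ∷ G) len′) (≡0-dec λ h →
             ℕₚ.1+n≢n (trans (sym (proj₁ (κ≢0 σ (*-≢0ˡ {b = z σ G} h)))) ρσ))) ⟩
      0ℚ ∎
      where
      open ≡-Reasoning
      open +-*-Solver
      len′ : suc (length G) ≡ ℓ
      len′ = length-ℓ G (trans (ℕₚ.+-suc (suc (length G)) r) (trans (cong (λ k → suc (suc (length G)) ℕ.+ k) (sym ρσ)) len))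
      below-σ : ∀ v → Y (v ∷ σ ∷ G) ≢ 0ℚ → ⊥
      below-σ v h = ℕₚ.<⇒≱ (subst (ρ v <_) ρσ (rank-lt (proj₁ (∧-out (lt v σ) (proj₂ (∧-out (lt s v) (Y-supp (v ∷ σ ∷ G) h)))))))
                           (Y-headed v (σ ∷ G) h)

    Coeff : Fin n → Set
    Coeff σ = Σ[ y ∈ ℚ ] (ρ σ ≡ r → T (lt s σ) → T (lt σ t) → ∀ F → suc (length F) ℕ.+ ρ σ ≡ ρ t → Y (σ ∷ F) ≡ y ℚ.* z σ F)

    coeffs : ∀ σ → Coeff σ
    coeffs σ = by (ρ σ ℕ.≟ r) (T? (lt s σ)) (T? (lt σ t))
      where
      by : Dec (ρ σ ≡ r) → Dec (T (lt s σ)) → Dec (T (lt σ t)) → Coeff σ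
      by (no h) _ _ = 0ℚ , λ p → contradiction p h
      by (yes _) (no h) _ = 0ℚ , λ _ p → contradiction p h
      by (yes _) (yes _) (no h) = 0ℚ , λ _ _ p → contradiction p h
      by (yes ρσ) (yes s<σ) (yes σ<t) =
        let y , h = unique-top σ σ<t (good-above σ s<σ)
                      (λ x σ≤x x<t → exact-above x (lt-le-trans s<σ σ≤x) x<t)
                      (λ F → Y (σ ∷ F)) (Supported-head Y-supp σ) (link-cycle σ ρσ)
        in y , λ _ _ _ → h

    y : Fin n → ℚ
    y σ = proj₁ (coeffs σ)

    term : ∀ σ τ F → ρ τ ≡ suc r → T (lt τ t) → suc (length F) ℕ.+ ρ τ ≡ ρ t →
           Y (σ ∷ τ ∷ F) ≡ ((δ s σ ℚ.* e σ τ) ℚ.* y σ) ℚ.* z τ F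
    term σ τ F ρτ τ<t len = by (ρ σ ℕ.≟ r) (T? (le s σ)) (T? (lt σ t))
      where
      open +-*-Solver
      e-zero : e σ τ ≡ 0ℚ → 0ℚ ≡ ((δ s σ ℚ.* e σ τ) ℚ.* y σ) ℚ.* z τ F
      e-zero h = sym (trans (cong (λ d → ((δ s σ ℚ.* d) ℚ.* y σ) ℚ.* z τ F) h)
        (solve 3 (λ d y k → ((d :* con 0ℚ) :* y) :* k := con 0ℚ) refl (δ s σ) (y σ) (z τ F)))
      by : Dec (ρ σ ≡ r) → Dec (T (le s σ)) → Dec (T (lt σ t)) → Y (σ ∷ τ ∷ F) ≡ ((δ s σ ℚ.* e σ τ) ℚ.* y σ) ℚ.* z τ F
      by (no ρσ≢) _ _ = trans
        (≡0-dec λ h → ρσ≢ (ℕₚ.≤-antisym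
          (s≤s⁻¹ (subst (ρ σ <_) ρτ (rank-lt (proj₁ (∧-out (lt σ τ) (proj₂ (∧-out (lt s σ) (Y-supp (σ ∷ τ ∷ F) h))))))))
          (Y-headed σ (τ ∷ F) h)))
        (e-zero (≡0-dec λ h → ρσ≢ (ℕₚ.suc-injective (trans (sym (e-rank h)) ρτ))))
      by (yes ρσ) (no s≰σ) _ = trans (unsupported Y-supp (σ ∷ τ ∷ F) (s≰σ ∘ lt⇒le ∘ proj₁ ∘ ∧-out (lt s σ)))
        (sym (trans (cong (λ d → ((d ℚ.* e σ τ) ℚ.* y σ) ℚ.* z τ F) (≡0-dec (s≰σ ∘ δ≢0)))
          (solve 3 (λ e y k → ((con 0ℚ :* e) :* y) :* k := con 0ℚ) refl (e σ τ) (y σ) (z τ F))))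
      by (yes ρσ) (yes s≤σ) (no σ≮t) = trans
        (unsupported Y-supp (σ ∷ τ ∷ F) (σ≮t ∘ asc⇒lt σ t (τ ∷ F) ∘ proj₂ ∘ ∧-out (lt s σ)))
        (e-zero (≡0-dec λ h → σ≮t (lt-trans (e-lt h) τ<t)))
      by (yes ρσ) (yes s≤σ) (yes σ<t) = trans
        (proj₂ (coeffs σ) ρσ (le∧rank⇒lt s≤σ (subst (ρ s <_) (sym ρσ) s<r)) σ<t (τ ∷ F)
          (trans (cong (λ k → suc (suc (length F)) ℕ.+ k) ρσ) (trans (sym (ℕₚ.+-suc (suc (length F)) r))
            (trans (cong (suc (length F) ℕ.+_) (sym ρτ)) len))))
        (trans (solve 3 (λ y e k → y :* (e :* k) := ((con 1ℚ :* e) :* y) :* k) refl (y σ) (e σ τ) (z τ F))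
               (cong (λ d → ((d ℚ.* e σ τ) ℚ.* y σ) ℚ.* z τ F) (sym (δ-yes s≤σ))))

    -- `Y` has top dimension among the ranks from `r` on, so its link at a cell `σ` of rank `r` is a
    -- top cycle of `( σ , t )`, that is `y σ` times the fundamental one. Comparing the boundary of
    -- `Y` with `chain` at `τ ∷ F` and cancelling `z τ F` shows that `y` is a primitive.
    primitive-y : Primitive (suc r) x
    primitive-y = y , λ τ ρτ s≤τ τ≤t →
      let s<τ = le∧rank⇒lt s≤τ (subst (ρ s <_) (sym ρτ) (ℕₚ.m≤n⇒m≤1+n s<r))
          τ<t = le∧rank⇒lt τ≤t (subst (_< ρ t) (sym ρτ) r<t)
          F , zF , len = saturated τ τ<t (good-above τ s<τ)
      in x-y≡0⇒x≡y (*-cancel-0 zF (begin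
        z τ F ℚ.* (∑ (λ σ → (δ s σ ℚ.* e σ τ) ℚ.* y σ) ℚ.- x τ)
          ≡⟨ solve 3 (λ k a b → k :* (a :- b) := a :* k :- b :* k) refl (z τ F) (∑ λ σ → (δ s σ ℚ.* e σ τ) ℚ.* y σ) (x τ) ⟩
        ∑ (λ σ → (δ s σ ℚ.* e σ τ) ℚ.* y σ) ℚ.* z τ F ℚ.- x τ ℚ.* z τ F
          ≡⟨ cong₂ ℚ._-_
               (trans (∑-*ʳ (λ σ → (δ s σ ℚ.* e σ τ) ℚ.* y σ) (z τ F)) (∑-cong λ σ → sym (term σ τ F ρτ τ<t len)))
               (cong (ℚ._* z τ F) (sym (trans (κ-yes τ ρτ) (trans (cong (ℚ._* x τ) (δ-yes s≤τ)) (ℚₚ.*-identityˡ (x τ)))))) ⟩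
        ∑ (λ σ → Y (σ ∷ τ ∷ F)) ℚ.- chain (τ ∷ F)
          ≡⟨ cong₂ ℚ._-_ (trans (solve 1 (λ a → a := a :- con 0ℚ) refl (∑ λ σ → Y (σ ∷ τ ∷ F)))
               (cong (λ u → ∑ (λ σ → Y (σ ∷ τ ∷ F)) ℚ.- u) (sym (too-long Y-supp τ F len))))
               (sym (Y-bound (τ ∷ F) (length-ℓ F (trans (cong (suc (length F) ℕ.+_) (sym ρτ)) len)))) ⟩
        ∂ᶜ Y (τ ∷ F) ℚ.- ∂ᶜ Y (τ ∷ F)
          ≡⟨ ℚₚ.+-inverseʳ (∂ᶜ Y (τ ∷ F)) ⟩
        0ℚ ∎))
      where
      open ≡-Reasoning
      open +-*-Solver

  module AtTop (r : ℕ) (s<r : ρ s < r) (ρt : suc r ≡ ρ t) (x : Fin n → ℚ) where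

    module FinUnits = Units {Fin n} Fin._≟_

    -- Only `t` has to be hit: the value `x t / e w t` at a coatom `w` does it. As `ρ s < r`, this
    -- coatom is strictly above `s` and its row is good.
    primitive-y : Primitive (suc r) x
    primitive-y =
      let w , s≤w , c = lower-cover s<t
          ρw : ρ w ≡ r
          ρw = ℕₚ.suc-injective (trans (sym (ρ-cover w t c)) (sym ρt))
          s<w = le∧rank⇒lt s≤w (subst (ρ s <_) (sym ρw) s<r)
          k , ke≡1 = inv (proj₁ (good w s<w) t c)
      in (λ π → FinUnits.unit w π ℚ.* (k ℚ.* x t)) , λ τ ρτ _ τ≤t → at-t w k (δ-yes s≤w) ke≡1 τ (rank-eq τ≤t (trans ρτ ρt))
      where
      open +-*-Solver
      open ≡-Reasoning
      at-t : ∀ w k → δ s w ≡ 1ℚ → k ℚ.* e w t ≡ 1ℚ → ∀ τ → τ ≡ t →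
             ∑ (λ π → (δ s π ℚ.* e π τ) ℚ.* (FinUnits.unit w π ℚ.* (k ℚ.* x t))) ≡ x τ
      at-t w k δ≡1 ke≡1 τ refl = begin
        ∑ (λ π → (δ s π ℚ.* e π t) ℚ.* (FinUnits.unit w π ℚ.* (k ℚ.* x t)))
          ≡⟨ ∑-single w (λ π π≢w → trans (cong (λ u → (δ s π ℚ.* e π t) ℚ.* (u ℚ.* (k ℚ.* x t))) (FinUnits.unit-diff w π π≢w))
               (solve 2 (λ a b → a :* (con 0ℚ :* b) := con 0ℚ) refl (δ s π ℚ.* e π t) (k ℚ.* x t))) ⟩
        (δ s w ℚ.* e w t) ℚ.* (FinUnits.unit w w ℚ.* (k ℚ.* x t))
          ≡⟨ cong₂ (λ a b → (a ℚ.* e w t) ℚ.* (b ℚ.* (k ℚ.* x t))) δ≡1 (FinUnits.unit-same w) ⟩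
        (1ℚ ℚ.* e w t) ℚ.* (1ℚ ℚ.* (k ℚ.* x t))
          ≡⟨ solve 3 (λ e k x → (con 1ℚ :* e) :* (con 1ℚ :* (k :* x)) := (k :* e) :* x) refl (e w t) k (x t) ⟩
        (k ℚ.* e w t) ℚ.* x t
          ≡⟨ trans (cong (ℚ._* x t) ke≡1) (ℚₚ.*-identityˡ (x t)) ⟩
        x t ∎

  -- Restricted to ranks beyond `ρ s + 1`, where coboundaries involve only rows strictly above `s`.
  exact-upper : ∀ r → ρ s < r → ∀ x → Closed (suc r) x → Primitive (suc r) x
  exact-upper r s<r x closed with ℕₚ.<-cmp (suc r) (ρ t)
  ... | tri< r<t _ _ = Middle.primitive-y r s<r r<t x closed
  ... | tri≈ _ r≡t _ = AtTop.primitive-y r s<r r≡t x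
  ... | tri> _ _ t<r = (λ _ → 0ℚ) , λ τ ρτ _ τ≤t → contradiction (ℕₚ.≤-trans (ℕₚ.≤-reflexive (sym ρτ)) (rank-≤ τ≤t)) (ℕₚ.<⇒≱ t<r)

proportional : ∀ {X} {S N : Subspace X} → Dim S N 1 → ∀ f g → S ∋ f → S ∋ g → ¬ (N ∋ g) →
               Σ[ a ∈ ℚ ] N ∋ (λ x → f x ℚ.- a ℚ.* g x)
proportional {X} {S} {N} (b , c , b∈ , cb , cN , D) f g f∈ g∈ g∉ =
  ap c f ℚ.* k , ∋-resp N combine
    (∋-- N (D _ (residual-∈ S {c = c} b∈ cb f f∈)) (∋-* N (ap c f ℚ.* k) (D _ (residual-∈ S {c = c} b∈ cb g g∈))))
  where
  open ≡-Reasoning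
  open +-*-Solver
  cg≢0 : ap c g ≢ 0ℚ
  cg≢0 h = g∉ (∋-resp N (λ x → trans (cong (λ t → g x ℚ.- b x ℚ.* t) h)
    (solve 2 (λ g b → g :- b :* con 0ℚ := g) refl (g x) (b x))) (D _ (residual-∈ S {c = c} b∈ cb g g∈)))
  k : ℚ
  k = proj₁ (inv cg≢0)
  combine : ∀ x → (f x ℚ.- b x ℚ.* ap c f) ℚ.- (ap c f ℚ.* k) ℚ.* (g x ℚ.- b x ℚ.* ap c g) ≡ f x ℚ.- (ap c f ℚ.* k) ℚ.* g x
  combine x = begin
    (f x ℚ.- b x ℚ.* ap c f) ℚ.- (ap c f ℚ.* k) ℚ.* (g x ℚ.- b x ℚ.* ap c g)
      ≡⟨ solve 6 (λ f b p k g q → (f :- b :* p) :- (p :* k) :* (g :- b :* q) := (f :- (p :* k) :* g) :+ (b :* p) :* (k :* q :- con 1ℚ)) refl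
           (f x) (b x) (ap c f) k (g x) (ap c g) ⟩
    (f x ℚ.- (ap c f ℚ.* k) ℚ.* g x) ℚ.+ (b x ℚ.* ap c f) ℚ.* (k ℚ.* ap c g ℚ.- 1ℚ)
      ≡⟨ cong (λ t → (f x ℚ.- (ap c f ℚ.* k) ℚ.* g x) ℚ.+ (b x ℚ.* ap c f) ℚ.* (t ℚ.- 1ℚ)) (proj₂ (inv cg≢0)) ⟩
    (f x ℚ.- (ap c f ℚ.* k) ℚ.* g x) ℚ.+ (b x ℚ.* ap c f) ℚ.* (1ℚ ℚ.- 1ℚ)
      ≡⟨ solve 2 (λ a b → a :+ b :* (con 1ℚ :- con 1ℚ) := a) refl (f x ℚ.- (ap c f ℚ.* k) ℚ.* g x) (b x ℚ.* ap c f) ⟩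
    f x ℚ.- (ap c f ℚ.* k) ℚ.* g x ∎

module _ {Y : Set} (_≟_ : DecidableEquality Y) where

  open Units _≟_

  Dim-coordinates : ∀ k {S N : Subspace Y} (g : Y → Bool) (ys : Fin k → Y) → (∀ {i j} → ys i ≡ ys j → i ≡ j) →
    (∀ i → S ∋ unit (ys i)) → (∀ i → T (g (ys i)) → ∀ f → N ∋ f → f (ys i) ≡ 0ℚ) →
    (∀ f → S ∋ f → (∀ i → T (g (ys i)) → f (ys i) ≡ 0ℚ) → N ∋ f) →
    Dim S N (sumℕ λ i → if g (ys i) then 1 else 0)
  Dim-coordinates zero    g ys inj units N-zero zero-N f f∈ = zero-N f f∈ λ ()
  Dim-coordinates (suc k) {S} {N} g ys inj units N-zero zero-N with g (ys zero) in eq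
  ... | false = Dim-coordinates k g (ys ∘ suc) (Finₚ.suc-injective ∘ inj) (units ∘ suc) (N-zero ∘ suc)
                  (λ f f∈ h → zero-N f f∈ λ { zero t → contradiction (subst T eq t) λ () ; (suc i) → h i })
  ... | true  = unit (ys zero) , ev (ys zero) , units zero , unit-same (ys zero) , N-zero zero (subst T (sym eq) tt) ,
                Dim-coordinates k g (ys ∘ suc) (Finₚ.suc-injective ∘ inj)
                  (λ i → units (suc i) , unit-diff _ _ λ h → case inj h of λ ())
                  (N-zero ∘ suc)
                  (λ f (f∈ , h₀) h → zero-N f f∈ λ { zero _ → h₀ ; (suc i) → h i })

module LowerExactness (P : FinGradedBoundedPoset) (eul : PosetNotions.Eulerian P) (cm : PosetNotions.CohenMacaulay P)
  (e : Fin (FinGradedBoundedPoset.n P) → Fin (FinGradedBoundedPoset.n P) → ℚ)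
  (e-cover : ∀ x y → e x y ≢ 0ℚ → PosetNotions.Covers P x y)
  (s t : Fin (FinGradedBoundedPoset.n P)) (s<t : T (PosetNotions.lt P s t))
  (good : ∀ x → T (PosetNotions.lt P s x) → Incidence.Good P e e-cover x)
  (exact-above : ∀ x → T (PosetNotions.lt P s x) → T (PosetNotions.lt P x t) →
                 Differential.Exact (FinGradedBoundedPoset.le P) (FinGradedBoundedPoset.ρ P) e x t) where

  open PosetNotions P hiding (∂)
  open GradedPoset P
  open Differential le ρ e
  open Incidence P e e-cover
  open UpperExactness P cm e e-cover s t s<t good exact-above

  module FinUnits = Units {Fin n} Fin._≟_

  Cl Ng : ℕ → Subspace (Fin n)
  _∋_ (Ng r) x = ∀ τ → ρ τ ≡ r → T (le s τ) → T (le τ t) → x τ ≡ 0ℚ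
  ∋-resp (Ng r) h p τ a b c = trans (sym (h τ)) (p τ a b c)
  ∋-0 (Ng r) τ a b c = refl
  ∋-+ (Ng r) p q τ a b c = cong₂ ℚ._+_ (p τ a b c) (q τ a b c)
  ∋-* (Ng r) k p τ a b c = trans (cong (k ℚ.*_) (p τ a b c)) (ℚₚ.*-zeroʳ k)

  d : Map (Fin n) (Fin n)
  d υ = ∑ᶠ λ τ → (δ s τ ℚ.* e τ υ) ·ᶠ ev τ

  Cl r = preimage d full (Ng (suc r))

  inRange : Fin n → Bool
  inRange τ = le s τ ∧ le τ t

  at : ℕ → Fin n → Bool
  at r τ = (ρ τ ℕ.≡ᵇ r) ∧ inRange τ

  at-in : ∀ r τ → ρ τ ≡ r → T (le s τ) → T (le τ t) → T (at r τ)
  at-in r τ p a b = ∧-in (ρ τ ℕ.≡ᵇ r) (ℕₚ.≡⇒≡ᵇ (ρ τ) r p) (∧-in (le s τ) a b)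

  at-out : ∀ r τ → T (at r τ) → ρ τ ≡ r × T (le s τ) × T (le τ t)
  at-out r τ h = let p , q = ∧-out (ρ τ ℕ.≡ᵇ r) h in ℕₚ.≡ᵇ⇒≡ (ρ τ) r p , ∧-out (le s τ) q

  count : ℕ → ℕ
  count r = sumℕ λ τ → if at r τ then 1 else 0

  Dim-full/Ng : ∀ r → Dim full (Ng r) (count r)
  Dim-full/Ng r = Dim-coordinates Fin._≟_ n (at r) (λ τ → τ) (λ h → h) (λ _ → tt)
    (λ τ h f p → let a , b , c = at-out r τ h in p τ a b c)
    (λ f _ h τ a b c → h τ (at-in r τ a b c))

  private
    ∑ℤ : (Fin n → ℤ) → ℤ
    ∑ℤ = ℤ-Sums.∑

  -- The Euler characteristic of the ranks from `r` on.
  tail : ℕ → ℤ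
  tail r = ∑ℤ λ τ → if (r ℕ.≤ᵇ ρ τ) ∧ inRange τ then sgn (ρ τ) else + 0

  if-zero : ∀ b {a : ℤ} → ¬ T b → (if b then a else + 0) ≡ + 0
  if-zero true  h = contradiction tt h
  if-zero false h = refl

  tail-suc : ∀ r → tail r ≡ sgn r ℤ.* + count r ℤ.+ tail (suc r)
  tail-suc r = begin
    tail r
      ≡⟨ ℤ-Sums.∑-cong (λ τ → split τ (ℕₚ.<-cmp r (ρ τ))) ⟩
    ∑ℤ (λ τ → sgn r ℤ.* + (if at r τ then 1 else 0) ℤ.+ (if (suc r ℕ.≤ᵇ ρ τ) ∧ inRange τ then sgn (ρ τ) else + 0))
      ≡⟨ ℤ-Sums.∑-+ (λ τ → sgn r ℤ.* + (if at r τ then 1 else 0)) (λ τ → if (suc r ℕ.≤ᵇ ρ τ) ∧ inRange τ then sgn (ρ τ) else + 0) ⟩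
    ∑ℤ (λ τ → sgn r ℤ.* + (if at r τ then 1 else 0)) ℤ.+ tail (suc r)
      ≡⟨ cong (λ u → u ℤ.+ tail (suc r)) (trans (sym (ℤ-Sums.∑-*ˡ (sgn r) (λ τ → + (if at r τ then 1 else 0))))
           (cong (λ u → sgn r ℤ.* u) (sym (+-sumℕ (λ τ → if at r τ then 1 else 0))))) ⟩
    sgn r ℤ.* + count r ℤ.+ tail (suc r) ∎
    where
    open ≡-Reasoning
    +-sumℕ : ∀ {k} (c : Fin k → ℕ) → + sumℕ c ≡ ℤ-Sums.∑ (λ i → + c i)
    +-sumℕ {zero}  c = refl
    +-sumℕ {suc k} c = trans (ℤₚ.pos-+ (c zero) (sumℕ (c ∘ suc))) (cong (λ u → + c zero ℤ.+ u) (+-sumℕ (c ∘ suc)))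
    pieces : ∀ b₁ b₂ b₃ b (τ : Fin n) → (T b₁ → T b₂ ⊎ T b₃) → (T b₂ → T b₁ × ρ τ ≡ r × ¬ T b₃) → (T b₃ → T b₁ × ¬ T b₂) →
             (if b₁ ∧ b then sgn (ρ τ) else + 0) ≡
             sgn r ℤ.* + (if b₂ ∧ b then 1 else 0) ℤ.+ (if b₃ ∧ b then sgn (ρ τ) else + 0)
    pieces false false false b     τ _ _ _ = sym (trans (ℤₚ.+-identityʳ _) (ℤₚ.*-zeroʳ (sgn r)))
    pieces false true  _     b     τ _ h _ = ⊥-elim (proj₁ (h tt))
    pieces false false true  b     τ _ _ h = ⊥-elim (proj₁ (h tt))
    pieces true  true  true  b     τ _ h _ = ⊥-elim (proj₂ (proj₂ (h tt)) tt)
    pieces true  false false b     τ h _ _ = case h tt of λ { (inj₁ ()) ; (inj₂ ()) }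
    pieces true  true  false true  τ _ h _ = sym (trans (ℤₚ.+-identityʳ _) (trans (ℤₚ.*-identityʳ (sgn r)) (cong sgn (sym (proj₁ (proj₂ (h tt)))))))
    pieces true  true  false false τ _ _ _ = sym (trans (ℤₚ.+-identityʳ _) (ℤₚ.*-zeroʳ (sgn r)))
    pieces true  false true  b     τ _ _ _ = sym (trans (cong (λ u → u ℤ.+ (if b then sgn (ρ τ) else + 0)) (ℤₚ.*-zeroʳ (sgn r))) (ℤₚ.+-identityˡ _))
    split : ∀ τ → _ → (if (r ℕ.≤ᵇ ρ τ) ∧ inRange τ then sgn (ρ τ) else + 0) ≡
                  sgn r ℤ.* + (if at r τ then 1 else 0) ℤ.+ (if (suc r ℕ.≤ᵇ ρ τ) ∧ inRange τ then sgn (ρ τ) else + 0)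
    split τ c = pieces (r ℕ.≤ᵇ ρ τ) (ρ τ ℕ.≡ᵇ r) (suc r ℕ.≤ᵇ ρ τ) (inRange τ) τ
      (λ h → weak c (ℕₚ.≤ᵇ⇒≤ r (ρ τ) h))
      (λ h → let p = ℕₚ.≡ᵇ⇒≡ (ρ τ) r h in
         ℕₚ.≤⇒≤ᵇ (ℕₚ.≤-reflexive (sym p)) , p , λ h′ → ℕₚ.<-irrefl (sym p) (ℕₚ.≤ᵇ⇒≤ (suc r) (ρ τ) h′))
      (λ h → let p = ℕₚ.≤ᵇ⇒≤ (suc r) (ρ τ) h in
         ℕₚ.≤⇒≤ᵇ (ℕₚ.<⇒≤ p) , λ h′ → ℕₚ.<-irrefl (sym (ℕₚ.≡ᵇ⇒≡ (ρ τ) r h′)) p)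
      where
      weak : _ → r ≤ ρ τ → T (ρ τ ℕ.≡ᵇ r) ⊎ T (suc r ℕ.≤ᵇ ρ τ)
      weak (tri< r<ρτ _ _) _ = inj₂ (ℕₚ.≤⇒≤ᵇ r<ρτ)
      weak (tri≈ _ r≡ρτ _) _ = inj₁ (ℕₚ.≡⇒≡ᵇ (ρ τ) r (sym r≡ρτ))
      weak (tri> _ _ ρτ<r) h = contradiction h (ℕₚ.<⇒≱ ρτ<r)

  tail-top : ∀ r → ρ t < r → tail r ≡ + 0
  tail-top r t<r = ℤ-Sums.∑-zero λ τ → if-zero ((r ℕ.≤ᵇ ρ τ) ∧ inRange τ) λ h →
    let p , q = ∧-out (r ℕ.≤ᵇ ρ τ) h in
    ℕₚ.<⇒≱ t<r (ℕₚ.≤-trans (ℕₚ.≤ᵇ⇒≤ r (ρ τ) p) (rank-≤ (proj₂ (∧-out (le s τ) q))))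

  tail-bottom : tail (suc (ρ s)) ≡ sgn (suc (ρ s))
  tail-bottom = begin
    tail (suc (ρ s))
      ≡⟨ solve 2 (λ a b → a := :- b :+ (b :+ a)) refl (tail (suc (ρ s))) (sgn (ρ s)) ⟩
    ℤ.- sgn (ρ s) ℤ.+ (sgn (ρ s) ℤ.+ tail (suc (ρ s)))
      ≡⟨ cong (λ u → ℤ.- sgn (ρ s) ℤ.+ u) (sym whole) ⟩
    ℤ.- sgn (ρ s) ℤ.+ ∑ℤ (λ τ → if inRange τ then sgn (ρ τ) else + 0)
      ≡⟨ cong (λ u → ℤ.- sgn (ρ s) ℤ.+ u) (euler eul s t (lt⇒le s<t) (lt⇒≢ s<t)) ⟩
    ℤ.- sgn (ρ s) ℤ.+ + 0
      ≡⟨ trans (ℤₚ.+-identityʳ _) (sym (sgn-suc (ρ s))) ⟩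
    sgn (suc (ρ s)) ∎
    where
    open ≡-Reasoning
    open ℤ-Solver.+-*-Solver
    isS : Fin n → ℤ
    isS τ = if does (τ Fin.≟ s) then sgn (ρ s) else + 0
    isS-s : isS s ≡ sgn (ρ s)
    isS-s with s Fin.≟ s
    ... | yes _  = refl
    ... | no s≢s = contradiction refl s≢s
    isS-other : ∀ τ → τ ≢ s → isS τ ≡ + 0
    isS-other τ τ≢s with τ Fin.≟ s
    ... | yes p = contradiction p τ≢s
    ... | no _  = refl
    pieces : ∀ b₁ b {a} → (T b → T b₁) → (if b then a else + 0) ≡ + 0 ℤ.+ (if b₁ ∧ b then a else + 0)
    pieces b₁    false h = trans (sym (ℤₚ.+-identityˡ (+ 0))) (cong (λ u → + 0 ℤ.+ u) (sym (if-zero (b₁ ∧ false) (proj₂ ∘ ∧-out b₁))))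
    pieces true  true  h = sym (ℤₚ.+-identityˡ _)
    pieces false true  h = ⊥-elim (h tt)
    split : ∀ τ → Dec (τ ≡ s) → (if inRange τ then sgn (ρ τ) else + 0) ≡
            isS τ ℤ.+ (if (suc (ρ s) ℕ.≤ᵇ ρ τ) ∧ inRange τ then sgn (ρ τ) else + 0)
    split τ (yes refl) = trans (cong (λ b → if b then sgn (ρ s) else + 0) (T⇒≡true (∧-in (le s s) (le-refl s) (lt⇒le s<t))))
      (sym (trans (cong₂ ℤ._+_ isS-s (if-zero ((suc (ρ s) ℕ.≤ᵇ ρ s) ∧ inRange s) λ h →
             ℕₚ.1+n≰n (ℕₚ.≤ᵇ⇒≤ (suc (ρ s)) (ρ s) (proj₁ (∧-out (suc (ρ s) ℕ.≤ᵇ ρ s) h)))))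
           (ℤₚ.+-identityʳ (sgn (ρ s)))))
    split τ (no τ≢s) = trans
      (pieces (suc (ρ s) ℕ.≤ᵇ ρ τ) (inRange τ) λ h → ℕₚ.≤⇒≤ᵇ (rank-< s τ (proj₁ (∧-out (le s τ) h)) (τ≢s ∘ sym)))
      (cong (λ u → u ℤ.+ (if (suc (ρ s) ℕ.≤ᵇ ρ τ) ∧ inRange τ then sgn (ρ τ) else + 0)) (sym (isS-other τ τ≢s)))
    whole : ∑ℤ (λ τ → if inRange τ then sgn (ρ τ) else + 0) ≡ sgn (ρ s) ℤ.+ tail (suc (ρ s))
    whole = trans (ℤ-Sums.∑-cong λ τ → split τ (τ Fin.≟ s))
      (trans (ℤ-Sums.∑-+ isS (λ τ → if (suc (ρ s) ℕ.≤ᵇ ρ τ) ∧ inRange τ then sgn (ρ τ) else + 0))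
        (cong (λ u → u ℤ.+ tail (suc (ρ s))) (trans (ℤ-Sums.∑-single s isS-other) isS-s)))

  -- The row of `s` may still be missing; since `ρ s < r`, only cells strictly above `s` contribute.
  d-d : ∀ r → ρ s < r → ∀ x → Ng (suc (suc r)) ∋ (d $ d $ x)
  d-d r s<r x υ ρυ _ _ = begin
    ∑ (λ τ → (δ s τ ℚ.* e τ υ) ℚ.* ∑ (λ π → (δ s π ℚ.* e π τ) ℚ.* x π))
      ≡⟨ ∑-cong (λ τ → ∑-*ˡ (δ s τ ℚ.* e τ υ) (λ π → (δ s π ℚ.* e π τ) ℚ.* x π)) ⟩
    ∑ (λ τ → ∑ λ π → (δ s τ ℚ.* e τ υ) ℚ.* ((δ s π ℚ.* e π τ) ℚ.* x π))
      ≡⟨ ∑-swap (λ τ π → (δ s τ ℚ.* e τ υ) ℚ.* ((δ s π ℚ.* e π τ) ℚ.* x π)) ⟩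
    ∑ (λ π → ∑ λ τ → (δ s τ ℚ.* e τ υ) ℚ.* ((δ s π ℚ.* e π τ) ℚ.* x π))
      ≡⟨ ∑-zero (λ π → by π (T? (lt s π))) ⟩
    0ℚ ∎
    where
    open ≡-Reasoning
    open +-*-Solver
    by : ∀ π → Dec (T (lt s π)) → ∑ (λ τ → (δ s τ ℚ.* e τ υ) ℚ.* ((δ s π ℚ.* e π τ) ℚ.* x π)) ≡ 0ℚ
    by π (no s≮π) = ∑-zero λ τ → *-zero-≢0 (δ s τ ℚ.* e τ υ) λ h → trans (cong (ℚ._* x π)
      (≡0-dec λ h′ → s≮π (le∧rank⇒lt (δ≢0 (*-≢0ˡ {b = e π τ} h′))
        (subst (ρ s <_) (sym (ℕₚ.suc-injective (trans (sym (e-rank (*-≢0ʳ {δ s π} h′)))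
          (ℕₚ.suc-injective (trans (sym (e-rank (*-≢0ʳ {δ s τ} h))) ρυ))))) s<r)))) (ℚₚ.*-zeroˡ (x π))
    by π (yes s<π) = begin
      ∑ (λ τ → (δ s τ ℚ.* e τ υ) ℚ.* ((δ s π ℚ.* e π τ) ℚ.* x π))
        ≡⟨ ∑-cong (λ τ → trans
             (solve 5 (λ a b c d x → (a :* b) :* ((c :* d) :* x) := (c :* x) :* (d :* (a :* b))) refl (δ s τ) (e τ υ) (δ s π) (e π τ) (x π))
             (cong ((δ s π ℚ.* x π) ℚ.*_) (*-cong-≢0 (e π τ) λ h → trans
               (cong (ℚ._* e τ υ) (δ-yes (lt⇒le (lt-trans s<π (e-lt h))))) (ℚₚ.*-identityˡ (e τ υ))))) ⟩
      ∑ (λ τ → (δ s π ℚ.* x π) ℚ.* (e π τ ℚ.* e τ υ))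
        ≡⟨ trans (sym (∑-*ˡ (δ s π ℚ.* x π) (λ τ → e π τ ℚ.* e τ υ)))
             (trans (cong ((δ s π ℚ.* x π) ℚ.*_) (proj₂ (good π s<π) υ)) (ℚₚ.*-zeroʳ (δ s π ℚ.* x π))) ⟩
      0ℚ ∎

  -- By exactness above, the cochains of rank `r` modulo the closed ones are the closed cochains of
  -- rank `r + 1`. Descending from `t`, the dimension is an alternating sum of numbers of cells.
  closedDim : ∀ j r → r ℕ.+ j ≡ ρ t → ρ s < r → Σ[ c ∈ ℕ ] Dim (Cl r) (Ng r) c × sgn r ℤ.* + c ≡ tail r
  closedDim zero r r≡ s<r = count r ,
    Dim-resp (count r) (λ _ _ → tt)
      (λ x _ → tt , λ υ ρυ _ υ≤t → contradiction (rank-≤ υ≤t) (ℕₚ.<⇒≱ (ℕₚ.≤-reflexive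
         (trans (cong suc (trans (sym r≡) (ℕₚ.+-identityʳ r))) (sym ρυ)))))
      (λ _ z → z) (λ _ z → z) (Dim-full/Ng r) ,
    trans (sym (ℤₚ.+-identityʳ _)) (trans (cong (λ u → sgn r ℤ.* + count r ℤ.+ u) (sym (tail-top (suc r)
      (ℕₚ.≤-reflexive (cong suc (trans (sym r≡) (ℕₚ.+-identityʳ r))))))) (sym (tail-suc r)))
  closedDim (suc j) r r≡ s<r =
    let c , D , sgn-c = closedDim j (suc r) (trans (sym (ℕₚ.+-suc r j)) r≡) (ℕₚ.m≤n⇒m≤1+n s<r)
        c′ , eq , D′ = kernelDim c {full} {Ng r} {Cl (suc r)} {Ng (suc r)} d (λ x _ → tt , d-d r s<r x) d-Ng onto D {count r} (Dim-full/Ng r)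
    in c′ , D′ , (begin
      sgn r ℤ.* + c′
        ≡⟨ solve 3 (λ s a b → s :* b := s :* (a :+ b) :+ (:- s) :* a) refl (sgn r) (+ c) (+ c′) ⟩
      sgn r ℤ.* (+ c ℤ.+ + c′) ℤ.+ ℤ.- sgn r ℤ.* + c
        ≡⟨ cong₂ (λ a b → sgn r ℤ.* a ℤ.+ b ℤ.* + c) (trans (sym (ℤₚ.pos-+ c c′)) (cong +_ (sym eq))) (sym (sgn-suc r)) ⟩
      sgn r ℤ.* + count r ℤ.+ sgn (suc r) ℤ.* + c
        ≡⟨ cong (λ u → sgn r ℤ.* + count r ℤ.+ u) sgn-c ⟩
      sgn r ℤ.* + count r ℤ.+ tail (suc r)
        ≡⟨ tail-suc r ⟨
      tail r ∎)
    where
    open ≡-Reasoning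
    open ℤ-Solver.+-*-Solver
    d-Ng : ∀ x → Ng r ∋ x → Ng (suc r) ∋ (d $ x)
    d-Ng x p υ ρυ _ υ≤t = ∑-zero λ τ → *-zero-≢0 (δ s τ ℚ.* e τ υ) λ h →
      p τ (ℕₚ.suc-injective (trans (sym (e-rank (*-≢0ʳ {δ s τ} h))) ρυ)) (δ≢0 (*-≢0ˡ {b = e τ υ} h))
        (le-trans τ υ t (lt⇒le (e-lt (*-≢0ʳ {δ s τ} h))) υ≤t)
    onto : ∀ x → Cl (suc r) ∋ x → Σ[ y ∈ (Fin n → ℚ) ] full ∋ y × Ng (suc r) ∋ (λ τ → x τ ℚ.- (d $ y) τ)
    onto x (_ , closed) = let y , h = exact-upper r s<r x closed in
      y , tt , λ τ a b c → trans (cong (λ u → x τ ℚ.- u) (h τ a b c)) (ℚₚ.+-inverseʳ (x τ))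

  -- Here the Eulerian condition enters: the signs over `[s, t]` sum to zero, so without `s` they
  -- sum to the opposite of its sign, and the dimension is one.
  closed-line : Dim (Cl (suc (ρ s))) (Ng (suc (ρ s))) 1
  closed-line =
    let c , D , h = closedDim (ρ t ∸ suc (ρ s)) (suc (ρ s)) (ℕₚ.m+[n∸m]≡n (rank-lt s<t)) (ℕₚ.n<1+n (ρ s))
        k = sgn (suc (ρ s))
        c≡1 : + c ≡ + 1
        c≡1 = begin
          + c                  ≡⟨ ℤₚ.*-identityˡ (+ c) ⟨
          + 1 ℤ.* + c          ≡⟨ cong (λ u → u ℤ.* + c) (sgn² (suc (ρ s))) ⟨
          k ℤ.* k ℤ.* + c      ≡⟨ ℤₚ.*-assoc k k (+ c) ⟩
          k ℤ.* (k ℤ.* + c)    ≡⟨ cong (λ u → k ℤ.* u) (trans h tail-bottom) ⟩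
          k ℤ.* k              ≡⟨ sgn² (suc (ρ s)) ⟩
          + 1                  ∎
    in subst (Dim (Cl (suc (ρ s))) (Ng (suc (ρ s)))) (ℤₚ.+-injective c≡1) D
    where open ≡-Reasoning

  -- A good row of `s` is a nonzero closed cochain of rank `ρ s + 1`, hence spans that line; this
  -- settles the degree left open by counting.
  module WithRow (good-s : Good s) where

    open +-*-Solver

    row-closed : Cl (suc (ρ s)) ∋ e s
    row-closed = tt , λ υ ρυ s≤υ υ≤t → trans
      (∑-cong λ τ → trans (solve 3 (λ d e f → (d :* e) :* f := f :* (d :* e)) refl (δ s τ) (e τ υ) (e s τ))
        (*-cong-≢0 (e s τ) λ h → trans (cong (ℚ._* e τ υ) (δ-yes (lt⇒le (e-lt h)))) (ℚₚ.*-identityˡ (e τ υ))))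
      (proj₂ good-s υ)

    row∉Ng : ¬ (Ng (suc (ρ s)) ∋ e s)
    row∉Ng h = let w , c , w≤t = upper-cover s<t in
      proj₁ good-s w c (h w (ρ-cover s w c) (lt⇒le (proj₁ c)) w≤t)

    only-s : ∀ (y : Fin n → ℚ) τ → ρ τ ≡ suc (ρ s) → ∑ (λ π → (δ s π ℚ.* e π τ) ℚ.* y π) ≡ e s τ ℚ.* y s
    only-s y τ ρτ = trans
      (∑-single s λ π π≢s → trans (cong (ℚ._* y π) (≡0-dec λ h → π≢s (sym (rank-eq (δ≢0 (*-≢0ˡ {b = e π τ} h))
        (ℕₚ.suc-injective (trans (sym ρτ) (e-rank (*-≢0ʳ {δ s π} h)))))))) (ℚₚ.*-zeroˡ (y π)))
      (cong (ℚ._* y s) (trans (cong (ℚ._* e s τ) (δ-yes (le-refl s))) (ℚₚ.*-identityˡ (e s τ))))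

    none-at-s : ∀ (y : Fin n → ℚ) → ∑ (λ π → (δ s π ℚ.* e π s) ℚ.* y π) ≡ 0ℚ
    none-at-s y = ∑-zero λ π → trans (cong (ℚ._* y π) (≡0-dec λ h →
      lt-irrefl (le-lt-trans (δ≢0 (*-≢0ˡ {b = e π s} h)) (e-lt (*-≢0ʳ {δ s π} h))))) (ℚₚ.*-zeroˡ (y π))

    at-bottom : ∀ x → Closed (ρ s) x → x s ≡ 0ℚ
    at-bottom x closed = let w , c , w≤t = upper-cover s<t in
      *-cancel-0 (proj₁ good-s w c) (trans (sym (only-s x w (ρ-cover s w c))) (closed w (ρ-cover s w c) (lt⇒le (proj₁ c)) w≤t))

    exact-lower : ∀ x → Closed (suc (ρ s)) x → Primitive (suc (ρ s)) x
    exact-lower x closed =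
      let a , h = proportional {S = Cl (suc (ρ s))} {Ng (suc (ρ s))} closed-line x (e s) (tt , closed) row-closed row∉Ng
      in (λ _ → a) , λ τ ρτ s≤τ τ≤t → trans (only-s (λ _ → a) τ ρτ)
           (trans (ℚₚ.*-comm (e s τ) a) (sym (x-y≡0⇒x≡y (h τ ρτ s≤τ τ≤t))))

    exact : Exact s t
    exact r x closed with ℕₚ.<-cmp r (ρ s)
    exact r x closed | tri< r<s _ _ = (λ _ → 0ℚ) , λ τ ρτ s≤τ _ →
      contradiction (rank-≤ s≤τ) (ℕₚ.<⇒≱ (subst (_< ρ s) (sym ρτ) r<s))
    exact .(ρ s) x closed | tri≈ _ refl _ = (λ _ → 0ℚ) , λ τ ρτ s≤τ _ → at-s τ (rank-eq s≤τ (sym ρτ))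
      where
      at-s : ∀ τ → s ≡ τ → ∑ (λ π → (δ s π ℚ.* e π τ) ℚ.* 0ℚ) ≡ x τ
      at-s τ refl = trans (none-at-s (λ _ → 0ℚ)) (sym (at-bottom x closed))
    exact (suc r) x closed | tri> _ _ s<r with r ℕ.≟ ρ s
    ... | no r≢s   = exact-upper r (ℕₚ.≤∧≢⇒< (s≤s⁻¹ s<r) (r≢s ∘ sym)) x closed
    ... | yes refl = exact-lower x closed

-- Construction of the incidence numbers from the top down.

module Orientation (P : FinGradedBoundedPoset) (eul : PosetNotions.Eulerian P) (cm : PosetNotions.CohenMacaulay P) where

  open PosetNotions P hiding (∂)
  open GradedPoset P
  open Chains P

  module Row (e : Fin n → Fin n → ℚ) (e-cover : ∀ x y → e x y ≢ 0ℚ → Covers x y) where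

    open Differential le ρ e
    open Incidence P e e-cover

    exact-all : ∀ x u → T (lt x u) → GoodAbove x → Exact x u
    exact-all x u = go x (gt-wf x)
      where
      go : ∀ x → Acc (λ x y → T (lt y x)) x → T (lt x u) → GoodAbove x → Exact x u
      go x (acc rec) x<u good = LowerExactness.WithRow.exact P eul cm e e-cover x u x<u
        (λ y x<y → good y (lt⇒le x<y))
        (λ y x<y y<u → go y (rec x<y) y<u λ v y≤v → good v (le-trans x y v (lt⇒le x<y) y≤v))
        (good x (le-refl x))

    module Connected (σ : Fin n) (good : ∀ x → T (lt σ x) → Good x) (b : Fin n → ℚ)
      (b-closed : ∀ υ → ρ υ ≡ suc (suc (ρ σ)) → T (le σ υ) → ∑ (λ τ → (δ σ τ ℚ.* e τ υ) ℚ.* b τ) ≡ 0ℚ) where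

      module FinUnits = Units {Fin n} Fin._≟_

      SameSupport : Fin n → Set
      SameSupport u = ∀ a a′ → Covers σ a → Covers σ a′ → T (le a u) → T (le a′ u) → b a ≢ 0ℚ → b a′ ≢ 0ℚ

      module RankTwo (u : Fin n) (σ<u : T (lt σ u)) (ρu : ρ u ≡ suc (suc (ρ σ))) where

        open LowerExactness P eul cm e e-cover σ u σ<u good
          (λ x σ<x x<u → exact-all x u x<u λ v x≤v → good v (lt-le-trans σ<x x≤v)) using (Cl; Ng; closed-line)

        -- The cochain `x`, supported on `a` and `a′`, is closed because its two contributions at
        -- `u` cancel. Closed cochains form a line, so `x` is a multiple of `b`; if `b` vanished at
        -- `a′`, so would `x`, whose value there is `e a u`.
        same-support : SameSupport u
        same-support a a′ ca ca′ a≤u a′≤u ba≢0 ba′≡0 =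
          let k , h = proportional {S = Cl (suc (ρ σ))} {Ng (suc (ρ σ))} closed-line x b (tt , x-closed) (tt , λ υ ρυ σ≤υ _ → b-closed υ ρυ σ≤υ)
                        (λ p → ba≢0 (p a (ρ-cover σ a ca) (lt⇒le (proj₁ ca)) a≤u))
          in e-a (x-a′ k (h a′ (ρ-cover σ a′ ca′) (lt⇒le (proj₁ ca′)) a′≤u))
          where
          open ≡-Reasoning
          open +-*-Solver
          a≢a′ : a ≢ a′
          a≢a′ refl = ba≢0 ba′≡0
          e-a : e a u ≢ 0ℚ
          e-a = proj₁ (good a (proj₁ ca)) u (le∧rank⇒Covers a≤u (trans ρu (cong suc (sym (ρ-cover σ a ca)))))
          x : Fin n → ℚ
          x τ = FinUnits.unit a′ τ ℚ.* e a u ℚ.- FinUnits.unit a τ ℚ.* e a′ u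
          x-a′ : ∀ k → x a′ ℚ.- k ℚ.* b a′ ≡ 0ℚ → e a u ≡ 0ℚ
          x-a′ k h = begin
            e a u
              ≡⟨ solve 3 (λ e e′ k → e := (con 1ℚ :* e :- con 0ℚ :* e′) :- k :* con 0ℚ) refl (e a u) (e a′ u) k ⟩
            (1ℚ ℚ.* e a u ℚ.- 0ℚ ℚ.* e a′ u) ℚ.- k ℚ.* 0ℚ
              ≡⟨ cong₂ (λ p q → (p ℚ.* e a u ℚ.- q ℚ.* e a′ u) ℚ.- k ℚ.* 0ℚ)
                   (FinUnits.unit-same a′) (FinUnits.unit-diff a a′ (a≢a′ ∘ sym)) ⟨
            x a′ ℚ.- k ℚ.* 0ℚ
              ≡⟨ cong (λ t → x a′ ℚ.- k ℚ.* t) ba′≡0 ⟨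
            x a′ ℚ.- k ℚ.* b a′
              ≡⟨ h ⟩
            0ℚ ∎
          pick : ∀ v c → T (lt σ v) → ∑ (λ τ → (δ σ τ ℚ.* e τ u) ℚ.* (FinUnits.unit v τ ℚ.* c)) ≡ e v u ℚ.* c
          pick v c σ<v = trans
            (∑-single v λ τ τ≢v → trans (cong (λ t → (δ σ τ ℚ.* e τ u) ℚ.* (t ℚ.* c)) (FinUnits.unit-diff v τ τ≢v))
              (solve 2 (λ d c → d :* (con 0ℚ :* c) := con 0ℚ) refl (δ σ τ ℚ.* e τ u) c))
            (trans (cong₂ (λ p q → (p ℚ.* e v u) ℚ.* (q ℚ.* c)) (δ-yes (lt⇒le σ<v)) (FinUnits.unit-same v))
              (solve 2 (λ e c → (con 1ℚ :* e) :* (con 1ℚ :* c) := e :* c) refl (e v u) c))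
          x-closed-u : ∑ (λ τ → (δ σ τ ℚ.* e τ u) ℚ.* x τ) ≡ 0ℚ
          x-closed-u = begin
            ∑ (λ τ → (δ σ τ ℚ.* e τ u) ℚ.* x τ)
              ≡⟨ ∑-cong (λ τ → solve 3 (λ d p q → d :* (p :- q) := d :* p :+ :- (d :* q)) refl
                   (δ σ τ ℚ.* e τ u) (FinUnits.unit a′ τ ℚ.* e a u) (FinUnits.unit a τ ℚ.* e a′ u)) ⟩
            ∑ (λ τ → (δ σ τ ℚ.* e τ u) ℚ.* (FinUnits.unit a′ τ ℚ.* e a u) ℚ.+ ℚ.- ((δ σ τ ℚ.* e τ u) ℚ.* (FinUnits.unit a τ ℚ.* e a′ u)))
              ≡⟨ trans (∑-+ (λ τ → (δ σ τ ℚ.* e τ u) ℚ.* (FinUnits.unit a′ τ ℚ.* e a u)) (λ τ → ℚ.- ((δ σ τ ℚ.* e τ u) ℚ.* (FinUnits.unit a τ ℚ.* e a′ u))))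
                   (cong₂ ℚ._+_ (pick a′ (e a u) (proj₁ ca′))
                     (trans (∑-neg (λ τ → (δ σ τ ℚ.* e τ u) ℚ.* (FinUnits.unit a τ ℚ.* e a′ u))) (cong ℚ.-_ (pick a (e a′ u) (proj₁ ca))))) ⟩
            e a′ u ℚ.* e a u ℚ.- e a u ℚ.* e a′ u
              ≡⟨ solve 2 (λ p q → p :* q :- q :* p := con 0ℚ) refl (e a′ u) (e a u) ⟩
            0ℚ ∎
          x-closed : ∀ υ → ρ υ ≡ suc (suc (ρ σ)) → T (le σ υ) → T (le υ u) → ∑ (λ τ → (δ σ τ ℚ.* e τ υ) ℚ.* x τ) ≡ 0ℚ
          x-closed υ ρυ _ υ≤u = subst (λ v → ∑ (λ τ → (δ σ τ ℚ.* e τ v) ℚ.* x τ) ≡ 0ℚ) (sym (rank-eq υ≤u (trans ρυ (sym ρu)))) x-closed-u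

      -- Two atoms a and a′ below u bound a chain of edges in ( σ , u ), and the support of b is constant along each edge.
      module HigherRank (u : Fin n) (σ<u : T (lt σ u)) (high : suc (suc (ρ σ)) < ρ u)
        (IH : ∀ v → T (lt v u) → SameSupport v) where

        -- Tests `b` at one chosen atom below `v`; by induction the choice does not matter when `v`
        -- is below `u`.
        atomBelow : ∀ v → Dec (T (lt σ v)) → ℚ
        atomBelow v (no _)  = 0ℚ
        atomBelow v (yes p) with b (proj₁ (upper-cover p)) ℚₚ.≟ 0ℚ
        ... | yes _ = 0ℚ
        ... | no _  = 1ℚ

        χ : Fin n → ℚ
        χ v = atomBelow v (T? (lt σ v))

        χ-one : ∀ v → T (lt v u) → ∀ a → Covers σ a → T (le a v) → b a ≢ 0ℚ → χ v ≡ 1ℚ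
        χ-one v v<u a ca a≤v ba≢0 = by (T? (lt σ v))
          where
          by : (p : Dec (T (lt σ v))) → atomBelow v p ≡ 1ℚ
          by (no h)  = contradiction (lt-le-trans (proj₁ ca) a≤v) h
          by (yes p) with b (proj₁ (upper-cover p)) ℚₚ.≟ 0ℚ
          ... | no _  = refl
          ... | yes h = contradiction h (IH v v<u a (proj₁ (upper-cover p)) ca (proj₁ (proj₂ (upper-cover p))) a≤v (proj₂ (proj₂ (upper-cover p))) ba≢0)

        χ-zero : ∀ v → T (lt v u) → ∀ a → Covers σ a → T (le a v) → b a ≡ 0ℚ → χ v ≡ 0ℚ
        χ-zero v v<u a ca a≤v ba≡0 = by (T? (lt σ v))
          where
          by : (p : Dec (T (lt σ v))) → atomBelow v p ≡ 0ℚ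
          by (no _)  = refl
          by (yes p) with b (proj₁ (upper-cover p)) ℚₚ.≟ 0ℚ
          ... | yes _ = refl
          ... | no h  = contradiction ba≡0 (IH v v<u (proj₁ (upper-cover p)) a (proj₁ (proj₂ (upper-cover p))) ca (proj₂ (proj₂ (upper-cover p))) a≤v h)

        χ-edge : ∀ v w → T (lt σ v) → T (lt v w) → T (lt w u) → χ v ≡ χ w
        χ-edge v w σ<v v<w w<u with upper-cover σ<v
        ... | a , ca , a≤v with b a ℚₚ.≟ 0ℚ
        ... | yes h = trans (χ-zero v (lt-trans v<w w<u) a ca a≤v h) (sym (χ-zero w w<u a ca (le-trans a v w a≤v (lt⇒le v<w)) h))
        ... | no h  = trans (χ-one v (lt-trans v<w w<u) a ca a≤v h) (sym (χ-one w w<u a ca (le-trans a v w a≤v (lt⇒le v<w)) h))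

        atom<u : ∀ a → Covers σ a → T (le a u) → T (lt a u)
        atom<u a ca a≤u = le∧rank⇒lt a≤u (subst (_< ρ u) (sym (ρ-cover σ a ca)) (ℕₚ.<-trans (ℕₚ.n<1+n _) high))

        same-support : SameSupport u
        same-support a a′ ca ca′ a≤u a′≤u ba≢0 ba′≡0 = 1ℚ≢0ℚ (begin
          1ℚ
            ≡⟨ cong₂ ℚ._-_ (χ-one a a<u a ca (le-refl a) ba≢0) (χ-zero a′ a′<u a′ ca′ (le-refl a′) ba′≡0) ⟨
          χ a ℚ.- χ a′
            ≡⟨ cong₂ ℚ._-_ (pick a) (pick a′) ⟨
          ∑ (λ v → χ v ℚ.* FinUnits.unit a v) ℚ.- ∑ (λ v → χ v ℚ.* FinUnits.unit a′ v)
            ≡⟨ ∑-minus (λ v → χ v ℚ.* FinUnits.unit a v) (λ v → χ v ℚ.* FinUnits.unit a′ v) ⟩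
          ∑ (λ v → χ v ℚ.* FinUnits.unit a v ℚ.- χ v ℚ.* FinUnits.unit a′ v)
            ≡⟨ ∑-cong (λ v → trans (solve 3 (λ x p q → x :* p :- x :* q := x :* (p :- q)) refl (χ v) (FinUnits.unit a v) (FinUnits.unit a′ v))
                 (cong (χ v ℚ.*_) (sym (d-bound (v ∷ []) refl)))) ⟩
          ∑ (λ v → χ v ℚ.* (∑ (λ w → d (w ∷ v ∷ [])) ℚ.- ∑ (λ w → d (v ∷ w ∷ []))))
            ≡⟨ ∑-cong (λ v → trans
                 (solve 3 (λ x p q → x :* (p :- q) := x :* p :- x :* q) refl (χ v) (∑ λ w → d (w ∷ v ∷ [])) (∑ λ w → d (v ∷ w ∷ [])))
                 (cong₂ ℚ._-_ (∑-*ˡ (χ v) (λ w → d (w ∷ v ∷ []))) (∑-*ˡ (χ v) (λ w → d (v ∷ w ∷ []))))) ⟩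
          ∑ (λ v → ∑ (λ w → χ v ℚ.* d (w ∷ v ∷ [])) ℚ.- ∑ (λ w → χ v ℚ.* d (v ∷ w ∷ [])))
            ≡⟨ ∑-minus (λ v → ∑ λ w → χ v ℚ.* d (w ∷ v ∷ [])) (λ v → ∑ λ w → χ v ℚ.* d (v ∷ w ∷ [])) ⟨
          ∑ (λ v → ∑ λ w → χ v ℚ.* d (w ∷ v ∷ [])) ℚ.- ∑ (λ v → ∑ λ w → χ v ℚ.* d (v ∷ w ∷ []))
            ≡⟨ cong₂ ℚ._-_ (trans (∑-swap λ v w → χ v ℚ.* d (w ∷ v ∷ [])) (∑-cong λ w → ∑-cong λ v → edge w v)) refl ⟩
          ∑ (λ v → ∑ λ w → χ v ℚ.* d (v ∷ w ∷ [])) ℚ.- ∑ (λ v → ∑ λ w → χ v ℚ.* d (v ∷ w ∷ []))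
            ≡⟨ ℚₚ.+-inverseʳ (∑ λ v → ∑ λ w → χ v ℚ.* d (v ∷ w ∷ [])) ⟩
          0ℚ ∎)
          where
          open ≡-Reasoning
          open +-*-Solver
          a<u = atom<u a ca a≤u
          a′<u = atom<u a′ ca′ a′≤u
          ∑-minus : ∀ {k} (f g : Fin k → ℚ) → ∑ f ℚ.- ∑ g ≡ ∑ λ i → f i ℚ.- g i
          ∑-minus f g = sym (trans (∑-+ f (λ i → ℚ.- g i)) (cong (∑ f ℚ.+_) (∑-neg g)))
          pick : ∀ a → ∑ (λ v → χ v ℚ.* FinUnits.unit a v) ≡ χ a
          pick a = trans (∑-single a λ v v≢a → trans (cong (χ v ℚ.*_) (FinUnits.unit-diff a v v≢a)) (ℚₚ.*-zeroʳ (χ v)))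
            (trans (cong (χ a ℚ.*_) (FinUnits.unit-same a)) (ℚₚ.*-identityʳ (χ a)))
          c : Chain → ℚ
          c (w ∷ []) = FinUnits.unit a w ℚ.- FinUnits.unit a′ w
          c _        = 0ℚ
          in-interval : ∀ w → T (lt w u) → Covers σ w → T (asc σ u (w ∷ []))
          in-interval w w<u cw = ∧-in (lt σ w) (proj₁ cw) w<u
          c-supp : Supported σ u c
          c-supp []          h = contradiction refl h
          c-supp (w ∷ v ∷ F) h = contradiction refl h
          c-supp (w ∷ []) h with w Fin.≟ a | w Fin.≟ a′
          ... | yes refl | _        = in-interval a a<u ca
          ... | no _     | yes refl = in-interval a′ a′<u ca′
          ... | no _     | no _     = contradiction refl h
          sum-unit : ∀ a → ∑ (FinUnits.unit a) ≡ 1ℚ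
          sum-unit a = trans (∑-single a λ v v≢a → FinUnits.unit-diff a v v≢a) (FinUnits.unit-same a)
          c-cycle : IsCycle 1 c
          c-cycle [] _ = trans (sym (∑-minus (FinUnits.unit a) (FinUnits.unit a′)))
            (cong₂ ℚ._-_ (sum-unit a) (sum-unit a′))
          -- Degree zero is below the top degree only from rank three on; in rank two no edges join
          -- the atoms, hence the separate argument there.
          not-top : 2 ≢ ρ[ σ , u ]
          not-top h = ℕₚ.<-irrefl (trans (cong (ℕ._+ ρ σ) h) (ℕₚ.m∸n+n≡m (rank-≤ (lt⇒le σ<u)))) high
          filling = cm-exact cm σ u σ<u 1 not-top c c-supp c-cycle
          d : Chain → ℚ
          d = proj₁ filling
          d-bound : ∀ F → length F ≡ 1 → ∂ᶜ d F ≡ c F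
          d-bound = proj₂ (proj₂ filling)
          edge : ∀ w v → χ v ℚ.* d (w ∷ v ∷ []) ≡ χ w ℚ.* d (w ∷ v ∷ [])
          edge w v = trans (ℚₚ.*-comm (χ v) _) (trans (*-cong-≢0 (d (w ∷ v ∷ [])) λ h →
              let p , q = ∧-out (lt σ w) (proj₁ (proj₂ filling) (w ∷ v ∷ []) h)
                  w<v , v<u = ∧-out (lt w v) q
              in sym (χ-edge w v p w<v v<u))
            (ℚₚ.*-comm _ (χ w)))

      connected : ∀ u → T (lt σ u) → SameSupport u
      connected u = go u (lt-wf u)
        where
        go : ∀ u → Acc (λ x y → T (lt x y)) u → T (lt σ u) → SameSupport u
        go u (acc rec) σ<u with ℕₚ.<-cmp (suc (suc (ρ σ))) (ρ u)
        ... | tri< high _ _ = HigherRank.same-support u σ<u high below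
          where
          below : ∀ v → T (lt v u) → SameSupport v
          below v v<u a a′ ca ca′ a≤v a′≤v = go v (rec v<u) (lt-le-trans (proj₁ ca) a≤v) a a′ ca ca′ a≤v a′≤v
        ... | tri≈ _ ρu _ = RankTwo.same-support u σ<u (sym ρu)
        ... | tri> _ _ low = λ a a′ ca ca′ a≤u a′≤u ba≢0 ba′≡0 → ba≢0 (trans (cong b (trans (atom≡u a ca a≤u) (sym (atom≡u a′ ca′ a′≤u)))) ba′≡0)
          where
          atom≡u : ∀ a → Covers σ a → T (le a u) → a ≡ u
          atom≡u a ca a≤u = rank-eq a≤u (trans (ρ-cover σ a ca) (ℕₚ.≤-antisym (rank-lt σ<u) (s≤s⁻¹ low)))

    NewRow : Fin n → Set
    NewRow σ = Σ[ row ∈ (Fin n → ℚ) ] (∀ y → row y ≢ 0ℚ → Covers σ y) × (∀ y → Covers σ y → row y ≢ 0ℚ) ×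
               (∀ z → ∑ (λ y → row y ℚ.* e y z) ≡ 0ℚ)

    -- A generator of the closed cochains of rank `ρ σ + 1` on `[σ, top]`, cut down to the covers of
    -- `σ`. It is nonzero somewhere, hence by connectedness at every cover. Working up to `top`
    -- makes one row serve all intervals that start at `σ`.
    newRow : ∀ σ → (∀ x → T (lt σ x) → Good x) → NewRow σ
    newRow σ good = by (T? (lt σ top))
      where
      by : Dec (T (lt σ top)) → NewRow σ
      by (no h) = (λ _ → 0ℚ) , (λ y p → contradiction refl p) ,
        (λ y c → contradiction (lt-le-trans (proj₁ c) (top-max y)) h) , λ z → ∑-zero λ y → ℚₚ.*-zeroˡ (e y z)
      by (yes σ<top) = row , row-cover , row-nonzero , row-closed
        where
        open LowerExactness P eul cm e e-cover σ top σ<top good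
          (λ x σ<x x<u → exact-all x top x<u λ v x≤v → good v (lt-le-trans σ<x x≤v)) using (Cl; Ng; closed-line)
        open +-*-Solver
        b : Fin n → ℚ
        b = proj₁ closed-line
        b∈ : Cl (suc (ρ σ)) ∋ b
        b∈ = proj₁ (proj₂ (proj₂ closed-line))
        b∉ : ¬ (Ng (suc (ρ σ)) ∋ b)
        b∉ h = let _ , c , _ , cb , cN , _ = closed-line in 1ℚ≢0ℚ (trans (sym cb) (cN b h))
        b-closed : ∀ υ → ρ υ ≡ suc (suc (ρ σ)) → T (le σ υ) → ∑ (λ τ → (δ σ τ ℚ.* e τ υ) ℚ.* b τ) ≡ 0ℚ
        b-closed υ ρυ σ≤υ = proj₂ b∈ υ ρυ σ≤υ (top-max υ)
        isCover : Fin n → Bool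
        isCover y = (ρ y ℕ.≡ᵇ suc (ρ σ)) ∧ le σ y
        cover-out : ∀ y → T (isCover y) → Covers σ y
        cover-out y h = let p , q = ∧-out (ρ y ℕ.≡ᵇ suc (ρ σ)) h in le∧rank⇒Covers q (ℕₚ.≡ᵇ⇒≡ (ρ y) (suc (ρ σ)) p)
        cover-in : ∀ y → Covers σ y → T (isCover y)
        cover-in y c = ∧-in (ρ y ℕ.≡ᵇ suc (ρ σ)) (ℕₚ.≡⇒≡ᵇ (ρ y) (suc (ρ σ)) (ρ-cover σ y c)) (lt⇒le (proj₁ c))
        row : Fin n → ℚ
        row y = if isCover y then b y else 0ℚ
        row-yes : ∀ y → Covers σ y → row y ≡ b y
        row-yes y c = cong (λ t → if t then b y else 0ℚ) (T⇒≡true (cover-in y c))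
        row-cover : ∀ y → row y ≢ 0ℚ → Covers σ y
        row-cover y h = cover-out y (if≢0 (isCover y) h)
          where
          if≢0 : ∀ t {a : ℚ} → (if t then a else 0ℚ) ≢ 0ℚ → T t
          if≢0 true  _ = tt
          if≢0 false h = contradiction refl h
        row-nonzero : ∀ y → Covers σ y → row y ≢ 0ℚ
        row-nonzero y c row≡0 = b∉ λ τ ρτ σ≤τ _ → ≡0-dec λ bτ≢0 →
          Connected.connected σ good b b-closed top σ<top τ y (le∧rank⇒Covers σ≤τ ρτ) c (top-max τ) (top-max y) bτ≢0
            (trans (sym (row-yes y c)) row≡0)
        row-closed : ∀ z → ∑ (λ y → row y ℚ.* e y z) ≡ 0ℚ
        row-closed z = at (ρ z ℕ.≟ suc (suc (ρ σ))) (T? (le σ z))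
          where
          at : Dec (ρ z ≡ suc (suc (ρ σ))) → Dec (T (le σ z)) → ∑ (λ y → row y ℚ.* e y z) ≡ 0ℚ
          at (no h) _ = ∑-zero λ y → *-zero-≢0 (row y) λ p → ≡0-dec λ q → h (trans (e-rank q) (cong suc (ρ-cover σ y (row-cover y p))))
          at (yes _) (no h) = ∑-zero λ y → *-zero-≢0 (row y) λ p → ≡0-dec λ q → h (lt⇒le (lt-trans (proj₁ (row-cover y p)) (e-lt q)))
          at (yes ρz) (yes σ≤z) = trans (∑-cong λ y → term y (T? (le σ y)) ) (b-closed z ρz σ≤z)
            where
            term : ∀ y → Dec (T (le σ y)) → row y ℚ.* e y z ≡ (δ σ y ℚ.* e y z) ℚ.* b y
            term y (yes σ≤y) = trans (ℚₚ.*-comm (row y) (e y z)) (trans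
              (*-cong-≢0 (e y z) λ h → row-yes y (le∧rank⇒Covers σ≤y (ℕₚ.suc-injective (trans (sym (e-rank h)) ρz))))
              (trans (solve 2 (λ e b → e :* b := (con 1ℚ :* e) :* b) refl (e y z) (b y)) (cong (λ t → (t ℚ.* e y z) ℚ.* b y) (sym (δ-yes σ≤y)))))
            term y (no σ≰y) = trans (cong (ℚ._* e y z) (≡0-dec λ h → σ≰y (lt⇒le (proj₁ (row-cover y h)))))
              (trans (solve 2 (λ e b → con 0ℚ :* e := (con 0ℚ :* e) :* b) refl (e y z) (b y))
                (cong (λ t → (t ℚ.* e y z) ℚ.* b y) (sym (≡0-dec (σ≰y ∘ δ≢0)))))

  OrientedFrom : ℕ → Set
  OrientedFrom q = Σ[ e ∈ (Fin n → Fin n → ℚ) ] Σ[ e-cover ∈ (∀ x y → e x y ≢ 0ℚ → Covers x y) ]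
                   (∀ x → q ≤ ρ x → Incidence.Good P e e-cover x)

  extend : ∀ q → OrientedFrom (suc q) → OrientedFrom q
  extend q (e , e-cover , good) = e′ , e′-cover , good′
    where
    open Row e e-cover
    open Incidence P e e-cover using (e-rank)
    rows : ∀ σ → ρ σ ≡ q → NewRow σ
    rows σ ρσ = newRow σ λ x σ<x → good x (subst (_< ρ x) ρσ (rank-lt σ<x))
    pick : ∀ σ → Dec (ρ σ ≡ q) → Fin n → ℚ
    pick σ (yes p) = proj₁ (rows σ p)
    pick σ (no _)  = e σ
    e′ : Fin n → Fin n → ℚ
    e′ σ = pick σ (ρ σ ℕ.≟ q)
    e′-cover : ∀ x y → e′ x y ≢ 0ℚ → Covers x y
    e′-cover x y = by (ρ x ℕ.≟ q)
      where
      by : ∀ p → pick x p y ≢ 0ℚ → Covers x y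
      by (yes p) = proj₁ (proj₂ (rows x p)) y
      by (no _)  = e-cover x y
    unchanged : ∀ y → q < ρ y → ∀ z → e′ y z ≡ e y z
    unchanged y q<ρy z = by (ρ y ℕ.≟ q)
      where
      by : ∀ p → pick y p z ≡ e y z
      by (yes p) = contradiction (sym p) (ℕₚ.<⇒≢ q<ρy)
      by (no _)  = refl
    good′ : ∀ x → q ≤ ρ x → Incidence.Good P e′ e′-cover x
    good′ x q≤ρx = nonzero (ρ x ℕ.≟ q) , λ z → trans
      (∑-cong λ y → *-cong-≢0 (e′ x y) λ h → unchanged y
        (ℕₚ.≤-<-trans q≤ρx (rank-lt (proj₁ (e′-cover x y h)))) z) (square (ρ x ℕ.≟ q) z)
      where
      above : ρ x ≢ q → q < ρ x
      above h = ℕₚ.≤∧≢⇒< q≤ρx (h ∘ sym)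
      nonzero : ∀ p y → Covers x y → pick x p y ≢ 0ℚ
      nonzero (yes p) = proj₁ (proj₂ (proj₂ (rows x p)))
      nonzero (no h)  = proj₁ (good x (above h))
      square : ∀ p z → ∑ (λ y → pick x p y ℚ.* e y z) ≡ 0ℚ
      square (yes p) = proj₂ (proj₂ (proj₂ (rows x p)))
      square (no h)  = proj₂ (good x (above h))

  oriented : ∀ j q → q ℕ.+ j ≡ suc (ρ top) → OrientedFrom q
  -- Beyond the rank of `top` there is no row to check, so zero rows are a valid start.
  oriented zero q q≡ = (λ _ _ → 0ℚ) , (λ x y h → contradiction refl h) ,
    λ x q≤ρx → contradiction (rank-≤ (top-max x)) (ℕₚ.<⇒≱ (subst (_≤ ρ x) (trans (sym (ℕₚ.+-identityʳ q)) q≡) q≤ρx))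
  oriented (suc j) q q≡ = extend q (oriented j (suc q) (trans (sym (ℕₚ.+-suc q j)) q≡))

  cellComplex : CellComplex
  cellComplex =
    let e , e-cover , good = oriented (suc (ρ top)) 0 refl in record
    { n = n ; le = le ; ρ = ρ ; e = e
    ; le-refl = le-refl ; le-trans = le-trans ; rank-< = rank-<
    ; e-cover = λ x y h → lt⇒le (proj₁ (e-cover x y h)) , ρ-cover x y (e-cover x y h)
    ; e-e     = λ x z → proj₂ (good x z≤n) z
    ; exact   = λ s t s≤t s≢t → Row.exact-all e e-cover s t (le∧≢⇒lt s≤t s≢t) λ x _ → good x z≤n
    }

-- The constant sheaf and the Chow polynomial.

polyAlgebra : ℤ-Algebra
polyAlgebra = record
  { ring = polyRing
  ; hom  = record
    { ⟦_⟧    = constₚ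
    ; +-homo = λ _ _ _ → refl
    ; *-homo = λ { a b zero → sym (ℤₚ.+-identityʳ (a ℤ.* b)) ; a b (suc k) → refl }
    ; -‿homo = λ { a zero → sym (ℤₚ.-1*i≡-i a) ; a (suc k) → refl }
    ; 0-homo = λ { zero → refl ; (suc k) → refl }
    ; 1-homo = λ _ → refl
    }
  }

module GorensteinPoset (P : FinGradedBoundedPoset) (gor : PosetNotions.Gorenstein* P) where

  open PosetNotions P hiding (∂)
  open GradedPoset P
  open Guards polyAlgebra

  K : CellComplex
  K = Orientation.cellComplex P (proj₁ gor) (proj₂ gor)

  ι-sum : ∀ {k} (f : Fin k → ℤ) → ι (ℤ-Sums.∑ f) ≈ ∑ᴿ (λ i → ι (f i))
  ι-sum {zero}  f = ι-0
  ι-sum {suc k} f = ≈-trans {ι (f zero ℤ.+ ℤ-Sums.∑ (f ∘ suc))} {ι (f zero) + ι (ℤ-Sums.∑ (f ∘ suc))} {∑ᴿ (λ i → ι (f i))}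
    (ι-+ (f zero) (ℤ-Sums.∑ (f ∘ suc)))
    (+-congˡ {ι (f zero)} {ι (ℤ-Sums.∑ (f ∘ suc))} {∑ᴿ (λ i → ι (f (suc i)))} (ι-sum (f ∘ suc)))

  sign≈ : ∀ k → sign k ≈ ι (sgn k)
  sign≈ zero    = λ _ → refl
  sign≈ (suc k) = begin
    - sign k         ≈⟨ -‿cong {sign k} {ι (sgn k)} (sign≈ k) ⟩
    - ι (sgn k)      ≈⟨ ι-neg (sgn k) ⟨
    ι (ℤ.- sgn k)    ≡⟨ cong ι (sgn-suc k) ⟨
    ι (sgn (suc k))  ∎
    where open ≈-Reasoning

  ι-if : ∀ b a → ι (if b then a else + 0) ≈ [ b ] ι a
  ι-if true  a = λ _ → refl
  ι-if false a = ι-0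

  euler-poly : ∀ s t → T (le s t) → s ≢ t → ∑ᴿ (λ τ → [ le s τ ∧ le τ t ] sign (ρ τ)) ≈ 0#
  euler-poly s t s≤t s≢t = begin
    ∑ᴿ (λ τ → [ b τ ] sign (ρ τ))
      ≈⟨ ∑ᴿ-cong {f = λ τ → [ b τ ] sign (ρ τ)} {λ τ → ι (h τ)} (λ τ → ≈-trans {[ b τ ] sign (ρ τ)} {[ b τ ] ι (sgn (ρ τ))} {ι (h τ)}
           ([]-cong (b τ) {sign (ρ τ)} {ι (sgn (ρ τ))} λ _ → sign≈ (ρ τ))
           (≈-sym {ι (h τ)} {[ b τ ] ι (sgn (ρ τ))} (ι-if (b τ) (sgn (ρ τ))))) ⟩
    ∑ᴿ (λ τ → ι (h τ))
      ≈⟨ ι-sum h ⟨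
    ι (ℤ-Sums.∑ h)
      ≡⟨ cong ι (euler (proj₁ gor) s t s≤t s≢t) ⟩
    ι (+ 0)
      ≈⟨ ι-0 ⟩
    0# ∎
    where
    open ≈-Reasoning
    b : Fin n → Bool
    b τ = le s τ ∧ le τ t
    h : Fin n → ℤ
    h τ = if b τ then sgn (ρ τ) else + 0

  Hᵇ : Fin n → Poly
  Hᵇ = H bot

  Hᵇ-bot : Hᵇ bot ≈ 1#
  Hᵇ-bot with bot Fin.≟ bot
  ... | yes _ = λ { zero → refl ; (suc k) → refl }
  ... | no h  = contradiction refl h

  pow≡ : ∀ p k → powₚ p k ≡ p ^^ k
  pow≡ p zero    = refl
  pow≡ p (suc k) = cong (p *ₚ_) (pow≡ p k)

  Hᵇ-rec : ∀ τ k → ρ τ ≡ suc k → Hᵇ τ ≈ ∑ᴿ λ σ → [ (ρ σ ℕ.≤ᵇ k) ∧ le σ τ ] (Hᵇ σ * Xm1 ^^ (k ∸ ρ σ))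
  Hᵇ-rec τ k ρτ = begin
    - εbarInv bot τ
      ≈⟨ -‿cong {εbarInv bot τ} {∑ᴿ (εbar.inverse-terms τ)} (εbar.εbarInv-rec λ { refl → case trans (sym ρ-bot) ρτ of λ () }) ⟩
    - ∑ᴿ (εbar.inverse-terms τ)
      ≈⟨ ∑-‿ (εbar.inverse-terms τ) ⟩
    ∑ᴿ (λ σ → - εbar.inverse-terms τ σ)
      ≈⟨ ∑ᴿ-cong {f = λ σ → - εbar.inverse-terms τ σ} {λ σ → [ (ρ σ ℕ.≤ᵇ k) ∧ le σ τ ] (Hᵇ σ * Xm1 ^^ (k ∸ ρ σ))} term ⟩
    ∑ᴿ (λ σ → [ (ρ σ ℕ.≤ᵇ k) ∧ le σ τ ] (Hᵇ σ * Xm1 ^^ (k ∸ ρ σ))) ∎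
    where
    open ≈-Reasoning
    exponent : ∀ σ → ρ τ ∸ ρ σ ∸ 1 ≡ k ∸ ρ σ
    exponent σ = trans (cong (λ j → j ∸ ρ σ ∸ 1) ρτ) (trans (ℕₚ.∸-+-assoc (suc k) (ρ σ) 1)
      (trans (cong (suc k ∸_) (ℕₚ.+-comm (ρ σ) 1)) refl))
    term : ∀ σ → - εbar.inverse-terms τ σ ≈ [ (ρ σ ℕ.≤ᵇ k) ∧ le σ τ ] (Hᵇ σ * Xm1 ^^ (k ∸ ρ σ))
    term σ = begin
      - ([ le bot σ ∧ lt σ τ ] (εbarInv bot σ * powₚ Xm1 (ρ τ ∸ ρ σ ∸ 1)))
        ≈⟨ []-‿* (le bot σ ∧ lt σ τ) (εbarInv bot σ) (powₚ Xm1 (ρ τ ∸ ρ σ ∸ 1)) ⟩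
      [ le bot σ ∧ lt σ τ ] (Hᵇ σ * powₚ Xm1 (ρ τ ∸ ρ σ ∸ 1))
        ≡⟨ cong (λ q → [ le bot σ ∧ lt σ τ ] (Hᵇ σ * q)) (trans (pow≡ Xm1 (ρ τ ∸ ρ σ ∸ 1)) (cong (Xm1 ^^_) (exponent σ))) ⟩
      [ le bot σ ∧ lt σ τ ] (Hᵇ σ * Xm1 ^^ (k ∸ ρ σ))
        ≈⟨ []-⇔ (le bot σ ∧ lt σ τ) ((ρ σ ℕ.≤ᵇ k) ∧ le σ τ) {Hᵇ σ * Xm1 ^^ (k ∸ ρ σ)}
             (λ h → let σ<τ = proj₂ (∧-out (le bot σ) h) in
                ∧-in (ρ σ ℕ.≤ᵇ k) (ℕₚ.≤⇒≤ᵇ (s≤s⁻¹ (subst (ρ σ <_) ρτ (rank-lt σ<τ)))) (lt⇒le σ<τ))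
             (λ h → let p , q = ∧-out (ρ σ ℕ.≤ᵇ k) h in
                ∧-in (le bot σ) (bot-min σ) (le∧rank⇒lt q (subst (ρ σ <_) (sym ρτ) (s≤s (ℕₚ.≤ᵇ⇒≤ (ρ σ) k p))))) ⟩
      [ (ρ σ ℕ.≤ᵇ k) ∧ le σ τ ] (Hᵇ σ * Xm1 ^^ (k ∸ ρ σ)) ∎

  open Sheaves K using (Sheaf; CM; D)

  constant : Sheaf
  constant = record
    { X        = ⊤
    ; Sub      = λ _ → full
    ; Nul      = λ _ → none
    ; Sub-mono = λ _ _ _ _ p → p
    ; Nul-mono = λ _ _ _ _ p → p
    ; m        = λ _ → 1
    ; dim      = λ _ → (λ _ → 1ℚ) , ev tt , tt , refl , (λ _ p → p tt) , λ _ (_ , p) _ → p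
    }

  -- The complex of `[σ, ∞)` is that of `[σ, top]`. Only `σ = top` fails to be exact, and its single
  -- degree is excluded by `i < ρ top`.
  constant-CM : ∀ i → i < ρ top → CM constant i
  constant-CM i i<r σ r r<i x x∈ closed = by (σ Fin.≟ top)
    where
    by : Dec (σ ≡ top) → Σ[ y ∈ (Fin n → ⊤ → ℚ) ] (∀ τ → ⊤) ×
         (∀ τ → ρ τ ≡ r → T (le σ τ) → ∀ a → x τ a ℚ.- D σ y τ a ≡ 0ℚ)
    by (yes refl) = (λ _ _ → 0ℚ) , (λ _ → tt) , λ τ ρτ top≤τ →
      contradiction (ℕₚ.≤-trans (rank-≤ top≤τ) (ℕₚ.≤-reflexive ρτ)) (ℕₚ.<⇒≱ (ℕₚ.<-trans r<i i<r))
    by (no σ≢top) =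
      let y , h = CellComplex.exact K σ top (top-max σ) σ≢top r (λ τ → x τ tt) (λ υ ρυ σ≤υ _ → closed υ ρυ σ≤υ tt)
      in (λ τ _ → y τ) , (λ _ → tt) , λ τ ρτ σ≤τ _ →
         trans (cong (λ u → x τ tt ℚ.- u) (h τ ρτ σ≤τ (top-max τ))) (ℚₚ.+-inverseʳ (x τ tt))

  open Numeric polyAlgebra le ρ le-refl rank-<
  open Involution euler-poly le-trans le-antisym
  open Recursion polyAlgebra le ρ le-refl rank-< Hᵇ Xm1 Hᵇ-rec
  module Γ = GammaPositivity polyAlgebra K le-antisym bot ρ-bot bot-unique euler-poly Hᵇ Xm1 Hᵇ-bot Hᵇ-rec

  one : Fin n → Poly
  one _ = ι (+ 1)

  module _ (i : ℕ) (rank≡ : ρ top ≡ suc i) where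

    rank-bounded : ∀ τ → ρ τ ≤ suc i
    rank-bounded τ = subst (ρ τ ≤_) rank≡ (rank-≤ (top-max τ))

    S-one : ∀ σ → S (suc i) one σ ≈ ι (+ 1)
    S-one σ = begin
      ∑ᴿ (λ τ → [ level (suc i) σ τ ] ι (+ 1))
        ≈⟨ ∑ᴿ-single {f = λ τ → [ level (suc i) σ τ ] ι (+ 1)} top (λ τ τ≢top → []-no (level (suc i) σ τ) {ι (+ 1)} λ h →
             τ≢top (rank-eq (top-max τ) (trans (ℕₚ.≡ᵇ⇒≡ (ρ τ) (suc i) (proj₁ (∧-out (ρ τ ℕ.≡ᵇ suc i) h))) (sym rank≡)))) ⟩
      [ level (suc i) σ top ] ι (+ 1)
        ≈⟨ []-yes (level (suc i) σ top) {ι (+ 1)} (∧-in (ρ top ℕ.≡ᵇ suc i) (ℕₚ.≡⇒≡ᵇ (ρ top) (suc i) rank≡) (top-max σ)) ⟩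
      ι (+ 1) ∎
      where open ≈-Reasoning

    C-one : ∀ σ → ρ σ ≤ i → C (suc i) one σ ≈ 0#
    C-one σ ρσ≤i = begin
      ∑ᴿ (λ τ → [ below (suc i) σ τ ] (sign (ρ τ) * ι (+ 1)))
        ≈⟨ ∑ᴿ-cong {f = λ τ → [ below (suc i) σ τ ] (sign (ρ τ) * ι (+ 1))} {λ τ → [ le σ τ ∧ le τ top ] sign (ρ τ)} term ⟩
      ∑ᴿ (λ τ → [ le σ τ ∧ le τ top ] sign (ρ τ))
        ≈⟨ euler-poly σ top (top-max σ) (λ { refl → ℕₚ.<⇒≱ (ℕₚ.n<1+n i) (subst (_≤ i) rank≡ ρσ≤i) }) ⟩
      0# ∎
      where
      open ≈-Reasoning
      term : ∀ τ → [ below (suc i) σ τ ] (sign (ρ τ) * ι (+ 1)) ≈ [ le σ τ ∧ le τ top ] sign (ρ τ)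
      term τ = begin
        [ below (suc i) σ τ ] (sign (ρ τ) * ι (+ 1))
          ≈⟨ []-cong (below (suc i) σ τ) {sign (ρ τ) * ι (+ 1)} {sign (ρ τ)} (λ _ → *-identityʳ (sign (ρ τ))) ⟩
        [ below (suc i) σ τ ] sign (ρ τ)
          ≈⟨ []-⇔ (below (suc i) σ τ) (le σ τ ∧ le τ top) {sign (ρ τ)}
               (λ h → ∧-in (le σ τ) (proj₂ (∧-out (ρ τ ℕ.≤ᵇ suc i) h)) (top-max τ))
               (λ h → ∧-in (ρ τ ℕ.≤ᵇ suc i) (ℕₚ.≤⇒≤ᵇ (rank-bounded τ)) (proj₁ (∧-out (le σ τ) h))) ⟩
        [ le σ τ ∧ le τ top ] sign (ρ τ) ∎

    -- By the Euler relation the signed count up to `top` is zero, and `top` is the only element of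
    -- its rank; the ranks below therefore contribute one.
    w-one : ∀ σ → ρ σ ≤ i → w i one σ ≈ one σ
    w-one σ ρσ≤i = begin
      w i one σ
        ≈⟨ minus-minus (S (suc i) one σ) (w i one σ) ⟩
      S (suc i) one σ - w (suc i) one σ
        ≈⟨ a-0 (S (suc i) one σ) (w (suc i) one σ) w≈0 ⟩
      S (suc i) one σ
        ≈⟨ S-one σ ⟩
      ι (+ 1) ∎
      where
      open ≈-Reasoning
      w≈0 : w (suc i) one σ ≈ 0#
      w≈0 = begin
        w (suc i) one σ                       ≈⟨ w-closed (suc i) one σ ⟩
        sign (suc i) * C (suc i) one σ        ≈⟨ *-congˡ {sign (suc i)} {C (suc i) one σ} {0#} (C-one σ ρσ≤i) ⟩
        sign (suc i) * 0#                     ≈⟨ zeroʳ (sign (suc i)) ⟩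
        0#                                    ∎

    Hs-one : Hs i one ≈ H-P
    Hs-one = begin
      ∑ᴿ (λ σ → [ ρ σ ℕ.≤ᵇ i ] (ι (+ 1) * t σ))
        ≈⟨ ∑ᴿ-cong {f = λ σ → [ ρ σ ℕ.≤ᵇ i ] (ι (+ 1) * t σ)} {λ σ → [ (ρ σ ℕ.≤ᵇ i) ∧ le σ top ] t σ} term ⟩
      ∑ᴿ (λ σ → [ (ρ σ ℕ.≤ᵇ i) ∧ le σ top ] t σ)
        ≈⟨ Hᵇ-rec top i rank≡ ⟨
      H-P ∎
      where
      open ≈-Reasoning
      t : Fin n → Poly
      t σ = Hᵇ σ * Xm1 ^^ (i ∸ ρ σ)
      term : ∀ σ → [ ρ σ ℕ.≤ᵇ i ] (ι (+ 1) * t σ) ≈ [ (ρ σ ℕ.≤ᵇ i) ∧ le σ top ] t σ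
      term σ = begin
        [ ρ σ ℕ.≤ᵇ i ] (ι (+ 1) * t σ)
          ≈⟨ []-cong (ρ σ ℕ.≤ᵇ i) {ι (+ 1) * t σ} {t σ} (λ _ → *-identityˡ (t σ)) ⟩
        [ ρ σ ℕ.≤ᵇ i ] t σ
          ≈⟨ []-⇔ (ρ σ ℕ.≤ᵇ i) ((ρ σ ℕ.≤ᵇ i) ∧ le σ top) {t σ} (λ h → ∧-in (ρ σ ℕ.≤ᵇ i) h (top-max σ)) (λ h → proj₁ (∧-out (ρ σ ℕ.≤ᵇ i) h)) ⟩
        [ (ρ σ ℕ.≤ᵇ i) ∧ le σ top ] t σ ∎

    H-P-positive : GammaPositive i H-P
    H-P-positive = GP-resp i {f i one} {H-P}
      (≈-trans {f i one} {Hs i one} {H-P} (f-self-dual i one w-one) Hs-one)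
      (Γ.γ-positive i constant (constant-CM i (ℕₚ.≤-reflexive (sym rank≡))))

  term : ℕ → (ℕ → ℕ) → ℕ → Poly
  term i γ j = constₚ (+ γ j) *ₚ powₚ Xₚ j *ₚ powₚ Xp1 (i ∸ 2 ℕ.* j)

  -- Raising the index by one and the degree by two leaves the exponent of `Xp1` unchanged and
  -- multiplies the term by `Xₚ`.
  gammaExpansion≈G : ∀ i γ → gammaExpansion (suc i) γ ≈ G i γ
  gammaExpansion≈G zero γ = begin
    (c * 1#) * 1# + 0#  ≈⟨ +-identityʳ ((c * 1#) * 1#) ⟩
    (c * 1#) * 1#       ≈⟨ *-identityʳ (c * 1#) ⟩
    c * 1#              ≈⟨ *-identityʳ c ⟩
    c                   ∎
    where
    open ≈-Reasoning
    c = constₚ (+ γ 0)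
  gammaExpansion≈G (suc zero) γ = begin
    (c * 1#) * (Xp1 * 1#) + 0#  ≈⟨ +-identityʳ ((c * 1#) * (Xp1 * 1#)) ⟩
    (c * 1#) * (Xp1 * 1#)       ≈⟨ *-cong {c * 1#} {c} {Xp1 * 1#} {Xp1} (*-identityʳ c) (*-identityʳ Xp1) ⟩
    c * Xp1                     ∎
    where
    open ≈-Reasoning
    c = constₚ (+ γ 0)
  gammaExpansion≈G (suc (suc i)) γ = begin
    term (suc (suc i)) γ 0 + sumₚ (map (term (suc (suc i)) γ) (applyUpTo suc k))
      ≈⟨ +-cong {term (suc (suc i)) γ 0} {c * Xp1 ^^ suc (suc i)} {sumₚ (map (term (suc (suc i)) γ) (applyUpTo suc k))}
           {Xₚ * sumₚ (map (term i (γ ∘ suc)) (upTo k))} first (shifted k (λ j → j)) ⟩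
    c * Xp1 ^^ suc (suc i) + Xₚ * gammaExpansion (suc i) (γ ∘ suc)
      ≈⟨ +-congˡ {c * Xp1 ^^ suc (suc i)} (*-congˡ {Xₚ} {gammaExpansion (suc i) (γ ∘ suc)} {G i (γ ∘ suc)} (gammaExpansion≈G i (γ ∘ suc))) ⟩
    G (suc (suc i)) γ ∎
    where
    open ≈-Reasoning
    c = constₚ (+ γ 0)
    k = suc ⌊ i /2⌋
    first : term (suc (suc i)) γ 0 ≈ c * Xp1 ^^ suc (suc i)
    first = begin
      (c * 1#) * powₚ Xp1 (suc (suc i))  ≈⟨ *-congʳ {powₚ Xp1 (suc (suc i))} {c * 1#} {c} (*-identityʳ c) ⟩
      c * powₚ Xp1 (suc (suc i))         ≡⟨ cong (c *_) (pow≡ Xp1 (suc (suc i))) ⟩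
      c * Xp1 ^^ suc (suc i)             ∎
    shift : ∀ j → term (suc (suc i)) γ (suc j) ≈ Xₚ * term i (γ ∘ suc) j
    shift j = begin
      (c′ * (Xₚ * powₚ Xₚ j)) * powₚ Xp1 (suc (suc i) ∸ 2 ℕ.* suc j)
        ≡⟨ cong (λ a → (c′ * (Xₚ * powₚ Xₚ j)) * powₚ Xp1 (suc (suc i) ∸ a)) (ℕₚ.*-suc 2 j) ⟩
      (c′ * (Xₚ * powₚ Xₚ j)) * powₚ Xp1 (i ∸ 2 ℕ.* j)
        ≈⟨ *-shuffle c′ Xₚ (powₚ Xₚ j) (powₚ Xp1 (i ∸ 2 ℕ.* j)) ⟩
      Xₚ * term i (γ ∘ suc) j ∎
      where c′ = constₚ (+ γ (suc j))
    shifted : ∀ k (g : ℕ → ℕ) → sumₚ (map (term (suc (suc i)) γ) (applyUpTo (suc ∘ g) k)) ≈ Xₚ * sumₚ (map (term i (γ ∘ suc)) (applyUpTo g k))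
    shifted zero    g = ≈-sym {Xₚ * 0#} {0#} (zeroʳ Xₚ)
    shifted (suc k) g = begin
      term (suc (suc i)) γ (suc (g 0)) + rest′
        ≈⟨ +-cong {term (suc (suc i)) γ (suc (g 0))} {Xₚ * term i (γ ∘ suc) (g 0)} {rest′} {Xₚ * rest} (shift (g 0)) (shifted k (g ∘ suc)) ⟩
      Xₚ * term i (γ ∘ suc) (g 0) + Xₚ * rest
        ≈⟨ distribˡ Xₚ (term i (γ ∘ suc) (g 0)) rest ⟨
      Xₚ * (term i (γ ∘ suc) (g 0) + rest) ∎
      where
      rest′ = sumₚ (map (term (suc (suc i)) γ) (applyUpTo (suc ∘ g ∘ suc) k))
      rest = sumₚ (map (term i (γ ∘ suc)) (applyUpTo (g ∘ suc) k))

  expansion : ∀ r → rank ≡ r → 1 ≤ r → Σ[ γ ∈ (ℕ → ℕ) ] (H-P ≈ₚ gammaExpansion r γ)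
  expansion (suc i) rank≡ _ =
    let γ , h = H-P-positive i rank≡
    in γ , ≈-trans {H-P} {G i γ} {gammaExpansion (suc i) γ} h
             (≈-sym {gammaExpansion (suc i) γ} {G i γ} (gammaExpansion≈G i γ))

theorem5p7 : (P : FinGradedBoundedPoset) →
    PosetNotions.Gorenstein* P →
    1 ≤ PosetNotions.rank P →
    Σ[ γ ∈ (ℕ → ℕ) ] (PosetNotions.H-P P ≈ₚ gammaExpansion (PosetNotions.rank P) γ)
theorem5p7 P gor = GorensteinPoset.expansion P gor (PosetNotions.rank P) refl
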